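{- There is an algorithm to compute a minimal set of representatives of $\mathrm{Mat}_{m,h}/\sim_\mathbb{Z}$.
   Context: Let $m=m_1\cdots m_n\in\mathbb{Z}[x]$ be a squarefree polynomial with distinct irreducible (monic) factors $m_i$, fix strictly positive integers $s_1,\ldots,s_n$, and put $h=m_1^{s_1}\cdots m_n^{s_n}$. Let $\mathrm{Mat}_{m,h}$ denote the set of square integral matrices with minimal polynomial $m$ and characteristic polynomial $h$. Two $r\times r$ integral matrices $A,B$ are $\mathbb{Z}$-conjugate, written $A\sim_\mathbb{Z} B$, if there exists $P\in\mathrm{GL}_r(\mathbb{Z})$ with $PA=BP$. -}

module Defs where

open import Data.Nat using (ℕ; zero; suc; _<_; _≤_)
open import Data.Integer using (ℤ; 0ℤ; 1ℤ; -1ℤ; _+_; _*_; -_)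
open import Data.Fin using (Fin; zero; suc; punchIn; toℕ; _≟_)
open import Data.List using (List; []; _∷_; map; length; lookup)
open import Data.Product using (Σ; _×_; _,_; ∃)
open import Data.Sum using (_⊎_)
open import Relation.Nullary using (¬_; yes; no)
open import Relation.Binary.PropositionalEquality using (_≡_; _≢_)

-- Polynomials in ℤ[x]: coefficient lists, lowest degree first.
-- Equality is coefficientwise (so trailing zeros are irrelevant).

Poly : Set
Poly = List ℤ

coeff : Poly → ℕ → ℤ
coeff []       _       = 0ℤ
coeff (c ∷ _)  zero    = c
coeff (_ ∷ p)  (suc k) = coeff p k

infix 4 _≈ₚ_
_≈ₚ_ : Poly → Poly → Set
p ≈ₚ q = ∀ k → coeff p k ≡ coeff q k

infixl 6 _+ₚ_
_+ₚ_ : Poly → Poly → Poly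
[]      +ₚ q       = q
(a ∷ p) +ₚ []      = a ∷ p
(a ∷ p) +ₚ (b ∷ q) = (a + b) ∷ (p +ₚ q)

-ₚ_ : Poly → Poly
-ₚ p = map -_ p

scaleₚ : ℤ → Poly → Poly
scaleₚ c p = map (c *_) p

infixl 7 _*ₚ_
_*ₚ_ : Poly → Poly → Poly
[]      *ₚ q = []
(a ∷ p) *ₚ q = scaleₚ a q +ₚ (0ℤ ∷ (p *ₚ q))

constₚ : ℤ → Poly
constₚ c = c ∷ []

0ₚ 1ₚ Xₚ : Poly
0ₚ = []
1ₚ = constₚ 1ℤ
Xₚ = 0ℤ ∷ 1ℤ ∷ []

_^ₚ_ : Poly → ℕ → Poly
p ^ₚ zero  = 1ₚ
p ^ₚ suc k = p *ₚ (p ^ₚ k)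

HasDegree : Poly → ℕ → Set
HasDegree p d = (coeff p d ≢ 0ℤ) × (∀ k → d < k → coeff p k ≡ 0ℤ)

Monic : Poly → Set
Monic p = Σ ℕ λ d → HasDegree p d × (coeff p d ≡ 1ℤ)

IsUnitₚ : Poly → Set
IsUnitₚ u = (u ≈ₚ 1ₚ) ⊎ (u ≈ₚ constₚ -1ℤ)

Irreducible : Poly → Set
Irreducible p = ¬ (p ≈ₚ 0ₚ) × ¬ IsUnitₚ p
              × (∀ a b → p ≈ₚ a *ₚ b → IsUnitₚ a ⊎ IsUnitₚ b)

prodₚ : (n : ℕ) → (Fin n → Poly) → Poly
prodₚ zero    f = 1ₚ
prodₚ (suc n) f = f zero *ₚ prodₚ n (λ i → f (suc i))

Matrix : ℕ → Set
Matrix r = Fin r → Fin r → ℤ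

sumℤ : (n : ℕ) → (Fin n → ℤ) → ℤ
sumℤ zero    f = 0ℤ
sumℤ (suc n) f = f zero + sumℤ n (λ i → f (suc i))

infix 4 _≈ₘ_
_≈ₘ_ : {r : ℕ} → Matrix r → Matrix r → Set
A ≈ₘ B = ∀ i j → A i j ≡ B i j

δ : {r : ℕ} → Fin r → Fin r → ℤ
δ i j with i ≟ j
... | yes _ = 1ℤ
... | no  _ = 0ℤ

idM : (r : ℕ) → Matrix r
idM r = δ

zeroM : (r : ℕ) → Matrix r
zeroM r _ _ = 0ℤ

_+ₘ_ : {r : ℕ} → Matrix r → Matrix r → Matrix r
(A +ₘ B) i j = A i j + B i j

_*ₘ_ : {r : ℕ} → Matrix r → Matrix r → Matrix r
_*ₘ_ {r} A B i j = sumℤ r (λ k → A i k * B k j)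

scaleₘ : {r : ℕ} → ℤ → Matrix r → Matrix r
scaleₘ c A i j = c * A i j

evalₘ : {r : ℕ} → Poly → Matrix r → Matrix r
evalₘ {r} []      A = zeroM r
evalₘ {r} (c ∷ p) A = scaleₘ c (idM r) +ₘ (A *ₘ evalₘ p A)

sumₚ : (n : ℕ) → (Fin n → Poly) → Poly
sumₚ zero    f = 0ₚ
sumₚ (suc n) f = f zero +ₚ sumₚ n (λ i → f (suc i))

signₚ : ℕ → Poly → Poly
signₚ zero          p = p
signₚ (suc zero)    p = -ₚ p
signₚ (suc (suc k)) p = signₚ k p

detₚ : (r : ℕ) → (Fin r → Fin r → Poly) → Poly
detₚ zero    M = 1ₚ
detₚ (suc r) M =
  sumₚ (suc r) (λ j → signₚ (toℕ j)
    (M zero j *ₚ detₚ r (λ a b → M (suc a) (punchIn j b))))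

charPoly : {r : ℕ} → Matrix r → Poly
charPoly {r} A = detₚ r (λ i j → scaleₚ (δ i j) Xₚ +ₚ constₚ (- A i j))

IsMinPoly : {r : ℕ} → Matrix r → Poly → Set
IsMinPoly {r} A m =
  Σ ℕ λ d → HasDegree m d × (coeff m d ≡ 1ℤ)
    × (evalₘ m A ≈ₘ zeroM r)
    × (∀ p e → HasDegree p e → evalₘ p A ≈ₘ zeroM r → d ≤ e)

InMat : {r : ℕ} → Poly → Poly → Matrix r → Set
InMat m h A = IsMinPoly A m × (charPoly A ≈ₚ h)

_∼ℤ_ : {r : ℕ} → Matrix r → Matrix r → Set
_∼ℤ_ {r} A B = Σ (Matrix r) λ P → Σ (Matrix r) λ Q →
  ((P *ₘ Q) ≈ₘ idM r) × ((Q *ₘ P) ≈ₘ idM r) × ((P *ₘ A) ≈ₘ (B *ₘ P))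

squarefreeProd : (n : ℕ) → (Fin n → Poly) → Poly
squarefreeProd n ms = prodₚ n ms

hPoly : (n : ℕ) → (Fin n → Poly) → (Fin n → ℕ) → Poly
hPoly n ms ss = prodₚ n (λ i → ms i ^ₚ ss i)

Hyp : (n : ℕ) → (Fin n → Poly) → (Fin n → ℕ) → Set
Hyp n ms ss = (∀ i → Monic (ms i)) × (∀ i → Irreducible (ms i))
            × (∀ i j → ms i ≈ₚ ms j → i ≡ j)
            × (∀ i → 1 ≤ ss i)

MinimalReps : (r : ℕ) → Poly → Poly → List (Matrix r) → Set
MinimalReps r m h L =
  (∀ i → InMat m h (lookup L i))
  × (∀ (A : Matrix r) → InMat m h A → ∃ λ i → A ∼ℤ lookup L i)
  × (∀ i j → lookup L i ∼ℤ lookup L j → i ≡ j)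

{-# OPTIONS --safe #-}
module Submission where

-- Let m be the squarefree product, v m' = d + u m a certificate that it is separable over ℚ (d ≠ 0 an integer), and A an
-- integral matrix with m(A) = 0, that is, a lattice with an endomorphism. The positive definite forms q with
-- q(Av) ≤ c q(v) form a convex set. In a reduced basis b of such a form a_ij² q(b_i) ≤ K q(b_j). If the q(b_i) are of
-- comparable size, A is bounded; where they jump, A is block triangular with bounded diagonal blocks, and the certificate
-- bounds the off-diagonal block modulo Y ↦ A₁Y - YA₂. This gives finitely many classes.
--
-- To decide conjugacy, join the forms |x|² and |Px|² attached to an isomorphism P by a segment and discretise it.
-- Reduced bases of neighbouring forms differ by a bounded matrix, or they share a jump, hence an invariant sublattice, and
-- one concludes by induction on the rank. So P is a product of bounded matrices passing through bounded conjugates of A, and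
-- conjugacy is connectedness in a finite graph. No real numbers occur: all forms are integral.

open import Defs
open import Data.Nat as ℕ using (ℕ; zero; suc)
import Data.Nat.Properties as ℕP
open import Data.Nat.Induction using (<-rec)
open import Data.Integer as ℤ using (ℤ; -[1+_]; 0ℤ; 1ℤ; -1ℤ; _+_; _*_; _-_; -_; _≤_; _<_; ∣_∣; +≤+; +<+)
import Data.Integer.Properties as ℤP
import Data.Integer.DivMod as ℤD
open import Data.Integer.Tactic.RingSolver using (solve-∀)
open import Data.Fin as F using (Fin; zero; suc; toℕ; punchIn; _↑ˡ_; _↑ʳ_)
import Data.Fin.Properties as FP
import Data.Fin.Permutation as Perm
open import Data.List as L using (List; []; _∷_; _++_)
open import Data.Product using (Σ; _×_; _,_; ∃; proj₁; proj₂)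
open import Data.Sum using (_⊎_; inj₁; inj₂)
open import Data.Empty using (⊥; ⊥-elim)
open import Relation.Nullary using (¬_; Dec; yes; no; contradiction; ¬?)
open import Relation.Nullary.Decidable using (dec-true; decidable-stable; _×-dec_; _⊎-dec_)
open import Relation.Binary.PropositionalEquality using (_≡_; _≢_; refl; sym; trans; cong; cong₂; subst; subst₂; module ≡-Reasoning)
open ≡-Reasoning
open import Level using (0ℓ)
open import Algebra.Bundles using (CommutativeRing)
open import Data.Maybe using (Maybe; just; nothing)
open import Tactic.RingSolver.Core.AlmostCommutativeRing using (AlmostCommutativeRing; fromCommutativeRing)
open import Tactic.RingSolver using () renaming (solve-∀ to solveR)
open import Data.Integer.Divisibility.Signed using () renaming (_∣_ to _∣ᵢ_)
import Data.Integer.Divisibility.Signed as ℤDS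
open import Data.Nat.Divisibility using () renaming (_∣_ to _ℕ∣_)
import Data.Nat.Divisibility as ℕD
open import Data.Nat.Primality using (Prime; euclidsLemma; prime⇒nonZero)
open import Data.Nat.Primality.Factorisation using (PrimeFactorisation; factorise)
open import Data.List.Relation.Unary.All using (All)
import Data.List.Relation.Unary.All as All
import Data.Nat.ListAction as Nat
import Data.List.Relation.Unary.All.Properties as AllP
open import Data.List.Relation.Unary.Any using (Any; here; there)
import Data.List.Relation.Unary.Any as Any
import Data.List.Relation.Unary.Any.Properties as AnyP
open import Data.List.Relation.Unary.AllPairs using (AllPairs)
import Data.List.Relation.Unary.AllPairs as AllPairs
import Data.List.Membership.Propositional as Membership
open import Data.List.Membership.Propositional.Properties using (∈-lookup; ∈-filter⁺)

-- The obstacle is uniformity: a search needs bounds known before the matrices, so every estimate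
-- computes its bound from `m`, the rank and earlier bounds alone. The constant in q(Av) ≤ c q(v)
-- comes from q(x) = Σ |Aⁱx|², i ≤ deg m: passing from x to Ax loses |x|² and gains one term, which
-- m(A) = 0 expresses through the others. For T Y = A₁Y - YA₂ the certificate gives a homotopy d = π
-- + Tκ = π + κT with π landing in ker T. The first identity makes off-diagonal blocks small modulo
-- the image of T, the second shows that unipotent isomorphisms are products of bounded ones. Inside
-- the segment A can be unbounded in the reduced basis; it is replaced there by a bounded standard
-- form, through a possibly large map that respects every jump and is the identity when there is
-- none, as at both ends. The size of P affects the number of steps, never their size. The
-- certificate is found by linear algebra, but its existence rests on Gauss's lemma, irreducibility
-- being over ℤ. That conjugates keep their characteristic polynomial is derived from the uniqueness
-- of alternating forms.

+-interchange : ∀ a b c d → (a + b) + (c + d) ≡ (a + c) + (b + d)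
+-interchange = solve-∀

*-swap : ∀ k c a → k * (c * a) ≡ c * (k * a)
*-swap = solve-∀

-- Integer vectors, linear maps and entry bounds

V : ℕ → Set
V n = Fin n → ℤ

infix 4 _≗_
_≗_ : ∀ {n} → V n → V n → Set
x ≗ y = ∀ i → x i ≡ y i

0v : ∀ {n} → V n
0v _ = 0ℤ

infixl 6 _+v_
_+v_ : ∀ {n} → V n → V n → V n
(x +v y) i = x i + y i

infixl 7 _·v_
_·v_ : ∀ {n} → ℤ → V n → V n
(c ·v x) i = c * x i

e : ∀ {n} → Fin n → V n
e zero    zero    = 1ℤ
e zero    (suc _) = 0ℤ
e (suc j) zero    = 0ℤ
e (suc j) (suc i) = e j i

-- Functions with laws rather than matrices: `ap` of a composite is a composite of functions, so
-- associativity and the unit laws hold by `refl`. The matrix is recovered through `ent` and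
-- `expand`.
record Lin (n r : ℕ) : Set where
  no-eta-equality
  field
    ap    : V n → V r
    congr : ∀ {x y} → x ≗ y → ap x ≗ ap y
    add   : ∀ x y → ap (x +v y) ≗ ap x +v ap y
    scal  : ∀ c x → ap (c ·v x) ≗ c ·v ap x
open Lin public

ent : ∀ {n r} → Lin n r → Fin r → Fin n → ℤ
ent f i j = ap f (e j) i

infix 4 _≐_
-- Wrapped in a record so that both maps can be inferred from the type of a proof. `_≋_` does the
-- same for polynomials.
record _≐_ {n r : ℕ} (f g : Lin n r) : Set where
  constructor eq
  field at : ∀ x → ap f x ≗ ap g x
open _≐_ public

≐-refl : ∀ {n r} {f : Lin n r} → f ≐ f
≐-refl = eq λ _ _ → refl

≐-sym : ∀ {n r} {f g : Lin n r} → f ≐ g → g ≐ f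
≐-sym p = eq λ x i → sym (at p x i)

≐-trans : ∀ {n r} {f g h : Lin n r} → f ≐ g → g ≐ h → f ≐ h
≐-trans p q = eq λ x i → trans (at p x i) (at q x i)

ap-0 : ∀ {n r} (f : Lin n r) → ap f 0v ≗ 0v
ap-0 f i = trans (congr f {0v} {0ℤ ·v 0v} (λ _ → refl) i) (trans (scal f 0ℤ 0v i) (ℤP.*-zeroˡ (ap f 0v i)))

ap-≗0 : ∀ {n r} (f : Lin n r) {x} → x ≗ 0v → ap f x ≗ 0v
ap-≗0 f p i = trans (congr f p i) (ap-0 f i)

idL : ∀ {n} → Lin n n
ap    idL = λ x → x
congr idL = λ p → p
add   idL = λ _ _ _ → refl
scal  idL = λ _ _ _ → refl

infixr 9 _∘L_
_∘L_ : ∀ {n r s} → Lin r s → Lin n r → Lin n s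
ap    (g ∘L f) = λ x → ap g (ap f x)
congr (g ∘L f) = λ p → congr g (congr f p)
add   (g ∘L f) = λ x y i → trans (congr g (add f x y) i) (add g _ _ i)
scal  (g ∘L f) = λ c x i → trans (congr g (scal f c x) i) (scal g c _ i)

infixl 6 _+L_
_+L_ : ∀ {n r} → Lin n r → Lin n r → Lin n r
ap    (f +L g) = λ x → ap f x +v ap g x
congr (f +L g) = λ p i → cong₂ _+_ (congr f p i) (congr g p i)
add   (f +L g) = λ x y i → trans (cong₂ _+_ (add f x y i) (add g x y i)) (+-interchange (ap f x i) (ap f y i) (ap g x i) (ap g y i))
scal  (f +L g) = λ c x i → trans (cong₂ _+_ (scal f c x i) (scal g c x i)) (sym (ℤP.*-distribˡ-+ c _ _))

infixl 7 _·L_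
_·L_ : ∀ {n r} → ℤ → Lin n r → Lin n r
ap    (k ·L f) = λ x → k ·v ap f x
congr (k ·L f) = λ p i → cong (k *_) (congr f p i)
add   (k ·L f) = λ x y i → trans (cong (k *_) (add f x y i)) (ℤP.*-distribˡ-+ k _ _)
scal  (k ·L f) = λ c x i → trans (cong (k *_) (scal f c x i)) (*-swap k c (ap f x i))

-L_ : ∀ {n r} → Lin n r → Lin n r
-L f = -1ℤ ·L f

0L : ∀ {n r} → Lin n r
ap    0L = λ _ → 0v
congr 0L = λ _ _ → refl
add   0L = λ _ _ _ → refl
scal  0L = λ c _ _ → sym (ℤP.*-zeroʳ c)

∘-cong : ∀ {n r s} {g g′ : Lin r s} {f f′ : Lin n r} → g ≐ g′ → f ≐ f′ → g ∘L f ≐ g′ ∘L f′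
∘-cong {g′ = g′} {f} p q = eq λ x i → trans (at p (ap f x) i) (congr g′ (at q x) i)

+L-cong : ∀ {n r} {f f′ g g′ : Lin n r} → f ≐ f′ → g ≐ g′ → f +L g ≐ f′ +L g′
+L-cong p q = eq λ x i → cong₂ _+_ (at p x i) (at q x i)

sum-cong : ∀ {n} {f g : Fin n → ℤ} → (∀ i → f i ≡ g i) → sumℤ n f ≡ sumℤ n g
sum-cong {zero}  p = refl
sum-cong {suc n} p = cong₂ _+_ (p zero) (sum-cong (λ i → p (suc i)))

sum-0 : ∀ n → sumℤ n (λ _ → 0ℤ) ≡ 0ℤ
sum-0 zero    = refl
sum-0 (suc n) = trans (ℤP.+-identityˡ _) (sum-0 n)

sum-≡0 : ∀ {n} {f : Fin n → ℤ} → (∀ i → f i ≡ 0ℤ) → sumℤ n f ≡ 0ℤ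
sum-≡0 {n} p = trans (sum-cong p) (sum-0 n)

sum-+ : ∀ {n} (f g : Fin n → ℤ) → sumℤ n (λ i → f i + g i) ≡ sumℤ n f + sumℤ n g
sum-+ {zero}  f g = refl
sum-+ {suc n} f g = trans (cong ((f zero + g zero) +_) (sum-+ (λ i → f (suc i)) (λ i → g (suc i))))
                          (+-interchange (f zero) (g zero) _ _)

sum-* : ∀ {n} c (f : Fin n → ℤ) → sumℤ n (λ i → c * f i) ≡ c * sumℤ n f
sum-* {zero}  c f = sym (ℤP.*-zeroʳ c)
sum-* {suc n} c f = trans (cong (c * f zero +_) (sum-* c (λ i → f (suc i)))) (sym (ℤP.*-distribˡ-+ c _ _))

tail-L : ∀ {n} → Lin (suc n) n
ap    tail-L = λ x i → x (suc i)
congr tail-L = λ p i → p (suc i)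
add   tail-L = λ _ _ _ → refl
scal  tail-L = λ _ _ _ → refl

cons0 : ∀ {n} → Lin n (suc n)
ap    cons0 = λ { x zero → 0ℤ ; x (suc i) → x i }
congr cons0 = λ { p zero → refl ; p (suc i) → p i }
add   cons0 = λ { _ _ zero → refl ; _ _ (suc i) → refl }
scal  cons0 = λ { c _ zero → sym (ℤP.*-zeroʳ c) ; _ _ (suc i) → refl }

uncons : ∀ {n} (x : V (suc n)) → x ≗ x zero ·v e zero +v ap cons0 (ap tail-L x)
uncons x zero    = sym (trans (ℤP.+-identityʳ _) (ℤP.*-identityʳ _))
uncons x (suc i) = sym (trans (cong (_+ x (suc i)) (ℤP.*-zeroʳ (x zero))) (ℤP.+-identityˡ _))

cons0-e : ∀ {n} (j : Fin n) → ap cons0 (e j) ≗ e (suc j)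
cons0-e j zero    = refl
cons0-e j (suc i) = refl

expand : ∀ {n r} (f : Lin n r) x i → ap f x i ≡ sumℤ n (λ j → x j * ent f i j)
expand {zero}  f x i = ap-≗0 f (λ ()) i
expand {suc n} f x i = begin
  ap f x i                                                     ≡⟨ congr f (uncons x) i ⟩
  ap f (x zero ·v e zero +v ap cons0 (ap tail-L x)) i          ≡⟨ add f _ _ i ⟩
  ap f (x zero ·v e zero) i + ap (f ∘L cons0) (ap tail-L x) i
    ≡⟨ cong₂ _+_ (scal f (x zero) (e zero) i) (expand (f ∘L cons0) (ap tail-L x) i) ⟩
  x zero * ent f i zero + sumℤ n (λ j → x (suc j) * ent (f ∘L cons0) i j)
    ≡⟨ cong (x zero * ent f i zero +_) (sum-cong λ j → cong (x (suc j) *_) (congr f (cons0-e j) i)) ⟩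
  sumℤ (suc n) (λ j → x j * ent f i j) ∎

≐-ent : ∀ {n r} {f g : Lin n r} → (∀ i j → ent f i j ≡ ent g i j) → f ≐ g
≐-ent {f = f} {g} p = eq λ x i → trans (expand f x i) (trans (sum-cong (λ j → cong (x j *_) (p i j))) (sym (expand g x i)))

fromMatrix : ∀ {n r} → (Fin r → Fin n → ℤ) → Lin n r
ap    (fromMatrix {n} M) = λ x i → sumℤ n (λ k → M i k * x k)
congr (fromMatrix {n} M) = λ p i → sum-cong (λ k → cong (M i k *_) (p k))
add   (fromMatrix {n} M) = λ x y i → trans (sum-cong (λ k → ℤP.*-distribˡ-+ (M i k) (x k) (y k))) (sum-+ (λ k → M i k * x k) (λ k → M i k * y k))
scal  (fromMatrix {n} M) = λ c x i → trans (sum-cong (λ k → *-swap (M i k) c (x k))) (sum-* c (λ k → M i k * x k))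

sum-e : ∀ {n} (f : Fin n → ℤ) j → sumℤ n (λ k → f k * e j k) ≡ f j
sum-e {suc n} f zero    = trans (cong₂ _+_ (ℤP.*-identityʳ (f zero)) (sum-≡0 {n} (λ k → ℤP.*-zeroʳ (f (suc k))))) (ℤP.+-identityʳ _)
sum-e {suc n} f (suc j) = trans (cong₂ _+_ (ℤP.*-zeroʳ (f zero)) (sum-e (λ k → f (suc k)) j)) (ℤP.+-identityˡ _)

ent-fromMatrix : ∀ {n r} (M : Fin r → Fin n → ℤ) i j → ent (fromMatrix M) i j ≡ M i j
ent-fromMatrix M i j = sum-e (M i) j

record Bdd {n r : ℕ} (N : ℕ) (f : Lin n r) : Set where
  constructor bdd
  field bound : ∀ i j → ∣ ent f i j ∣ ℕ.≤ N
open Bdd public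

Bdd-mono : ∀ {n r} {f : Lin n r} {M N} → M ℕ.≤ N → Bdd M f → Bdd N f
Bdd-mono p b = bdd λ i j → ℕP.≤-trans (bound b i j) p

Bdd-≐ : ∀ {n r N} {f g : Lin n r} → f ≐ g → Bdd N f → Bdd N g
Bdd-≐ {N = N} p b = bdd λ i j → subst (λ z → ∣ z ∣ ℕ.≤ N) (at p (e j) i) (bound b i j)

∣sum∣≤ : ∀ {n} (f : Fin n → ℤ) M → (∀ i → ∣ f i ∣ ℕ.≤ M) → ∣ sumℤ n f ∣ ℕ.≤ n ℕ.* M
∣sum∣≤ {zero}  f M b = ℕ.z≤n
∣sum∣≤ {suc n} f M b = ℕP.≤-trans (ℤP.∣i+j∣≤∣i∣+∣j∣ (f zero) _) (ℕP.+-mono-≤ (b zero) (∣sum∣≤ (λ i → f (suc i)) M (λ i → b (suc i))))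

Bdd-ap : ∀ {n r} (f : Lin n r) {M N x} → Bdd N f → (∀ j → ∣ x j ∣ ℕ.≤ M) → ∀ i → ∣ ap f x i ∣ ℕ.≤ n ℕ.* (M ℕ.* N)
Bdd-ap {n} f {M} {N} {x} b bx i = subst (λ z → ∣ z ∣ ℕ.≤ n ℕ.* (M ℕ.* N)) (sym (expand f x i))
  (∣sum∣≤ _ _ (λ j → subst (ℕ._≤ M ℕ.* N) (sym (ℤP.∣i*j∣≡∣i∣*∣j∣ (x j) (ent f i j))) (ℕP.*-mono-≤ (bx j) (bound b i j))))

Bdd-∘ : ∀ {n r s} (g : Lin r s) (f : Lin n r) {M N} → Bdd M g → Bdd N f → Bdd (r ℕ.* (N ℕ.* M)) (g ∘L f)
Bdd-∘ g f bg bf = bdd λ i j → Bdd-ap g bg (λ k → bound bf k j) i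

Bdd-+ : ∀ {n r} (f g : Lin n r) {M N} → Bdd M f → Bdd N g → Bdd (M ℕ.+ N) (f +L g)
Bdd-+ f g bf bg = bdd λ i j → ℕP.≤-trans (ℤP.∣i+j∣≤∣i∣+∣j∣ (ent f i j) _) (ℕP.+-mono-≤ (bound bf i j) (bound bg i j))

Bdd-· : ∀ {n r} c (f : Lin n r) {N} → Bdd N f → Bdd (∣ c ∣ ℕ.* N) (c ·L f)
Bdd-· c f {N} bf = bdd λ i j → subst (ℕ._≤ ∣ c ∣ ℕ.* N) (sym (ℤP.∣i*j∣≡∣i∣*∣j∣ c (ent f i j))) (ℕP.*-monoʳ-≤ ∣ c ∣ (bound bf i j))

Bdd-- : ∀ {n r} (f : Lin n r) {N} → Bdd N f → Bdd N (-L f)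
Bdd-- f {N} bf = Bdd-mono (ℕP.≤-reflexive (ℕP.*-identityˡ N)) (Bdd-· -1ℤ f bf)

∣e∣≤1 : ∀ {n} (j i : Fin n) → ∣ e j i ∣ ℕ.≤ 1
∣e∣≤1 zero    zero    = ℕP.≤-refl
∣e∣≤1 zero    (suc i) = ℕ.z≤n
∣e∣≤1 (suc j) zero    = ℕ.z≤n
∣e∣≤1 (suc j) (suc i) = ∣e∣≤1 j i

Bdd-id : ∀ {n} → Bdd 1 (idL {n})
Bdd-id = bdd λ i j → ∣e∣≤1 j i

Bdd-0 : ∀ {n r} → Bdd 0 (0L {n} {r})
Bdd-0 = bdd λ i j → ℕ.z≤n

-- Block decomposition of V (k + n)

module _ {k n : ℕ} where

  leftL : Lin (k ℕ.+ n) k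
  ap    leftL = λ x i → x (i ↑ˡ n)
  congr leftL = λ p i → p _
  add   leftL = λ _ _ _ → refl
  scal  leftL = λ _ _ _ → refl

  rightL : Lin (k ℕ.+ n) n
  ap    rightL = λ x i → x (k ↑ʳ i)
  congr rightL = λ p i → p _
  add   rightL = λ _ _ _ → refl
  scal  rightL = λ _ _ _ → refl

  append : V k → V n → V (k ℕ.+ n)
  append x y i with F.splitAt k i
  ... | inj₁ a = x a
  ... | inj₂ b = y b

  append-l : ∀ x y i → append x y (i ↑ˡ n) ≡ x i
  append-l x y i rewrite FP.splitAt-↑ˡ k i n = refl

  append-r : ∀ x y i → append x y (k ↑ʳ i) ≡ y i
  append-r x y i rewrite FP.splitAt-↑ʳ k n i = refl

  data Split : Fin (k ℕ.+ n) → Set where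
    isL : ∀ i → Split (i ↑ˡ n)
    isR : ∀ i → Split (k ↑ʳ i)

  split : ∀ i → Split i
  split i with F.splitAt k i in eq
  ... | inj₁ a = subst Split (FP.splitAt⁻¹-↑ˡ eq) (isL a)
  ... | inj₂ b = subst Split (FP.splitAt⁻¹-↑ʳ eq) (isR b)

  split-ext : ∀ {x y : V (k ℕ.+ n)} → ap leftL x ≗ ap leftL y → ap rightL x ≗ ap rightL y → x ≗ y
  split-ext p q i with split i
  ... | isL a = p a
  ... | isR b = q b

  appendL : ∀ {s} → Lin s k → Lin s n → Lin s (k ℕ.+ n)
  ap    (appendL f g) = λ x → append (ap f x) (ap g x)
  congr (appendL f g) = λ p → split-ext (λ i → trans (append-l _ _ i) (trans (congr f p i) (sym (append-l _ _ i))))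
                     (λ i → trans (append-r _ _ i) (trans (congr g p i) (sym (append-r _ _ i))))
  add   (appendL f g) = λ x y → split-ext (λ i → trans (append-l _ _ i) (trans (add f x y i) (sym (cong₂ _+_ (append-l _ _ i) (append-l _ _ i)))))
                       (λ i → trans (append-r _ _ i) (trans (add g x y i) (sym (cong₂ _+_ (append-r _ _ i) (append-r _ _ i)))))
  scal  (appendL f g) = λ c x → split-ext (λ i → trans (append-l _ _ i) (trans (scal f c x i) (sym (cong (c *_) (append-l _ _ i)))))
                       (λ i → trans (append-r _ _ i) (trans (scal g c x i) (sym (cong (c *_) (append-r _ _ i)))))

  inlL : Lin k (k ℕ.+ n)
  inlL = appendL idL 0L

  inrL : Lin n (k ℕ.+ n)
  inrL = appendL 0L idL

  opaque
    -- The matrix with block rows (A X) and (0 B): the first k basis vectors span an invariant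
    -- sublattice, on which A acts, and B acts on the quotient. Opaque, so that it does not unfold
    -- into case distinctions on `splitAt`.
    blk : Lin k k → Lin n k → Lin n n → Lin (k ℕ.+ n) (k ℕ.+ n)
    blk A X B = appendL ((A ∘L leftL) +L (X ∘L rightL)) (B ∘L rightL)

    blk-l : ∀ A X B x i → ap (blk A X B) x (i ↑ˡ n) ≡ ap A (ap leftL x) i + ap X (ap rightL x) i
    blk-l A X B x i = append-l _ _ i

    blk-r : ∀ A X B x i → ap (blk A X B) x (k ↑ʳ i) ≡ ap B (ap rightL x) i
    blk-r A X B x i = append-r _ _ i

  blk-ext : ∀ {f g : Lin (k ℕ.+ n) (k ℕ.+ n)} →
            (∀ x i → ap f x (i ↑ˡ n) ≡ ap g x (i ↑ˡ n)) → (∀ x i → ap f x (k ↑ʳ i) ≡ ap g x (k ↑ʳ i)) → f ≐ g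
  blk-ext p q = eq λ x → split-ext (p x) (q x)

  blk-cong : ∀ {A A′ X X′ B B′} → A ≐ A′ → X ≐ X′ → B ≐ B′ → blk A X B ≐ blk A′ X′ B′
  blk-cong {A} {A′} {X} {X′} {B} {B′} p q r = blk-ext
    (λ x i → trans (blk-l A X B x i) (trans (cong₂ _+_ (at p _ i) (at q _ i)) (sym (blk-l A′ X′ B′ x i))))
    (λ x i → trans (blk-r A X B x i) (trans (at r _ i) (sym (blk-r A′ X′ B′ x i))))

  blk-∘ : ∀ A X B A′ X′ B′ → blk A X B ∘L blk A′ X′ B′ ≐ blk (A ∘L A′) (A ∘L X′ +L X ∘L B′) (B ∘L B′)
  blk-∘ A X B A′ X′ B′ = blk-ext
    (λ x i → begin
      ap (blk A X B) (ap (blk A′ X′ B′) x) (i ↑ˡ n)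
        ≡⟨ blk-l A X B (ap (blk A′ X′ B′) x) i ⟩
      ap A (ap leftL (ap (blk A′ X′ B′) x)) i + ap X (ap rightL (ap (blk A′ X′ B′) x)) i
        ≡⟨ cong₂ _+_ (trans (congr A (blk-l A′ X′ B′ x) i) (add A _ _ i)) (congr X (blk-r A′ X′ B′ x) i) ⟩
      ap A (ap A′ (ap leftL x)) i + ap A (ap X′ (ap rightL x)) i + ap X (ap B′ (ap rightL x)) i
        ≡⟨ ℤP.+-assoc (ap A (ap A′ (ap leftL x)) i) _ _ ⟩
      ap A (ap A′ (ap leftL x)) i + (ap A (ap X′ (ap rightL x)) i + ap X (ap B′ (ap rightL x)) i)
        ≡⟨ blk-l (A ∘L A′) (A ∘L X′ +L X ∘L B′) (B ∘L B′) x i ⟨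
      ap (blk (A ∘L A′) (A ∘L X′ +L X ∘L B′) (B ∘L B′)) x (i ↑ˡ n) ∎)
    (λ x i → trans (blk-r A X B (ap (blk A′ X′ B′) x) i) (trans (congr B (blk-r A′ X′ B′ x) i) (sym (blk-r (A ∘L A′) (A ∘L X′ +L X ∘L B′) (B ∘L B′) x i))))

  blk-id : blk idL 0L idL ≐ idL
  blk-id = blk-ext (λ x i → trans (blk-l idL 0L idL x i) (ℤP.+-identityʳ _)) (λ x i → blk-r idL 0L idL x i)

  e-ll : ∀ (j i : Fin k) → e (j ↑ˡ n) (i ↑ˡ n) ≡ e j i
  e-ll j i = go k j i
    where
    go : ∀ k (j i : Fin k) → e (j ↑ˡ n) (i ↑ˡ n) ≡ e j i
    go (suc k) zero    zero    = refl
    go (suc k) zero    (suc i) = refl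
    go (suc k) (suc j) zero    = refl
    go (suc k) (suc j) (suc i) = go k j i

  e-lr : ∀ (j : Fin k) (i : Fin n) → e (j ↑ˡ n) (k ↑ʳ i) ≡ 0ℤ
  e-lr j i = go k j i
    where
    go : ∀ k (j : Fin k) (i : Fin n) → e (j ↑ˡ n) (k ↑ʳ i) ≡ 0ℤ
    go (suc k) zero    i = refl
    go (suc k) (suc j) i = go k j i

  e-rl : ∀ (j : Fin n) (i : Fin k) → e (k ↑ʳ j) (i ↑ˡ n) ≡ 0ℤ
  e-rl j i = go k j i
    where
    go : ∀ k (j : Fin n) (i : Fin k) → e (k ↑ʳ j) (i ↑ˡ n) ≡ 0ℤ
    go (suc k) j zero    = refl
    go (suc k) j (suc i) = go k j i

  e-rr : ∀ (j i : Fin n) → e (k ↑ʳ j) (k ↑ʳ i) ≡ e j i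
  e-rr j i = go k j i
    where
    go : ∀ k (j i : Fin n) → e (k ↑ʳ j) (k ↑ʳ i) ≡ e j i
    go zero    j i = refl
    go (suc k) j i = go k j i

  topLeft : Lin (k ℕ.+ n) (k ℕ.+ n) → Lin k k
  topLeft A = leftL ∘L A ∘L inlL

  topRight : Lin (k ℕ.+ n) (k ℕ.+ n) → Lin n k
  topRight A = leftL ∘L A ∘L inrL

  botRight : Lin (k ℕ.+ n) (k ℕ.+ n) → Lin n n
  botRight A = rightL ∘L A ∘L inrL

  inl-e : ∀ j → ap inlL (e j) ≗ e (j ↑ˡ n)
  inl-e j = split-ext (λ i → trans (append-l (e j) 0v i) (sym (e-ll j i))) (λ i → trans (append-r (e j) 0v i) (sym (e-lr j i)))

  inr-e : ∀ j → ap inrL (e j) ≗ e (k ↑ʳ j)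
  inr-e j = split-ext (λ i → trans (append-l 0v (e j) i) (sym (e-rl j i))) (λ i → trans (append-r 0v (e j) i) (sym (e-rr j i)))

  ent-topLeft : ∀ A i j → ent (topLeft A) i j ≡ ent A (i ↑ˡ n) (j ↑ˡ n)
  ent-topLeft A i j = congr A (inl-e j) (i ↑ˡ n)

  ent-topRight : ∀ A i j → ent (topRight A) i j ≡ ent A (i ↑ˡ n) (k ↑ʳ j)
  ent-topRight A i j = congr A (inr-e j) (i ↑ˡ n)

  ent-botRight : ∀ A i j → ent (botRight A) i j ≡ ent A (k ↑ʳ i) (k ↑ʳ j)
  ent-botRight A i j = congr A (inr-e j) (k ↑ʳ i)

  ent-blk-ll : ∀ A X B i j → ent (blk A X B) (i ↑ˡ n) (j ↑ˡ n) ≡ ent A i j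
  ent-blk-ll A X B i j = trans (blk-l A X B (e (j ↑ˡ n)) i)
    (trans (cong₂ _+_ (congr A (e-ll j) i) (ap-≗0 X (e-lr j) i)) (ℤP.+-identityʳ _))

  ent-blk-lr : ∀ A X B i j → ent (blk A X B) (i ↑ˡ n) (k ↑ʳ j) ≡ ent X i j
  ent-blk-lr A X B i j = trans (blk-l A X B (e (k ↑ʳ j)) i)
    (trans (cong₂ _+_ (ap-≗0 A (e-rl j) i) (congr X (e-rr j) i)) (ℤP.+-identityˡ _))

  ent-blk-rl : ∀ A X B i j → ent (blk A X B) (k ↑ʳ i) (j ↑ˡ n) ≡ 0ℤ
  ent-blk-rl A X B i j = trans (blk-r A X B (e (j ↑ˡ n)) i) (ap-≗0 B (e-lr j) i)

  ent-blk-rr : ∀ A X B i j → ent (blk A X B) (k ↑ʳ i) (k ↑ʳ j) ≡ ent B i j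
  ent-blk-rr A X B i j = trans (blk-r A X B (e (k ↑ʳ j)) i) (congr B (e-rr j) i)

  Bdd-blk : ∀ {N} A X B → Bdd N A → Bdd N X → Bdd N B → Bdd N (blk A X B)
  Bdd-blk {N} A X B bA bX bB = bdd go
    where
    go : ∀ i j → ∣ ent (blk A X B) i j ∣ ℕ.≤ N
    go i j with split i | split j
    ... | isL a | isL b = subst (λ z → ∣ z ∣ ℕ.≤ N) (sym (ent-blk-ll A X B a b)) (bound bA a b)
    ... | isL a | isR b = subst (λ z → ∣ z ∣ ℕ.≤ N) (sym (ent-blk-lr A X B a b)) (bound bX a b)
    ... | isR a | isL b = subst (λ z → ∣ z ∣ ℕ.≤ N) (sym (ent-blk-rl A X B a b)) ℕ.z≤n
    ... | isR a | isR b = subst (λ z → ∣ z ∣ ℕ.≤ N) (sym (ent-blk-rr A X B a b)) (bound bB a b)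

  blk-inj : ∀ {A X B A′ X′ B′} → blk A X B ≐ blk A′ X′ B′ → A ≐ A′ × X ≐ X′ × B ≐ B′
  blk-inj {A} {X} {B} {A′} {X′} {B′} p =
      ≐-ent (λ i j → trans (sym (ent-blk-ll A X B i j)) (trans (at p (e (j ↑ˡ n)) (i ↑ˡ n)) (ent-blk-ll A′ X′ B′ i j)))
    , ≐-ent (λ i j → trans (sym (ent-blk-lr A X B i j)) (trans (at p (e (k ↑ʳ j)) (i ↑ˡ n)) (ent-blk-lr A′ X′ B′ i j)))
    , ≐-ent (λ i j → trans (sym (ent-blk-rr A X B i j)) (trans (at p (e (k ↑ʳ j)) (k ↑ʳ i)) (ent-blk-rr A′ X′ B′ i j)))

-- Block triangularity at position k without a decomposition r = k + n in the type, so that it can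
-- be asserted for all k simultaneously; `Tri⇒blk` passes to actual blocks.
Tri : ∀ {r} → ℕ → Lin r r → Set
Tri k f = ∀ i j → toℕ j ℕ.< k → k ℕ.≤ toℕ i → ent f i j ≡ 0ℤ

Tri-≐ : ∀ {r k} {f g : Lin r r} → f ≐ g → Tri k f → Tri k g
Tri-≐ p t i j a b = trans (sym (at p (e j) i)) (t i j a b)

e-≢ : ∀ {n} {i j : Fin n} → i ≢ j → e j i ≡ 0ℤ
e-≢ {i = zero}  {zero}  p = ⊥-elim (p refl)
e-≢ {i = zero}  {suc j} p = refl
e-≢ {i = suc i} {zero}  p = refl
e-≢ {i = suc i} {suc j} p = e-≢ {i = i} {j} (λ q → p (cong suc q))

e-≡ : ∀ {n} (i : Fin n) → e i i ≡ 1ℤ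
e-≡ zero    = refl
e-≡ (suc i) = e-≡ i

Tri-id : ∀ {r} k → Tri {r} k idL
Tri-id k i j a b = e-≢ {i = i} {j} (λ { refl → ℕP.<-irrefl refl (ℕP.<-≤-trans a b) })

Tri-∘ : ∀ {r k} {f g : Lin r r} → Tri k f → Tri k g → Tri k (f ∘L g)
Tri-∘ {r} {k} {f} {g} tf tg i j a b = trans (expand f (ap g (e j)) i) (sum-≡0 zeroes)
  where
  zeroes : ∀ l → ent g l j * ent f i l ≡ 0ℤ
  zeroes l with toℕ l ℕ.<? k
  ... | yes l<k = trans (cong (ent g l j *_) (tf i l l<k b)) (ℤP.*-zeroʳ (ent g l j))
  ... | no  l≮k = cong (_* ent f i l) (tg l j a (ℕP.≮⇒≥ l≮k))

module _ {k n : ℕ} where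

  ↑ˡ<k : ∀ (i : Fin k) → toℕ (i ↑ˡ n) ℕ.< k
  ↑ˡ<k i = subst (ℕ._< k) (sym (FP.toℕ-↑ˡ i n)) (FP.toℕ<n i)

  k≤↑ʳ : ∀ (i : Fin n) → k ℕ.≤ toℕ (k ↑ʳ i)
  k≤↑ʳ i = subst (k ℕ.≤_) (sym (FP.toℕ-↑ʳ k i)) (ℕP.m≤m+n k (toℕ i))

  Tri⇒blk : ∀ (A : Lin (k ℕ.+ n) (k ℕ.+ n)) → Tri k A → A ≐ blk {k} {n} (topLeft A) (topRight A) (botRight A)
  Tri⇒blk A t = ≐-ent go
    where
    go : ∀ i j → ent A i j ≡ ent (blk {k} {n} (topLeft A) (topRight A) (botRight A)) i j
    go i j with split {k} {n} i | split {k} {n} j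
    ... | isL a | isL b = sym (trans (ent-blk-ll (topLeft {k} {n} A) (topRight {k} {n} A) (botRight {k} {n} A) a b) (ent-topLeft A a b))
    ... | isL a | isR b = sym (trans (ent-blk-lr (topLeft {k} {n} A) (topRight {k} {n} A) (botRight {k} {n} A) a b) (ent-topRight A a b))
    ... | isR a | isR b = sym (trans (ent-blk-rr (topLeft {k} {n} A) (topRight {k} {n} A) (botRight {k} {n} A) a b) (ent-botRight A a b))
    ... | isR a | isL b = trans (t _ _ (↑ˡ<k b) (k≤↑ʳ a)) (sym (ent-blk-rl (topLeft {k} {n} A) (topRight {k} {n} A) (botRight {k} {n} A) a b))

  Tri-blk-lo : ∀ {l} A X B → l ℕ.≤ k → Tri l A → Tri l (blk {k} {n} A X B)
  Tri-blk-lo A X B l≤k t i j a b with split {k} {n} i | split {k} {n} j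
  ... | isR i′ | isL j′ = ent-blk-rl A X B i′ j′
  ... | _      | isR j′ = ⊥-elim (ℕP.<⇒≱ a (ℕP.≤-trans l≤k (k≤↑ʳ j′)))
  ... | isL i′ | isL j′ = trans (ent-blk-ll A X B i′ j′)
      (t i′ j′ (subst (ℕ._< _) (FP.toℕ-↑ˡ j′ n) a) (subst (_ ℕ.≤_) (FP.toℕ-↑ˡ i′ n) b))

  Tri-blk-hi : ∀ {l} A X B → Tri l B → Tri (k ℕ.+ l) (blk {k} {n} A X B)
  Tri-blk-hi A X B t i j a b with split {k} {n} i | split {k} {n} j
  ... | isR i′ | isL j′ = ent-blk-rl A X B i′ j′
  ... | isL i′ | _      = ⊥-elim (ℕP.<⇒≱ (↑ˡ<k i′) (ℕP.≤-trans (ℕP.m≤m+n k _) b))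
  ... | isR i′ | isR j′ = trans (ent-blk-rr A X B i′ j′)
      (t i′ j′ (ℕP.+-cancelˡ-< k _ _ (subst (ℕ._< _) (FP.toℕ-↑ʳ k j′) a))
               (ℕP.+-cancelˡ-≤ k _ _ (subst (_ ℕ.≤_) (FP.toℕ-↑ʳ k i′) b)))

+-cancelʳ : ∀ b {a c : ℤ} → a + b ≡ c + b → a ≡ c
+-cancelʳ b {a} {c} q = trans (lemma a b) (trans (cong (_+ - b) q) (sym (lemma c b)))
  where
  lemma : ∀ a b → a ≡ a + b + - b
  lemma = solve-∀

-- Polynomials in endomorphisms and the separability homotopy

evalL : ∀ {r} → Poly → Lin r r → Lin r r
evalL []      A = 0L
evalL (c ∷ p) A = c ·L idL +L A ∘L evalL p A

evalL-cong : ∀ {r} p {A B : Lin r r} → A ≐ B → evalL p A ≐ evalL p B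
evalL-cong []      q = ≐-refl
evalL-cong (c ∷ p) q = +L-cong (≐-refl {f = c ·L idL}) (∘-cong q (evalL-cong p q))

evalL-intertwine : ∀ {r s} p {A : Lin r r} {B : Lin s s} (P : Lin r s) → P ∘L A ≐ B ∘L P → P ∘L evalL p A ≐ evalL p B ∘L P
evalL-intertwine []      P q = eq λ x → ap-0 P
evalL-intertwine (c ∷ p) {A} {B} P q = eq λ x i → begin
  ap P (c ·v x +v ap A (ap (evalL p A) x)) i              ≡⟨ add P _ _ i ⟩
  ap P (c ·v x) i + ap P (ap A (ap (evalL p A) x)) i      ≡⟨ cong₂ _+_ (scal P c x i) (at q (ap (evalL p A) x) i) ⟩
  c * ap P x i + ap B (ap P (ap (evalL p A) x)) i         ≡⟨ cong (c * ap P x i +_) (congr B (at (evalL-intertwine p P q) x) i) ⟩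
  c * ap P x i + ap B (ap (evalL p B) (ap P x)) i         ∎

evalL-comm : ∀ {r} p (A : Lin r r) → A ∘L evalL p A ≐ evalL p A ∘L A
evalL-comm p A = evalL-intertwine p A ≐-refl

evalL-+ : ∀ {r} p q (A : Lin r r) → evalL (p +ₚ q) A ≐ evalL p A +L evalL q A
evalL-+ []      q       A = eq λ x i → sym (ℤP.+-identityˡ _)
evalL-+ (a ∷ p) []      A = eq λ x i → sym (ℤP.+-identityʳ _)
evalL-+ (a ∷ p) (b ∷ q) A = eq λ x i → trans
  (cong ((a + b) * x i +_) (trans (congr A (at (evalL-+ p q A) x) i) (add A _ _ i)))
  (lemma a b (x i) _ _)
  where
  lemma : ∀ a b x y z → (a + b) * x + (y + z) ≡ (a * x + y) + (b * x + z)
  lemma = solve-∀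

evalL-scale : ∀ {r} c p (A : Lin r r) → evalL (scaleₚ c p) A ≐ c ·L evalL p A
evalL-scale c []      A = eq λ x i → sym (ℤP.*-zeroʳ c)
evalL-scale c (a ∷ p) A = eq λ x i → trans
  (cong (c * a * x i +_) (trans (congr A (at (evalL-scale c p A) x) i) (scal A c _ i)))
  (lemma c a (x i) _)
  where
  lemma : ∀ c a x y → c * a * x + c * y ≡ c * (a * x + y)
  lemma = solve-∀

evalL-* : ∀ {r} p q (A : Lin r r) → evalL (p *ₚ q) A ≐ evalL p A ∘L evalL q A
evalL-* []      q A = eq λ _ _ → refl
evalL-* (a ∷ p) q A = eq λ x i → trans (at (evalL-+ (scaleₚ a q) (0ℤ ∷ (p *ₚ q)) A) x i)
  (cong₂ _+_ (at (evalL-scale a q A) x i)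
             (trans (ℤP.+-identityˡ _) (congr A (at (evalL-* p q A) x) i)))

evalL-≈0 : ∀ {r} p (A : Lin r r) → (∀ k → coeff p k ≡ 0ℤ) → evalL p A ≐ 0L
evalL-≈0 []      A z = ≐-refl
evalL-≈0 (c ∷ p) A z = eq λ x i → trans
  (cong₂ _+_ (cong (_* x i) (z 0)) (ap-≗0 A (at (evalL-≈0 p A (λ k → z (suc k))) x) i)) (ℤP.+-identityʳ 0ℤ)

evalL-≈ : ∀ {r} p q (A : Lin r r) → p ≈ₚ q → evalL p A ≐ evalL q A
evalL-≈ []      q       A z = ≐-sym (evalL-≈0 q A (λ k → sym (z k)))
evalL-≈ (a ∷ p) []      A z = evalL-≈0 (a ∷ p) A z
evalL-≈ (a ∷ p) (b ∷ q) A z = eq λ x i →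
  cong₂ _+_ (cong (_* x i) (z 0)) (congr A (at (evalL-≈ p q A (λ k → z (suc k))) x) i)

deriv : Poly → Poly
deriv []      = []
deriv (c ∷ p) = p +ₚ (0ℤ ∷ deriv p)

-- For l = A ∘_ and ρ = _∘ B acting on Lin n k, Φ p is the divided difference (p(l) - p(ρ)) / (l - ρ) and
-- Ψ p is (p′(l) - Φ p) / (l - ρ).
module _ {k n : ℕ} (A : Lin k k) (B : Lin n n) where

  Φ : Poly → Lin n k → Lin n k
  Φ []      X = 0L
  Φ (c ∷ p) X = A ∘L Φ p X +L X ∘L evalL p B

  Ψ : Poly → Lin n k → Lin n k
  Ψ []      X = 0L
  Ψ (c ∷ p) X = A ∘L Ψ p X +L Φ p X

  -- This is (l - ρ) Φ p = p(l) - p(ρ), with the negative terms moved across.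
  Φ-commutator : ∀ p X → A ∘L Φ p X +L X ∘L evalL p B ≐ Φ p X ∘L B +L evalL p A ∘L X
  Φ-commutator []      X = eq λ x i → cong₂ _+_ (ap-0 A i) (ap-0 X i)
  Φ-commutator (c ∷ p) X = eq λ x i → begin
    ap A (ap (A ∘L Φ p X +L X ∘L evalL p B) x) i + ap X (c ·v x +v ap B (ap (evalL p B) x)) i
      ≡⟨ cong₂ _+_ (trans (congr A (at (Φ-commutator p X) x) i) (add A _ _ i)) (trans (add X _ _ i) (cong (_+ ap X (ap B (ap (evalL p B) x)) i) (scal X c x i))) ⟩
    (ap A (ap (Φ p X) (ap B x)) i + ap A (ap (evalL p A) (ap X x)) i) + (c * ap X x i + ap X (ap B (ap (evalL p B) x)) i)
      ≡⟨ lemma (ap A (ap (Φ p X) (ap B x)) i) (ap A (ap (evalL p A) (ap X x)) i) (c * ap X x i) (ap X (ap B (ap (evalL p B) x)) i) ⟩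
    (ap A (ap (Φ p X) (ap B x)) i + ap X (ap B (ap (evalL p B) x)) i) + (c * ap X x i + ap A (ap (evalL p A) (ap X x)) i)
      ≡⟨ cong (λ z → (ap A (ap (Φ p X) (ap B x)) i + z) + (c * ap X x i + ap A (ap (evalL p A) (ap X x)) i))
              (congr X (at (evalL-comm p B) x) i) ⟩
    (ap A (ap (Φ p X) (ap B x)) i + ap X (ap (evalL p B) (ap B x)) i) + (c * ap X x i + ap A (ap (evalL p A) (ap X x)) i) ∎
    where
    lemma : ∀ a b c d → (a + b) + (c + d) ≡ (a + d) + (c + b)
    lemma = solve-∀

  -- This is (l - ρ) Ψ p = p′(l) - Φ p. It holds because the divided difference becomes p′(l) when ρ
  -- is set equal to l, so that the difference is again divisible by l - ρ.
  Ψ-commutator : ∀ p X → evalL (deriv p) A ∘L X +L Ψ p X ∘L B ≐ Φ p X +L A ∘L Ψ p X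
  Ψ-commutator []      X = eq λ x i → cong (0ℤ +_) (sym (ap-0 A i))
  Ψ-commutator (c ∷ p) X = eq λ x i → begin
    ap (evalL (p +ₚ (0ℤ ∷ deriv p)) A) (ap X x) i + (ap A (ap (Ψ p X) (ap B x)) i + ap (Φ p X) (ap B x) i)
      ≡⟨ cong (_+ (ap A (ap (Ψ p X) (ap B x)) i + ap (Φ p X) (ap B x) i)) (trans (at (evalL-+ p (0ℤ ∷ deriv p) A) (ap X x) i) (cong (ap (evalL p A) (ap X x) i +_) (ℤP.+-identityˡ _))) ⟩
    (ap (evalL p A) (ap X x) i + ap A (ap (evalL (deriv p) A) (ap X x)) i) + (ap A (ap (Ψ p X) (ap B x)) i + ap (Φ p X) (ap B x) i)
      ≡⟨ lemma (ap (evalL p A) (ap X x) i) (ap A (ap (evalL (deriv p) A) (ap X x)) i) (ap A (ap (Ψ p X) (ap B x)) i) (ap (Φ p X) (ap B x) i) ⟩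
    (ap (Φ p X) (ap B x) i + ap (evalL p A) (ap X x) i) + (ap A (ap (evalL (deriv p) A) (ap X x)) i + ap A (ap (Ψ p X) (ap B x)) i)
      ≡⟨ cong₂ _+_ (sym (at (Φ-commutator p X) x i)) (sym (add A _ _ i)) ⟩
    ap (A ∘L Φ p X +L X ∘L evalL p B) x i + ap A (ap (evalL (deriv p) A ∘L X +L Ψ p X ∘L B) x) i
      ≡⟨ cong (ap (A ∘L Φ p X +L X ∘L evalL p B) x i +_) (trans (congr A (at (Ψ-commutator p X) x) i) (trans (add A _ _ i) (trans (ℤP.+-comm (ap A (ap (Φ p X) x) i) _) (sym (add A _ _ i))))) ⟩
    ap (A ∘L Φ p X +L X ∘L evalL p B) x i + ap A (ap (A ∘L Ψ p X +L Φ p X) x) i ∎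
    where
    lemma : ∀ a b c d → (a + b) + (c + d) ≡ (d + a) + (b + c)
    lemma = solve-∀

  Φ-cong : ∀ p {X Y} → X ≐ Y → Φ p X ≐ Φ p Y
  Φ-cong []      q = ≐-refl
  Φ-cong (c ∷ p) q = +L-cong (∘-cong (≐-refl {f = A}) (Φ-cong p q)) (∘-cong q (≐-refl {f = evalL p B}))

  Ψ-cong : ∀ p {X Y} → X ≐ Y → Ψ p X ≐ Ψ p Y
  Ψ-cong []      q = ≐-refl
  Ψ-cong (c ∷ p) q = +L-cong (∘-cong (≐-refl {f = A}) (Ψ-cong p q)) (Φ-cong p q)

  Φ-+ : ∀ p X Y → Φ p (X +L Y) ≐ Φ p X +L Φ p Y
  Φ-+ []      X Y = eq λ _ _ → refl
  Φ-+ (c ∷ p) X Y = eq λ x i → trans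
    (cong (_+ ap (X +L Y) (ap (evalL p B) x) i) (trans (congr A (at (Φ-+ p X Y) x) i) (add A _ _ i)))
    (+-interchange (ap A (ap (Φ p X) x) i) _ _ _)

  Ψ-+ : ∀ p X Y → Ψ p (X +L Y) ≐ Ψ p X +L Ψ p Y
  Ψ-+ []      X Y = eq λ _ _ → refl
  Ψ-+ (c ∷ p) X Y = eq λ x i → trans
    (cong₂ _+_ (trans (congr A (at (Ψ-+ p X Y) x) i) (add A _ _ i)) (at (Φ-+ p X Y) x i))
    (+-interchange (ap A (ap (Ψ p X) x) i) _ _ _)

  Φ-· : ∀ p c X → Φ p (c ·L X) ≐ c ·L Φ p X
  Φ-· []      c X = eq λ x i → sym (ℤP.*-zeroʳ c)
  Φ-· (a ∷ p) c X = eq λ x i → trans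
    (cong (_+ ap (c ·L X) (ap (evalL p B) x) i) (trans (congr A (at (Φ-· p c X) x) i) (scal A c _ i)))
    (sym (ℤP.*-distribˡ-+ c _ _))

  Φ-l : ∀ p X → Φ p (A ∘L X) ≐ A ∘L Φ p X
  Φ-l []      X = eq λ x i → sym (ap-0 A i)
  Φ-l (c ∷ p) X = eq λ x i → trans (cong (_+ ap A (ap X (ap (evalL p B) x)) i) (congr A (at (Φ-l p X) x) i)) (sym (add A _ _ i))

  Φ-r : ∀ p X → Φ p (X ∘L B) ≐ Φ p X ∘L B
  Φ-r []      X = eq λ _ _ → refl
  Φ-r (c ∷ p) X = eq λ x i → cong₂ _+_ (congr A (at (Φ-r p X) x) i) (congr X (at (evalL-comm p B) x) i)

  Ψ-l : ∀ p X → Ψ p (A ∘L X) ≐ A ∘L Ψ p X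
  Ψ-l []      X = eq λ x i → sym (ap-0 A i)
  Ψ-l (c ∷ p) X = eq λ x i → trans (cong₂ _+_ (congr A (at (Ψ-l p X) x) i) (at (Φ-l p X) x i)) (sym (add A _ _ i))

  Ψ-r : ∀ p X → Ψ p (X ∘L B) ≐ Ψ p X ∘L B
  Ψ-r []      X = eq λ _ _ → refl
  Ψ-r (c ∷ p) X = eq λ x i → cong₂ _+_ (congr A (at (Ψ-r p X) x) i) (at (Φ-r p X) x i)

  -- The divided difference enters the proof here: it is the off-diagonal block of p evaluated at a
  -- block triangular matrix. So m kills the block matrix exactly when it kills A and B and Φ m X =
  -- 0.
  evalL-blk : ∀ p X → evalL p (blk A X B) ≐ blk (evalL p A) (Φ p X) (evalL p B)
  evalL-blk []      X = blk-ext {k} {n} (λ x i → sym (blk-l {k} {n} 0L 0L 0L x i)) (λ x i → sym (blk-r {k} {n} 0L 0L 0L x i))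
  evalL-blk (c ∷ p) X = blk-ext
    (λ x i → begin
      c * x (i ↑ˡ n) + ap (blk A X B) (ap (evalL p (blk A X B)) x) (i ↑ˡ n)
        ≡⟨ cong (c * x (i ↑ˡ n) +_) (trans (congr (blk A X B) (at (evalL-blk p X) x) (i ↑ˡ n)) (at (blk-∘ A X B (evalL p A) (Φ p X) (evalL p B)) x (i ↑ˡ n))) ⟩
      c * x (i ↑ˡ n) + ap (blk (A ∘L evalL p A) (A ∘L Φ p X +L X ∘L evalL p B) (B ∘L evalL p B)) x (i ↑ˡ n)
        ≡⟨ cong (c * x (i ↑ˡ n) +_) (blk-l (A ∘L evalL p A) (A ∘L Φ p X +L X ∘L evalL p B) (B ∘L evalL p B) x i) ⟩
      c * x (i ↑ˡ n) + (ap (A ∘L evalL p A) (ap leftL x) i + ap (A ∘L Φ p X +L X ∘L evalL p B) (ap rightL x) i)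
        ≡⟨ sym (ℤP.+-assoc (c * x (i ↑ˡ n)) _ _) ⟩
      ap (evalL (c ∷ p) A) (ap leftL x) i + ap (Φ (c ∷ p) X) (ap rightL x) i
        ≡⟨ blk-l (evalL (c ∷ p) A) (Φ (c ∷ p) X) (evalL (c ∷ p) B) x i ⟨
      ap (blk (evalL (c ∷ p) A) (Φ (c ∷ p) X) (evalL (c ∷ p) B)) x (i ↑ˡ n) ∎)
    (λ x i → trans (cong (c * x (k ↑ʳ i) +_) (trans (congr (blk A X B) (at (evalL-blk p X) x) (k ↑ʳ i)) (trans (at (blk-∘ A X B (evalL p A) (Φ p X) (evalL p B)) x (k ↑ʳ i)) (blk-r (A ∘L evalL p A) (A ∘L Φ p X +L X ∘L evalL p B) (B ∘L evalL p B) x i))))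
                   (sym (blk-r (evalL (c ∷ p) A) (Φ (c ∷ p) X) (evalL (c ∷ p) B) x i)))

record Separable (m : Poly) : Set where
  field
    u v  : Poly
    d    : ℤ
    d≢0  : d ≢ 0ℤ
    cert : v *ₚ deriv m ≈ₚ constₚ d +ₚ u *ₚ m

Kills : ∀ {r} → Poly → Lin r r → Set
Kills m A = evalL m A ≐ 0L

module Homotopy {m : Poly} (S : Separable m) {k n : ℕ} (A : Lin k k) (B : Lin n n) (mA : Kills m A) (mB : Kills m B) where
  open Separable S

  -- For T Y = A Y - Y B these satisfy d = π + Tκ = π + κT and Tπ = 0. Over ℚ, π / d is the
  -- projector onto ker T, the maps that intertwine B and A, and κ / d inverts T on the complement.
  π κ : Lin n k → Lin n k
  π X = evalL v A ∘L Φ A B m X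
  κ X = evalL v A ∘L Ψ A B m X

  v∘m′ : evalL v A ∘L evalL (deriv m) A ≐ d ·L idL
  v∘m′ = eq λ x i → begin
    ap (evalL v A) (ap (evalL (deriv m) A) x) i  ≡⟨ at (evalL-* v (deriv m) A) x i ⟨
    ap (evalL (v *ₚ deriv m) A) x i              ≡⟨ at (evalL-≈ (v *ₚ deriv m) (constₚ d +ₚ u *ₚ m) A cert) x i ⟩
    ap (evalL (constₚ d +ₚ u *ₚ m) A) x i        ≡⟨ at (evalL-+ (constₚ d) (u *ₚ m) A) x i ⟩
    (d * x i + ap A 0v i) + ap (evalL (u *ₚ m) A) x i
      ≡⟨ cong₂ _+_ (trans (cong (d * x i +_) (ap-0 A i)) (ℤP.+-identityʳ (d * x i)))
                   (trans (at (evalL-* u m A) x i) (ap-≗0 (evalL u A) (at mA x) i)) ⟩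
    d * x i + 0ℤ                                 ≡⟨ ℤP.+-identityʳ (d * x i) ⟩
    d * x i                                      ∎

  d≐π+Tκ : ∀ X → d ·L X +L κ X ∘L B ≐ π X +L A ∘L κ X
  d≐π+Tκ X = eq λ x i → begin
    d * ap X x i + ap (κ X) (ap B x) i
      ≡⟨ cong (_+ ap (κ X) (ap B x) i) (at v∘m′ (ap X x) i) ⟨
    ap (evalL v A) (ap (evalL (deriv m) A) (ap X x)) i + ap (κ X) (ap B x) i
      ≡⟨ add (evalL v A) _ _ i ⟨
    ap (evalL v A) (ap (evalL (deriv m) A ∘L X +L Ψ A B m X ∘L B) x) i
      ≡⟨ congr (evalL v A) (at (Ψ-commutator A B m X) x) i ⟩
    ap (evalL v A) (ap (Φ A B m X +L A ∘L Ψ A B m X) x) i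
      ≡⟨ add (evalL v A) _ _ i ⟩
    ap (π X) x i + ap (evalL v A) (ap A (ap (Ψ A B m X) x)) i
      ≡⟨ cong (ap (π X) x i +_) (at (evalL-comm v A) (ap (Ψ A B m X) x) i) ⟨
    ap (π X) x i + ap A (ap (κ X) x) i ∎

  -- Since m(A) and m(B) vanish, the right side m(l) - m(ρ) of the commutator identity for Φ m is
  -- zero, so Φ m X intertwines; v(A) commutes with A and preserves this.
  π-hom : ∀ X → A ∘L π X ≐ π X ∘L B
  π-hom X = eq λ x i → begin
    ap A (ap (evalL v A) (ap (Φ A B m X) x)) i  ≡⟨ at (evalL-comm v A) _ i ⟩
    ap (evalL v A) (ap A (ap (Φ A B m X) x)) i  ≡⟨ congr (evalL v A) (λ j → lemma x j) i ⟩
    ap (evalL v A) (ap (Φ A B m X) (ap B x)) i  ∎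
    where
    lemma : ∀ x j → ap A (ap (Φ A B m X) x) j ≡ ap (Φ A B m X) (ap B x) j
    lemma x j = begin
      ap A (ap (Φ A B m X) x) j                               ≡⟨ ℤP.+-identityʳ _ ⟨
      ap A (ap (Φ A B m X) x) j + 0ℤ                          ≡⟨ cong (ap A (ap (Φ A B m X) x) j +_) (ap-≗0 X (at mB x) j) ⟨
      ap A (ap (Φ A B m X) x) j + ap X (ap (evalL m B) x) j   ≡⟨ at (Φ-commutator A B m X) x j ⟩
      ap (Φ A B m X) (ap B x) j + ap (evalL m A) (ap X x) j   ≡⟨ cong (ap (Φ A B m X) (ap B x) j +_) (at mA (ap X x) j) ⟩
      ap (Φ A B m X) (ap B x) j + 0ℤ                          ≡⟨ ℤP.+-identityʳ _ ⟩
      ap (Φ A B m X) (ap B x) j                               ∎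

  π-+ : ∀ X Y → π (X +L Y) ≐ π X +L π Y
  π-+ X Y = eq λ x i → trans (congr (evalL v A) (at (Φ-+ A B m X Y) x) i) (add (evalL v A) _ _ i)

  π-· : ∀ c X → π (c ·L X) ≐ c ·L π X
  π-· c X = eq λ x i → trans (congr (evalL v A) (at (Φ-· A B m c X) x) i) (scal (evalL v A) c _ i)

  π-cong : ∀ {X Y} → X ≐ Y → π X ≐ π Y
  π-cong p = ∘-cong (≐-refl {f = evalL v A}) (Φ-cong A B m p)

  κ-cong : ∀ {X Y} → X ≐ Y → κ X ≐ κ Y
  κ-cong p = ∘-cong (≐-refl {f = evalL v A}) (Ψ-cong A B m p)

  -- Ψ commutes with composition by A on the left and by B on the right, so κT = Tκ, and the
  -- identity d = π + Tκ can be read with the factors exchanged.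
  d≐π+κT : ∀ W Z → A ∘L W ≐ W ∘L B +L Z → d ·L W ≐ π W +L κ Z
  d≐π+κT W Z q = eq λ x i → cancel (d * ap W x i) (ap (κ W) (ap B x) i) (ap (π W) x i) (ap (κ Z) x i) (trans (at (d≐π+Tκ W) x i) (cong (ap (π W) x i +_) (Tκ x i)))
    where
    Tκ : ∀ x i → ap A (ap (κ W) x) i ≡ ap (κ W) (ap B x) i + ap (κ Z) x i
    Tκ x i = begin
      ap A (ap (evalL v A) (ap (Ψ A B m W) x)) i      ≡⟨ at (evalL-comm v A) _ i ⟩
      ap (evalL v A) (ap A (ap (Ψ A B m W) x)) i      ≡⟨ congr (evalL v A) (at (Ψ-l A B m W) x) i ⟨
      ap (κ (A ∘L W)) x i                             ≡⟨ at (κ-cong q) x i ⟩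
      ap (κ (W ∘L B +L Z)) x i                        ≡⟨ congr (evalL v A) (at (Ψ-+ A B m (W ∘L B) Z) x) i ⟩
      ap (evalL v A) (ap (Ψ A B m (W ∘L B)) x +v ap (Ψ A B m Z) x) i
        ≡⟨ add (evalL v A) _ _ i ⟩
      ap (evalL v A) (ap (Ψ A B m (W ∘L B)) x) i + ap (κ Z) x i
        ≡⟨ cong (_+ ap (κ Z) x i) (congr (evalL v A) (at (Ψ-r A B m W) x) i) ⟩
      ap (κ W) (ap B x) i + ap (κ Z) x i ∎
    cancel : ∀ a b c e → a + b ≡ c + (b + e) → a ≡ c + e
    cancel a b c e q = +-cancelʳ b {a} {c + e} (trans q (lemma c b e))
      where
      lemma : ∀ c b e → c + (b + e) ≡ (c + e) + b
      lemma = solve-∀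

evalL-Bdd : ∀ r p N → Σ ℕ λ N′ → ∀ (A : Lin r r) → Bdd N A → Bdd N′ (evalL p A)
evalL-Bdd r []      N = 0 , λ A b → Bdd-0
evalL-Bdd r (c ∷ p) N with evalL-Bdd r p N
... | N′ , h = _ , λ A b → Bdd-+ (c ·L idL) (A ∘L evalL p A) (Bdd-· c idL Bdd-id) (Bdd-∘ A (evalL p A) b (h A b))

module _ (k n : ℕ) where

  Φ-Bdd : ∀ p N → Σ ℕ λ N′ → ∀ A B X → Bdd N A → Bdd N B → Bdd N X → Bdd N′ (Φ {k} {n} A B p X)
  Φ-Bdd []      N = 0 , λ A B X _ _ _ → Bdd-0
  Φ-Bdd (c ∷ p) N with Φ-Bdd p N | evalL-Bdd n p N
  ... | _ , h | _ , g = _ , λ A B X a b x →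
    Bdd-+ (A ∘L Φ A B p X) (X ∘L evalL p B) (Bdd-∘ A (Φ A B p X) a (h A B X a b x)) (Bdd-∘ X (evalL p B) x (g B b))

  Ψ-Bdd : ∀ p N → Σ ℕ λ N′ → ∀ A B X → Bdd N A → Bdd N B → Bdd N X → Bdd N′ (Ψ {k} {n} A B p X)
  Ψ-Bdd []      N = 0 , λ A B X _ _ _ → Bdd-0
  Ψ-Bdd (c ∷ p) N with Ψ-Bdd p N | Φ-Bdd p N
  ... | _ , h | _ , g = _ , λ A B X a b x →
    Bdd-+ (A ∘L Ψ A B p X) (Φ A B p X) (Bdd-∘ A (Ψ A B p X) a (h A B X a b x)) (g A B X a b x)

  module _ {m : Poly} (S : Separable m) where
    open Separable S

    π-Bdd : ∀ N → Σ ℕ λ N′ → ∀ A B mA mB X → Bdd N A → Bdd N B → Bdd N X → Bdd N′ (Homotopy.π S {k} {n} A B mA mB X)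
    π-Bdd N with evalL-Bdd k v N | Φ-Bdd m N
    ... | _ , h | _ , g = _ , λ A B _ _ X a b x → Bdd-∘ (evalL v A) (Φ A B m X) (h A a) (g A B X a b x)

    κ-Bdd : ∀ N → Σ ℕ λ N′ → ∀ A B mA mB X → Bdd N A → Bdd N B → Bdd N X → Bdd N′ (Homotopy.κ S {k} {n} A B mA mB X)
    κ-Bdd N with evalL-Bdd k v N | Ψ-Bdd m N
    ... | _ , h | _ , g = _ , λ A B _ _ X a b x → Bdd-∘ (evalL v A) (Ψ A B m X) (h A a) (g A B X a b x)

-- Isomorphisms and their bounded factorisations

record Iso {r : ℕ} (A B P Q : Lin r r) : Set where
  field
    PQ≐id : P ∘L Q ≐ idL
    QP≐id : Q ∘L P ≐ idL
    tw    : P ∘L A ≐ B ∘L P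
open Iso public

Iso-id : ∀ {r} {A B : Lin r r} → A ≐ B → Iso A B idL idL
Iso-id p = record { PQ≐id = eq λ _ _ → refl ; QP≐id = eq λ _ _ → refl ; tw = eq λ x i → at p x i }

Iso-sym : ∀ {r} {A B P Q : Lin r r} → Iso A B P Q → Iso B A Q P
Iso-sym {A = A} {B} {P} {Q} I = record { PQ≐id = QP≐id I ; QP≐id = PQ≐id I ; tw = eq λ x i → begin
  ap Q (ap B x) i                  ≡⟨ congr Q (congr B (at (PQ≐id I) x)) i ⟨
  ap Q (ap B (ap P (ap Q x))) i    ≡⟨ congr Q (at (tw I) (ap Q x)) i ⟨
  ap Q (ap P (ap A (ap Q x))) i    ≡⟨ at (QP≐id I) (ap A (ap Q x)) i ⟩
  ap A (ap Q x) i                  ∎ }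

Iso-trans : ∀ {r} {A B C P Q P′ Q′ : Lin r r} → Iso A B P Q → Iso B C P′ Q′ → Iso A C (P′ ∘L P) (Q ∘L Q′)
Iso-trans {A = A} {P = P} {Q} {P′} {Q′} I J = record
  { PQ≐id = eq λ x i → trans (congr P′ (at (PQ≐id I) (ap Q′ x)) i) (at (PQ≐id J) x i)
  ; QP≐id = eq λ x i → trans (congr Q (at (QP≐id J) (ap P x)) i) (at (QP≐id I) x i)
  ; tw = eq λ x i → trans (congr P′ (at (tw I) x) i) (at (tw J) (ap P x) i) }

Iso-≐ : ∀ {r} {A A′ B B′ P Q : Lin r r} → A ≐ A′ → B ≐ B′ → Iso A B P Q → Iso A′ B′ P Q
Iso-≐ {P = P} p q I = record { PQ≐id = PQ≐id I ; QP≐id = QP≐id I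
  ; tw = eq λ x i → trans (congr P (λ j → sym (at p x j)) i) (trans (at (tw I) x i) (at q (ap P x) i)) }

Kills-Iso : ∀ {r} m {A B P Q : Lin r r} → Iso A B P Q → Kills m A → Kills m B
Kills-Iso m {A} {B} {P} {Q} I z = eq λ x i → begin
  ap (evalL m B) x i                  ≡⟨ congr (evalL m B) (at (PQ≐id I) x) i ⟨
  ap (evalL m B) (ap P (ap Q x)) i    ≡⟨ at (evalL-intertwine m P (tw I)) (ap Q x) i ⟨
  ap P (ap (evalL m A) (ap Q x)) i    ≡⟨ ap-≗0 P (at z (ap Q x)) i ⟩
  0ℤ                                  ∎

-- A path of bounded isomorphisms, with bounded inverses, through bounded conjugates. The composite
-- P is recorded and not just the ends: lifting a path from the diagonal blocks must reproduce their
-- isomorphisms exactly, so that only a unipotent error remains.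
data Gen {r : ℕ} (N : ℕ) : (A B P : Lin r r) → Set where
  done : ∀ {A B P} → Bdd N A → A ≐ B → P ≐ idL → Gen N A B P
  step : ∀ {A B C P P′} Q Q′ → Bdd N A → Bdd N C → Bdd N Q → Bdd N Q′ → Iso A C Q Q′ →
         Gen N C B P′ → P ≐ P′ ∘L Q → Gen N A B P

Gen-mono : ∀ {r M N} {A B P : Lin r r} → M ℕ.≤ N → Gen M A B P → Gen N A B P
Gen-mono h (done {A} b p q) = done (Bdd-mono h b) p q
Gen-mono h (step {A} {C = C} Q Q′ a c b b′ I g p) =
  step Q Q′ (Bdd-mono h a) (Bdd-mono h c) (Bdd-mono h b) (Bdd-mono h b′) I (Gen-mono h g) p

Gen-≐ : ∀ {r N} {A A′ B B′ P P′ : Lin r r} → A ≐ A′ → B ≐ B′ → P ≐ P′ → Gen N A B P → Gen N A′ B′ P′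
Gen-≐ p q s (done b t u) = done (Bdd-≐ p b) (≐-trans (≐-sym p) (≐-trans t q)) (≐-trans (≐-sym s) u)
Gen-≐ p q s (step Q Q′ a c b b′ I g t) =
  step Q Q′ (Bdd-≐ p a) c b b′ (Iso-≐ p ≐-refl I) (Gen-≐ ≐-refl q ≐-refl g) (≐-trans (≐-sym s) t)

Gen-trans : ∀ {r N} {A B C P P′ : Lin r r} → Gen N A B P → Gen N B C P′ → Gen N A C (P′ ∘L P)
Gen-trans {P′ = P′} (done b p q) h = Gen-≐ (≐-sym p) ≐-refl (eq λ x i → congr P′ (λ j → sym (at q x j)) i) h
Gen-trans {P′ = P′} (step Q Q′ a c b b′ I g p) h =
  step Q Q′ a c b b′ I (Gen-trans g h) (eq λ x i → congr P′ (at p x) i)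

Gen-edge : ∀ {r N} {A B P Q : Lin r r} → Bdd N A → Bdd N B → Bdd N P → Bdd N Q → Iso A B P Q → Gen N A B P
Gen-edge {P = P} {Q} a b p q I = step P Q a b p q I (done b ≐-refl ≐-refl) (eq λ _ _ → refl)

Gen-Iso : ∀ {r N} {A B P : Lin r r} → Gen N A B P → Σ (Lin r r) λ Q → Iso A B P Q
Gen-Iso (done {A} {B} {P} b p q) = idL , record
  { PQ≐id = eq (at q) ; QP≐id = eq (at q)
  ; tw = eq λ x i → trans (at q (ap A x) i) (trans (at p x i) (congr B (λ j → sym (at q x j)) i)) }
Gen-Iso (step {A} {B} {C} {P} {P′} Q Q′ _ _ _ _ I g p) with Gen-Iso g
... | R , J = Q′ ∘L R , record
  { PQ≐id = eq λ x i → trans (at p _ i) (at (PQ≐id K) x i)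
  ; QP≐id = eq λ x i → trans (congr (Q′ ∘L R) (at p x) i) (at (QP≐id K) x i)
  ; tw = eq λ x i → trans (at p (ap A x) i) (trans (at (tw K) x i) (congr B (λ j → sym (at p x j)) i)) }
  where K = Iso-trans I J

-- Division of maps by d, and matrix units

module Division (d : ℤ) (d≢0 : d ≢ 0ℤ) where
  instance
    nz : ℤ.NonZero d
    nz = ℤ.≢-nonZero d≢0

  quo rem : ∀ {n r} → Lin n r → Lin n r
  quo f = fromMatrix (λ i j → ent f i j ℤD./ d)
  rem f = fromMatrix (λ i j → ℤ.+ (ent f i j ℤD.% d))

  rem-quo : ∀ {n r} (f : Lin n r) → f ≐ rem f +L d ·L quo f
  rem-quo f = ≐-ent λ i j → begin
    ent f i j                                                     ≡⟨ ℤD.a≡a%n+[a/n]*n (ent f i j) d ⟩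
    ℤ.+ (ent f i j ℤD.% d) + ent f i j ℤD./ d * d
      ≡⟨ cong₂ _+_ (sym (ent-fromMatrix (λ i j → ℤ.+ (ent f i j ℤD.% d)) i j))
                   (trans (ℤP.*-comm (ent f i j ℤD./ d) d) (cong (d *_) (sym (ent-fromMatrix (λ i j → ent f i j ℤD./ d) i j)))) ⟩
    ent (rem f +L d ·L quo f) i j ∎

  rem-Bdd : ∀ {n r} (f : Lin n r) → Bdd ∣ d ∣ (rem f)
  rem-Bdd f = bdd λ i j → subst (λ z → ∣ z ∣ ℕ.≤ ∣ d ∣) (sym (ent-fromMatrix (λ i j → ℤ.+ (ent f i j ℤD.% d)) i j))
    (ℕP.<⇒≤ (ℤD.n%d<d (ent f i j) d))

  cancel-Bdd : ∀ {n r N} (f : Lin n r) → Bdd N (d ·L f) → Bdd N f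
  cancel-Bdd f b = bdd λ i j → ℕP.≤-trans
    (ℕP.≤-trans (ℕP.m≤n*m ∣ ent f i j ∣ ∣ d ∣) (ℕP.≤-reflexive (sym (ℤP.∣i*j∣≡∣i∣*∣j∣ d (ent f i j))))) (bound b i j)

  quo-Bdd : ∀ {n r N} (f : Lin n r) → Bdd N f → Bdd (N ℕ.+ ∣ d ∣) (quo f)
  quo-Bdd f b = cancel-Bdd (quo f) (Bdd-≐ {f = f +L -L rem f}
      (eq λ x i → trans (cong (_+ -1ℤ * ap (rem f) x i) (at (rem-quo f) x i)) (lemma (ap (rem f) x i) (d * ap (quo f) x i)))
      (Bdd-+ f (-L rem f) b (Bdd-- (rem f) (rem-Bdd f))))
    where
    lemma : ∀ a b → a + b + -1ℤ * a ≡ b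
    lemma = solve-∀

E : ∀ {n k} → Fin k → Fin n → Lin n k
ap    (E i j) = λ x → x j ·v e i
congr (E i j) = λ p a → cong (_* e i a) (p j)
add   (E i j) = λ x y a → ℤP.*-distribʳ-+ (e i a) (x j) (y j)
scal  (E i j) = λ c x a → ℤP.*-assoc c (x j) (e i a)

E-Bdd : ∀ {n k} (i : Fin k) (j : Fin n) → Bdd 1 (E i j)
E-Bdd i j = bdd λ a b → subst (ℕ._≤ 1) (sym (ℤP.∣i*j∣≡∣i∣*∣j∣ (e b j) (e i a))) (ℕP.*-mono-≤ (∣e∣≤1 b j) (∣e∣≤1 i a))

sumL : ∀ {n r s} → (Fin s → Lin n r) → Lin n r
sumL {s = zero}  f = 0L
sumL {s = suc s} f = f zero +L sumL (λ i → f (suc i))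

ap-sumL : ∀ {n r s} (f : Fin s → Lin n r) x i → ap (sumL f) x i ≡ sumℤ s (λ j → ap (f j) x i)
ap-sumL {s = zero}  f x i = refl
ap-sumL {s = suc s} f x i = cong (ap (f zero) x i +_) (ap-sumL (λ j → f (suc j)) x i)

E-decompose : ∀ {n k} (C : Lin n k) → C ≐ sumL (λ i → sumL (λ j → ent C i j ·L E i j))
E-decompose {n} {k} C = eq λ x a → sym (begin
  ap (sumL (λ i → sumL (λ j → ent C i j ·L E i j))) x a   ≡⟨ ap-sumL (λ i → sumL (λ j → ent C i j ·L E i j)) x a ⟩
  sumℤ k (λ i → ap (sumL (λ j → ent C i j ·L E i j)) x a)
    ≡⟨ sum-cong (λ i → trans (ap-sumL (λ j → ent C i j ·L E i j) x a) (row x a i)) ⟩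
  sumℤ k (λ i → ap C x i * e a i)                         ≡⟨ sum-e (ap C x) a ⟩
  ap C x a                                                ∎)
  where
  e-sym : ∀ {n} (i j : Fin n) → e i j ≡ e j i
  e-sym zero    zero    = refl
  e-sym zero    (suc j) = refl
  e-sym (suc i) zero    = refl
  e-sym (suc i) (suc j) = e-sym i j
  lemma : ∀ a b c → a * (b * c) ≡ c * (b * a)
  lemma = solve-∀
  row : ∀ x a i → sumℤ n (λ j → ent C i j * (x j * e i a)) ≡ ap C x i * e a i
  row x a i = begin
    sumℤ n (λ j → ent C i j * (x j * e i a))   ≡⟨ sum-cong (λ j → lemma (ent C i j) (x j) (e i a)) ⟩
    sumℤ n (λ j → e i a * (x j * ent C i j))   ≡⟨ sum-* (e i a) (λ j → x j * ent C i j) ⟩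
    e i a * sumℤ n (λ j → x j * ent C i j)     ≡⟨ cong₂ _*_ (e-sym i a) (sym (expand C x i)) ⟩
    e a i * ap C x i                           ≡⟨ ℤP.*-comm (e a i) (ap C x i) ⟩
    ap C x i * e a i                           ∎

-- Meant for predicates such as `Good` below, which follow sums by composing paths but come with no
-- rule for negation; hence the negated units form a separate hypothesis.
module Span {n k : ℕ} (S : Lin n k → Set) (S-≐ : ∀ {X Y} → X ≐ Y → S X → S Y) (S-0 : S 0L)
            (S-+ : ∀ {X Y} → S X → S Y → S (X +L Y)) (S-E : ∀ i j → S (E i j)) (S-E⁻ : ∀ i j → S (-L E i j)) where

  multiples : ∀ c i j → S (c ·L E i j)
  multiples (ℤ.+ zero)   i j = S-≐ {0L} (eq λ x a → refl) S-0
  multiples (ℤ.+ suc c)  i j = S-≐ (eq λ x a → lemma (ℤ.+ c) (ap (E i j) x a)) (S-+ (S-E i j) (multiples (ℤ.+ c) i j))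
    where
    lemma : ∀ c z → z + c * z ≡ (1ℤ + c) * z
    lemma = solve-∀
  multiples -[1+ zero ]  i j = S-E⁻ i j
  multiples -[1+ suc c ] i j = S-≐ (eq λ x a → lemma -[1+ c ] (ap (E i j) x a)) (S-+ (S-E⁻ i j) (multiples -[1+ c ] i j))
    where
    lemma : ∀ c z → -1ℤ * z + c * z ≡ (-1ℤ + c) * z
    lemma = solve-∀

  sums : ∀ {s} (f : Fin s → Lin n k) → (∀ i → S (f i)) → S (sumL f)
  sums {zero}  f h = S-0
  sums {suc s} f h = S-+ (h zero) (sums (λ i → f (suc i)) (λ i → h (suc i)))

  spans : ∀ C → S C
  spans C = S-≐ (≐-sym (E-decompose C)) (sums _ λ i → sums _ λ j → multiples (ent C i j) i j)

-- Isomorphisms of block triangular matrices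

module _ {k n : ℕ} where

  blk-Iso : ∀ {A B P Q : Lin k k} {A′ B′ P′ Q′ : Lin n n} {X X′ Y : Lin n k} → Iso A B P Q → Iso A′ B′ P′ Q′ →
            P ∘L X +L Y ∘L A′ ≐ B ∘L Y +L X′ ∘L P′ →
            Iso (blk A X A′) (blk B X′ B′) (blk P Y P′) (blk Q (-L (Q ∘L Y ∘L Q′)) Q′)
  blk-Iso {A} {B} {P} {Q} {A′} {B′} {P′} {Q′} {X} {X′} {Y} I J h = record
    { PQ≐id = ≐-trans (blk-∘ P Y P′ Q (-L (Q ∘L Y ∘L Q′)) Q′) (≐-trans (blk-cong (PQ≐id I)
        (eq {g = 0L} λ x i → trans (cong (_+ ap Y (ap Q′ x) i) (trans (scal P -1ℤ _ i) (cong (-1ℤ *_) (at (PQ≐id I) (ap Y (ap Q′ x)) i))))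
                          (cancel (ap Y (ap Q′ x) i)))
        (PQ≐id J)) blk-id)
    ; QP≐id = ≐-trans (blk-∘ Q (-L (Q ∘L Y ∘L Q′)) Q′ P Y P′) (≐-trans (blk-cong (QP≐id I)
        (eq {g = 0L} λ x i → trans (cong (λ z → ap Q (ap Y x) i + -1ℤ * z) (congr (Q ∘L Y) (at (QP≐id J) x) i))
                          (cancel′ (ap Q (ap Y x) i)))
        (QP≐id J)) blk-id)
    ; tw = ≐-trans (blk-∘ P Y P′ A X A′) (≐-trans (blk-cong (tw I) h (tw J)) (≐-sym (blk-∘ B X′ B′ P Y P′))) }
    where
    cancel : ∀ z → -1ℤ * z + z ≡ 0ℤ
    cancel = solve-∀
    cancel′ : ∀ z → z + -1ℤ * z ≡ 0ℤ
    cancel′ = solve-∀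

-- Reducing off-diagonal blocks

module Parabolic (m : Poly) (S : Separable m) where
  open Separable S
  open Division d d≢0

  -- Finite generation: the number of factors is unrestricted, but all come from the finite set of
  -- maps with entries up to N′. Since N′ depends on N and the rank alone, this can serve as
  -- induction hypothesis on the rank.
  FG : ℕ → Set
  FG r = ∀ N → Σ ℕ λ N′ → ∀ (A B P Q : Lin r r) → Bdd N A → Bdd N B → Kills m A → Iso A B P Q → Gen N′ A B P

  module _ {k n : ℕ} where

    blk-kills : ∀ {A : Lin k k} {B : Lin n n} {X} → Kills m (blk A X B) → Kills m A × Φ A B m X ≐ 0L × Kills m B
    blk-kills {A} {B} {X} z = blk-inj (≐-trans (≐-sym (evalL-blk A B m X)) (≐-trans z 0≐blk))
      where
      0≐blk : 0L ≐ blk {k} {n} 0L 0L 0L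
      0≐blk = blk-ext (λ x i → sym (blk-l {k} {n} 0L 0L 0L x i)) (λ x i → sym (blk-r {k} {n} 0L 0L 0L x i))

  module _ (k n : ℕ) where

    -- The off-diagonal block X of a matrix killed by m satisfies d X = T (κ X), T Y = A Y - Y B; so X can be
    -- reduced modulo the image of T to a size that only depends on A and B.
    reduceX : ∀ N → Σ ℕ λ N₀ → Σ (ℕ → ℕ) λ bd → ∀ (A : Lin k k) (B : Lin n n) X → Bdd N A → Bdd N B → Kills m (blk A X B) →
              Σ (Lin n k) λ Y → Σ (Lin n k) λ X′ → Bdd N₀ X′ × (X +L Y ∘L B ≐ A ∘L Y +L X′) ×
              (∀ M → Bdd M A → Bdd M B → Bdd M X → Bdd (bd M) Y)
    reduceX N = k ℕ.* (∣ d ∣ ℕ.* N) ℕ.+ n ℕ.* (N ℕ.* ∣ d ∣) , (λ M → proj₁ (κ-Bdd k n S M) ℕ.+ ∣ d ∣) , λ A B X bA bB z →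
      let mA , φ , mB = blk-kills z
          open Homotopy S A B mA mB
          -- Since Φ m X = 0 also π X = 0, so d X = T (κ X). Dividing, κ X = R + d Y with R bounded
          -- by d, whence d (X - T Y) = T R, and X′ = X - T Y is small.
          Y  = quo (κ X)
          R  = rem (κ X)
          X′ = X +L Y ∘L B +L -L (A ∘L Y)
          dX′ : d ·L X′ ≐ A ∘L R +L -L (R ∘L B)
          dX′ = eq λ x i → begin
            d * (ap X x i + ap Y (ap B x) i + -1ℤ * ap A (ap Y x) i)
              ≡⟨ expandd d (ap X x i) (ap Y (ap B x) i) (ap A (ap Y x) i) ⟩
            d * ap X x i + d * ap Y (ap B x) i + -1ℤ * (d * ap A (ap Y x) i)
              ≡⟨ shuffle (d * ap X x i) (ap R (ap B x) i) (d * ap Y (ap B x) i) (ap A (ap R x) i) (d * ap A (ap Y x) i)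
                   (begin
                     d * ap X x i + (ap R (ap B x) i + d * ap Y (ap B x) i)
                       ≡⟨ cong (d * ap X x i +_) (at (rem-quo (κ X)) (ap B x) i) ⟨
                     d * ap X x i + ap (κ X) (ap B x) i
                       ≡⟨ at (d≐π+Tκ X) x i ⟩
                     ap (π X) x i + ap A (ap (κ X) x) i
                       ≡⟨ cong₂ _+_ (ap-≗0 (evalL v A) (at φ x) i) (congr A (at (rem-quo (κ X)) x) i) ⟩
                     0ℤ + ap A (ap R x +v d ·v ap Y x) i
                       ≡⟨ ℤP.+-identityˡ _ ⟩
                     ap A (ap R x +v d ·v ap Y x) i
                       ≡⟨ trans (add A _ _ i) (cong (ap A (ap R x) i +_) (scal A d (ap Y x) i)) ⟩
                     ap A (ap R x) i + d * ap A (ap Y x) i ∎) ⟩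
            ap A (ap R x) i + -1ℤ * ap R (ap B x) i ∎
      in Y , X′
       , cancel-Bdd X′ (Bdd-≐ (≐-sym dX′) (Bdd-+ (A ∘L R) (-L (R ∘L B)) (Bdd-∘ A R bA (rem-Bdd (κ X))) (Bdd-- (R ∘L B) (Bdd-∘ R B (rem-Bdd (κ X)) bB))))
       , eq (λ x i → recover (ap X x i) (ap Y (ap B x) i) (ap A (ap Y x) i))
       , λ M a b c → quo-Bdd (κ X) (proj₂ (κ-Bdd k n S M) A B mA mB X a b c)
      where
      expandd : ∀ d a b c → d * (a + b + -1ℤ * c) ≡ d * a + d * b + -1ℤ * (d * c)
      expandd = solve-∀
      shuffle : ∀ a r y s t → a + (r + y) ≡ s + t → a + y + -1ℤ * t ≡ s + -1ℤ * r
      shuffle a r y s t h = trans (l1 a r y t) (trans (cong (λ z → z + -1ℤ * r + -1ℤ * t) h) (l2 s t r))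
        where
        l1 : ∀ a r y t → a + y + -1ℤ * t ≡ (a + (r + y)) + -1ℤ * r + -1ℤ * t
        l1 = solve-∀
        l2 : ∀ s t r → (s + t) + -1ℤ * r + -1ℤ * t ≡ s + -1ℤ * r
        l2 = solve-∀
      recover : ∀ a b c → a + b ≡ c + (a + b + -1ℤ * c)
      recover = solve-∀

    -- A diagonal isomorphism with blocks Q and R followed by the unipotent one with block Y has
    -- off-diagonal block `Y ∘L R`. In this form the condition on Y only involves the new diagonal
    -- blocks C and D.
    twist : ∀ {A C Q Q₁ : Lin k k} {B D R R₁ : Lin n n} {X X′ Y : Lin n k} → Iso A C Q Q₁ → Iso B D R R₁ →
            Q ∘L X ∘L R₁ +L Y ∘L D ≐ C ∘L Y +L X′ →
            Iso (blk A X B) (blk C X′ D) (blk Q (Y ∘L R) R) (blk Q₁ (-L (Q₁ ∘L (Y ∘L R) ∘L R₁)) R₁)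
    twist {A} {C} {Q} {Q₁} {B} {D} {R} {R₁} {X} {X′} {Y} I J h = blk-Iso I J (eq λ x i → begin
      ap Q (ap X x) i + ap Y (ap R (ap B x)) i
        ≡⟨ cong₂ _+_ (congr (Q ∘L X) (λ j → sym (at (QP≐id J) x j)) i) (congr Y (at (tw J) x) i) ⟩
      ap Q (ap X (ap R₁ (ap R x))) i + ap Y (ap D (ap R x)) i
        ≡⟨ at h (ap R x) i ⟩
      ap C (ap Y (ap R x)) i + ap X′ (ap R x) i ∎)

    -- After transport by the diagonal isomorphism, `reduceX` applies over C and D. So the new block
    -- X′ is bounded through C and D alone, however large X, Q and R are; Y is bounded only when the
    -- transported block is.
    normalise : ∀ N → Σ ℕ λ N₀ → Σ (ℕ → ℕ) λ bd → ∀ {A C Q Q₁ : Lin k k} {B D R R₁ : Lin n n} X →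
                Iso A C Q Q₁ → Iso B D R R₁ → Bdd N C → Bdd N D → Kills m (blk A X B) →
                Σ (Lin n k) λ Y → Σ (Lin n k) λ X′ → Bdd N₀ X′ × (Q ∘L X ∘L R₁ +L Y ∘L D ≐ C ∘L Y +L X′) ×
                (∀ M → Bdd M C → Bdd M D → Bdd M (Q ∘L X ∘L R₁) → Bdd (bd M) Y)
    normalise N = proj₁ (reduceX N) , proj₁ (proj₂ (reduceX N)) , λ {A} {C} {Q} {Q₁} {B} {D} {R} {R₁} X I J c d z →
      proj₂ (proj₂ (reduceX N)) C D (Q ∘L X ∘L R₁) c d (Kills-Iso m (diagonal X I J) z)
      where
      diagonal : ∀ {A C Q Q₁ : Lin k k} {B D R R₁ : Lin n n} X → Iso A C Q Q₁ → Iso B D R R₁ →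
                 Iso (blk A X B) (blk C (Q ∘L X ∘L R₁) D) (blk Q 0L R) (blk Q₁ (-L (Q₁ ∘L 0L ∘L R₁)) R₁)
      diagonal {C = C} {Q} {R = R} {R₁} X I J = blk-Iso I J (eq λ x i →
        trans (ℤP.+-identityʳ (ap Q (ap X x) i)) (trans (congr (Q ∘L X) (λ j → sym (at (QP≐id J) x j)) i)
          (trans (sym (ℤP.+-identityˡ (ap Q (ap X (ap R₁ (ap R x))) i))) (cong (_+ ap Q (ap X (ap R₁ (ap R x))) i) (sym (ap-0 C i))))))

    -- The same M bounds the off-diagonal block before and after an edge. This invariance allows
    -- paths of arbitrary length to be lifted without loss.
    record Lift (N M : ℕ) : Set where
      field
        N′    : ℕ
        N≤N′  : N ℕ.≤ N′
        M≤N′  : M ℕ.≤ N′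
        1≤N′  : 1 ℕ.≤ N′
        edge  : ∀ {A C Q Q₁ : Lin k k} {B D R R₁ : Lin n n} X → Bdd N A → Bdd N C → Bdd N Q → Bdd N Q₁ → Iso A C Q Q₁ →
                Bdd N B → Bdd N D → Bdd N R → Bdd N R₁ → Iso B D R R₁ → Bdd M X → Kills m (blk A X B) →
                Σ (Lin n k) λ Y → Σ (Lin n k) λ X′ → Bdd M X′ × Kills m (blk C X′ D) ×
                Gen N′ (blk A X B) (blk C X′ D) (blk Q Y R)

    lift : ∀ N L → Σ ℕ λ M → (L ℕ.≤ M) × Lift N M
    lift N L = M , ℕP.m≤n⊔m N₀ L , record
      { N′ = N′
      ; N≤N′ = ℕP.≤-trans (ℕP.m≤m⊔n N M) (ℕP.≤-trans (ℕP.m≤n+m NM 1) (ℕP.≤-trans (ℕP.m≤n+m (suc NM) y₂) (ℕP.m≤n+m (y₂ ℕ.+ suc NM) y)))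
      ; M≤N′ = ℕP.≤-trans (ℕP.m≤n⊔m N M) (ℕP.≤-trans (ℕP.m≤n+m NM 1) (ℕP.≤-trans (ℕP.m≤n+m (suc NM) y₂) (ℕP.m≤n+m (y₂ ℕ.+ suc NM) y)))
      ; 1≤N′ = ℕP.≤-trans (ℕP.m≤m+n 1 NM) (ℕP.≤-trans (ℕP.m≤n+m (suc NM) y₂) (ℕP.m≤n+m (y₂ ℕ.+ suc NM) y))
      ; edge = λ {A} {C} {Q} {Q₁} {B} {D} {R} {R₁} X bA bC bQ bQ₁ I bB bD bR bR₁ J bX z →
          let Y , X′ , bX′ , rel , bY = h {A} {C} {Q} {Q₁} {B} {D} {R} {R₁} X I J bC bD z
              bZ : Bdd t (Q ∘L X ∘L R₁)
              bZ = Bdd-∘ Q (X ∘L R₁) bQ (Bdd-∘ X R₁ bX bR₁)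
              bYR : Bdd y (Y ∘L R)
              bYR = Bdd-∘ Y R (bY (t ℕ.⊔ N) (Bdd-mono (ℕP.m≤n⊔m t N) bC) (Bdd-mono (ℕP.m≤n⊔m t N) bD)
                                 (Bdd-mono (ℕP.m≤m⊔n t N) bZ)) bR
              bY₂ : Bdd y₂ (-L (Q₁ ∘L (Y ∘L R) ∘L R₁))
              bY₂ = Bdd-- (Q₁ ∘L (Y ∘L R) ∘L R₁) (Bdd-∘ Q₁ ((Y ∘L R) ∘L R₁) bQ₁ (Bdd-∘ (Y ∘L R) R₁ bYR bR₁))
              K = twist I J rel
              N≤ = ℕP.≤-trans (ℕP.m≤m⊔n N M) (ℕP.≤-trans (ℕP.m≤n+m NM 1) (ℕP.≤-trans (ℕP.m≤n+m (suc NM) y₂) (ℕP.m≤n+m (y₂ ℕ.+ suc NM) y)))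
              M≤ = ℕP.≤-trans (ℕP.m≤n⊔m N M) (ℕP.≤-trans (ℕP.m≤n+m NM 1) (ℕP.≤-trans (ℕP.m≤n+m (suc NM) y₂) (ℕP.m≤n+m (y₂ ℕ.+ suc NM) y)))
              bX′M = Bdd-mono (ℕP.m≤m⊔n N₀ L) bX′
          in Y ∘L R , X′ , bX′M , Kills-Iso m K z
             , Gen-edge (Bdd-blk A X B (Bdd-mono N≤ bA) (Bdd-mono M≤ bX) (Bdd-mono N≤ bB))
                 (Bdd-blk C X′ D (Bdd-mono N≤ bC) (Bdd-mono M≤ bX′M) (Bdd-mono N≤ bD))
                 (Bdd-blk Q (Y ∘L R) R (Bdd-mono N≤ bQ) (Bdd-mono (ℕP.m≤m+n y (y₂ ℕ.+ suc NM)) bYR) (Bdd-mono N≤ bR))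
                 (Bdd-blk Q₁ (-L (Q₁ ∘L (Y ∘L R) ∘L R₁)) R₁ (Bdd-mono N≤ bQ₁)
                   (Bdd-mono (ℕP.≤-trans (ℕP.m≤m+n y₂ (suc NM)) (ℕP.m≤n+m (y₂ ℕ.+ suc NM) y)) bY₂) (Bdd-mono N≤ bR₁))
                 K }
      where
      N₀ = proj₁ (normalise N)
      bd = proj₁ (proj₂ (normalise N))
      h  = proj₂ (proj₂ (normalise N))
      -- N₀ bounds every block produced by `normalise` and L admits the initial one, so M reproduces
      -- itself. Below, t bounds the transported block Q X R₁, y the off-diagonal block of the
      -- lifted edge and y₂ that of its inverse.
      M  = N₀ ℕ.⊔ L
      NM = N ℕ.⊔ M
      t  = k ℕ.* (n ℕ.* (N ℕ.* M) ℕ.* N)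
      y  = n ℕ.* (N ℕ.* bd (t ℕ.⊔ N))
      y₂ = k ℕ.* (n ℕ.* (N ℕ.* y) ℕ.* N)
      N′ = y ℕ.+ (y₂ ℕ.+ suc NM)

-- Isomorphisms that preserve an invariant sublattice

module ParabolicLemma (m : Poly) (S : Separable m) where
  open Separable S
  open Division d d≢0
  open Parabolic m S

  module _ {k n : ℕ} where

    blk-unipotent : ∀ {A : Lin k k} {B : Lin n n} {X X′ W : Lin n k} → X +L W ∘L B ≐ A ∘L W +L X′ →
                    Iso (blk A X B) (blk A X′ B) (blk idL W idL) (blk idL (-L (idL ∘L W ∘L idL)) idL)
    blk-unipotent h = blk-Iso (Iso-id ≐-refl) (Iso-id ≐-refl) (eq (at h))

    blk-idˡ : ∀ {W W′ : Lin n k} → blk idL W idL ∘L blk idL W′ idL ≐ blk idL (W′ +L W) idL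
    blk-idˡ {W} {W′} = ≐-trans (blk-∘ idL W idL idL W′ idL) (blk-cong (eq λ _ _ → refl) (eq λ _ _ → refl) (eq λ _ _ → refl))

    module _ {N M : ℕ} (L : Lift k n N M) (1≤N : 1 ℕ.≤ N) where
      open Lift L

      -- Each edge is lifted with the identity on the other diagonal block. No bound is claimed for
      -- the block Y of the composite, which can grow along the path; a unipotent correction removes
      -- this defect afterwards.
      liftˡ : ∀ {A B P : Lin k k} {C : Lin n n} {X} → Gen N A B P → Bdd N C → Bdd M X → Kills m (blk A X C) →
              Σ (Lin n k) λ Y → Σ (Lin n k) λ X′ → Bdd M X′ × Gen N′ (blk A X C) (blk B X′ C) (blk P Y idL)
      liftˡ {A} {B} {P} {C} {X} (done bA p q) bC bX z = 0L , X , bX ,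
        done (Bdd-blk A X C (Bdd-mono N≤N′ bA) (Bdd-mono M≤N′ bX) (Bdd-mono N≤N′ bC)) (blk-cong p ≐-refl ≐-refl)
             (≐-trans (blk-cong q ≐-refl ≐-refl) blk-id)
      liftˡ {P = P} {C} {X} (step {P′ = P′} Q Q′ bA bC′ bQ bQ′ I g p) bC bX z =
        let Y , X₁ , bX₁ , z₁ , g₁ = edge X bA bC′ bQ bQ′ I bC bC (Bdd-mono 1≤N Bdd-id) (Bdd-mono 1≤N Bdd-id) (Iso-id ≐-refl) bX z
            Y′ , X₂ , bX₂ , g₂ = liftˡ g bC bX₁ z₁
        in P′ ∘L Y +L Y′ ∘L idL , X₂ , bX₂ ,
           Gen-≐ ≐-refl ≐-refl (≐-trans (blk-∘ P′ Y′ idL Q Y idL) (blk-cong (≐-sym p) ≐-refl (eq λ _ _ → refl))) (Gen-trans g₁ g₂)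

      liftʳ : ∀ {A B P : Lin n n} {C : Lin k k} {X} → Gen N A B P → Bdd N C → Bdd M X → Kills m (blk C X A) →
              Σ (Lin n k) λ Y → Σ (Lin n k) λ X′ → Bdd M X′ × Gen N′ (blk C X A) (blk C X′ B) (blk idL Y P)
      liftʳ {A} {B} {P} {C} {X} (done bA p q) bC bX z = 0L , X , bX ,
        done (Bdd-blk C X A (Bdd-mono N≤N′ bC) (Bdd-mono M≤N′ bX) (Bdd-mono N≤N′ bA)) (blk-cong ≐-refl ≐-refl p)
             (≐-trans (blk-cong ≐-refl ≐-refl q) blk-id)
      liftʳ {P = P} {C} {X} (step {P′ = P′} Q Q′ bA bC′ bQ bQ′ I g p) bC bX z =
        let Y , X₁ , bX₁ , z₁ , g₁ = edge X bC bC (Bdd-mono 1≤N Bdd-id) (Bdd-mono 1≤N Bdd-id) (Iso-id ≐-refl) bA bC′ bQ bQ′ I bX z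
            Y′ , X₂ , bX₂ , g₂ = liftʳ g bC bX₁ z₁
        in idL ∘L Y +L Y′ ∘L Q , X₂ , bX₂ ,
           Gen-≐ ≐-refl ≐-refl (≐-trans (blk-∘ idL Y′ P′ idL Y Q) (blk-cong (eq λ _ _ → refl) ≐-refl (≐-sym p))) (Gen-trans g₁ g₂)

  module Unipotent (k n N : ℕ) where

    -- c₁ bounds κ (X - Z), where X - Z has entries up to N + N; c₂ bounds π of a remainder modulo
    -- d; c₃ bounds π of a matrix unit or its negative.
    c₁ = proj₁ (κ-Bdd k n S (N ℕ.+ N))
    c₂ = proj₁ (π-Bdd k n S (N ℕ.⊔ ∣ d ∣))
    c₃ = proj₁ (π-Bdd k n S (N ℕ.⊔ 1))
    N′ = N ℕ.⊔ (1 ℕ.⊔ ((c₁ ℕ.+ c₂) ℕ.⊔ c₃))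

    N≤N′ : N ℕ.≤ N′
    N≤N′ = ℕP.m≤m⊔n N _

    1≤N′ : 1 ℕ.≤ N′
    1≤N′ = ℕP.≤-trans (ℕP.m≤m⊔n 1 ((c₁ ℕ.+ c₂) ℕ.⊔ c₃)) (ℕP.m≤n⊔m N _)

    c₁₂≤N′ : c₁ ℕ.+ c₂ ℕ.≤ N′
    c₁₂≤N′ = ℕP.≤-trans (ℕP.m≤m⊔n (c₁ ℕ.+ c₂) c₃) (ℕP.≤-trans (ℕP.m≤n⊔m 1 _) (ℕP.m≤n⊔m N _))

    c₃≤N′ : c₃ ℕ.≤ N′
    c₃≤N′ = ℕP.≤-trans (ℕP.m≤n⊔m (c₁ ℕ.+ c₂) c₃) (ℕP.≤-trans (ℕP.m≤n⊔m 1 _) (ℕP.m≤n⊔m N _))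

    module _ (A : Lin k k) (B : Lin n n) (X Z : Lin n k) (bA : Bdd N A) (bB : Bdd N B) (bX : Bdd N X) (bZ : Bdd N Z)
             (mA : Kills m A) (mB : Kills m B) where
      open Homotopy S A B mA mB

      edge-unipotent : ∀ {X} → Bdd N X → ∀ W → Bdd N′ W → X +L W ∘L B ≐ A ∘L W +L Z → Gen N′ (blk A X B) (blk A Z B) (blk idL W idL)
      edge-unipotent {X} bX W bW h = Gen-edge
        (Bdd-blk A X B (Bdd-mono N≤N′ bA) (Bdd-mono N≤N′ bX) (Bdd-mono N≤N′ bB))
        (Bdd-blk A Z B (Bdd-mono N≤N′ bA) (Bdd-mono N≤N′ bZ) (Bdd-mono N≤N′ bB))
        (Bdd-blk idL W idL (Bdd-mono 1≤N′ Bdd-id) bW (Bdd-mono 1≤N′ Bdd-id))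
        (Bdd-blk idL (-L (idL ∘L W ∘L idL)) idL (Bdd-mono 1≤N′ Bdd-id)
          (Bdd-- (idL ∘L W ∘L idL) (Bdd-≐ {f = W} (eq λ _ _ → refl) bW)) (Bdd-mono 1≤N′ Bdd-id))
        (blk-unipotent h)

      Good : Lin n k → Set
      Good C = Gen N′ (blk A Z B) (blk A Z B) (blk idL (π C) idL)

      π0≐0 : π 0L ≐ 0L
      π0≐0 = ≐-trans (π-cong {0L} {0ℤ ·L 0L} (eq λ _ _ → refl)) (≐-trans (π-· 0ℤ 0L) (eq λ _ _ → refl))

      good-small : ∀ C → Bdd 1 C → Good C
      good-small C bC = edge-unipotent bZ (π C)
        (Bdd-mono c₃≤N′ (proj₂ (π-Bdd k n S (N ℕ.⊔ 1)) A B mA mB C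
          (Bdd-mono (ℕP.m≤m⊔n N 1) bA) (Bdd-mono (ℕP.m≤m⊔n N 1) bB) (Bdd-mono (ℕP.m≤n⊔m N 1) bC)))
        (eq λ x i → trans (ℤP.+-comm (ap Z x i) (ap (π C) (ap B x) i)) (cong (_+ ap Z x i) (sym (at (π-hom C) x i))))

      -- π is additive and unipotent blocks add under composition, so it suffices to reach π of plus
      -- or minus the matrix units. These give bounded automorphisms, as π lands in the
      -- intertwiners.
      good : ∀ C → Good C
      good = Span.spans Good
        (λ p → Gen-≐ ≐-refl ≐-refl (blk-cong ≐-refl (π-cong p) ≐-refl))
        (done (Bdd-blk A Z B (Bdd-mono N≤N′ bA) (Bdd-mono N≤N′ bZ) (Bdd-mono N≤N′ bB)) ≐-refl
              (≐-trans (blk-cong ≐-refl π0≐0 ≐-refl) blk-id))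
        (λ {X} {Y} g h → Gen-≐ ≐-refl ≐-refl (≐-trans blk-idˡ (blk-cong ≐-refl (≐-sym (π-+ X Y)) ≐-refl)) (Gen-trans g h))
        (λ i j → good-small (E i j) (E-Bdd i j))
        (λ i j → good-small (-L E i j) (Bdd-- (E i j) (E-Bdd i j)))

      -- The relation says T W = X - Z, hence d W = π W + κ (X - Z). With W = R + d C this gives d
      -- (W - π C) = κ (X - Z) + π R, so W - π C is a single bounded edge, and what remains is the
      -- automorphism π C of the target, covered by `good`.
      unipotent : ∀ W → X +L W ∘L B ≐ A ∘L W +L Z → Gen N′ (blk A X B) (blk A Z B) (blk idL W idL)
      unipotent W h = Gen-≐ ≐-refl ≐-refl
          (≐-trans blk-idˡ (blk-cong ≐-refl (eq λ x i → back (ap W x i) (ap (π C) x i)) ≐-refl))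
          (Gen-trans (edge-unipotent bX Y bY hY) (good C))
        where
        C = quo W
        R = rem W
        Y = W +L -L (π C)
        D = X +L -L Z
        back : ∀ a b → a + -1ℤ * b + b ≡ a
        back = solve-∀
        hD : A ∘L W ≐ W ∘L B +L D
        hD = eq λ x i → l (ap A (ap W x) i) (ap W (ap B x) i) (ap X x i) (ap Z x i) (at h x i)
          where
          l : ∀ a b x z → x + b ≡ a + z → a ≡ b + (x + -1ℤ * z)
          l a b x z q = trans (l1 a z) (trans (cong (_+ -1ℤ * z) (sym q)) (l2 x b z))
            where
            l1 : ∀ a z → a ≡ a + z + -1ℤ * z
            l1 = solve-∀
            l2 : ∀ x b z → x + b + -1ℤ * z ≡ b + (x + -1ℤ * z)
            l2 = solve-∀
        dY : d ·L Y ≐ κ D +L π R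
        dY = eq λ x i → begin
          d * (ap W x i + -1ℤ * ap (π C) x i)
            ≡⟨ l1 d (ap W x i) (ap (π C) x i) ⟩
          d * ap W x i + -1ℤ * (d * ap (π C) x i)
            ≡⟨ cong (_+ -1ℤ * (d * ap (π C) x i)) (at (d≐π+κT W D hD) x i) ⟩
          ap (π W) x i + ap (κ D) x i + -1ℤ * (d * ap (π C) x i)
            ≡⟨ cong (λ z → z + ap (κ D) x i + -1ℤ * (d * ap (π C) x i))
                    (trans (at (π-cong (rem-quo W)) x i) (trans (at (π-+ R (d ·L C)) x i) (cong (ap (π R) x i +_) (at (π-· d C) x i)))) ⟩
          ap (π R) x i + d * ap (π C) x i + ap (κ D) x i + -1ℤ * (d * ap (π C) x i)
            ≡⟨ l2 (ap (π R) x i) (d * ap (π C) x i) (ap (κ D) x i) ⟩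
          ap (κ D) x i + ap (π R) x i ∎
          where
          l1 : ∀ d a b → d * (a + -1ℤ * b) ≡ d * a + -1ℤ * (d * b)
          l1 = solve-∀
          l2 : ∀ a b c → a + b + c + -1ℤ * b ≡ c + a
          l2 = solve-∀
        bY : Bdd N′ Y
        bY = Bdd-mono c₁₂≤N′ (cancel-Bdd Y (Bdd-≐ (≐-sym dY) (Bdd-+ (κ D) (π R)
          (proj₂ (κ-Bdd k n S (N ℕ.+ N)) A B mA mB D (Bdd-mono (ℕP.m≤m+n N N) bA) (Bdd-mono (ℕP.m≤m+n N N) bB)
            (Bdd-+ X (-L Z) bX (Bdd-- Z bZ)))
          (proj₂ (π-Bdd k n S (N ℕ.⊔ ∣ d ∣)) A B mA mB R (Bdd-mono (ℕP.m≤m⊔n N ∣ d ∣) bA) (Bdd-mono (ℕP.m≤m⊔n N ∣ d ∣) bB)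
            (Bdd-mono (ℕP.m≤n⊔m N ∣ d ∣) (rem-Bdd W))))))
        hY : X +L Y ∘L B ≐ A ∘L Y +L Z
        hY = eq λ x i → begin
          ap X x i + (ap W (ap B x) i + -1ℤ * ap (π C) (ap B x) i)
            ≡⟨ ℤP.+-assoc (ap X x i) (ap W (ap B x) i) (-1ℤ * ap (π C) (ap B x) i) ⟨
          ap X x i + ap W (ap B x) i + -1ℤ * ap (π C) (ap B x) i
            ≡⟨ cong₂ (λ a b → a + -1ℤ * b) (at h x i) (sym (at (π-hom C) x i)) ⟩
          ap A (ap W x) i + ap Z x i + -1ℤ * ap A (ap (π C) x) i
            ≡⟨ l (ap A (ap W x) i) (ap Z x i) (-1ℤ * ap A (ap (π C) x) i) ⟩
          ap A (ap W x) i + -1ℤ * ap A (ap (π C) x) i + ap Z x i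
            ≡⟨ cong (_+ ap Z x i) (trans (cong (ap A (ap W x) i +_) (sym (scal A -1ℤ (ap (π C) x) i))) (sym (add A (ap W x) (-1ℤ ·v ap (π C) x) i))) ⟩
          ap A (ap Y x) i + ap Z x i ∎
          where
          l : ∀ a b c → a + b + c ≡ a + c + b
          l = solve-∀

  module ParabolicIso (k n N : ℕ) (fgₖ : FG k) (fgₙ : FG n) where

    N₁ = proj₁ (fgₖ N)
    N₂ = proj₁ (fgₙ N)
    N₃ = 1 ℕ.⊔ (N ℕ.⊔ (N₁ ℕ.⊔ N₂))

    1≤N₃ : 1 ℕ.≤ N₃
    1≤N₃ = ℕP.m≤m⊔n 1 (N ℕ.⊔ (N₁ ℕ.⊔ N₂))

    N≤N₃ : N ℕ.≤ N₃
    N≤N₃ = ℕP.≤-trans (ℕP.m≤m⊔n N _) (ℕP.m≤n⊔m 1 _)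

    N₁≤N₃ : N₁ ℕ.≤ N₃
    N₁≤N₃ = ℕP.≤-trans (ℕP.m≤m⊔n N₁ N₂) (ℕP.≤-trans (ℕP.m≤n⊔m N _) (ℕP.m≤n⊔m 1 _))

    N₂≤N₃ : N₂ ℕ.≤ N₃
    N₂≤N₃ = ℕP.≤-trans (ℕP.m≤n⊔m N₁ N₂) (ℕP.≤-trans (ℕP.m≤n⊔m N _) (ℕP.m≤n⊔m 1 _))

    M = proj₁ (lift k n N₃ N)

    N≤M : N ℕ.≤ M
    N≤M = proj₁ (proj₂ (lift k n N₃ N))

    L : Lift k n N₃ M
    L = proj₂ (proj₂ (lift k n N₃ N))

    N₄ = Lift.N′ L
    N₅ = Unipotent.N′ k n M
    N′ = N₄ ℕ.⊔ N₅

    module _ {A₁ B₁ P₁ Q₁ : Lin k k} {A₂ B₂ P₂ Q₂ : Lin n n} {X Z Y Y⁻ : Lin n k}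
             (bA₁ : Bdd N A₁) (bB₁ : Bdd N B₁) (bA₂ : Bdd N A₂) (bB₂ : Bdd N B₂) (bX : Bdd N X) (bZ : Bdd N Z)
             (z : Kills m (blk A₁ X A₂)) (I : Iso (blk A₁ X A₂) (blk B₁ Z B₂) (blk P₁ Y P₂) (blk Q₁ Y⁻ Q₂)) where

      pq : P₁ ∘L Q₁ ≐ idL × P₁ ∘L Y⁻ +L Y ∘L Q₂ ≐ 0L × P₂ ∘L Q₂ ≐ idL
      pq = blk-inj (≐-trans (≐-sym (blk-∘ P₁ Y P₂ Q₁ Y⁻ Q₂)) (≐-trans (PQ≐id I) (≐-sym blk-id)))

      qp : Q₁ ∘L P₁ ≐ idL × Q₁ ∘L Y +L Y⁻ ∘L P₂ ≐ 0L × Q₂ ∘L P₂ ≐ idL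
      qp = blk-inj (≐-trans (≐-sym (blk-∘ Q₁ Y⁻ Q₂ P₁ Y P₂)) (≐-trans (QP≐id I) (≐-sym blk-id)))

      intertwine : ∀ {Z Y} → blk P₁ Y P₂ ∘L blk A₁ X A₂ ≐ blk B₁ Z B₂ ∘L blk P₁ Y P₂ →
                   P₁ ∘L A₁ ≐ B₁ ∘L P₁ × P₁ ∘L X +L Y ∘L A₂ ≐ B₁ ∘L Y +L Z ∘L P₂ × P₂ ∘L A₂ ≐ B₂ ∘L P₂
      intertwine {Z} {Y} t = blk-inj (≐-trans (≐-sym (blk-∘ P₁ Y P₂ A₁ X A₂)) (≐-trans t (blk-∘ B₁ Z B₂ P₁ Y P₂)))

      I₁ : Iso A₁ B₁ P₁ Q₁
      I₁ = record { PQ≐id = proj₁ pq ; QP≐id = proj₁ qp ; tw = proj₁ (intertwine (tw I)) }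

      I₂ : Iso A₂ B₂ P₂ Q₂
      I₂ = record { PQ≐id = proj₂ (proj₂ pq) ; QP≐id = proj₂ (proj₂ qp) ; tw = proj₂ (proj₂ (intertwine (tw I))) }

      gen-diagonal : Σ (Lin n k) λ V → Σ (Lin n k) λ X₂ → Bdd M X₂ × Gen N₄ (blk A₁ X A₂) (blk B₁ X₂ B₂) (blk P₁ V P₂)
      gen-diagonal =
        let mA₁ , _ , mA₂ = blk-kills z
            Y₁ , X₁ , bX₁ , h₁ = liftˡ L 1≤N₃ (Gen-mono N₁≤N₃ (proj₂ (fgₖ N) A₁ B₁ P₁ Q₁ bA₁ bB₁ mA₁ I₁))
                                       (Bdd-mono N≤N₃ bA₂) (Bdd-mono N≤M bX) z
            Y₂ , X₂ , bX₂ , h₂ = liftʳ L 1≤N₃ (Gen-mono N₂≤N₃ (proj₂ (fgₙ N) A₂ B₂ P₂ Q₂ bA₂ bB₂ mA₂ I₂))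
                                       (Bdd-mono N≤N₃ bB₁) bX₁ (Kills-Iso m (proj₂ (Gen-Iso h₁)) z)
        in idL ∘L Y₁ +L Y₂ ∘L idL , X₂ , bX₂ ,
           Gen-≐ ≐-refl ≐-refl (≐-trans (blk-∘ idL Y₂ P₂ P₁ Y₁ idL) (blk-cong (eq λ _ _ → refl) ≐-refl (eq λ _ _ → refl)))
                 (Gen-trans h₁ h₂)

      -- The lifted path has the right diagonal blocks P₁ and P₂, but a wrong block V and a wrong
      -- end X₂. The quotient of the two isomorphisms is unipotent with block W = (Y - V) Q₂ and
      -- joins two bounded matrices, which `unipotent` handles.
      gen-via : ∀ V X₂ → Bdd M X₂ → Gen N₄ (blk A₁ X A₂) (blk B₁ X₂ B₂) (blk P₁ V P₂) → Gen N′ (blk A₁ X A₂) (blk B₁ Z B₂) (blk P₁ Y P₂)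
      gen-via V X₂ bX₂ h = Gen-≐ ≐-refl ≐-refl
          (≐-trans (blk-∘ idL W idL P₁ V P₂) (blk-cong (eq λ _ _ → refl)
            (eq λ x i → trans (cong (λ w → ap V x i + w) (cong₂ (λ a b → a + -1ℤ * b) (congr Y (at (QP≐id I₂) x) i) (congr V (at (QP≐id I₂) x) i)))
                              (back (ap V x i) (ap Y x i)))
            (eq λ _ _ → refl)))
          (Gen-trans (Gen-mono (ℕP.m≤m⊔n N₄ N₅) h) (Gen-mono (ℕP.m≤n⊔m N₄ N₅) gW))
        where
        W = (Y +L -L V) ∘L Q₂
        back : ∀ a b → a + (b + -1ℤ * a) ≡ b
        back = solve-∀
        subtract : ∀ p a b c a′ b′ c′ → p + a ≡ b + c → p + a′ ≡ b′ + c′ → c′ + (a + -1ℤ * a′) ≡ (b + -1ℤ * b′) + c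
        subtract p a b c a′ b′ c′ q q′ = trans (l1 p a a′ c′) (trans (cong₂ (λ s t → s + -1ℤ * t + c′) q q′) (l2 b c b′ c′))
          where
          l1 : ∀ p a a′ c′ → c′ + (a + -1ℤ * a′) ≡ (p + a) + -1ℤ * (p + a′) + c′
          l1 = solve-∀
          l2 : ∀ b c b′ c′ → (b + c) + -1ℤ * (b′ + c′) + c′ ≡ (b + -1ℤ * b′) + c
          l2 = solve-∀
        twY : P₁ ∘L X +L Y ∘L A₂ ≐ B₁ ∘L Y +L Z ∘L P₂
        twY = proj₁ (proj₂ (intertwine (tw I)))
        twV : P₁ ∘L X +L V ∘L A₂ ≐ B₁ ∘L V +L X₂ ∘L P₂
        twV = proj₁ (proj₂ (intertwine (tw (proj₂ (Gen-Iso h)))))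
        rel : X₂ +L W ∘L B₂ ≐ B₁ ∘L W +L Z
        rel = eq λ x i → let y = ap Q₂ x in begin
          ap X₂ x i + (ap Y (ap Q₂ (ap B₂ x)) i + -1ℤ * ap V (ap Q₂ (ap B₂ x)) i)
            ≡⟨ cong₂ _+_ (congr X₂ (λ j → sym (at (PQ≐id I₂) x j)) i)
                 (cong₂ (λ a b → a + -1ℤ * b) (congr Y (at (tw (Iso-sym I₂)) x) i) (congr V (at (tw (Iso-sym I₂)) x) i)) ⟩
          ap X₂ (ap P₂ y) i + (ap Y (ap A₂ y) i + -1ℤ * ap V (ap A₂ y) i)
            ≡⟨ subtract (ap P₁ (ap X y) i) (ap Y (ap A₂ y) i) (ap B₁ (ap Y y) i) (ap Z (ap P₂ y) i) (ap V (ap A₂ y) i) (ap B₁ (ap V y) i)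
                 (ap X₂ (ap P₂ y) i) (at twY y i) (at twV y i) ⟩
          (ap B₁ (ap Y y) i + -1ℤ * ap B₁ (ap V y) i) + ap Z (ap P₂ y) i
            ≡⟨ cong₂ _+_ (trans (cong (ap B₁ (ap Y y) i +_) (sym (scal B₁ -1ℤ (ap V y) i))) (sym (add B₁ (ap Y y) (-1ℤ ·v ap V y) i)))
                         (congr Z (at (PQ≐id I₂) x) i) ⟩
          ap B₁ (ap W x) i + ap Z x i ∎
        mB = blk-kills (Kills-Iso m I z)
        gW = Unipotent.unipotent k n M B₁ B₂ X₂ Z (Bdd-mono N≤M bB₁) (Bdd-mono N≤M bB₂) bX₂ (Bdd-mono N≤M bZ)
              (proj₁ mB) (proj₂ (proj₂ mB)) W rel

      parabolic-blk : Gen N′ (blk A₁ X A₂) (blk B₁ Z B₂) (blk P₁ Y P₂)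
      parabolic-blk = let V , X₂ , bX₂ , h = gen-diagonal in gen-via V X₂ bX₂ h

    parabolic : ∀ (A B P Q : Lin (k ℕ.+ n) (k ℕ.+ n)) → Bdd N A → Bdd N B → Kills m A → Iso A B P Q →
                Tri k A → Tri k B → Tri k P → Tri k Q → Gen N′ A B P
    parabolic A B P Q bA bB z I tA tB tP tQ =
      Gen-≐ (≐-sym A≐) (≐-sym B≐) (≐-sym P≐) (parabolic-blk
        (bdd λ i j → subst (λ w → ∣ w ∣ ℕ.≤ N) (sym (ent-topLeft A i j)) (bound bA (i ↑ˡ n) (j ↑ˡ n)))
        (bdd λ i j → subst (λ w → ∣ w ∣ ℕ.≤ N) (sym (ent-topLeft B i j)) (bound bB (i ↑ˡ n) (j ↑ˡ n)))
        (bdd λ i j → subst (λ w → ∣ w ∣ ℕ.≤ N) (sym (ent-botRight {k} A i j)) (bound bA (k ↑ʳ i) (k ↑ʳ j)))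
        (bdd λ i j → subst (λ w → ∣ w ∣ ℕ.≤ N) (sym (ent-botRight {k} B i j)) (bound bB (k ↑ʳ i) (k ↑ʳ j)))
        (bdd λ i j → subst (λ w → ∣ w ∣ ℕ.≤ N) (sym (ent-topRight A i j)) (bound bA (i ↑ˡ n) (k ↑ʳ j)))
        (bdd λ i j → subst (λ w → ∣ w ∣ ℕ.≤ N) (sym (ent-topRight B i j)) (bound bB (i ↑ˡ n) (k ↑ʳ j)))
        (≐-trans (evalL-cong m (≐-sym A≐)) z)
        (record { PQ≐id = ≐-trans (∘-cong (≐-sym P≐) (≐-sym Q≐)) (PQ≐id I)
                ; QP≐id = ≐-trans (∘-cong (≐-sym Q≐) (≐-sym P≐)) (QP≐id I)
                ; tw = ≐-trans (∘-cong (≐-sym P≐) (≐-sym A≐)) (≐-trans (tw I) (∘-cong B≐ P≐)) }))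
      where
      A≐ = Tri⇒blk {k} {n} A tA
      B≐ = Tri⇒blk {k} {n} B tB
      P≐ = Tri⇒blk {k} {n} P tP
      Q≐ = Tri⇒blk {k} {n} Q tQ

-- Integer inequalities

0≤+ : ∀ {a b} → 0ℤ ≤ a → 0ℤ ≤ b → 0ℤ ≤ a + b
0≤+ = ℤP.+-mono-≤

0≤* : ∀ {a b} → 0ℤ ≤ a → 0ℤ ≤ b → 0ℤ ≤ a * b
0≤* {ℤ.+ a} {ℤ.+ b} _ _ = subst (0ℤ ≤_) (ℤP.pos-* a b) (+≤+ ℕ.z≤n)

0≤sq : ∀ a → 0ℤ ≤ a * a
0≤sq (ℤ.+ zero)  = ℤP.≤-refl
0≤sq (ℤ.+ suc n) = +≤+ ℕ.z≤n
0≤sq -[1+ n ]    = +≤+ ℕ.z≤n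

≤⇒0≤ : ∀ {a b} → a ≤ b → 0ℤ ≤ b - a
≤⇒0≤ = ℤP.i≤j⇒0≤j-i

-- The standard pattern for the estimates below: write b - a as a visibly nonnegative expression z
-- and leave the identity to the ring solver.
≤-by : ∀ {a b} z → 0ℤ ≤ z → b - a ≡ z → a ≤ b
≤-by z p q = ℤP.0≤i-j⇒j≤i (subst (0ℤ ≤_) (sym q) p)

cancel-≤ : ∀ {g a b} → 0ℤ < g → g * a ≤ g * b → a ≤ b
cancel-≤ {ℤ.+ suc g} {a} {b} _ p = ℤP.*-cancelˡ-≤-pos a b (ℤ.+ suc g) p
cancel-≤ {ℤ.+ zero} (+<+ ()) _

mono-≤ : ∀ {g a b} → 0ℤ ≤ g → a ≤ b → g * a ≤ g * b
mono-≤ {g} {a} {b} p q = ≤-by (g * (b - a)) (0≤* p (≤⇒0≤ q)) (l g a b)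
  where
  l : ∀ g a b → g * b - g * a ≡ g * (b - a)
  l = solve-∀

mono-≤ʳ : ∀ {g a b} → 0ℤ ≤ g → a ≤ b → a * g ≤ b * g
mono-≤ʳ {g} {a} {b} p q = subst₂ _≤_ (ℤP.*-comm g a) (ℤP.*-comm g b) (mono-≤ p q)

≤0⇒≡0 : ∀ {a} → 0ℤ ≤ a → a ≤ 0ℤ → a ≡ 0ℤ
≤0⇒≡0 p q = ℤP.≤-antisym q p

sq≡0 : ∀ {a} → a * a ≡ 0ℤ → a ≡ 0ℤ
sq≡0 {a} q with ℤP.i*j≡0⇒i≡0∨j≡0 a q
... | inj₁ p = p
... | inj₂ p = p

sq≢0 : ∀ {a} → a ≢ 0ℤ → 1ℤ ≤ a * a
sq≢0 {a} p = ℤP.i<j⇒suc[i]≤j (ℤP.≤∧≢⇒< (0≤sq a) (λ q → p (sq≡0 (sym q))))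

-- An integer satisfies |a| ≤ a², so a bound on the square bounds the integer without any square
-- root.
∣∣≤-sq : ∀ {a} K → a * a ≤ K → ∣ a ∣ ℕ.≤ ∣ K ∣
∣∣≤-sq {a} K p = ℤP.drop‿+≤+ (subst (ℤ.+ ∣ a ∣ ≤_) (sym (ℤP.0≤i⇒+∣i∣≡i (ℤP.≤-trans (0≤sq a) p))) (ℤP.≤-trans (l a) p))
  where
  l : ∀ a → ℤ.+ ∣ a ∣ ≤ a * a
  l (ℤ.+ zero)  = ℤP.≤-refl
  l (ℤ.+ suc n) = +≤+ (ℕP.m≤m*n (suc n) (suc n))
  l -[1+ n ]    = +≤+ (ℕP.m≤m*n (suc n) (suc n))

sq-+-≤ : ∀ {a b M N} → a * a ≤ M → b * b ≤ N → (a + b) * (a + b) ≤ ℤ.+ 2 * M + ℤ.+ 2 * N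
sq-+-≤ {a} {b} {M} {N} p q = ≤-by ((M - a * a) + (M - a * a) + ((N - b * b) + (N - b * b)) + (a - b) * (a - b))
  (0≤+ (0≤+ (0≤+ (≤⇒0≤ p) (≤⇒0≤ p)) (0≤+ (≤⇒0≤ q) (≤⇒0≤ q))) (0≤sq (a - b))) (l a b M N)
  where
  l : ∀ a b M N → (ℤ.+ 2 * M + ℤ.+ 2 * N) - (a + b) * (a + b) ≡ (M - a * a) + (M - a * a) + ((N - b * b) + (N - b * b)) + (a - b) * (a - b)
  l = solve-∀

-- Equal to 2^(n+1) - 2, the factor obtained by iterating (a + b)² ≤ 2a² + 2b² over n summands. It
-- is cruder than Cauchy-Schwarz, but only the existence of a constant matters.
sumC : ℕ → ℤ
sumC zero    = 0ℤ
sumC (suc n) = ℤ.+ 2 + ℤ.+ 2 * sumC n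

0≤sumC : ∀ n → 0ℤ ≤ sumC n
0≤sumC zero    = ℤP.≤-refl
0≤sumC (suc n) = 0≤+ {ℤ.+ 2} (+≤+ ℕ.z≤n) (0≤* {ℤ.+ 2} (+≤+ ℕ.z≤n) (0≤sumC n))

sq-sum-≤ : ∀ {n} (f : Fin n → ℤ) {M} → (∀ i → f i * f i ≤ M) → sumℤ n f * sumℤ n f ≤ sumC n * M
sq-sum-≤ {zero}  f p = ℤP.≤-refl
sq-sum-≤ {suc n} f {M} p = ℤP.≤-trans (sq-+-≤ {f zero} (p zero) (sq-sum-≤ (λ i → f (suc i)) (λ i → p (suc i)))) (ℤP.≤-reflexive (l (sumC n) M))
  where
  l : ∀ c M → ℤ.+ 2 * M + ℤ.+ 2 * (c * M) ≡ (ℤ.+ 2 + ℤ.+ 2 * c) * M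
  l = solve-∀

nearest : ∀ h g → 0ℤ < g → Σ ℤ λ k → ℤ.+ 4 * ((h - k * g) * (h - k * g)) ≤ g * g
nearest h (ℤ.+ zero) (+<+ ())
nearest h g@(ℤ.+ suc _) 0<g with ℤ.+ 2 * (ℤ.+ (h ℤD.% g)) ℤP.≤? g
... | yes p = h ℤD./ g , ≤-by ((g - ℤ.+ 2 * a) * (g + ℤ.+ 2 * a)) (0≤* (≤⇒0≤ p) (0≤+ (ℤP.<⇒≤ 0<g) (0≤* {ℤ.+ 2} (+≤+ ℕ.z≤n) 0≤a)))
                (trans (cong (λ z → g * g - ℤ.+ 4 * (z * z)) h-kg) (l g a))
  where
  a = ℤ.+ (h ℤD.% g)
  0≤a : 0ℤ ≤ a
  0≤a = +≤+ ℕ.z≤n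
  h-kg : h - h ℤD./ g * g ≡ a
  h-kg = trans (cong (_- h ℤD./ g * g) (ℤD.a≡a%n+[a/n]*n h g)) (l′ a (h ℤD./ g * g))
    where
    l′ : ∀ a b → a + b - b ≡ a
    l′ = solve-∀
  l : ∀ g a → g * g - ℤ.+ 4 * (a * a) ≡ (g - ℤ.+ 2 * a) * (g + ℤ.+ 2 * a)
  l = solve-∀
... | no ¬p = h ℤD./ g + 1ℤ , ≤-by ((ℤ.+ 2 * a - g) * (ℤ.+ 2 * (g - a) + g)) (0≤* (≤⇒0≤ (ℤP.<⇒≤ (ℤP.≰⇒> ¬p)))
                (0≤+ (0≤* {ℤ.+ 2} (+≤+ ℕ.z≤n) (≤⇒0≤ a≤g)) (ℤP.<⇒≤ 0<g)))
                (trans (cong (λ z → g * g - ℤ.+ 4 * (z * z)) h-kg) (l g a))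
  where
  a = ℤ.+ (h ℤD.% g)
  a≤g : a ≤ g
  a≤g = +≤+ (ℕP.<⇒≤ (ℤD.n%d<d h g))
  h-kg : h - (h ℤD./ g + 1ℤ) * g ≡ a - g
  h-kg = trans (cong (_- (h ℤD./ g + 1ℤ) * g) (ℤD.a≡a%n+[a/n]*n h g)) (l′ a (h ℤD./ g) g)
    where
    l′ : ∀ a b g → a + b * g - (b + 1ℤ) * g ≡ a - g
    l′ = solve-∀
  l : ∀ g a → g * g - ℤ.+ 4 * ((a - g) * (a - g)) ≡ (ℤ.+ 2 * a - g) * (ℤ.+ 2 * (g - a) + g)
  l = solve-∀

-- Positive definite integral forms

record Form (n : ℕ) : Set where
  no-eta-equality
  field
    B      : V n → V n → ℤ
    B-cong : ∀ {x x′ y y′} → x ≗ x′ → y ≗ y′ → B x y ≡ B x′ y′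
    B-sym  : ∀ x y → B x y ≡ B y x
    B-add  : ∀ x x′ y → B (x +v x′) y ≡ B x y + B x′ y
    B-scal : ∀ c x y → B (c ·v x) y ≡ c * B x y
    B-pos  : ∀ x → ¬ (x ≗ 0v) → 0ℤ < B x x

  B-addʳ : ∀ x y y′ → B x (y +v y′) ≡ B x y + B x y′
  B-addʳ x y y′ = trans (B-sym x _) (trans (B-add y y′ x) (cong₂ _+_ (B-sym y x) (B-sym y′ x)))

  B-scalʳ : ∀ c x y → B x (c ·v y) ≡ c * B x y
  B-scalʳ c x y = trans (B-sym x _) (trans (B-scal c y x) (cong (c *_) (B-sym y x)))

  B-comb : ∀ a x b y → B (a ·v x +v b ·v y) (a ·v x +v b ·v y) ≡ a * a * B x x + ℤ.+ 2 * (a * b * B x y) + b * b * B y y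
  B-comb a x b y = begin
    B (a ·v x +v b ·v y) (a ·v x +v b ·v y)
      ≡⟨ trans (B-add _ _ _) (cong₂ _+_ (B-scal a x _) (B-scal b y _)) ⟩
    a * B x (a ·v x +v b ·v y) + b * B y (a ·v x +v b ·v y)
      ≡⟨ cong₂ (λ s t → a * s + b * t) (trans (B-addʳ x _ _) (cong₂ _+_ (B-scalʳ a x x) (B-scalʳ b x y)))
                                       (trans (B-addʳ y _ _) (cong₂ _+_ (trans (B-scalʳ a y x) (cong (a *_) (B-sym y x))) (B-scalʳ b y y))) ⟩
    a * (a * B x x + b * B x y) + b * (a * B x y + b * B y y)
      ≡⟨ l a b (B x x) (B x y) (B y y) ⟩
    a * a * B x x + ℤ.+ 2 * (a * b * B x y) + b * b * B y y ∎
    where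
    l : ∀ a b p q r → a * (a * p + b * q) + b * (a * q + b * r) ≡ a * a * p + ℤ.+ 2 * (a * b * q) + b * b * r
    l = solve-∀

  B-0 : ∀ y → B 0v y ≡ 0ℤ
  B-0 y = trans (B-cong {0v} {0ℤ ·v 0v} {y} {y} (λ _ → refl) (λ _ → refl)) (trans (B-scal 0ℤ 0v y) (ℤP.*-zeroˡ (B 0v y)))

  B-nonneg : ∀ x → 0ℤ ≤ B x x
  B-nonneg x with FP.all? (λ i → x i ℤP.≟ 0ℤ)
  ... | yes z = ℤP.≤-reflexive (sym (trans (B-cong {x} {0v} {x} {x} z (λ _ → refl)) (B-0 x)))
  ... | no ¬z = ℤP.<⇒≤ (B-pos x ¬z)

  functional : V n → Lin n 1
  ap    (functional x) y _   = B x y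
  congr (functional x) p _   = B-cong {x} {x} (λ _ → refl) p
  add   (functional x) y z _ = B-addʳ x y z
  scal  (functional x) c y _ = B-scalʳ c x y

pullback : ∀ {k n} → Form n → (f : Lin k n) → (∀ x → ap f x ≗ 0v → x ≗ 0v) → Form k
pullback F f inj = record
  { B = λ x y → B (ap f x) (ap f y)
  ; B-cong = λ p q → B-cong (congr f p) (congr f q)
  ; B-sym = λ x y → B-sym (ap f x) (ap f y)
  ; B-add = λ x x′ y → trans (B-cong (add f x x′) (λ _ → refl)) (B-add (ap f x) (ap f x′) (ap f y))
  ; B-scal = λ c x y → trans (B-cong (scal f c x) (λ _ → refl)) (B-scal c (ap f x) (ap f y))
  ; B-pos = λ x ¬z → B-pos (ap f x) (λ z → ¬z (inj x z)) }
  where open Form F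

left-inverse⇒inj : ∀ {k n} {P : Lin k n} {Q : Lin n k} → Q ∘L P ≐ idL → ∀ x → ap P x ≗ 0v → x ≗ 0v
left-inverse⇒inj {Q = Q} h x z i = trans (sym (at h x i)) (ap-≗0 Q z i)

-- Bases of the lattice and their reduction

record Frame (n : ℕ) : Set where
  no-eta-equality
  field
    P Q : Lin n n
    PQ  : P ∘L Q ≐ idL
    QP  : Q ∘L P ≐ idL

idFrame : ∀ {n} → Frame n
idFrame = record { P = idL ; Q = idL ; PQ = eq λ _ _ → refl ; QP = eq λ _ _ → refl }

infixr 9 _∘F_
_∘F_ : ∀ {n} → Frame n → Frame n → Frame n
F ∘F G = record
  { P = Frame.P F ∘L Frame.P G ; Q = Frame.Q G ∘L Frame.Q F
  ; PQ = eq λ x i → trans (congr (Frame.P F) (at (Frame.PQ G) (ap (Frame.Q F) x)) i) (at (Frame.PQ F) x i)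
  ; QP = eq λ x i → trans (congr (Frame.Q G) (at (Frame.QP F) (ap (Frame.P G) x)) i) (at (Frame.QP G) x i) }

-- The one consequence of reduction theory that is used: a vector cannot be much shorter than its
-- component along any basis vector. Applied to the image of a basis vector it yields the weight
-- inequality for matrix entries.
Reduced : ∀ {n} → Form n → ℤ → Lin n n → Set
Reduced F C P = ∀ x i → x i * x i * Form.B F (ap P (e i)) (ap P (e i)) ≤ C * Form.B F (ap P x) (ap P x)

permL : ∀ {n} → Perm.Permutation n n → Lin n n
ap    (permL σ) x j     = x (σ Perm.⟨$⟩ʳ j)
congr (permL σ) p j     = p (σ Perm.⟨$⟩ʳ j)
add   (permL σ) x y j   = refl
scal  (permL σ) c x j   = refl

permFrame : ∀ {n} → Perm.Permutation n n → Frame n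
permFrame σ = record
  { P = permL σ ; Q = permL (Perm.flip σ)
  ; PQ = eq λ x i → cong x (Perm.inverseˡ σ)
  ; QP = eq λ x i → cong x (Perm.inverseʳ σ) }

permL-e : ∀ {n} (σ : Perm.Permutation n n) j → ap (permL σ) (e (σ Perm.⟨$⟩ʳ j)) ≗ e j
permL-e σ j i with i F.≟ j
... | yes refl = trans (e-≡ (σ Perm.⟨$⟩ʳ i)) (sym (e-≡ i))
... | no  i≢j  = trans (e-≢ {i = σ Perm.⟨$⟩ʳ i} {σ Perm.⟨$⟩ʳ j} (λ q → i≢j (trans (sym (Perm.inverseˡ σ)) (trans (cong (σ Perm.⟨$⟩ˡ_) q) (Perm.inverseˡ σ)))))
                       (sym (e-≢ {i = i} {j} i≢j))

consL : ∀ {k n} → Lin k 1 → Lin k n → Lin k (suc n)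
ap    (consL φ f) x zero      = ap φ x zero
ap    (consL φ f) x (suc i)   = ap f x i
congr (consL φ f) p zero      = congr φ p zero
congr (consL φ f) p (suc i)   = congr f p i
add   (consL φ f) x y zero    = add φ x y zero
add   (consL φ f) x y (suc i) = add f x y i
scal  (consL φ f) c x zero    = scal φ c x zero
scal  (consL φ f) c x (suc i) = scal f c x i

headL : ∀ {n} → Lin (suc n) 1
ap    headL x _   = x zero
congr headL p _   = p zero
add   headL _ _ _ = refl
scal  headL _ _ _ = refl

module Projection {n : ℕ} (F : Form (suc n)) where
  open Form F

  g : ℤ
  g = B (e zero) (e zero)

  0<g : 0ℤ < g
  0<g = B-pos (e zero) (λ z → contradiction (z zero) (λ ()))

  ι : V n → V (suc n)
  ι = ap cons0

  β : V n → ℤ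
  β x = B (e zero) (ι x)

  -- g times the form induced on the orthogonal complement of e zero; the factor keeps it integral.
  projected : Form n
  projected = record
    { B = λ x y → g * B (ι x) (ι y) - β x * β y
    ; B-cong = λ {x} {x′} {y} {y′} p q → cong₂ _-_ (cong (g *_) (B-cong (congr cons0 p) (congr cons0 q)))
        (cong₂ _*_ (B-cong (λ _ → refl) (congr cons0 p)) (B-cong (λ _ → refl) (congr cons0 q)))
    ; B-sym = λ x y → cong₂ _-_ (cong (g *_) (B-sym (ι x) (ι y))) (ℤP.*-comm (β x) (β y))
    ; B-add = λ x x′ y → trans (cong₂ (λ s t → g * s - t * β y) (trans (B-cong (add cons0 x x′) (λ _ → refl)) (B-add (ι x) (ι x′) (ι y)))
        (trans (B-cong {e zero} (λ _ → refl) (add cons0 x x′)) (B-addʳ (e zero) (ι x) (ι x′))))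
        (l1 g (B (ι x) (ι y)) (B (ι x′) (ι y)) (β x) (β x′) (β y))
    ; B-scal = λ c x y → trans (cong₂ (λ s t → g * s - t * β y) (trans (B-cong (scal cons0 c x) (λ _ → refl)) (B-scal c (ι x) (ι y)))
        (trans (B-cong {e zero} (λ _ → refl) (scal cons0 c x)) (B-scalʳ c (e zero) (ι x))))
        (l2 g c (B (ι x) (ι y)) (β x) (β y))
    ; B-pos = λ x ¬z → positive x ¬z }
    where
    l1 : ∀ g a a′ b b′ c → g * (a + a′) - (b + b′) * c ≡ (g * a - b * c) + (g * a′ - b′ * c)
    l1 = solve-∀
    l2 : ∀ g k a b c → g * (k * a) - (k * b) * c ≡ k * (g * a - b * c)
    l2 = solve-∀
    l3 : ∀ g b c → g * g * c + ℤ.+ 2 * (g * (- b) * b) + (- b) * (- b) * g ≡ g * (g * c - b * b)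
    l3 = solve-∀
    cancel-<0 : ∀ {g z} → 0ℤ < g → 0ℤ < g * z → 0ℤ < z
    cancel-<0 {g} {z} 0<g 0<gz = ℤP.≰⇒> λ z≤0 → ℤP.<⇒≱ 0<gz (subst (g * z ≤_) (ℤP.*-zeroʳ g) (mono-≤ (ℤP.<⇒≤ 0<g) z≤0))
    positive : ∀ x → ¬ (x ≗ 0v) → 0ℤ < g * B (ι x) (ι x) - β x * β x
    positive x ¬z = cancel-<0 0<g (subst (0ℤ <_) (trans (B-comb g (ι x) (- β x) (e zero))
        (trans (cong (λ t → g * g * B (ι x) (ι x) + ℤ.+ 2 * (g * (- β x) * t) + (- β x) * (- β x) * g) (B-sym (ι x) (e zero))) (l3 g (β x) (B (ι x) (ι x)))))
        (B-pos (g ·v ι x +v (- β x) ·v e zero) λ z → ¬z (λ i → nz i (z (suc i)))))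
      where
      nz : ∀ i → g * x i + (- β x) * 0ℤ ≡ 0ℤ → x i ≡ 0ℤ
      nz i q with ℤP.i*j≡0⇒i≡0∨j≡0 g (trans (sym (trans (cong (g * x i +_) (ℤP.*-zeroʳ (- β x))) (ℤP.+-identityʳ (g * x i)))) q)
      ... | inj₁ g≡0 = ⊥-elim (ℤP.<-irrefl (sym g≡0) 0<g)
      ... | inj₂ p   = p

  pythagoras : ∀ y → g * B y y ≡ B (e zero) y * B (e zero) y + Form.B projected (ap tail-L y) (ap tail-L y)
  pythagoras y = begin
    g * B y y                                   ≡⟨ cong (g *_) (B-cong y≗ y≗) ⟩
    g * B (y zero ·v e zero +v 1ℤ ·v t) (y zero ·v e zero +v 1ℤ ·v t)
      ≡⟨ cong (g *_) (B-comb (y zero) (e zero) 1ℤ t) ⟩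
    g * (y zero * y zero * g + ℤ.+ 2 * (y zero * 1ℤ * B (e zero) t) + 1ℤ * 1ℤ * B t t)
      ≡⟨ l g (y zero) (B (e zero) t) (B t t) ⟩
    (y zero * g + 1ℤ * B (e zero) t) * (y zero * g + 1ℤ * B (e zero) t) + (g * B t t - B (e zero) t * B (e zero) t)
      ≡⟨ cong (λ z → z * z + (g * B t t - B (e zero) t * B (e zero) t))
              (sym (trans (B-cong {e zero} (λ _ → refl) y≗) (trans (B-addʳ (e zero) _ _) (cong₂ _+_ (B-scalʳ (y zero) (e zero) (e zero)) (B-scalʳ 1ℤ (e zero) t))))) ⟩
    B (e zero) y * B (e zero) y + Form.B projected (ap tail-L y) (ap tail-L y) ∎
    where
    t = ι (ap tail-L y)
    y≗ : y ≗ y zero ·v e zero +v 1ℤ ·v t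
    y≗ i = trans (uncons y i) (cong (y zero * e zero i +_) (sym (ℤP.*-identityˡ (t i))))
    l : ∀ g a b c → g * (a * a * g + ℤ.+ 2 * (a * 1ℤ * b) + 1ℤ * 1ℤ * c) ≡ (a * g + 1ℤ * b) * (a * g + 1ℤ * b) + (g * c - b * b)
    l = solve-∀

-- The summand 4C serves the coordinates along the lifted basis vectors, 2 + 2 (sumC n) C the
-- coordinate along `e zero`; adding them replaces a maximum.
nextC : ℕ → ℤ → ℤ
nextC n C = ℤ.+ 4 * C + (ℤ.+ 2 + ℤ.+ 2 * (sumC n * C))

0≤nextC : ∀ n {C} → 0ℤ ≤ C → 0ℤ ≤ nextC n C
0≤nextC n 0≤C = 0≤+ (0≤* {ℤ.+ 4} (+≤+ ℕ.z≤n) 0≤C) (0≤+ {ℤ.+ 2} (+≤+ ℕ.z≤n) (0≤* {ℤ.+ 2} (+≤+ ℕ.z≤n) (0≤* (0≤sumC n) 0≤C)))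

module ReductionStep {n : ℕ} (F : Form (suc n)) (R : Frame n) (C : ℤ) (0≤C : 0ℤ ≤ C)
                     (red : Reduced (Projection.projected F) C (Frame.P R)) where
  open Form F
  open Projection F
  open Form projected using () renaming (B to B₂)
  open Frame R using () renaming (P to P₂; Q to Q₂)

  k : Fin n → ℤ
  k i = proj₁ (nearest (β (ap P₂ (e i))) g 0<g)

  K : Lin n 1
  K = fromMatrix (λ _ → k)

  -- Size reduction: the reduced basis of the projected form is lifted, and each lift is shifted by
  -- a multiple of `e zero` so that its product with `e zero` is at most g / 2 in absolute value.
  W W⁻¹ : Lin (suc n) (suc n)
  W   = consL (headL +L -L (K ∘L tail-L)) (P₂ ∘L tail-L)
  W⁻¹ = consL (headL +L K ∘L Q₂ ∘L tail-L) (Q₂ ∘L tail-L)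

  shear : Frame (suc n)
  shear = record { P = W ; Q = W⁻¹ ; PQ = eq pq ; QP = eq qp }
    where
    pq : ∀ x → ap W (ap W⁻¹ x) ≗ x
    pq x zero    = l (x zero) (ap K (ap Q₂ (ap tail-L x)) zero)
      where
      l : ∀ a b → a + b + -1ℤ * b ≡ a
      l = solve-∀
    pq x (suc i) = at (Frame.PQ R) (ap tail-L x) i
    qp : ∀ x → ap W⁻¹ (ap W x) ≗ x
    qp x zero    = trans (cong (x zero + -1ℤ * ap K (ap tail-L x) zero +_) (congr K (at (Frame.QP R) (ap tail-L x)) zero)) (l (x zero) (ap K (ap tail-L x) zero))
      where
      l : ∀ a b → a + -1ℤ * b + b ≡ a
      l = solve-∀
    qp x (suc i) = at (Frame.QP R) (ap tail-L x) i

  sheared : Form (suc n)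
  sheared = pullback F W (left-inverse⇒inj (Frame.QP shear))
  open Form sheared using () renaming (B to B′)

  W-e0 : ap W (e zero) ≗ e zero
  W-e0 zero    = trans (cong (λ z → 1ℤ + -1ℤ * z) (ap-0 K zero)) refl
  W-e0 (suc i) = ap-0 P₂ i

  g′≡g : B′ (e zero) (e zero) ≡ g
  g′≡g = B-cong W-e0 W-e0

  W-e : ∀ i → ap W (e (suc i)) ≗ ι (ap P₂ (e i)) +v (- k i) ·v e zero
  W-e i zero    = trans (cong (λ z → 0ℤ + -1ℤ * z) (ent-fromMatrix {r = 1} (λ _ → k) zero i)) (l (k i))
    where
    l : ∀ k → 0ℤ + -1ℤ * k ≡ 0ℤ + - k * 1ℤ
    l = solve-∀
  W-e i (suc j) = sym (trans (cong (ap P₂ (e i) j +_) (ℤP.*-zeroʳ (- k i))) (ℤP.+-identityʳ (ap P₂ (e i) j)))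

  h : Fin n → ℤ
  h i = B′ (e zero) (e (suc i))

  h-small : ∀ i → ℤ.+ 4 * (h i * h i) ≤ g * g
  h-small i = subst (λ z → ℤ.+ 4 * (z * z) ≤ g * g) (sym h≡) (proj₂ (nearest (β (ap P₂ (e i))) g 0<g))
    where
    h≡ : h i ≡ β (ap P₂ (e i)) - k i * g
    h≡ = begin
      B (ap W (e zero)) (ap W (e (suc i)))                ≡⟨ B-cong W-e0 (W-e i) ⟩
      B (e zero) (ι (ap P₂ (e i)) +v (- k i) ·v e zero)   ≡⟨ B-addʳ (e zero) (ι (ap P₂ (e i))) _ ⟩
      β (ap P₂ (e i)) + B (e zero) ((- k i) ·v e zero)    ≡⟨ cong (β (ap P₂ (e i)) +_) (trans (B-scalʳ (- k i) (e zero) (e zero)) (sym (ℤP.neg-distribˡ-* (k i) g))) ⟩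
      β (ap P₂ (e i)) - k i * g                           ∎

  pythagoras′ : ∀ x → g * B′ x x ≡ B′ (e zero) x * B′ (e zero) x + B₂ (ap P₂ (ap tail-L x)) (ap P₂ (ap tail-L x))
  pythagoras′ x = trans (pythagoras (ap W x))
    (cong (λ z → z * z + B₂ (ap P₂ (ap tail-L x)) (ap P₂ (ap tail-L x))) (B-cong {e zero} {ap W (e zero)} {ap W x} {ap W x} (λ i → sym (W-e0 i)) (λ _ → refl)))

  C′ : ℤ
  C′ = nextC n C

  module _ (shortest : ∀ i → g ≤ B′ (e (suc i)) (e (suc i))) where

    w : Fin n → ℤ
    w i = B′ (e (suc i)) (e (suc i))

    0≤g : 0ℤ ≤ g
    0≤g = ℤP.<⇒≤ 0<g

    -- The projected length is D = g w - h². With 4h² ≤ g² and g ≤ w even 4D ≥ 3 g w follows; the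
    -- weaker form suffices. This is where `e zero` must be shortest among the new basis vectors.
    4D≥gw : ∀ i → g * w i ≤ ℤ.+ 4 * B₂ (ap P₂ (e i)) (ap P₂ (e i))
    4D≥gw i = ≤-by (((g * g) - ℤ.+ 4 * (h i * h i)) + g * (w i - g) + g * (w i + w i))
      (0≤+ (0≤+ (≤⇒0≤ (h-small i)) (0≤* 0≤g (≤⇒0≤ (shortest i)))) (0≤* 0≤g (0≤+ 0≤w 0≤w)))
      (trans (cong (λ z → ℤ.+ 4 * z - g * w i) D≡) (l g (w i) (h i)))
      where
      0≤w : 0ℤ ≤ w i
      0≤w = ℤP.≤-trans 0≤g (shortest i)
      D≡ : B₂ (ap P₂ (e i)) (ap P₂ (e i)) ≡ g * w i - h i * h i
      D≡ = trans (l1 (h i * h i) (B₂ (ap P₂ (e i)) (ap P₂ (e i)))) (cong (_- h i * h i) (sym (pythagoras′ (e (suc i)))))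
        where
        l1 : ∀ a b → b ≡ a + b - a
        l1 = solve-∀
      l : ∀ g w h → ℤ.+ 4 * (g * w - h * h) - g * w ≡ (g * g - ℤ.+ 4 * (h * h)) + g * (w - g) + g * (w + w)
      l = solve-∀

    module _ (x : V (suc n)) where
      b = B′ x x
      a = B′ (e zero) x
      D = B₂ (ap P₂ (ap tail-L x)) (ap P₂ (ap tail-L x))

      0≤b : 0ℤ ≤ b
      0≤b = Form.B-nonneg sheared x

      0≤D : 0ℤ ≤ D
      0≤D = Form.B-nonneg projected (ap P₂ (ap tail-L x))

      D≤gb : D ≤ g * b
      D≤gb = ≤-by (a * a) (0≤sq a) (trans (cong (_- D) (pythagoras′ x)) (l (a * a) D))
        where
        l : ∀ a b → a + b - b ≡ a
        l = solve-∀

      aa≤gb : a * a ≤ g * b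
      aa≤gb = ≤-by D 0≤D (trans (cong (_- a * a) (pythagoras′ x)) (l (a * a) D))
        where
        l : ∀ a b → a + b - a ≡ b
        l = solve-∀

      gxxw≤ : ∀ i → g * (x (suc i) * x (suc i) * w i) ≤ ℤ.+ 4 * (C * (g * b))
      gxxw≤ i = ≤-by (xx * (ℤ.+ 4 * Dᵢ - g * w i) + ℤ.+ 4 * (C * D - xx * Dᵢ) + ℤ.+ 4 * (C * (g * b - D)))
        (0≤+ (0≤+ (0≤* (0≤sq (x (suc i))) (≤⇒0≤ (4D≥gw i))) (0≤* {ℤ.+ 4} (+≤+ ℕ.z≤n) (≤⇒0≤ (red (ap tail-L x) i))))
             (0≤* {ℤ.+ 4} (+≤+ ℕ.z≤n) (0≤* 0≤C (≤⇒0≤ D≤gb))))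
        (l g xx (w i) C b Dᵢ D)
        where
        xx = x (suc i) * x (suc i)
        Dᵢ = B₂ (ap P₂ (e i)) (ap P₂ (e i))
        l : ∀ g xx w C b d D → ℤ.+ 4 * (C * (g * b)) - g * (xx * w) ≡ xx * (ℤ.+ 4 * d - g * w) + ℤ.+ 4 * (C * D - xx * d) + ℤ.+ 4 * (C * (g * b - D))
        l = solve-∀

      0≤rest : 0ℤ ≤ ℤ.+ 2 + ℤ.+ 2 * (sumC n * C)
      0≤rest = 0≤+ {ℤ.+ 2} (+≤+ ℕ.z≤n) (0≤* {ℤ.+ 2} (+≤+ ℕ.z≤n) (0≤* (0≤sumC n) 0≤C))

      suc-bound : ∀ i → x (suc i) * x (suc i) * w i ≤ C′ * b
      suc-bound i = ℤP.≤-trans (cancel-≤ 0<g (subst (g * (x (suc i) * x (suc i) * w i) ≤_) (l C g b) (gxxw≤ i)))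
          (mono-≤ʳ {b} {ℤ.+ 4 * C} {C′} 0≤b (≤-by (ℤ.+ 2 + ℤ.+ 2 * (sumC n * C)) 0≤rest (l2 (ℤ.+ 4 * C) (ℤ.+ 2 + ℤ.+ 2 * (sumC n * C)))))
        where
        l : ∀ C g b → ℤ.+ 4 * (C * (g * b)) ≡ g * (ℤ.+ 4 * C * b)
        l = solve-∀
        l2 : ∀ a b → a + b - a ≡ b
        l2 = solve-∀

      S : ℤ
      S = sumℤ n (λ i → x (suc i) * h i)

      a≡ : a ≡ x zero * g + S
      a≡ = begin
        B′ (e zero) x                                          ≡⟨ expand (Form.functional sheared (e zero)) x zero ⟩
        x zero * B′ (e zero) (e zero) + S                      ≡⟨ cong (λ z → x zero * z + S) g′≡g ⟩
        x zero * g + S                                         ∎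

      xh≤ : ∀ i → (x (suc i) * h i) * (x (suc i) * h i) ≤ C * (g * b)
      xh≤ i = cancel-≤ {ℤ.+ 4} (+<+ (ℕ.s≤s ℕ.z≤n)) (≤-by
          (xx * (g * g - ℤ.+ 4 * (h i * h i)) + g * (xx * (w i - g)) + (ℤ.+ 4 * (C * (g * b)) - g * (xx * w i)))
          (0≤+ (0≤+ (0≤* (0≤sq (x (suc i))) (≤⇒0≤ (h-small i))) (0≤* 0≤g (0≤* (0≤sq (x (suc i))) (≤⇒0≤ (shortest i))))) (≤⇒0≤ (gxxw≤ i)))
          (l g (x (suc i)) (h i) (w i) (C * (g * b))))
        where
        xx = x (suc i) * x (suc i)
        l : ∀ g x h w c → ℤ.+ 4 * c - ℤ.+ 4 * ((x * h) * (x * h)) ≡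
            x * x * (g * g - ℤ.+ 4 * (h * h)) + g * (x * x * (w - g)) + (ℤ.+ 4 * c - g * (x * x * w))
        l = solve-∀

      -- Here x₀ g = a - S with a the product of `e zero` and x. Pythagoras bounds a² by g b, the
      -- bounds on the other coordinates give S² ≤ (sumC n) C g b, and one factor g cancels.
      zero-bound : x zero * x zero * g ≤ C′ * b
      zero-bound = ℤP.≤-trans (cancel-≤ 0<g (subst₂ _≤_ (l1 (x zero) g S) (l2 g b (sumC n) C) le))
                     (mono-≤ʳ {b} {ℤ.+ 2 + ℤ.+ 2 * (sumC n * C)} {C′} 0≤b (≤-by (ℤ.+ 4 * C) (0≤* {ℤ.+ 4} (+≤+ ℕ.z≤n) 0≤C) (l3 (ℤ.+ 4 * C) (ℤ.+ 2 + ℤ.+ 2 * (sumC n * C)))))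
        where
        le : (x zero * g + S + - S) * (x zero * g + S + - S) ≤ ℤ.+ 2 * (g * b) + ℤ.+ 2 * (sumC n * (C * (g * b)))
        le = sq-+-≤ {x zero * g + S} { - S} (subst (λ z → z * z ≤ g * b) a≡ aa≤gb)
               (subst (_≤ sumC n * (C * (g * b))) (l S) (sq-sum-≤ (λ i → x (suc i) * h i) xh≤))
          where
          l : ∀ s → s * s ≡ - s * - s
          l = solve-∀
        l1 : ∀ x g s → (x * g + s + - s) * (x * g + s + - s) ≡ g * (x * x * g)
        l1 = solve-∀
        l2 : ∀ g b s C → ℤ.+ 2 * (g * b) + ℤ.+ 2 * (s * (C * (g * b))) ≡ g * ((ℤ.+ 2 + ℤ.+ 2 * (s * C)) * b)
        l2 = solve-∀
        l3 : ∀ a b → a + b - b ≡ a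
        l3 = solve-∀

    reduced : Reduced F C′ W
    reduced x zero    = subst (λ z → x zero * x zero * z ≤ C′ * B′ x x) (sym g′≡g) (zero-bound x)
    reduced x (suc i) = suc-bound x i

transpose-suc : ∀ {n} (i : Fin n) → Perm.transpose zero (suc i) Perm.⟨$⟩ʳ (suc i) ≡ zero
transpose-suc i rewrite dec-true (i F.≟ i) refl = refl

module ReductionLoop {n : ℕ} (C : ℤ) (0≤C : 0ℤ ≤ C) (ih : ∀ F → Σ (Frame n) λ R → Reduced F C (Frame.P R)) where

  C′ : ℤ
  C′ = nextC n C

  R₂ : ∀ F → Frame n
  R₂ F = proj₁ (ih (Projection.projected F))

  module RS (F : Form (suc n)) = ReductionStep F (R₂ F) C 0≤C (proj₂ (ih (Projection.projected F)))

  module _ (F : Form (suc n)) where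
    open RS F hiding (C′)

    module Swap (i : Fin n) (q : Form.B sheared (e (suc i)) (e (suc i)) < Projection.g F) where

      σ : Perm.Permutation (suc n) (suc n)
      σ = Perm.transpose zero (suc i)

      F′ : Form (suc n)
      F′ = pullback sheared (permL σ) (left-inverse⇒inj (Frame.QP (permFrame σ)))

      σe0 : ap (permL σ) (e zero) ≗ e (suc i)
      σe0 j = trans (cong (λ z → ap (permL σ) (e z) j) (sym (transpose-suc i))) (permL-e σ (suc i) j)

      smaller : Projection.g F′ < Projection.g F
      smaller = subst (_< Projection.g F) (sym (Form.B-cong sheared σe0 σe0)) q

      less : ∀ {fuel} → ∣ Projection.g F ∣ ℕ.≤ suc fuel → ∣ Projection.g F′ ∣ ℕ.≤ fuel
      less p = ℕP.≤-pred (ℕP.<-≤-trans (ℤP.drop‿+<+ (subst₂ _<_ (sym (ℤP.0≤i⇒+∣i∣≡i (ℤP.<⇒≤ (Projection.0<g F′))))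
                                                          (sym (ℤP.0≤i⇒+∣i∣≡i (ℤP.<⇒≤ (Projection.0<g F)))) smaller)) p)

      transport : (Σ (Frame (suc n)) λ R → Reduced F′ C′ (Frame.P R)) → Σ (Frame (suc n)) λ R → Reduced F C′ (Frame.P R)
      transport (R , red) = shear ∘F permFrame σ ∘F R , red

  -- If some new basis vector is shorter than the first one, swap the two and start again.
  loop : ∀ fuel (F : Form (suc n)) → ∣ Projection.g F ∣ ℕ.≤ fuel → Σ (Frame (suc n)) λ R → Reduced F C′ (Frame.P R)
  loop zero F p = ⊥-elim (ℤP.<-irrefl (sym (ℤP.∣i∣≡0⇒i≡0 (ℕP.n≤0⇒n≡0 p))) (Projection.0<g F))
  loop (suc fuel) F p = go (FP.any? (λ i → Form.B (RS.sheared F) (e (suc i)) (e (suc i)) ℤP.<? Projection.g F))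
    where
    go : Dec (∃ λ i → Form.B (RS.sheared F) (e (suc i)) (e (suc i)) < Projection.g F) → Σ (Frame (suc n)) λ R → Reduced F C′ (Frame.P R)
    go (no ¬∃) = RS.shear F , RS.reduced F (λ i → ℤP.≮⇒≥ (λ q → ¬∃ (i , q)))
    go (yes (i , q)) = Swap.transport F i q (loop fuel (Swap.F′ F i q) (Swap.less F i q p))

opaque
  -- C depends on the rank alone. The form itself enters only through the fuel: the positive integer
  -- g drops with every swap, so its initial value bounds the number of rounds.
  reduceForm : ∀ n → Σ ℤ λ C → 0ℤ ≤ C × (∀ F → Σ (Frame n) λ R → Reduced F C (Frame.P R))
  reduceForm zero = 0ℤ , ℤP.≤-refl , λ F → idFrame , λ _ ()
  reduceForm (suc n) with reduceForm n
  ... | C , 0≤C , ih = nextC n C , 0≤nextC n 0≤C , λ F → ReductionLoop.loop C 0≤C ih ∣ Projection.g F ∣ F ℕP.≤-refl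

Sorted : ∀ {n} → (Fin n → ℤ) → Set
Sorted w = ∀ i j → toℕ i ℕ.≤ toℕ j → w i ≤ w j

argmin : ∀ {n} (w : Fin (suc n) → ℤ) → Σ (Fin (suc n)) λ i → ∀ j → w i ≤ w j
argmin {zero}  w = zero , λ { zero → ℤP.≤-refl }
argmin {suc n} w with argmin (λ i → w (suc i))
... | i , p with ℤP.≤-total (w zero) (w (suc i))
...   | inj₁ q = zero , λ { zero → ℤP.≤-refl ; (suc j) → ℤP.≤-trans q (p j) }
...   | inj₂ q = suc i , λ { zero → q ; (suc j) → p j }

sort : ∀ {n} (w : Fin n → ℤ) → Σ (Perm.Permutation n n) λ σ → Sorted (λ j → w (σ Perm.⟨$⟩ʳ j))
sort {zero}  w = Perm.id , λ ()
sort {suc n} w = Perm.lift₀ σ Perm.∘ₚ τ , sorted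
  where
  τ = Perm.transpose zero (proj₁ (argmin w))
  rest = sort (λ i → w (τ Perm.⟨$⟩ʳ (suc i)))
  σ = proj₁ rest
  sorted : Sorted (λ j → w ((Perm.lift₀ σ Perm.∘ₚ τ) Perm.⟨$⟩ʳ j))
  sorted zero    j       _         = proj₂ (argmin w) _
  sorted (suc i) (suc j) (ℕ.s≤s p) = proj₂ rest i j p

weight : ∀ {n} → Form n → Frame n → Fin n → ℤ
weight F R i = Form.B F (ap (Frame.P R) (e i)) (ap (Frame.P R) (e i))

reduceSorted : ∀ {n} C (F : Form n) (R : Frame n) → Reduced F C (Frame.P R) →
               Σ (Frame n) λ R′ → Reduced F C (Frame.P R′) × Sorted (weight F R′)
reduceSorted C F R red = R′ , red′ , λ i j p → subst₂ _≤_ (sym (w≡ i)) (sym (w≡ j)) (proj₂ s i j p)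
  where
  s = sort (weight F R)
  σ = proj₁ s
  R′ = R ∘F permFrame (Perm.flip σ)
  e↦ : ∀ j → ap (permL (Perm.flip σ)) (e j) ≗ e (σ Perm.⟨$⟩ʳ j)
  e↦ j i = trans (cong (λ z → ap (permL (Perm.flip σ)) (e z) i) (sym (Perm.inverseˡ σ))) (permL-e (Perm.flip σ) (σ Perm.⟨$⟩ʳ j) i)
  w≡ : ∀ j → weight F R′ j ≡ weight F R (σ Perm.⟨$⟩ʳ j)
  w≡ j = Form.B-cong F (congr (Frame.P R) (e↦ j)) (congr (Frame.P R) (e↦ j))
  red′ : Reduced F C (Frame.P R′)
  red′ x i = subst (_≤ C * Form.B F (ap (Frame.P R′) x) (ap (Frame.P R′) x))
    (cong₂ (λ a b → a * a * b) (cong x (Perm.inverseˡ σ)) (sym (w≡ i)))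
    (red (ap (permL (Perm.flip σ)) x) (σ Perm.⟨$⟩ʳ i))

-- Kernels of integer linear maps, by fraction-free elimination

KernelVector : ∀ {n m} → Lin n m → Set
KernelVector {n} f = Σ (V n) λ x → ¬ (x ≗ 0v) × ap f x ≗ 0v

module Pivot {n m : ℕ} (f : Lin (suc n) (suc m)) (a≢0 : ap f (e zero) zero ≢ 0ℤ) where

  a : ℤ
  a = ap f (e zero) zero

  -- Sends y to a y - f₀(y) e₀, with f₀ the first row of f and a its pivot. Over ℚ the image is the
  -- kernel of that row, so a kernel vector of the remaining rows composed with `h` is one of f.
  h : Lin n (suc n)
  h = consL (-L (headL ∘L f ∘L cons0)) (a ·L idL)

  h-comb : ∀ y → ap h y ≗ (-1ℤ * ap f (ap cons0 y) zero) ·v e zero +v a ·v ap cons0 y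
  h-comb y zero    = l (-1ℤ * ap f (ap cons0 y) zero) a
    where
    l : ∀ b a → b ≡ b * 1ℤ + a * 0ℤ
    l = solve-∀
  h-comb y (suc i) = l (-1ℤ * ap f (ap cons0 y) zero) (a * y i)
    where
    l : ∀ b c → c ≡ b * 0ℤ + c
    l = solve-∀

  f∘h-zero : ∀ y → ap f (ap h y) zero ≡ 0ℤ
  f∘h-zero y = begin
    ap f (ap h y) zero ≡⟨ congr f (h-comb y) zero ⟩
    ap f ((-1ℤ * φ) ·v e zero +v a ·v ap cons0 y) zero
      ≡⟨ trans (add f _ _ zero) (cong₂ _+_ (scal f (-1ℤ * φ) (e zero) zero) (scal f a (ap cons0 y) zero)) ⟩
    -1ℤ * φ * a + a * φ ≡⟨ l φ a ⟩
    0ℤ ∎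
    where
    φ = ap f (ap cons0 y) zero
    l : ∀ φ a → -1ℤ * φ * a + a * φ ≡ 0ℤ
    l = solve-∀

  g : Lin n m
  g = tail-L ∘L f ∘L h

  cancel-a : ∀ {z} → a * z ≡ 0ℤ → z ≡ 0ℤ
  cancel-a q with ℤP.i*j≡0⇒i≡0∨j≡0 a q
  ... | inj₁ p = ⊥-elim (a≢0 p)
  ... | inj₂ p = p

  from-g : KernelVector g → KernelVector f
  from-g (y , y≢0 , gy) = ap h y , (λ z → y≢0 (λ i → cancel-a (z (suc i)))) , λ { zero → f∘h-zero y ; (suc i) → gy i }

  to-g : (∀ y → ap g y ≗ 0v → y ≗ 0v) → ∀ x → ap f x ≗ 0v → x ≗ 0v
  to-g inj x fx = λ { zero → x0≡0 ; (suc i) → y≡0 i }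
    where
    y = ap tail-L x
    φ = ap f (ap cons0 y) zero
    fx0 : x zero * a + φ ≡ 0ℤ
    fx0 = trans (sym (trans (congr f (uncons x) zero) (trans (add f _ _ zero) (cong (_+ φ) (scal f (x zero) (e zero) zero))))) (fx zero)
    hy : ap h y ≗ a ·v x
    hy zero    = trans (l (x zero) a φ) (trans (cong (λ z → a * x zero + -1ℤ * z) fx0) (ℤP.+-identityʳ (a * x zero)))
      where
      l : ∀ x a φ → -1ℤ * φ ≡ a * x + -1ℤ * (x * a + φ)
      l = solve-∀
    hy (suc i) = refl
    y≡0 : y ≗ 0v
    y≡0 = inj y (λ i → trans (congr f hy (suc i)) (trans (scal f a x (suc i)) (trans (cong (a *_) (fx (suc i))) (ℤP.*-zeroʳ a))))
    x0≡0 : x zero ≡ 0ℤ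
    x0≡0 = cancel-a (trans (ℤP.*-comm a (x zero)) (trans (sym (ℤP.+-identityʳ (x zero * a)))
             (trans (cong (x zero * a +_) (sym (ap-≗0 (f ∘L cons0) y≡0 zero))) fx0)))

Injective-or-kernel : ∀ {n m} → Lin n m → Set
Injective-or-kernel {n} {m} f = KernelVector f ⊎ ((∀ x → ap f x ≗ 0v → x ≗ 0v) × n ℕ.≤ m)

module _ {n m : ℕ} (f : Lin n m) (R : Frame n) where

  unframe : Injective-or-kernel (f ∘L Frame.P R) → Injective-or-kernel f
  unframe (inj₁ (x , x≢0 , fx)) = inj₁ (ap (Frame.P R) x , (λ z → x≢0 (left-inverse⇒inj {P = Frame.P R} (Frame.QP R) x z)) , fx)
  unframe (inj₂ (inj , n≤m)) = inj₂ ((λ x fx → left-inverse⇒inj {P = Frame.Q R} {Frame.P R} (Frame.PQ R) x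
    (inj (ap (Frame.Q R) x) (λ i → trans (congr f (at (Frame.PQ R) x) i) (fx i)))) , n≤m)

-- Elimination of one row and at most one column at a time. The dichotomy serves twice:
-- `wide-kernel` extracts existence from n > m, and minimality of `m` at a matrix is decided by it.
kernel : ∀ m {n} (f : Lin n m) → Injective-or-kernel f
kernel zero    {zero}  f = inj₂ ((λ x _ ()) , ℕ.z≤n)
kernel zero    {suc n} f = inj₁ (e zero , (λ z → contradiction (z zero) (λ ())) , λ ())
kernel (suc m) {n} f with FP.any? (λ j → ¬? (ent f zero j ℤP.≟ 0ℤ))
kernel (suc m) {n} f | no none with kernel m (tail-L ∘L f)
... | inj₁ (x , x≢0 , fx) = inj₁ (x , x≢0 , λ { zero → row0 f none x ; (suc i) → fx i })
  where
  row0 : ∀ {n m} (f : Lin n (suc m)) → ¬ (∃ λ j → ¬ (ent f zero j ≡ 0ℤ)) → ∀ x → ap f x zero ≡ 0ℤ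
  row0 f none x = trans (expand f x zero) (sum-≡0 (λ j → trans (cong (x j *_) (decidable-stable (ent f zero j ℤP.≟ 0ℤ) (λ q → none (j , q)))) (ℤP.*-zeroʳ (x j))))
... | inj₂ (inj , n≤m) = inj₂ ((λ x fx → inj x (λ i → fx (suc i))) , ℕP.m≤n⇒m≤1+n n≤m)
kernel (suc m) {suc n} f | yes (j , a≢0) = unframe f R (finish (kernel m (Pivot.g f′ a′≢0)))
  where
  σ = Perm.transpose zero j
  R = permFrame (Perm.flip σ)
  f′ = f ∘L Frame.P R
  e↦ : ap (Frame.P R) (e zero) ≗ e j
  e↦ i = trans (cong (λ z → ap (permL (Perm.flip σ)) (e z) i) (sym (Perm.inverseˡ σ {zero}))) (permL-e (Perm.flip σ) j i)
  a′≢0 : ap f′ (e zero) zero ≢ 0ℤ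
  a′≢0 q = a≢0 (trans (sym (congr f e↦ zero)) q)
  finish : Injective-or-kernel (Pivot.g f′ a′≢0) → Injective-or-kernel f′
  finish (inj₁ y) = inj₁ (Pivot.from-g f′ a′≢0 y)
  finish (inj₂ (inj , n≤m)) = inj₂ (Pivot.to-g f′ a′≢0 inj , ℕ.s≤s n≤m)

wide-kernel : ∀ {n m} → m ℕ.< n → (f : Lin n m) → KernelVector f
wide-kernel {m = m} m<n f with kernel m f
... | inj₁ v          = v
... | inj₂ (_ , n≤m)  = ⊥-elim (ℕP.<⇒≱ m<n n≤m)

-- Weights, their comparison and their jumps

resL : ∀ {k r} → k ℕ.≤ r → Lin r k
ap    (resL p) x j   = x (F.inject≤ j p)
congr (resL p) q j   = q (F.inject≤ j p)
add   (resL p) _ _ _ = refl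
scal  (resL p) _ _ _ = refl

extL : ∀ {k r} → k ℕ.≤ r → Lin k r
extL {zero}          p           = 0L
extL {suc k} {suc r} (ℕ.s≤s p)   = consL headL (extL p ∘L tail-L)

ext-inj : ∀ {k r} (p : k ℕ.≤ r) x → ap (extL p) x ≗ 0v → x ≗ 0v
ext-inj {suc k} {suc r} (ℕ.s≤s p) x z zero    = z zero
ext-inj {suc k} {suc r} (ℕ.s≤s p) x z (suc i) = ext-inj p (ap tail-L x) (λ j → z (suc j)) i

ext-hi : ∀ {k r} (p : k ℕ.≤ r) x j → k ℕ.≤ toℕ j → ap (extL p) x j ≡ 0ℤ
ext-hi {zero}          p         x j       q         = refl
ext-hi {suc k} {suc r} (ℕ.s≤s p) x (suc j) (ℕ.s≤s q) = ext-hi p (ap tail-L x) j q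

-- The entry bound satisfied by a map between reduced bases whose vectors have squared lengths w in
-- the source and w′ in the target.
Weighted : ∀ {r} → ℤ → (w w′ : Fin r → ℤ) → Lin r r → Set
Weighted K w w′ P = ∀ i j → ent P i j * ent P i j * w′ i ≤ K * w j

-- A substitute for comparing successive minima. If w′ i exceeded K w i, then by sortedness all
-- entries in columns up to i and rows from i on would vanish; i + 1 columns would lie in a
-- sublattice of rank i, and P would have a kernel.
weight-compare : ∀ {r K} {w w′ : Fin r → ℤ} {P Q : Lin r r} → 0ℤ ≤ K → Sorted w → Sorted w′ → (∀ i → 0ℤ ≤ w′ i) →
                 Q ∘L P ≐ idL → Weighted K w w′ P → ∀ i → w′ i ≤ K * w i
weight-compare {r} {K} {w} {w′} {P} {Q} 0≤K sw sw′ 0≤w′ qp wb i with w′ i ℤP.≤? K * w i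
... | yes p = p
... | no ¬p = ⊥-elim (x≢0 (ext-inj i<r x (left-inverse⇒inj {P = P} {Q} qp (ap (extL i<r) x) Px≡0)))
  where
  i<r = FP.toℕ<n i
  i≤r = ℕP.<⇒≤ i<r
  kv = wide-kernel ℕP.≤-refl (resL i≤r ∘L P ∘L extL i<r)
  x = proj₁ kv
  x≢0 = proj₁ (proj₂ kv)
  entry≡0 : ∀ l j → toℕ j ℕ.≤ toℕ i → toℕ i ℕ.≤ toℕ l → ent P l j ≡ 0ℤ
  entry≡0 l j j≤i i≤l with ent P l j ℤP.≟ 0ℤ
  ... | yes q = q
  ... | no  q = ⊥-elim (ℤP.<⇒≱ (ℤP.≰⇒> ¬p) (ℤP.≤-trans (sw′ i l i≤l) (ℤP.≤-trans
                  (subst (_≤ ent P l j * ent P l j * w′ l) (ℤP.*-identityˡ (w′ l)) (mono-≤ʳ (0≤w′ l) (sq≢0 q)))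
                  (ℤP.≤-trans (wb l j) (mono-≤ 0≤K (sw j i j≤i))))))
  Px≡0 : ap P (ap (extL i<r) x) ≗ 0v
  Px≡0 l with toℕ l ℕ.<? toℕ i
  ... | yes l<i = subst (λ z → ap P (ap (extL i<r) x) z ≡ 0ℤ) (FP.toℕ-injective (trans (FP.toℕ-inject≤ _ i≤r) (FP.toℕ-fromℕ< l<i)))
                        (proj₂ (proj₂ kv) (F.fromℕ< l<i))
  ... | no  l≮i = trans (expand P (ap (extL i<r) x) l) (sum-≡0 term)
    where
    term : ∀ j → ap (extL i<r) x j * ent P l j ≡ 0ℤ
    term j with toℕ j ℕ.≤? toℕ i
    ... | yes j≤i = trans (cong (ap (extL i<r) x j *_) (entry≡0 l j j≤i (ℕP.≮⇒≥ l≮i))) (ℤP.*-zeroʳ (ap (extL i<r) x j))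
    ... | no  j≰i = cong (_* ent P l j) (ext-hi i<r x j (ℕP.≰⇒> j≰i))

maxOver : ∀ r → (Fin r → ℕ) → ℕ
maxOver zero    f = 0
maxOver (suc r) f = f zero ℕ.⊔ maxOver r (λ i → f (suc i))

≤maxOver : ∀ {r} (f : Fin r → ℕ) i → f i ℕ.≤ maxOver r f
≤maxOver f zero    = ℕP.m≤m⊔n (f zero) _
≤maxOver f (suc i) = ℕP.≤-trans (≤maxOver (λ i → f (suc i)) i) (ℕP.m≤n⊔m (f zero) _)

Cut : ∀ {r} → ℤ → (Fin r → ℤ) → ℕ → Set
Cut G w k = ∀ i j → toℕ i ℕ.< k → k ℕ.≤ toℕ j → G * w i < w j

ProperCut : ∀ {r} → ℤ → (Fin r → ℤ) → Set
ProperCut {r} G w = Σ ℕ λ k → 0 ℕ.< k × k ℕ.< r × Cut G w k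

pow : ℤ → ℕ → ℤ
pow G zero    = 1ℤ
pow G (suc r) = G * pow G r

1≤pow : ∀ {G} → 1ℤ ≤ G → ∀ r → 1ℤ ≤ pow G r
1≤pow 1≤G zero    = ℤP.≤-refl
1≤pow {G} 1≤G (suc r) = ℤP.≤-trans 1≤G (subst (_≤ G * pow G r) (ℤP.*-identityʳ G) (mono-≤ (ℤP.≤-trans (+≤+ ℕ.z≤n) 1≤G) (1≤pow 1≤G r)))

module _ {G : ℤ} (1≤G : 1ℤ ≤ G) where

  0≤G : 0ℤ ≤ G
  0≤G = ℤP.≤-trans (+≤+ ℕ.z≤n) 1≤G

  chain : ∀ r (w : Fin (suc r) → ℤ) → (∀ i → 0ℤ ≤ w i) → (∀ i → w (suc i) ≤ G * w (F.inject₁ i)) → ∀ j → w j ≤ pow G r * w zero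
  chain r       w 0≤w p zero    = subst (_≤ pow G r * w zero) (ℤP.*-identityˡ (w zero)) (mono-≤ʳ (0≤w zero) (1≤pow 1≤G r))
  chain (suc r) w 0≤w p (suc j) = ℤP.≤-trans (chain r (λ i → w (suc i)) (λ i → 0≤w (suc i)) (λ i → p (suc i)) j)
    (ℤP.≤-trans (mono-≤ (ℤP.≤-trans (+≤+ ℕ.z≤n) (1≤pow 1≤G r)) (p zero)) (ℤP.≤-reflexive (l (pow G r) G (w zero))))
    where
    l : ∀ p G w → p * (G * w) ≡ G * p * w
    l = solve-∀

  -- It suffices to inspect consecutive weights: by sortedness a jump between neighbours separates
  -- everything before from everything after, and without a jump at most r factors G accumulate.
  cut? : ∀ {r} (w : Fin r → ℤ) → (∀ i → 0ℤ ≤ w i) → Sorted w → ProperCut G w ⊎ (∀ i j → w j ≤ pow G r * w i)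
  cut? {zero}  w 0≤w s = inj₂ λ ()
  cut? {suc r} w 0≤w s with FP.any? (λ i → G * w (F.inject₁ i) ℤP.<? w (suc i))
  ... | yes (i , p) = inj₁ (suc (toℕ i) , ℕ.s≤s ℕ.z≤n , ℕ.s≤s (FP.toℕ<n i) , λ a b a<k k≤b →
        ℤP.≤-<-trans (mono-≤ 0≤G (s a (F.inject₁ i) (subst (toℕ a ℕ.≤_) (sym (FP.toℕ-inject₁ i)) (ℕP.≤-pred a<k)))) (ℤP.<-≤-trans p (s (suc i) b k≤b)))
  ... | no ¬p = inj₂ λ i j → ℤP.≤-trans (chain r w 0≤w (λ i → ℤP.≮⇒≥ (λ q → ¬p (i , q))) j)
        (ℤP.≤-trans (mono-≤ (ℤP.≤-trans (+≤+ ℕ.z≤n) (1≤pow 1≤G r)) (s zero i ℕ.z≤n))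
          (mono-≤ʳ (0≤w i) (subst (_≤ G * pow G r) (ℤP.*-identityˡ (pow G r)) (mono-≤ʳ (ℤP.≤-trans (+≤+ ℕ.z≤n) (1≤pow 1≤G r)) 1≤G))))

weighted-Bdd : ∀ {r K H} {w w′ : Fin r → ℤ} {P : Lin r r} → 0ℤ ≤ K → Weighted K w w′ P → (∀ i → 0ℤ < w′ i) → (∀ i j → w j ≤ H * w′ i) → Bdd ∣ K * H ∣ P
weighted-Bdd {K = K} {H} {w} {w′} {P} 0≤K wb pos ratio = bdd λ i j → ∣∣≤-sq {ent P i j} (K * H)
  (cancel-≤ (pos i) (subst₂ _≤_ (ℤP.*-comm (ent P i j * ent P i j) (w′ i)) (l K H (w′ i)) (ℤP.≤-trans (wb i j) (mono-≤ 0≤K (ratio i j)))))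
  where
  l : ∀ K H w → K * (H * w) ≡ w * (K * H)
  l = solve-∀

-- An entry below a cut would have square at least 1 and so violate the weight inequality.
weighted-Tri : ∀ {r K} {w w′ : Fin r → ℤ} {P : Lin r r} → (∀ i → 0ℤ ≤ w′ i) → Weighted K w w′ P →
               ∀ k → (∀ i j → toℕ j ℕ.< k → k ℕ.≤ toℕ i → K * w j < w′ i) → Tri {r} k P
weighted-Tri {w′ = w′} {P} 0≤w′ wb k c i j a b with ent P i j ℤP.≟ 0ℤ
... | yes q = q
... | no  q = ⊥-elim (ℤP.<⇒≱ (c i j a b) (ℤP.≤-trans (subst (_≤ ent P i j * ent P i j * w′ i) (ℤP.*-identityˡ (w′ i)) (mono-≤ʳ (0≤w′ i) (sq≢0 q))) (wb i j)))

-- Bounded standard forms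

module Standard (m : Poly) (S : Separable m) (K G : ℤ) (0≤K : 0ℤ ≤ K) (1≤G : 1ℤ ≤ G) (K≤G : K ≤ G) where
  open Parabolic m S

  -- U and its inverse respect every cut, so two standard forms over weights with a common cut still
  -- share the invariant sublattice. `trivial` states that nothing was changed unless there is a
  -- proper cut; this identifies the standard forms at the ends of the segment with the given
  -- matrices.
  record StdForm {r : ℕ} (N : ℕ) (w : Fin r → ℤ) (A : Lin r r) : Set where
    field
      A′ U U⁻¹ : Lin r r
      iso      : Iso A A′ U U⁻¹
      bounded  : Bdd N A′
      triU     : ∀ k → Cut G w k → Tri k U
      triU⁻¹   : ∀ k → Cut G w k → Tri k U⁻¹
      trivial  : ProperCut G w ⊎ (A′ ≐ A × U ≐ idL)

  record Hyps {r : ℕ} (w : Fin r → ℤ) (A : Lin r r) : Set where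
    field
      sorted : Sorted w
      pos    : ∀ i → 0ℤ < w i
      wb     : Weighted K w w A
      kills  : Kills m A

  Std : ℕ → ℕ → Set
  Std r N = ∀ (w : Fin r → ℤ) A → Hyps w A → StdForm N w A

  StdForm-mono : ∀ {r M N} {w : Fin r → ℤ} {A} → M ℕ.≤ N → StdForm M w A → StdForm N w A
  StdForm-mono p s = record { A′ = A′ ; U = U ; U⁻¹ = U⁻¹ ; iso = iso ; bounded = Bdd-mono p bounded ; triU = triU ; triU⁻¹ = triU⁻¹ ; trivial = trivial }
    where open StdForm s

  tri-A : ∀ {r} {w : Fin r → ℤ} {A} → Hyps w A → ∀ k → Cut G w k → Tri k A
  tri-A {w = w} {A} H k c = weighted-Tri {K = K} {w} {w} {A} (λ i → ℤP.<⇒≤ (pos i)) wb k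
    (λ i j a b → ℤP.≤-<-trans (mono-≤ʳ (ℤP.<⇒≤ (pos j)) K≤G) (c j i a b))
    where open Hyps H

  module SplitAt (k n : ℕ) (N₁ N₂ : ℕ) (std₁ : Std k N₁) (std₂ : Std n N₂) where

    N₃ = N₁ ℕ.⊔ N₂
    nrm = normalise k n N₃
    N₄ = N₃ ℕ.⊔ proj₁ nrm

    module _ (w : Fin (k ℕ.+ n) → ℤ) (A : Lin (k ℕ.+ n) (k ℕ.+ n)) (H : Hyps w A) (c : Cut G w k) (0<k : 0 ℕ.< k) (0<n : 0 ℕ.< n) where
      open Hyps H

      w₁ : Fin k → ℤ
      w₁ i = w (i ↑ˡ n)

      w₂ : Fin n → ℤ
      w₂ i = w (k ↑ʳ i)

      A₁ = topLeft {k} {n} A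
      X  = topRight {k} {n} A
      A₂ = botRight {k} {n} A

      A≐ : A ≐ blk A₁ X A₂
      A≐ = Tri⇒blk A (tri-A H k c)

      kills-blk : Kills m (blk A₁ X A₂)
      kills-blk = ≐-trans (evalL-cong m (≐-sym A≐)) kills

      H₁ : Hyps w₁ A₁
      H₁ = record
        { sorted = λ i j p → sorted (i ↑ˡ n) (j ↑ˡ n) (subst₂ ℕ._≤_ (sym (FP.toℕ-↑ˡ i n)) (sym (FP.toℕ-↑ˡ j n)) p)
        ; pos = λ i → pos (i ↑ˡ n)
        ; wb = λ i j → subst (λ z → z * z * w₁ i ≤ K * w₁ j) (sym (ent-topLeft A i j)) (wb (i ↑ˡ n) (j ↑ˡ n))
        ; kills = proj₁ (blk-kills kills-blk) }

      H₂ : Hyps w₂ A₂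
      H₂ = record
        { sorted = λ i j p → sorted (k ↑ʳ i) (k ↑ʳ j) (subst₂ ℕ._≤_ (sym (FP.toℕ-↑ʳ k i)) (sym (FP.toℕ-↑ʳ k j)) (ℕP.+-monoʳ-≤ k p))
        ; pos = λ i → pos (k ↑ʳ i)
        ; wb = λ i j → subst (λ z → z * z * w₂ i ≤ K * w₂ j) (sym (ent-botRight {k} A i j)) (wb (k ↑ʳ i) (k ↑ʳ j))
        ; kills = proj₂ (proj₂ (blk-kills kills-blk)) }

      s₁ = std₁ w₁ A₁ H₁
      s₂ = std₂ w₂ A₂ H₂
      open StdForm s₁ using () renaming (A′ to C₁; U to U₁; U⁻¹ to V₁; iso to I₁; bounded to b₁; triU to t₁; triU⁻¹ to t₁⁻¹)
      open StdForm s₂ using () renaming (A′ to C₂; U to U₂; U⁻¹ to V₂; iso to I₂; bounded to b₂; triU to t₂; triU⁻¹ to t₂⁻¹)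

      nf = proj₂ (proj₂ nrm) X I₁ I₂ (Bdd-mono (ℕP.m≤m⊔n N₁ N₂) b₁) (Bdd-mono (ℕP.m≤n⊔m N₁ N₂) b₂) kills-blk

      Y  = proj₁ nf
      X′ = proj₁ (proj₂ nf)

      cut-left : ∀ l → Cut G w l → Cut G w₁ l
      cut-left l d i j a b = d (i ↑ˡ n) (j ↑ˡ n) (subst (ℕ._< l) (sym (FP.toℕ-↑ˡ i n)) a) (subst (l ℕ.≤_) (sym (FP.toℕ-↑ˡ j n)) b)

      cut-right : ∀ l → Cut G w (k ℕ.+ l) → Cut G w₂ l
      cut-right l d i j a b = d (k ↑ʳ i) (k ↑ʳ j) (subst (ℕ._< k ℕ.+ l) (sym (FP.toℕ-↑ʳ k i)) (ℕP.+-monoʳ-< k a))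
                                (subst (k ℕ.+ l ℕ.≤_) (sym (FP.toℕ-↑ʳ k j)) (ℕP.+-monoʳ-≤ k b))

      tri-blk : ∀ (P : Lin k k) Z (Q : Lin n n) → (∀ l → Cut G w₁ l → Tri l P) → (∀ l → Cut G w₂ l → Tri l Q) →
                ∀ l → Cut G w l → Tri l (blk P Z Q)
      tri-blk P Z Q tP tQ l d with l ℕ.≤? k
      ... | yes l≤k = Tri-blk-lo P Z Q l≤k (tP l (cut-left l d))
      ... | no  l≰k = subst (λ z → Tri z (blk P Z Q)) l≡ (Tri-blk-hi P Z Q (tQ (l ℕ.∸ k) (cut-right (l ℕ.∸ k) (subst (Cut G w) (sym l≡) d))))
        where
        l≡ : k ℕ.+ (l ℕ.∸ k) ≡ l
        l≡ = ℕP.m+[n∸m]≡n (ℕP.<⇒≤ (ℕP.≰⇒> l≰k))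

      -- U has the block `Y ∘L U₂`, for which there is no bound. A′ is bounded all the same, because
      -- `normalise` bounds X′ through the standard forms of the two diagonal blocks alone.
      split-std : StdForm N₄ w A
      split-std = record
        { A′ = blk C₁ X′ C₂ ; U = blk U₁ (Y ∘L U₂) U₂ ; U⁻¹ = blk V₁ (-L (V₁ ∘L (Y ∘L U₂) ∘L V₂)) V₂
        ; iso = Iso-≐ (≐-sym A≐) ≐-refl (twist k n I₁ I₂ (proj₁ (proj₂ (proj₂ (proj₂ nf)))))
        ; bounded = Bdd-blk C₁ X′ C₂ (Bdd-mono (ℕP.≤-trans (ℕP.m≤m⊔n N₁ N₂) (ℕP.m≤m⊔n N₃ _)) b₁) (Bdd-mono (ℕP.m≤n⊔m N₃ _) (proj₁ (proj₂ (proj₂ nf))))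
                                     (Bdd-mono (ℕP.≤-trans (ℕP.m≤n⊔m N₁ N₂) (ℕP.m≤m⊔n N₃ _)) b₂)
        ; triU = tri-blk U₁ (Y ∘L U₂) U₂ t₁ t₂
        ; triU⁻¹ = tri-blk V₁ (-L (V₁ ∘L (Y ∘L U₂) ∘L V₂)) V₂ t₁⁻¹ t₂⁻¹
        ; trivial = inj₁ (k , 0<k , subst (ℕ._< k ℕ.+ n) (ℕP.+-identityʳ k) (ℕP.+-monoʳ-< k 0<n) , c) }

  StdAt : ℕ → ℕ → ℕ → Set
  StdAt r k N = ∀ (w : Fin r → ℤ) A → Hyps w A → Cut G w k → 0 ℕ.< k → k ℕ.< r → StdForm N w A

  stdAt : ∀ r k → k ℕ.< r → 0 ℕ.< k → (∀ {s} → s ℕ.< r → Σ ℕ (Std s)) → Σ ℕ (StdAt r k)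
  stdAt r k k<r 0<k ih = subst (λ r → Σ ℕ (StdAt r k)) (ℕP.m+[n∸m]≡n (ℕP.<⇒≤ k<r))
      (SplitAt.N₄ k n N₁ N₂ std₁ std₂ , λ w A H c 0<k _ → SplitAt.split-std k n N₁ N₂ std₁ std₂ w A H c 0<k (ℕP.m<n⇒0<n∸m k<r))
    where
    n = r ℕ.∸ k
    N₁ = proj₁ (ih k<r)
    std₁ = proj₂ (ih k<r)
    n<r : n ℕ.< r
    n<r = ℕP.∸-monoʳ-< 0<k (ℕP.<⇒≤ k<r)
    N₂ = proj₁ (ih n<r)
    std₂ = proj₂ (ih n<r)

  std-step : ∀ r → (∀ {s} → s ℕ.< r → Σ ℕ (Std s)) → Σ ℕ (Std r)
  std-step r ih = N , λ w A H → build w A H (cut? 1≤G w (λ i → ℤP.<⇒≤ (Hyps.pos H i)) (Hyps.sorted H))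
    where
    at-cut : (k : Fin r) → Dec (0 ℕ.< toℕ k) → Σ ℕ λ N → 0 ℕ.< toℕ k → StdAt r (toℕ k) N
    at-cut k (yes 0<k) = let N , s = stdAt r (toℕ k) (FP.toℕ<n k) 0<k ih in N , λ _ → s
    -- Position 0 is not a proper cut; the bound 0 is a dummy that does not change the maximum.
    at-cut k (no  0≮k) = 0 , λ 0<k → ⊥-elim (0≮k 0<k)
    Nₖ : Fin r → ℕ
    Nₖ k = proj₁ (at-cut k (0 ℕ.<? toℕ k))
    N₀ = ∣ K * pow G r ∣
    N = N₀ ℕ.⊔ maxOver r Nₖ
    build : ∀ w A → Hyps w A → ProperCut G w ⊎ (∀ i j → w j ≤ pow G r * w i) → StdForm N w A
    build w A H (inj₂ ratio) = record
      { A′ = A ; U = idL ; U⁻¹ = idL ; iso = Iso-id ≐-refl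
      ; bounded = Bdd-mono (ℕP.m≤m⊔n N₀ _) (weighted-Bdd {w = w} {w} 0≤K (Hyps.wb H) (Hyps.pos H) ratio)
      ; triU = λ k _ → Tri-id k ; triU⁻¹ = λ k _ → Tri-id k ; trivial = inj₂ (≐-refl , ≐-refl) }
    build w A H (inj₁ (k , 0<k , k<r , c)) = StdForm-mono (ℕP.≤-trans (≤maxOver Nₖ κ) (ℕP.m≤n⊔m N₀ _))
        (proj₂ (at-cut κ (0 ℕ.<? toℕ κ)) (subst (0 ℕ.<_) (sym κ≡) 0<k) w A H (subst (Cut G w) (sym κ≡) c) (subst (0 ℕ.<_) (sym κ≡) 0<k) (FP.toℕ<n κ))
      where
      κ = F.fromℕ< k<r
      κ≡ : toℕ κ ≡ k
      κ≡ = FP.toℕ-fromℕ< k<r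

  opaque
    standard : ∀ r → Σ ℕ (Std r)
    standard = <-rec (λ r → Σ ℕ (Std r)) std-step

-- The Euclidean form and operator norms

dot : ∀ {n} → V n → V n → ℤ
dot {n} x y = sumℤ n (λ i → x i * y i)

sum-mono : ∀ {n} {f g : Fin n → ℤ} → (∀ i → f i ≤ g i) → sumℤ n f ≤ sumℤ n g
sum-mono {zero}  p = ℤP.≤-refl
sum-mono {suc n} p = ℤP.+-mono-≤ (p zero) (sum-mono (λ i → p (suc i)))

0≤sum : ∀ {n} {f : Fin n → ℤ} → (∀ i → 0ℤ ≤ f i) → 0ℤ ≤ sumℤ n f
0≤sum {n} {f} p = subst (_≤ sumℤ n f) (sum-0 n) (sum-mono p)

0≤dot : ∀ {n} (x : V n) → 0ℤ ≤ dot x x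
0≤dot x = 0≤sum (λ i → 0≤sq (x i))

term≤sum : ∀ {n} {f : Fin n → ℤ} → (∀ i → 0ℤ ≤ f i) → ∀ i → f i ≤ sumℤ n f
term≤sum {suc n} {f} p zero    = ≤-by (sumℤ n (λ i → f (suc i))) (0≤sum (λ i → p (suc i))) (l (f zero) (sumℤ n (λ i → f (suc i))))
  where
  l : ∀ a b → a + b - a ≡ b
  l = solve-∀
term≤sum {suc n} {f} p (suc i) = ℤP.≤-trans (term≤sum (λ i → p (suc i)) i) (≤-by (f zero) (p zero) (l (f zero) (sumℤ n (λ i → f (suc i)))))
  where
  l : ∀ a b → a + b - b ≡ a
  l = solve-∀

sq≤dot : ∀ {n} (x : V n) i → x i * x i ≤ dot x x
sq≤dot x i = term≤sum (λ i → 0≤sq (x i)) i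

sum-const : ∀ n c → sumℤ n (λ _ → c) ≡ ℤ.+ n * c
sum-const zero    c = refl
sum-const (suc n) c = trans (cong (c +_) (sum-const n c)) (l (ℤ.+ n) c)
  where
  l : ∀ n c → c + n * c ≡ (1ℤ + n) * c
  l = solve-∀

dot≤ : ∀ {n} (x : V n) M → (∀ i → x i * x i ≤ M) → dot x x ≤ ℤ.+ n * M
dot≤ {n} x M p = ℤP.≤-trans (sum-mono p) (ℤP.≤-reflexive (sum-const n M))

dot-cong : ∀ {n} {x x′ y y′ : V n} → x ≗ x′ → y ≗ y′ → dot x y ≡ dot x′ y′
dot-cong p q = sum-cong (λ i → cong₂ _*_ (p i) (q i))

dotForm : ∀ {n} → Form n
dotForm {n} = record
  { B = dot
  ; B-cong = dot-cong
  ; B-sym = λ x y → sum-cong (λ i → ℤP.*-comm (x i) (y i))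
  ; B-add = λ x x′ y → trans (sum-cong (λ i → ℤP.*-distribʳ-+ (y i) (x i) (x′ i))) (sum-+ (λ i → x i * y i) (λ i → x′ i * y i))
  ; B-scal = λ c x y → trans (sum-cong (λ i → ℤP.*-assoc c (x i) (y i))) (sum-* c (λ i → x i * y i))
  ; B-pos = λ x ¬z → ℤP.≰⇒> (λ p → ¬z (λ i → sq≡0 (≤0⇒≡0 (0≤sq (x i)) (ℤP.≤-trans (sq≤dot x i) p)))) }

combForm : ∀ {n k} (F : Form n) (G : Form k) (f : Lin n k) (a b : ℤ) →
           (∀ x → ¬ (x ≗ 0v) → 0ℤ < a * Form.B F x x + b * Form.B G (ap f x) (ap f x)) → Form n
combForm F G f a b pos = record
  { B = λ x y → a * BF.B x y + b * BG.B (ap f x) (ap f y)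
  ; B-cong = λ p q → cong₂ (λ s t → a * s + b * t) (BF.B-cong p q) (BG.B-cong (congr f p) (congr f q))
  ; B-sym = λ x y → cong₂ (λ s t → a * s + b * t) (BF.B-sym x y) (BG.B-sym (ap f x) (ap f y))
  ; B-add = λ x x′ y → trans (cong₂ (λ s t → a * s + b * t) (BF.B-add x x′ y) (trans (BG.B-cong (add f x x′) (λ _ → refl)) (BG.B-add (ap f x) (ap f x′) (ap f y))))
      (l1 a b (BF.B x y) (BF.B x′ y) (BG.B (ap f x) (ap f y)) (BG.B (ap f x′) (ap f y)))
  ; B-scal = λ c x y → trans (cong₂ (λ s t → a * s + b * t) (BF.B-scal c x y) (trans (BG.B-cong (scal f c x) (λ _ → refl)) (BG.B-scal c (ap f x) (ap f y))))
      (l2 a b c (BF.B x y) (BG.B (ap f x) (ap f y)))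
  ; B-pos = pos }
  where
  module BF = Form F
  module BG = Form G
  l1 : ∀ a b s s′ t t′ → a * (s + s′) + b * (t + t′) ≡ (a * s + b * t) + (a * s′ + b * t′)
  l1 = solve-∀
  l2 : ∀ a b c s t → a * (c * s) + b * (c * t) ≡ c * (a * s + b * t)
  l2 = solve-∀

0<+ : ∀ {a b} → 0ℤ < a → 0ℤ ≤ b → 0ℤ < a + b
0<+ {a} {b} p q = subst (_< a + b) (ℤP.+-identityʳ 0ℤ) (ℤP.+-mono-<-≤ p q)

0<* : ∀ {a b} → 0ℤ < a → 0ℤ < b → 0ℤ < a * b
0<* {ℤ.+ suc a} {ℤ.+ suc b} _ _ = +<+ (ℕ.s≤s ℕ.z≤n)
0<* {ℤ.+ zero}  (+<+ ()) _
0<* {ℤ.+ suc a} {ℤ.+ zero} _ (+<+ ())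

-- A squared operator norm: each of the r coordinates of the image has square at most (sumC r) N²
-- |x|².
opC : ℕ → ℕ → ℤ
opC r N = ℤ.+ r * (sumC r * (ℤ.+ N * ℤ.+ N))

sq≤N² : ∀ a N → ∣ a ∣ ℕ.≤ N → a * a ≤ ℤ.+ N * ℤ.+ N
sq≤N² a N p = subst₂ _≤_ (l a) (ℤP.pos-* N N) (+≤+ (ℕP.*-mono-≤ p p))
  where
  l : ∀ a → ℤ.+ (∣ a ∣ ℕ.* ∣ a ∣) ≡ a * a
  l (ℤ.+ zero)  = refl
  l (ℤ.+ suc n) = refl
  l -[1+ n ]    = refl

op-norm : ∀ {r N} (f : Lin r r) → Bdd N f → ∀ x → dot (ap f x) (ap f x) ≤ opC r N * dot x x
op-norm {r} {N} f b x = ℤP.≤-trans (dot≤ (ap f x) (sumC r * (ℤ.+ N * ℤ.+ N * dot x x)) (λ i →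
    subst (λ z → z * z ≤ sumC r * (ℤ.+ N * ℤ.+ N * dot x x)) (sym (expand f x i)) (sq-sum-≤ (λ j → x j * ent f i j) (λ j → term i j))))
    (ℤP.≤-reflexive (l (ℤ.+ r) (sumC r) (ℤ.+ N * ℤ.+ N) (dot x x)))
  where
  term : ∀ i j → (x j * ent f i j) * (x j * ent f i j) ≤ ℤ.+ N * ℤ.+ N * dot x x
  term i j = subst (_≤ ℤ.+ N * ℤ.+ N * dot x x) (l2 (x j) (ent f i j))
    (ℤP.≤-trans (mono-≤ʳ (0≤sq (x j)) (sq≤N² (ent f i j) N (bound b i j))) (mono-≤ (0≤sq (ℤ.+ N)) (sq≤dot x j)))
    where
    l2 : ∀ x a → a * a * (x * x) ≡ (x * a) * (x * a)
    l2 = solve-∀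
  l : ∀ r s n d → r * (s * (n * d)) ≡ r * (s * n) * d
  l = solve-∀

0≤opC : ∀ r N → 0ℤ ≤ opC r N
0≤opC r N = 0≤* {ℤ.+ r} (+≤+ ℕ.z≤n) (0≤* (0≤sumC r) (0≤sq (ℤ.+ N)))

maxEntry : ∀ {n r} → Lin n r → ℕ
maxEntry {n} {r} f = maxOver r (λ i → maxOver n (λ j → ∣ ent f i j ∣))

maxEntry-Bdd : ∀ {n r} (f : Lin n r) → Bdd (maxEntry f) f
maxEntry-Bdd {n} f = bdd λ i j → ℕP.≤-trans (≤maxOver (λ j → ∣ ent f i j ∣) j) (≤maxOver (λ i → maxOver n (λ j → ∣ ent f i j ∣)) i)

-- The inequality (a + b)² ≤ 2a² + 2b² carried along Horner's scheme: `evC p` times a common bound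
-- for the squared coordinates of the Aⁱy bounds those of p(A)y.
evC : Poly → ℤ
evC []      = 0ℤ
evC (c ∷ p) = ℤ.+ 2 * (c * c) + ℤ.+ 2 * evC p

0≤evC : ∀ p → 0ℤ ≤ evC p
0≤evC []      = ℤP.≤-refl
0≤evC (a ∷ p) = 0≤+ (0≤* {ℤ.+ 2} (+≤+ ℕ.z≤n) (0≤sq a)) (0≤* {ℤ.+ 2} (+≤+ ℕ.z≤n) (0≤evC p))

-- The form Σ_{i ≤ D} |Aⁱ x|², for which A has norm bounded in terms of m only

module Krylov {r : ℕ} (A : Lin r r) where

  powL : ℕ → Lin r r
  powL zero    = idL
  powL (suc i) = powL i ∘L A

  krylov : ℕ → Form r
  krylov zero    = dotForm
  krylov (suc D) = combForm dotForm (krylov D) A 1ℤ 1ℤ (λ x ¬z → 0<+ (0<* {1ℤ} (+<+ (ℕ.s≤s ℕ.z≤n)) (Form.B-pos dotForm x ¬z))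
                                                              (0≤* {1ℤ} (+≤+ ℕ.z≤n) (Form.B-nonneg (krylov D) (ap A x))))

  q : ℕ → V r → ℤ
  q D x = Form.B (krylov D) x x

  N² : V r → ℤ
  N² x = dot x x

  q-suc : ∀ D x → q (suc D) x ≡ N² x + q D (ap A x)
  q-suc D x = cong₂ _+_ (ℤP.*-identityˡ (N² x)) (ℤP.*-identityˡ (q D (ap A x)))

  telescope : ∀ D y → q D y + N² (ap (powL (suc D)) y) ≡ N² y + q D (ap A y)
  telescope zero    y = refl
  telescope (suc D) y = begin
    q (suc D) y + t                                       ≡⟨ cong (_+ t) (q-suc D y) ⟩
    N² y + q D (ap A y) + t                               ≡⟨ ℤP.+-assoc (N² y) (q D (ap A y)) t ⟩
    N² y + (q D (ap A y) + t)                             ≡⟨ cong (N² y +_) (telescope D (ap A y)) ⟩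
    N² y + (N² (ap A y) + q D (ap A (ap A y)))            ≡⟨ cong (N² y +_) (q-suc D (ap A y)) ⟨
    N² y + q (suc D) (ap A y)                             ∎
    where t = N² (ap (powL (suc (suc D))) y)

  q-term : ∀ {i D} → i ℕ.≤ D → ∀ x → N² (ap (powL i) x) ≤ q D x
  q-term {zero}  {zero}  _ x = ℤP.≤-refl
  q-term {zero}  {suc D} _ x = subst (N² x ≤_) (sym (q-suc D x)) (≤-by (q D (ap A x)) (Form.B-nonneg (krylov D) (ap A x)) (l (N² x) (q D (ap A x))))
    where
    l : ∀ a b → a + b - a ≡ b
    l = solve-∀
  q-term {suc i} {suc D} (ℕ.s≤s p) x = ℤP.≤-trans (q-term p (ap A x)) (subst (q D (ap A x) ≤_) (sym (q-suc D x)) (≤-by (N² x) (0≤dot x) (l (N² x) (q D (ap A x)))))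
    where
    l : ∀ a b → a + b - b ≡ a
    l = solve-∀

  eval-≤ : ∀ p y M → (∀ i → i ℕ.< L.length p → ∀ l → ap (powL i) y l * ap (powL i) y l ≤ M) →
           ∀ l → ap (evalL p A) y l * ap (evalL p A) y l ≤ evC p * M
  eval-≤ []      y M h l = ℤP.≤-refl
  eval-≤ (c ∷ p) y M h l = subst₂ (λ z t → z * z ≤ t) (cong (c * y l +_) (sym (at (evalL-comm p A) y l))) (l2 (c * c) (evC p) M)
    (sq-+-≤ {c * y l} (subst (_≤ c * c * M) (l1 c (y l)) (mono-≤ (0≤sq c) (h 0 (ℕ.s≤s ℕ.z≤n) l)))
            (eval-≤ p (ap A y) M (λ i q → h (suc i) (ℕ.s≤s q)) l))
    where
    l1 : ∀ c y → c * c * (y * y) ≡ (c * y) * (c * y)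
    l1 = solve-∀
    l2 : ∀ c e M → ℤ.+ 2 * (c * M) + ℤ.+ 2 * (e * M) ≡ (ℤ.+ 2 * c + ℤ.+ 2 * e) * M
    l2 = solve-∀

  eval-monic : ∀ p y l → ap (evalL (p ++ 1ℤ ∷ []) A) y l ≡ ap (evalL p A) y l + ap (powL (L.length p)) y l
  eval-monic [] y l = trans (cong (1ℤ * y l +_) (ap-0 A l)) (trans (ℤP.+-identityʳ (1ℤ * y l)) (trans (ℤP.*-identityˡ (y l)) (sym (ℤP.+-identityˡ (y l)))))
  eval-monic (c ∷ p) y l = begin
    c * y l + ap A (ap (evalL (p ++ 1ℤ ∷ []) A) y) l                    ≡⟨ cong (c * y l +_) (at (evalL-comm (p ++ 1ℤ ∷ []) A) y l) ⟩
    c * y l + ap (evalL (p ++ 1ℤ ∷ []) A) (ap A y) l                    ≡⟨ cong (c * y l +_) (eval-monic p (ap A y) l) ⟩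
    c * y l + (ap (evalL p A) (ap A y) l + ap (powL (L.length p)) (ap A y) l)
      ≡⟨ ℤP.+-assoc (c * y l) (ap (evalL p A) (ap A y) l) (ap (powL (L.length p)) (ap A y) l) ⟨
    c * y l + ap (evalL p A) (ap A y) l + ap (powL (L.length p)) (ap A y) l
      ≡⟨ cong (λ z → c * y l + z + ap (powL (L.length p)) (ap A y) l) (at (evalL-comm p A) y l) ⟨
    ap (evalL (c ∷ p) A) y l + ap (powL (L.length (c ∷ p))) y l ∎

  -- Telescoping gives q(Ax) = q(x) - |x|² + |A^(D+1) x|² with D the length of p. As p + X^D kills
  -- A, the last vector is -p(A)Ax, a combination of the Aⁱx with 1 ≤ i ≤ D, each of which is
  -- bounded by q(x).
  compatible : ∀ p → Kills (p ++ 1ℤ ∷ []) A → ∀ x → q (L.length p) (ap A x) ≤ (1ℤ + ℤ.+ r * evC p) * q (L.length p) x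
  compatible p z x = ≤-by (((ℤ.+ r * (evC p * q D x)) - t) + N² x) (0≤+ (≤⇒0≤ top) (0≤dot x))
      (trans (cong (λ w → (1ℤ + ℤ.+ r * evC p) * q D x - w) qA) (l (ℤ.+ r) (evC p) (q D x) t (N² x)))
    where
    D = L.length p
    t = N² (ap (powL (suc D)) x)
    qA : q D (ap A x) ≡ q D x + t - N² x
    qA = trans (l1 (N² x) (q D (ap A x))) (cong (_- N² x) (sym (telescope D x)))
      where
      l1 : ∀ a b → b ≡ a + b - a
      l1 = solve-∀
    l : ∀ r e q t n → (1ℤ + r * e) * q - (q + t - n) ≡ (r * (e * q) - t) + n
    l = solve-∀
    top : t ≤ ℤ.+ r * (evC p * q D x)
    top = dot≤ (ap (powL (suc D)) x) (evC p * q D x) (λ l → subst (_≤ evC p * q D x) (square l)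
            (eval-≤ p (ap A x) (q D x) (λ i i<D l → ℤP.≤-trans (sq≤dot (ap (powL (suc i)) x) l) (q-term i<D x)) l))
      where
      square : ∀ l → ap (evalL p A) (ap A x) l * ap (evalL p A) (ap A x) l ≡ ap (powL (suc D)) x l * ap (powL (suc D)) x l
      square l = negate (ap (evalL p A) (ap A x) l) (ap (powL (suc D)) x l) (trans (sym (eval-monic p (ap A x) l)) (at z (ap A x) l))
        where
        negate : ∀ a b → a + b ≡ 0ℤ → a * a ≡ b * b
        negate a b s = trans (l2 a b) (trans (cong (λ w → b * b + (a - b) * w) s) (trans (cong (b * b +_) (ℤP.*-zeroʳ (a - b))) (ℤP.+-identityʳ (b * b))))
          where
          l2 : ∀ a b → a * a ≡ b * b + (a - b) * (a + b)
          l2 = solve-∀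

-- Forms compatible with A and their reduced bases

module Nodes {r : ℕ} (A : Lin r r) (C c : ℤ) (0≤C : 0ℤ ≤ C) where

  record Node : Set where
    no-eta-equality
    field
      form     : Form r
      frame    : Frame r
      reduced  : Reduced form C (Frame.P frame)
      sortedW  : Sorted (weight form frame)
      compat   : ∀ x → Form.B form (ap A x) (ap A x) ≤ c * Form.B form x x
    open Frame frame public

    w : Fin r → ℤ
    w = weight form frame

    A∘ : Lin r r
    A∘ = Q ∘L A ∘L P

    w-pos : ∀ i → 0ℤ < w i
    w-pos i = Form.B-pos form (ap P (e i)) (λ z → contradiction (trans (sym (e-≡ i)) (left-inverse⇒inj {P = P} {Q} QP (e i) z i)) (λ ()))

    coords : ∀ x i → ap Q x i * ap Q x i * w i ≤ C * Form.B form x x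
    coords x i = subst (λ z → ap Q x i * ap Q x i * w i ≤ C * z) (Form.B-cong form (at PQ x) (at PQ x)) (reduced (ap Q x) i)

    -- Reducedness is applied to the image under A of the j-th basis vector: its i-th coordinate is
    -- the matrix entry, and `compat` bounds its length.
    weighted-A : Weighted (C * c) w w A∘
    weighted-A i j = ℤP.≤-trans (coords (ap A (ap P (e j))) i)
      (subst (C * Form.B form (ap A (ap P (e j))) (ap A (ap P (e j))) ≤_) (sym (ℤP.*-assoc C c (w j))) (mono-≤ 0≤C (compat (ap P (e j)))))

    isoA : Iso A A∘ Q P
    isoA = record { PQ≐id = QP ; QP≐id = PQ ; tw = eq λ x i → congr (Q ∘L A) (λ j → sym (at PQ x j)) i }
  open Node

  transition : (n n′ : Node) → Lin r r
  transition n n′ = Q n′ ∘L P n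

  weighted-transition : ∀ n n′ b → (∀ x → Form.B (form n′) x x ≤ b * Form.B (form n) x x) → Weighted (C * b) (w n) (w n′) (transition n n′)
  weighted-transition n n′ b h i j = ℤP.≤-trans (coords n′ (ap (P n) (e j)) i)
    (subst (C * Form.B (form n′) (ap (P n) (e j)) (ap (P n) (e j)) ≤_) (sym (ℤP.*-assoc C b (w n j))) (mono-≤ 0≤C (h (ap (P n) (e j)))))

  iso-transition : ∀ n n′ → Iso (A∘ n) (A∘ n′) (transition n n′) (transition n′ n)
  iso-transition n n′ = record
    { PQ≐id = eq λ x i → trans (congr (Q n′) (at (PQ n) (ap (P n′) x)) i) (at (QP n′) x i)
    ; QP≐id = eq λ x i → trans (congr (Q n) (at (PQ n′) (ap (P n) x)) i) (at (QP n) x i)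
    ; tw = eq λ x i → trans (congr (Q n′) (at (PQ n) (ap A (ap (P n) x))) i)
             (congr (Q n′ ∘L A) (λ j → sym (at (PQ n′) (ap (P n) x) j)) i) }

Weighted-mono : ∀ {r K K′} {w w′ : Fin r → ℤ} {P : Lin r r} → K ≤ K′ → (∀ i → 0ℤ ≤ w i) → Weighted K w w′ P → Weighted K′ w w′ P
Weighted-mono K≤ 0≤w wb i j = ℤP.≤-trans (wb i j) (mono-≤ʳ (0≤w j) K≤)

-- Finitely many classes

module Finiteness (p : Poly) (S : Separable (p ++ 1ℤ ∷ [])) (r : ℕ) where

  m = p ++ 1ℤ ∷ []

  C = proj₁ (reduceForm r)
  0≤C = proj₁ (proj₂ (reduceForm r))

  c : ℤ
  c = 1ℤ + ℤ.+ r * evC p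

  -- C c is the weight constant of A in a reduced basis; the summand 1 ensures K ≥ 1. The same K is
  -- used as threshold for the cuts.
  K : ℤ
  K = C * c + 1ℤ

  0≤Cc : 0ℤ ≤ C * c
  0≤Cc = 0≤* 0≤C (0≤+ {1ℤ} (+≤+ ℕ.z≤n) (0≤* {ℤ.+ r} (+≤+ ℕ.z≤n) (0≤evC p)))

  1≤K : 1ℤ ≤ K
  1≤K = ℤP.+-monoˡ-≤ 1ℤ 0≤Cc

  module Std = Standard m S K K (ℤP.≤-trans (+≤+ ℕ.z≤n) 1≤K) 1≤K ℤP.≤-refl

  N₀ : ℕ
  N₀ = proj₁ (Std.standard r)

  finiteness : ∀ (A : Lin r r) → Kills m A → Σ (Lin r r) λ A′ → Σ (Lin r r) λ P → Σ (Lin r r) λ Q → Bdd N₀ A′ × Iso A A′ P Q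
  finiteness A z = A′ , U ∘L Q node , P node ∘L U⁻¹ , bounded , Iso-trans (isoA node) iso
    where
    open Nodes A C c 0≤C
    open Node
    F = Krylov.krylov A (L.length p)
    R = proj₂ (proj₂ (reduceForm r)) F
    R′ = reduceSorted C F (proj₁ R) (proj₂ R)
    node : Node
    node = record { form = F ; frame = proj₁ R′ ; reduced = proj₁ (proj₂ R′) ; sortedW = proj₂ (proj₂ R′)
      ; compat = Krylov.compatible A p z }
    hyps : Std.Hyps (w node) (A∘ node)
    hyps = record { sorted = sortedW node ; pos = w-pos node
      ; wb = Weighted-mono {K = C * c} {K} {w node} {w node} {A∘ node} (≤-by 1ℤ (+≤+ ℕ.z≤n) (l (C * c))) (λ i → ℤP.<⇒≤ (w-pos node i)) (weighted-A node)
      ; kills = Kills-Iso m (isoA node) z }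
      where
      l : ∀ a → a + 1ℤ - a ≡ 1ℤ
      l = solve-∀
    open Std.StdForm (proj₂ (Std.standard r) (w node) (A∘ node) hyps)

-- Passing between neighbouring forms

module Generation (m : Poly) (S : Separable m) where
  open Parabolic m S
  open ParabolicLemma m S

  ParAt : ℕ → ℕ → ℕ → ℕ → Set
  ParAt r N k N′ = ∀ (A B P Q : Lin r r) → Bdd N A → Bdd N B → Kills m A → Iso A B P Q →
                   Tri k A → Tri k B → Tri k P → Tri k Q → Gen N′ A B P

  parAt : ∀ r N k → k ℕ.< r → 0 ℕ.< k → (∀ {s} → s ℕ.< r → FG s) → Σ ℕ (ParAt r N k)
  parAt r N k k<r 0<k ih = subst (λ r → Σ ℕ (ParAt r N k)) (ℕP.m+[n∸m]≡n (ℕP.<⇒≤ k<r))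
      (ParabolicIso.N′ k n N fgₖ fgₙ , ParabolicIso.parabolic k n N fgₖ fgₙ)
    where
    n = r ℕ.∸ k
    fgₖ : FG k
    fgₖ = ih k<r
    fgₙ : FG n
    fgₙ = ih (ℕP.∸-monoʳ-< 0<k (ℕP.<⇒≤ k<r))

  parAll : ∀ r N → (∀ {s} → s ℕ.< r → FG s) → Σ ℕ λ N′ → ∀ k → 0 ℕ.< k → k ℕ.< r → ParAt r N k N′
  parAll r N ih = maxOver r Nₖ , λ k 0<k k<r A B P Q bA bB z I tA tB tP tQ →
      let κ = F.fromℕ< k<r
          κ≡ = FP.toℕ-fromℕ< k<r
      in Gen-mono (≤maxOver Nₖ κ) (proj₂ (at-cut κ (0 ℕ.<? toℕ κ)) (subst (0 ℕ.<_) (sym κ≡) 0<k) A B P Q bA bB z I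
           (subst (λ k → Tri k A) (sym κ≡) tA) (subst (λ k → Tri k B) (sym κ≡) tB) (subst (λ k → Tri k P) (sym κ≡) tP) (subst (λ k → Tri k Q) (sym κ≡) tQ))
    where
    at-cut : (k : Fin r) → Dec (0 ℕ.< toℕ k) → Σ ℕ λ N′ → 0 ℕ.< toℕ k → ParAt r N (toℕ k) N′
    at-cut k (yes 0<k) = let N , s = parAt r N (toℕ k) (FP.toℕ<n k) 0<k ih in N , λ _ → s
    at-cut k (no  0≮k) = 0 , λ 0<k → ⊥-elim (0≮k 0<k)
    Nₖ : Fin r → ℕ
    Nₖ k = proj₁ (at-cut k (0 ℕ.<? toℕ k))

  module Step (r : ℕ) (ih : ∀ {s} → s ℕ.< r → FG s) (K : ℤ) (1≤K : 1ℤ ≤ K) where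

    0≤K : 0ℤ ≤ K
    0≤K = ℤP.≤-trans (+≤+ ℕ.z≤n) 1≤K

    grow : ∀ {a} → 0ℤ ≤ a → a ≤ K * a
    grow {a} 0≤a = subst (_≤ K * a) (ℤP.*-identityˡ a) (mono-≤ʳ 0≤a 1≤K)

    -- Weights of neighbouring bases agree up to K in both directions. Hence G₂ = K² G: a G₂-cut of
    -- the first weights is a G-cut of the second. H bounds all ratios of the first weights when
    -- they have no G₂-cut, and H′ = K² H carries this bound over to the second.
    G G₂ H H′ : ℤ
    G  = K * K
    G₂ = K * (K * G)
    H  = pow G₂ r
    H′ = K * (K * H)

    K≤G : K ≤ G
    K≤G = grow 0≤K

    1≤G : 1ℤ ≤ G
    1≤G = ℤP.≤-trans 1≤K K≤G

    0≤G′ : 0ℤ ≤ G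
    0≤G′ = ℤP.≤-trans (+≤+ ℕ.z≤n) 1≤G

    G≤G₂ : G ≤ G₂
    G≤G₂ = ℤP.≤-trans (grow 0≤G′) (grow (0≤* 0≤K 0≤G′))

    1≤G₂ : 1ℤ ≤ G₂
    1≤G₂ = ℤP.≤-trans 1≤G G≤G₂

    0≤H : 0ℤ ≤ H
    0≤H = ℤP.≤-trans (+≤+ ℕ.z≤n) (1≤pow 1≤G₂ r)

    module Std = Standard m S K G 0≤K 1≤G K≤G
    open Std using (StdForm; Hyps)

    N₀ N₁ N₂ N′ : ℕ
    N₀ = proj₁ (Std.standard r)
    N₁ = ∣ K * H′ ∣
    N₂ = N₀ ℕ.⊔ N₁
    N′ = N₂ ℕ.⊔ proj₁ (parAll r N₂ ih)

    std : ∀ w A → Hyps w A → StdForm N₀ w A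
    std = proj₂ (Std.standard r)

    par : ∀ k → 0 ℕ.< k → k ℕ.< r → ParAt r N₂ k N′
    par k 0<k k<r A B P Q bA bB z I tA tB tP tQ =
      Gen-mono (ℕP.m≤n⊔m N₂ _) (proj₂ (parAll r N₂ ih) k 0<k k<r A B P Q bA bB z I tA tB tP tQ)

    module _ {w : Fin r → ℤ} {A : Lin r r} (h : Hyps w A) where
      s = std w A h
      open StdForm s

      tri-A′ : ∀ k → Cut G w k → Tri k A′
      tri-A′ k c = Tri-≐ A′≐ (Tri-∘ {f = U} {A ∘L U⁻¹} (triU k c) (Tri-∘ {f = A} {U⁻¹} (Std.tri-A h k c) (triU⁻¹ k c)))
        where
        A′≐ : U ∘L A ∘L U⁻¹ ≐ A′
        A′≐ = eq λ x i → trans (at (tw iso) (ap U⁻¹ x) i) (congr A′ (at (PQ≐id iso) x) i)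

      bA′ : Bdd N₂ A′
      bA′ = Bdd-mono (ℕP.m≤m⊔n N₀ N₁) bounded

      -- U⁻¹ may be unbounded even when A and A′ are bounded, so it need not be an edge. If there is
      -- a proper cut, A, A′, U and U⁻¹ are all triangular there and the parabolic case applies;
      -- otherwise U is the identity.
      from-std : Bdd N₂ A → Gen N′ A′ A U⁻¹
      from-std bA = go trivial
        where
        go : ProperCut G w ⊎ (A′ ≐ A × U ≐ idL) → Gen N′ A′ A U⁻¹
        go (inj₁ (k , 0<k , k<r , c)) = par k 0<k k<r A′ A U⁻¹ U bA′ bA (Kills-Iso m iso (Hyps.kills h)) (Iso-sym iso)
          (tri-A′ k c) (Std.tri-A h k c) (triU⁻¹ k c) (triU k c)
        go (inj₂ (p , q)) = done (Bdd-mono (ℕP.m≤m⊔n N₂ _) bA′) p (eq λ x i → trans (sym (at q (ap U⁻¹ x) i)) (at (PQ≐id iso) x i))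

      to-std : Bdd N₂ A → Gen N′ A A′ U
      to-std bA = go trivial
        where
        go : ProperCut G w ⊎ (A′ ≐ A × U ≐ idL) → Gen N′ A A′ U
        go (inj₁ (k , 0<k , k<r , c)) = par k 0<k k<r A A′ U U⁻¹ bA bA′ (Hyps.kills h) iso
          (Std.tri-A h k c) (tri-A′ k c) (triU k c) (triU⁻¹ k c)
        go (inj₂ (p , q)) = done (Bdd-mono (ℕP.m≤m⊔n N₂ _) bA) (≐-sym p) q

    module _ {w₁ w₂ : Fin r → ℤ} {A₁ A₂ T T⁻¹ : Lin r r} (h₁ : Hyps w₁ A₁) (h₂ : Hyps w₂ A₂) (I : Iso A₁ A₂ T T⁻¹)
             (wT : Weighted K w₁ w₂ T) (wT⁻¹ : Weighted K w₂ w₁ T⁻¹) where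
      open Hyps h₁ using () renaming (sorted to sorted₁; pos to pos₁; wb to wb₁; kills to kills₁)
      open Hyps h₂ using () renaming (sorted to sorted₂; pos to pos₂; wb to wb₂)
      open StdForm (s h₁) using () renaming (A′ to B₁; U to U₁; U⁻¹ to V₁; iso to J₁; triU to t₁; triU⁻¹ to t₁⁻¹)
      open StdForm (s h₂) using () renaming (A′ to B₂; U to U₂; U⁻¹ to V₂; iso to J₂; triU to t₂; triU⁻¹ to t₂⁻¹)

      0≤w₁ : ∀ i → 0ℤ ≤ w₁ i
      0≤w₁ i = ℤP.<⇒≤ (pos₁ i)

      0≤w₂ : ∀ i → 0ℤ ≤ w₂ i
      0≤w₂ i = ℤP.<⇒≤ (pos₂ i)

      w₂≤ : ∀ i → w₂ i ≤ K * w₁ i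
      w₂≤ = weight-compare {P = T} {T⁻¹} 0≤K sorted₁ sorted₂ 0≤w₂ (QP≐id I) wT

      w₁≤ : ∀ i → w₁ i ≤ K * w₂ i
      w₁≤ = weight-compare {P = T⁻¹} {T} 0≤K sorted₂ sorted₁ 0≤w₁ (PQ≐id I) wT⁻¹

      cut₁ : ∀ k → Cut G₂ w₁ k → Cut G w₁ k
      cut₁ k c i j a b = ℤP.≤-<-trans (mono-≤ʳ (0≤w₁ i) G≤G₂) (c i j a b)

      cut-K : ∀ k → Cut G₂ w₁ k → ∀ i j → toℕ i ℕ.< k → k ℕ.≤ toℕ j → G * w₂ i < w₂ j
      cut-K k c i j a b = ℤP.≰⇒> λ p → ℤP.<⇒≱ (c i j a b) (ℤP.≤-trans (w₁≤ j) (ℤP.≤-trans (mono-≤ 0≤K p)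
        (ℤP.≤-trans (mono-≤ 0≤K (mono-≤ 0≤G′ (w₂≤ i))) (ℤP.≤-reflexive (l K G (w₁ i))))))
        where
        l : ∀ K G w → K * (G * (K * w)) ≡ K * (K * G) * w
        l = solve-∀

      tri-T : ∀ k → Cut G₂ w₁ k → Tri k T
      tri-T k c = weighted-Tri {K = K} {w₁} {w₂} {T} 0≤w₂ wT k λ i j a b → ℤP.≰⇒> λ p → ℤP.<⇒≱ (c j i a b)
        (ℤP.≤-trans (w₁≤ i) (ℤP.≤-trans (mono-≤ 0≤K p) (ℤP.≤-trans (ℤP.≤-reflexive (sym (ℤP.*-assoc K K (w₁ j)))) (mono-≤ʳ (0≤w₁ j) G≤G₂))))

      tri-T⁻¹ : ∀ k → Cut G₂ w₁ k → Tri k T⁻¹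
      tri-T⁻¹ k c = weighted-Tri {K = K} {w₂} {w₁} {T⁻¹} 0≤w₁ wT⁻¹ k λ i j a b → ℤP.≰⇒> λ p → ℤP.<⇒≱ (c j i a b)
        (ℤP.≤-trans p (ℤP.≤-trans (mono-≤ 0≤K (w₂≤ j)) (ℤP.≤-trans (ℤP.≤-reflexive (sym (ℤP.*-assoc K K (w₁ j)))) (mono-≤ʳ (0≤w₁ j) G≤G₂))))

      I′ : Iso B₁ B₂ (U₂ ∘L T ∘L V₁) ((U₁ ∘L T⁻¹) ∘L V₂)
      I′ = Iso-trans (Iso-trans (Iso-sym J₁) I) J₂

      -- Every factor of the composite preserves the sublattice below the cut, and the two standard
      -- forms are bounded. So the parabolic case applies, although A₁, A₂ and T themselves may be
      -- large.
      common-cut : ProperCut G₂ w₁ → Gen N′ B₁ B₂ (U₂ ∘L T ∘L V₁)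
      common-cut (k , 0<k , k<r , c) = par k 0<k k<r B₁ B₂ (U₂ ∘L T ∘L V₁) ((U₁ ∘L T⁻¹) ∘L V₂) (bA′ h₁) (bA′ h₂) (Kills-Iso m J₁ kills₁) I′
        (tri-A′ h₁ k (cut₁ k c)) (tri-A′ h₂ k (cut-K k c))
        (Tri-∘ {f = U₂} {T ∘L V₁} (t₂ k (cut-K k c)) (Tri-∘ {f = T} {V₁} (tri-T k c) (t₁⁻¹ k (cut₁ k c))))
        (Tri-∘ {f = U₁ ∘L T⁻¹} {V₂} (Tri-∘ {f = U₁} {T⁻¹} (t₁ k (cut₁ k c)) (tri-T⁻¹ k c)) (t₂⁻¹ k (cut-K k c)))

      -- With comparable weights the weight inequalities bound A₁, A₂, T and its inverse outright,
      -- so T is one edge; the passages between A₁, A₂ and their standard forms are added at both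
      -- ends.
      thick : (∀ i j → w₁ j ≤ H * w₁ i) → Gen N′ B₁ B₂ (U₂ ∘L T ∘L V₁)
      thick ratio = Gen-trans (Gen-trans (from-std h₁ bA₁) (Gen-edge (up bA₁) (up bA₂) (up bT) (up bT⁻¹) I)) (to-std h₂ bA₂)
        where
        up : ∀ {f : Lin r r} → Bdd N₂ f → Bdd N′ f
        up = Bdd-mono (ℕP.m≤m⊔n N₂ _)
        lower : ∀ {a} → 0ℤ ≤ a → H * a ≤ H′ * a
        lower 0≤a = mono-≤ʳ 0≤a (ℤP.≤-trans (grow 0≤H) (grow (0≤* 0≤K 0≤H)))
        bA₁ : Bdd N₂ A₁
        bA₁ = Bdd-mono (ℕP.m≤n⊔m N₀ N₁) (weighted-Bdd {K = K} {H′} {w₁} {w₁} 0≤K wb₁ pos₁ (λ i j → ℤP.≤-trans (ratio i j) (lower (0≤w₁ i))))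
        r₁₂ : ∀ i j → w₁ j ≤ K * H * w₂ i
        r₁₂ i j = ℤP.≤-trans (ratio i j) (ℤP.≤-trans (mono-≤ 0≤H (w₁≤ i)) (ℤP.≤-reflexive (l H K (w₂ i))))
          where
          l : ∀ H K w → H * (K * w) ≡ K * H * w
          l = solve-∀
        KH≤ : K * H ≤ H′
        KH≤ = grow (0≤* 0≤K 0≤H)
        bA₂ : Bdd N₂ A₂
        bA₂ = Bdd-mono (ℕP.m≤n⊔m N₀ N₁) (weighted-Bdd {K = K} {H′} {w₂} {w₂} 0≤K wb₂ pos₂ (λ i j →
          ℤP.≤-trans (w₂≤ j) (ℤP.≤-trans (mono-≤ 0≤K (r₁₂ i j)) (ℤP.≤-reflexive (sym (ℤP.*-assoc K (K * H) (w₂ i)))))))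
        bT : Bdd N₂ T
        bT = Bdd-mono (ℕP.m≤n⊔m N₀ N₁) (weighted-Bdd {K = K} {H′} {w₁} {w₂} 0≤K wT pos₂ (λ i j → ℤP.≤-trans (r₁₂ i j) (mono-≤ʳ (0≤w₂ i) KH≤)))
        bT⁻¹ : Bdd N₂ T⁻¹
        bT⁻¹ = Bdd-mono (ℕP.m≤n⊔m N₀ N₁) (weighted-Bdd {K = K} {H′} {w₂} {w₁} 0≤K wT⁻¹ pos₁ (λ i j →
          ℤP.≤-trans (w₂≤ j) (ℤP.≤-trans (mono-≤ 0≤K (ratio i j)) (ℤP.≤-trans (ℤP.≤-reflexive (sym (ℤP.*-assoc K H (w₁ i)))) (mono-≤ʳ (0≤w₁ i) KH≤)))))

      step-gen : Gen N′ B₁ B₂ (U₂ ∘L T ∘L V₁)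
      step-gen = decide (cut? 1≤G₂ w₁ 0≤w₁ sorted₁)
        where
        decide : ProperCut G₂ w₁ ⊎ (∀ i j → w₁ j ≤ H * w₁ i) → Gen N′ B₁ B₂ (U₂ ∘L T ∘L V₁)
        decide (inj₁ c) = common-cut c
        decide (inj₂ q) = thick q

ℕ-ind : (X : ℕ → Set) → X 0 → (∀ n → X n → X (suc n)) → ∀ n → X n
ℕ-ind X z s zero    = z
ℕ-ind X z s (suc n) = s n (ℕ-ind X z s n)

-- The discretised segment of forms

module GenerationPath (m : Poly) (S : Separable m) (r : ℕ) (ih : ∀ {s} → s ℕ.< r → Parabolic.FG m S s) (N : ℕ) where
  open Parabolic m S
  open Generation m S

  -- The reduction constant is raised by 1 to have C ≥ 1, so that the prescribed bases at the ends,
  -- reduced with constant 1, also qualify. K covers C c for A itself and 2C for transitions between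
  -- forms within a factor 2; the final 1 gives K ≥ 1.
  C c K : ℤ
  C = proj₁ (reduceForm r) + 1ℤ
  c = opC r N
  K = C * c + C * ℤ.+ 2 + 1ℤ

  1≤C : 1ℤ ≤ C
  1≤C = ℤP.+-monoˡ-≤ 1ℤ (proj₁ (proj₂ (reduceForm r)))

  0≤C : 0ℤ ≤ C
  0≤C = ℤP.≤-trans (+≤+ ℕ.z≤n) 1≤C

  0≤Cc : 0ℤ ≤ C * c
  0≤Cc = 0≤* 0≤C (0≤opC r N)

  0≤2C : 0ℤ ≤ C * ℤ.+ 2
  0≤2C = 0≤* {b = ℤ.+ 2} 0≤C (+≤+ ℕ.z≤n)

  1≤K : 1ℤ ≤ K
  1≤K = ℤP.+-monoˡ-≤ 1ℤ (0≤+ 0≤Cc 0≤2C)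

  Cc≤K : C * c ≤ K
  Cc≤K = ≤-by (C * ℤ.+ 2 + 1ℤ) (0≤+ {b = 1ℤ} 0≤2C (+≤+ ℕ.z≤n)) (l (C * c) (C * ℤ.+ 2))
    where
    l : ∀ a b → a + b + 1ℤ - a ≡ b + 1ℤ
    l = solve-∀

  2C≤K : C * ℤ.+ 2 ≤ K
  2C≤K = ≤-by (C * c + 1ℤ) (0≤+ {b = 1ℤ} 0≤Cc (+≤+ ℕ.z≤n)) (l (C * c) (C * ℤ.+ 2))
    where
    l : ∀ a b → a + b + 1ℤ - b ≡ a + 1ℤ
    l = solve-∀

  open Step r ih K 1≤K

  N″ : ℕ
  N″ = N′ ℕ.⊔ N

  module _ (A B P Q : Lin r r) (bA : Bdd N A) (bB : Bdd N B) (z : Kills m A) (I : Iso A B P Q) where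
    open Nodes A C c 0≤C
    open Node using (form; frame; w; A∘; w-pos; isoA)

    hyps : (n : Node) → Std.Hyps (w n) (A∘ n)
    hyps n = record { sorted = Node.sortedW n ; pos = w-pos n
      ; wb = Weighted-mono {K = C * c} {K} {w n} {w n} {A∘ n} Cc≤K (λ i → ℤP.<⇒≤ (w-pos n i)) (Node.weighted-A n)
      ; kills = Kills-Iso m (isoA n) z }

    opaque
      stdAt : (n : Node) → Std.StdForm N₀ (w n) (A∘ n)
      stdAt n = std (w n) (A∘ n) (hyps n)

      transition-gen : ∀ n n′ → Weighted K (w n) (w n′) (transition n n′) → Weighted K (w n′) (w n) (transition n′ n) →
        Gen N′ (Std.StdForm.A′ (stdAt n)) (Std.StdForm.A′ (stdAt n′)) (Std.StdForm.U (stdAt n′) ∘L transition n n′ ∘L Std.StdForm.U⁻¹ (stdAt n))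
      transition-gen n n′ = step-gen (hyps n) (hyps n′) (iso-transition n n′)

    -- Q n passes to the coordinates of the basis at n and U to the standard form. With the
    -- composite prescribed, the transitions telescope: at the last node, where the coordinate
    -- change is P and U is the identity, the path has composite P.
    Reach : Node → Set
    Reach n = Gen N″ A (Std.StdForm.A′ (stdAt n)) (Std.StdForm.U (stdAt n) ∘L Node.Q n)

    q : Node → V r → ℤ
    q n x = Form.B (form n) x x

    move : ∀ n n′ → (∀ x → q n′ x ≤ ℤ.+ 2 * q n x) → (∀ x → q n x ≤ ℤ.+ 2 * q n′ x) → Reach n → Reach n′
    move n n′ h h′ g = Gen-≐ ≐-refl ≐-refl
        (eq λ x i → congr (U n′ ∘L Node.Q n′) (λ j → trans (congr (Node.P n) (at (QP≐id (iso n)) (ap (Node.Q n) x)) j) (at (Node.PQ n) x j)) i)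
        (Gen-trans g (Gen-mono (ℕP.m≤m⊔n N′ N) (transition-gen n n′
          (Weighted-mono {K = C * ℤ.+ 2} {K} {w n} {w n′} {transition n n′} 2C≤K (λ i → ℤP.<⇒≤ (w-pos n i)) (weighted-transition n n′ (ℤ.+ 2) h))
          (Weighted-mono {K = C * ℤ.+ 2} {K} {w n′} {w n} {transition n′ n} 2C≤K (λ i → ℤP.<⇒≤ (w-pos n′ i)) (weighted-transition n′ n (ℤ.+ 2) h′)))))
      where
      U : (n : Node) → Lin r r
      U n = Std.StdForm.U (stdAt n)
      iso : (n : Node) → Iso (A∘ n) (Std.StdForm.A′ (stdAt n)) (U n) (Std.StdForm.U⁻¹ (stdAt n))
      iso n = Std.StdForm.iso (stdAt n)

    makeNode : (F : Form r) → (∀ x → Form.B F (ap A x) (ap A x) ≤ c * Form.B F x x) → Node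
    makeNode F compat = record { form = F ; frame = proj₁ R′ ; reduced = proj₁ (proj₂ R′) ; sortedW = proj₂ (proj₂ R′) ; compat = compat }
      where
      R = proj₂ (proj₂ (reduceForm r)) F
      C₀≤C : proj₁ (reduceForm r) ≤ C
      C₀≤C = ≤-by 1ℤ (+≤+ ℕ.z≤n) (l (proj₁ (reduceForm r)))
        where
        l : ∀ a → a + 1ℤ - a ≡ 1ℤ
        l = solve-∀
      R′ = reduceSorted C F (proj₁ R) (λ x i → ℤP.≤-trans (proj₂ R x i) (mono-≤ʳ (Form.B-nonneg F (ap (Frame.P (proj₁ R)) x)) C₀≤C))

    dot-e : ∀ i → dot {r} (e i) (e i) ≡ 1ℤ
    dot-e i = trans (sum-e (e i) i) (e-≡ i)

    module Flat (F : Form r) (R : Frame r) (compat : ∀ x → Form.B F (ap A x) (ap A x) ≤ c * Form.B F x x)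
                (ℓ : ℤ) (0<ℓ : 0ℤ < ℓ) (flat : ∀ x → Form.B F (ap (Frame.P R) x) (ap (Frame.P R) x) ≡ ℓ * dot x x) where

      w≡ℓ : ∀ i → weight F R i ≡ ℓ
      w≡ℓ i = trans (flat (e i)) (trans (cong (ℓ *_) (dot-e i)) (ℤP.*-identityʳ ℓ))

      opaque
        -- The basis is prescribed, not computed: the path must begin and end at the given matrices,
        -- while `reduceForm` may choose other bases. All weights equal ℓ, so there is no cut and
        -- the standard form is the matrix itself.
        flatNode : Node
        flatNode = record { form = F ; frame = R
          ; reduced = λ x i → subst₂ (λ a b → x i * x i * a ≤ C * b) (sym (w≡ℓ i)) (sym (flat x))
              (ℤP.≤-trans (mono-≤ʳ (ℤP.<⇒≤ 0<ℓ) (sq≤dot x i)) (subst₂ _≤_ (trans (ℤP.*-identityˡ _) (ℤP.*-comm ℓ (dot x x))) refl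
                (mono-≤ʳ (0≤* (ℤP.<⇒≤ 0<ℓ) (0≤dot x)) 1≤C)))
          ; sortedW = λ i j _ → ℤP.≤-reflexive (trans (w≡ℓ i) (sym (w≡ℓ j)))
          ; compat = compat }

        flat-w : ∀ i → w flatNode i ≡ ℓ
        flat-w = w≡ℓ

        flat-q : ∀ x → q flatNode x ≡ Form.B F x x
        flat-q x = refl

        flat-A : Frame.Q R ∘L A ∘L Frame.P R ≐ A∘ flatNode
        flat-A = ≐-refl

        flat-Q : Frame.Q R ≐ Node.Q flatNode
        flat-Q = ≐-refl

      no-cut : ¬ ProperCut G (w flatNode)
      no-cut (k , 0<k , k<r , cut) = ℤP.<⇒≱
        (cut (F.fromℕ< 0<r) (F.fromℕ< k<r) (subst (ℕ._< k) (sym (FP.toℕ-fromℕ< 0<r)) 0<k) (ℕP.≤-reflexive (sym (FP.toℕ-fromℕ< k<r))))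
        (subst₂ _≤_ (sym (flat-w (F.fromℕ< k<r))) (cong (G *_) (sym (flat-w (F.fromℕ< 0<r))))
          (subst (_≤ G * ℓ) (ℤP.*-identityˡ ℓ) (mono-≤ʳ (ℤP.<⇒≤ 0<ℓ) 1≤G)))
        where
        0<r = ℕP.<-trans 0<k k<r

      flat-trivial : Std.StdForm.A′ (stdAt flatNode) ≐ A∘ flatNode × Std.StdForm.U (stdAt flatNode) ≐ idL
      flat-trivial = decide (Std.StdForm.trivial (stdAt flatNode))
        where
        decide : ∀ {X : Set} → ProperCut G (w flatNode) ⊎ X → X
        decide (inj₁ cut) = ⊥-elim (no-cut cut)
        decide (inj₂ x)   = x

    comb-pos : ∀ a b → 0 ℕ.< a ℕ.+ b → ∀ x → ¬ (x ≗ 0v) → 0ℤ < ℤ.+ a * dot x x + ℤ.+ b * dot (ap P x) (ap P x)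
    comb-pos (suc a) b       _ x ¬z = 0<+ (0<* {ℤ.+ suc a} (+<+ (ℕ.s≤s ℕ.z≤n)) (Form.B-pos dotForm x ¬z)) (0≤* {ℤ.+ b} (+≤+ ℕ.z≤n) (0≤dot (ap P x)))
    comb-pos zero    (suc b) _ x ¬z = subst (0ℤ <_) (ℤP.+-comm (ℤ.+ suc b * dot (ap P x) (ap P x)) (0ℤ * dot x x))
      (0<+ {b = 0ℤ} (0<* {ℤ.+ suc b} (+<+ (ℕ.s≤s ℕ.z≤n)) (Form.B-pos dotForm (ap P x) (λ p → ¬z (left-inverse⇒inj {P = P} {Q} (QP≐id I) x p)))) ℤP.≤-refl)

    comb : ∀ a b → 0 ℕ.< a ℕ.+ b → Form r
    comb a b nz = combForm dotForm dotForm P (ℤ.+ a) (ℤ.+ b) (comb-pos a b nz)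

    -- One constant serves the whole segment: |Ax|² is controlled by the bound on A, and |PAx|² =
    -- |BPx|² by the same bound on B.
    comb-compat : ∀ a b nz x → Form.B (comb a b nz) (ap A x) (ap A x) ≤ c * Form.B (comb a b nz) x x
    comb-compat a b nz x = subst₂ (λ s t → ℤ.+ a * dot (ap A x) (ap A x) + ℤ.+ b * s ≤ t)
      (dot-cong (λ i → sym (at (tw I) x i)) (λ i → sym (at (tw I) x i))) (l c (ℤ.+ a) (ℤ.+ b) (dot x x) (dot (ap P x) (ap P x)))
      (ℤP.+-mono-≤ (mono-≤ {ℤ.+ a} (+≤+ ℕ.z≤n) (op-norm A bA x)) (mono-≤ {ℤ.+ b} (+≤+ ℕ.z≤n) (op-norm B bB (ap P x))))
      where
      l : ∀ c a b s t → a * (c * s) + b * (c * t) ≡ c * (a * s + b * t)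
      l = solve-∀

    p² q² : V r → ℤ
    p² x = dot x x
    q² x = dot (ap P x) (ap P x)

    opaque
      node : ∀ a b → 0 ℕ.< a ℕ.+ b → Node
      node a b nz = makeNode (comb a b nz) (comb-compat a b nz)

      q-node : ∀ a b nz x → q (node a b nz) x ≡ ℤ.+ a * p² x + ℤ.+ b * q² x
      q-node a b nz x = refl

    0≤p² : ∀ x → 0ℤ ≤ p² x
    0≤p² x = 0≤dot x

    0≤q² : ∀ x → 0ℤ ≤ q² x
    0≤q² x = 0≤dot (ap P x)

    0≤ℕ : ∀ {n} → 0ℤ ≤ ℤ.+ n
    0≤ℕ = +≤+ ℕ.z≤n

    dbl : ∀ {a} → 0ℤ ≤ a → a ≤ ℤ.+ 2 * a
    dbl {a} h = ≤-by a h (l a)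
      where
      l : ∀ a → ℤ.+ 2 * a - a ≡ a
      l = solve-∀

    0≤q : ∀ n x → 0ℤ ≤ q n x
    0≤q n x = Form.B-nonneg (form n) x

    module Walk (ℓ : ℕ) (0<ℓ : 0 ℕ.< ℓ) (q²≤ : ∀ x → q² x ≤ ℤ.+ ℓ * p² x) (p²≤ : ∀ x → p² x ≤ ℤ.+ ℓ * q² x) where

      nzˡ : ∀ b → 0 ℕ.< ℓ ℕ.+ b
      nzˡ b = ℕP.≤-trans 0<ℓ (ℕP.m≤m+n ℓ b)

      nzʳ : ∀ a → 0 ℕ.< a ℕ.+ ℓ
      nzʳ a = ℕP.≤-trans 0<ℓ (ℕP.m≤n+m ℓ a)

      -- As q ≤ ℓ p, one further copy of q is absorbed by the ℓ copies of p already present. This is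
      -- why the forms are scaled by ℓ: unit steps of a coefficient then change a form by at most a
      -- factor 2.
      raise-≤ : ∀ {b p q} → 0ℤ ≤ b → 0ℤ ≤ p → 0ℤ ≤ q → q ≤ ℤ.+ ℓ * p →
                (ℤ.+ ℓ * p + (1ℤ + b) * q ≤ ℤ.+ 2 * (ℤ.+ ℓ * p + b * q)) × (ℤ.+ ℓ * p + b * q ≤ ℤ.+ 2 * (ℤ.+ ℓ * p + (1ℤ + b) * q))
      raise-≤ {b} {p} {q} 0≤b 0≤p 0≤q h =
          ≤-by ((ℤ.+ ℓ * p - q) + b * q) (0≤+ (≤⇒0≤ h) (0≤* 0≤b 0≤q)) (l1 (ℤ.+ ℓ) b p q)
        , ≤-by (ℤ.+ ℓ * p + b * q + (q + q)) (0≤+ (0≤+ (0≤* {ℤ.+ ℓ} 0≤ℕ 0≤p) (0≤* 0≤b 0≤q)) (0≤+ 0≤q 0≤q)) (l2 (ℤ.+ ℓ) b p q)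
        where
        l1 : ∀ ℓ b p q → ℤ.+ 2 * (ℓ * p + b * q) - (ℓ * p + (1ℤ + b) * q) ≡ (ℓ * p - q) + b * q
        l1 = solve-∀
        l2 : ∀ ℓ b p q → ℤ.+ 2 * (ℓ * p + (1ℤ + b) * q) - (ℓ * p + b * q) ≡ ℓ * p + b * q + (q + q)
        l2 = solve-∀

      -- The segment is taken in two halves, ℓ|x|² + b|Px|² with b rising to ℓ and a|x|² + ℓ|Px|²
      -- with a falling to 0, so that at every point one coefficient equals ℓ.
      nodeˡ nodeʳ : ℕ → Node
      nodeˡ b = node ℓ b (nzˡ b)
      nodeʳ a = node a ℓ (nzʳ a)

      q-nodeʳ : ∀ a x → q (nodeʳ a) x ≡ ℤ.+ ℓ * q² x + ℤ.+ a * p² x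
      q-nodeʳ a x = trans (q-node a ℓ (nzʳ a) x) (ℤP.+-comm (ℤ.+ a * p² x) (ℤ.+ ℓ * q² x))

      raise-p : ∀ b x → (ℤ.+ ℓ * p² x + ℤ.+ suc b * q² x ≤ ℤ.+ 2 * (ℤ.+ ℓ * p² x + ℤ.+ b * q² x)) ×
                        (ℤ.+ ℓ * p² x + ℤ.+ b * q² x ≤ ℤ.+ 2 * (ℤ.+ ℓ * p² x + ℤ.+ suc b * q² x))
      raise-p b x = raise-≤ {ℤ.+ b} {p² x} {q² x} 0≤ℕ (0≤p² x) (0≤q² x) (q²≤ x)

      raise-q : ∀ a x → (ℤ.+ ℓ * q² x + ℤ.+ suc a * p² x ≤ ℤ.+ 2 * (ℤ.+ ℓ * q² x + ℤ.+ a * p² x)) ×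
                        (ℤ.+ ℓ * q² x + ℤ.+ a * p² x ≤ ℤ.+ 2 * (ℤ.+ ℓ * q² x + ℤ.+ suc a * p² x))
      raise-q a x = raise-≤ {ℤ.+ a} {q² x} {p² x} 0≤ℕ (0≤q² x) (0≤p² x) (p²≤ x)

      raise : ∀ b → Reach (nodeˡ b) → Reach (nodeˡ (suc b))
      raise b = move (nodeˡ b) (nodeˡ (suc b)) h h′
        where
        h : ∀ x → q (nodeˡ (suc b)) x ≤ ℤ.+ 2 * q (nodeˡ b) x
        h x = subst₂ (λ s t → s ≤ ℤ.+ 2 * t) (sym (q-node ℓ (suc b) (nzˡ (suc b)) x)) (sym (q-node ℓ b (nzˡ b) x)) (proj₁ (raise-p b x))
        h′ : ∀ x → q (nodeˡ b) x ≤ ℤ.+ 2 * q (nodeˡ (suc b)) x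
        h′ x = subst₂ (λ s t → s ≤ ℤ.+ 2 * t) (sym (q-node ℓ b (nzˡ b) x)) (sym (q-node ℓ (suc b) (nzˡ (suc b)) x)) (proj₂ (raise-p b x))

      lower : ∀ a → Reach (nodeʳ (suc a)) → Reach (nodeʳ a)
      lower a = move (nodeʳ (suc a)) (nodeʳ a) h h′
        where
        h : ∀ x → q (nodeʳ a) x ≤ ℤ.+ 2 * q (nodeʳ (suc a)) x
        h x = subst₂ (λ s t → s ≤ ℤ.+ 2 * t) (sym (q-nodeʳ a x)) (sym (q-nodeʳ (suc a) x)) (proj₂ (raise-q a x))
        h′ : ∀ x → q (nodeʳ (suc a)) x ≤ ℤ.+ 2 * q (nodeʳ a) x
        h′ x = subst₂ (λ s t → s ≤ ℤ.+ 2 * t) (sym (q-nodeʳ (suc a) x)) (sym (q-nodeʳ a x)) (proj₁ (raise-q a x))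

      raise-all : ∀ b → Reach (nodeˡ 0) → Reach (nodeˡ b)
      raise-all b g = ℕ-ind (λ b → Reach (nodeˡ b)) g raise b

      lower-all : ∀ a → Reach (nodeʳ a) → Reach (nodeʳ 0)
      lower-all = ℕ-ind (λ a → Reach (nodeʳ a) → Reach (nodeʳ 0)) (λ g → g) (λ a h g → h (lower a g))

      module Start = Flat (comb ℓ 0 (nzˡ 0)) idFrame (comb-compat ℓ 0 (nzˡ 0)) (ℤ.+ ℓ) (+<+ 0<ℓ)
                          (λ x → trans (cong (ℤ.+ ℓ * dot x x +_) (ℤP.*-zeroˡ (q² x))) (ℤP.+-identityʳ (ℤ.+ ℓ * dot x x)))

      -- The basis of the vectors P⁻¹e_i: in it |Px|² becomes the Euclidean form and A becomes P A
      -- P⁻¹ = B.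
      PFrame : Frame r
      PFrame = record { P = Q ; Q = P ; PQ = QP≐id I ; QP = PQ≐id I }

      module End = Flat (comb 0 ℓ (nzʳ 0)) PFrame (comb-compat 0 ℓ (nzʳ 0)) (ℤ.+ ℓ) (+<+ 0<ℓ)
                        (λ x → trans (cong₂ _+_ (ℤP.*-zeroˡ (dot (ap Q x) (ap Q x))) (cong (ℤ.+ ℓ *_) (dot-cong (at (PQ≐id I) x) (at (PQ≐id I) x))))
                                     (ℤP.+-identityˡ (ℤ.+ ℓ * dot x x)))

      reach-start : Reach Start.flatNode
      reach-start = done (Bdd-mono (ℕP.m≤n⊔m N′ N) bA) A≐ (eq λ x i → trans (at (proj₂ Start.flat-trivial) (ap (Node.Q Start.flatNode) x) i) (sym (at Start.flat-Q x i)))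
        where
        A≐ : A ≐ Std.StdForm.A′ (stdAt Start.flatNode)
        A≐ = ≐-trans {g = idL ∘L A ∘L idL} (eq λ _ _ → refl) (≐-trans Start.flat-A (≐-sym (proj₁ Start.flat-trivial)))

      -- Equal forms may still carry different bases: a prescribed and a computed one at the ends,
      -- or computations from different positivity proofs at the middle. So this too is a move, with
      -- ratio 1.
      same : ∀ n n′ → (∀ x → q n x ≡ q n′ x) → Reach n → Reach n′
      same n n′ h = move n n′ (λ x → subst (λ t → q n′ x ≤ ℤ.+ 2 * t) (sym (h x)) (dbl (0≤q n′ x)))
                              (λ x → subst (λ t → q n x ≤ ℤ.+ 2 * t) (h x) (dbl (0≤q n x)))

      reach-end : Reach End.flatNode
      reach-end = same (nodeʳ 0) End.flatNode (λ x → trans (q-node 0 ℓ (nzʳ 0) x) (sym (End.flat-q x)))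
        (lower-all ℓ (same (nodeˡ ℓ) (nodeʳ ℓ) (λ x → trans (q-node ℓ ℓ (nzˡ ℓ) x) (sym (q-node ℓ ℓ (nzʳ ℓ) x)))
          (raise-all ℓ (same Start.flatNode (nodeˡ 0) (λ x → trans (Start.flat-q x) (sym (q-node ℓ 0 (nzˡ 0) x))) reach-start))))

      walk : Gen N″ A B P
      walk = Gen-≐ ≐-refl
        (≐-trans (proj₁ End.flat-trivial) (≐-trans (≐-sym End.flat-A) (eq λ x i → trans (at (tw I) (ap Q x) i) (congr B (at (PQ≐id I) x) i))))
        (eq λ x i → trans (at (proj₂ End.flat-trivial) (ap (Node.Q End.flatNode) x) i) (sym (at End.flat-Q x i))) reach-end

    -- It depends on the entries of P and Q, which are not bounded in advance. It determines only
    -- the number of nodes; the bound N″ was fixed before.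
    ℓ : ℕ
    ℓ = suc (∣ opC r (maxEntry P) ∣ ℕ.+ ∣ opC r (maxEntry Q) ∣)

    opC≤ : ∀ {M a} → 0ℤ ≤ a → ∣ opC r M ∣ ℕ.≤ ℓ → opC r M * a ≤ ℤ.+ ℓ * a
    opC≤ {M} 0≤a h = mono-≤ʳ 0≤a (subst (_≤ ℤ.+ ℓ) (ℤP.0≤i⇒+∣i∣≡i (0≤opC r M)) (+≤+ h))

    q²≤ : ∀ x → q² x ≤ ℤ.+ ℓ * p² x
    q²≤ x = ℤP.≤-trans (op-norm P (maxEntry-Bdd P) x) (opC≤ {maxEntry P} (0≤p² x) (ℕP.m≤n⇒m≤1+n (ℕP.m≤m+n _ ∣ opC r (maxEntry Q) ∣)))

    p²≤ : ∀ x → p² x ≤ ℤ.+ ℓ * q² x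
    p²≤ x = ℤP.≤-trans (subst (_≤ opC r (maxEntry Q) * q² x) (dot-cong (at (QP≐id I) x) (at (QP≐id I) x)) (op-norm Q (maxEntry-Bdd Q) (ap P x)))
              (opC≤ {maxEntry Q} (0≤q² x) (ℕP.m≤n⇒m≤1+n (ℕP.m≤n+m _ ∣ opC r (maxEntry P) ∣)))

    generated : Gen N″ A B P
    generated = Walk.walk ℓ (ℕ.s≤s ℕ.z≤n) q²≤ p²≤

module FiniteGeneration (m : Poly) (S : Separable m) where
  open Parabolic m S

  opaque
    finitely-generated : ∀ r → FG r
    finitely-generated = <-rec FG (λ r ih N → GenerationPath.N″ m S r ih N , GenerationPath.generated m S r ih N)

-- The ring of integer polynomials

infix 4 _≋_
record _≋_ (p q : Poly) : Set where
  constructor co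
  field coeffs : p ≈ₚ q
open _≋_ public

coeff-+ : ∀ p q k → coeff (p +ₚ q) k ≡ coeff p k + coeff q k
coeff-+ []      q       k       = sym (ℤP.+-identityˡ (coeff q k))
coeff-+ (a ∷ p) []      k       = sym (ℤP.+-identityʳ (coeff (a ∷ p) k))
coeff-+ (a ∷ p) (b ∷ q) zero    = refl
coeff-+ (a ∷ p) (b ∷ q) (suc k) = coeff-+ p q k

coeff-neg : ∀ p k → coeff (-ₚ p) k ≡ - coeff p k
coeff-neg []      k       = refl
coeff-neg (a ∷ p) zero    = refl
coeff-neg (a ∷ p) (suc k) = coeff-neg p k

coeff-scale : ∀ c p k → coeff (scaleₚ c p) k ≡ c * coeff p k
coeff-scale c []      k       = sym (ℤP.*-zeroʳ c)
coeff-scale c (a ∷ p) zero    = refl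
coeff-scale c (a ∷ p) (suc k) = coeff-scale c p k

≋-refl : ∀ {p} → p ≋ p
≋-refl = co λ _ → refl

≋-sym : ∀ {p q} → p ≋ q → q ≋ p
≋-sym h = co λ k → sym (coeffs h k)

≋-trans : ∀ {p q r} → p ≋ q → q ≋ r → p ≋ r
≋-trans h g = co λ k → trans (coeffs h k) (coeffs g k)

∷-cong : ∀ {a b p q} → a ≡ b → p ≋ q → a ∷ p ≋ b ∷ q
∷-cong h g = co λ { zero → h ; (suc k) → coeffs g k }

∷-0 : ∀ {a p} → a ≡ 0ℤ → p ≋ [] → a ∷ p ≋ []
∷-0 h g = co λ { zero → h ; (suc k) → coeffs g k }

+ₚ-cong : ∀ {p p′ q q′} → p ≋ p′ → q ≋ q′ → p +ₚ q ≋ p′ +ₚ q′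
+ₚ-cong {p} {p′} {q} {q′} h g = co λ k → trans (coeff-+ p q k) (trans (cong₂ _+_ (coeffs h k) (coeffs g k)) (sym (coeff-+ p′ q′ k)))

-ₚ-cong : ∀ {p q} → p ≋ q → -ₚ p ≋ -ₚ q
-ₚ-cong {p} {q} h = co λ k → trans (coeff-neg p k) (trans (cong -_ (coeffs h k)) (sym (coeff-neg q k)))

scale-cong : ∀ {c d p q} → c ≡ d → p ≋ q → scaleₚ c p ≋ scaleₚ d q
scale-cong {c} {d} {p} {q} h g = co λ k → trans (coeff-scale c p k) (trans (cong₂ _*_ h (coeffs g k)) (sym (coeff-scale d q k)))

+ₚ-comm : ∀ p q → p +ₚ q ≋ q +ₚ p
+ₚ-comm p q = co λ k → trans (coeff-+ p q k) (trans (ℤP.+-comm (coeff p k) (coeff q k)) (sym (coeff-+ q p k)))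

+ₚ-assoc : ∀ p q r → (p +ₚ q) +ₚ r ≋ p +ₚ (q +ₚ r)
+ₚ-assoc p q r = co λ k → begin
  coeff ((p +ₚ q) +ₚ r) k                ≡⟨ trans (coeff-+ (p +ₚ q) r k) (cong (_+ coeff r k) (coeff-+ p q k)) ⟩
  coeff p k + coeff q k + coeff r k      ≡⟨ ℤP.+-assoc (coeff p k) (coeff q k) (coeff r k) ⟩
  coeff p k + (coeff q k + coeff r k)    ≡⟨ trans (coeff-+ p (q +ₚ r) k) (cong (coeff p k +_) (coeff-+ q r k)) ⟨
  coeff (p +ₚ (q +ₚ r)) k                ∎

+ₚ-identityʳ : ∀ p → p +ₚ [] ≋ p
+ₚ-identityʳ p = co λ k → trans (coeff-+ p [] k) (ℤP.+-identityʳ (coeff p k))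

-ₚ-inverseʳ : ∀ p → p +ₚ (-ₚ p) ≋ []
-ₚ-inverseʳ p = co λ k → trans (coeff-+ p (-ₚ p) k) (trans (cong (coeff p k +_) (coeff-neg p k)) (ℤP.+-inverseʳ (coeff p k)))

+ₚ-interchange : ∀ p q r s → (p +ₚ q) +ₚ (r +ₚ s) ≋ (p +ₚ r) +ₚ (q +ₚ s)
+ₚ-interchange p q r s = co λ k → begin
  coeff ((p +ₚ q) +ₚ (r +ₚ s)) k                   ≡⟨ trans (coeff-+ (p +ₚ q) (r +ₚ s) k) (cong₂ _+_ (coeff-+ p q k) (coeff-+ r s k)) ⟩
  coeff p k + coeff q k + (coeff r k + coeff s k)  ≡⟨ +-interchange (coeff p k) (coeff q k) (coeff r k) (coeff s k) ⟩
  coeff p k + coeff r k + (coeff q k + coeff s k)  ≡⟨ trans (coeff-+ (p +ₚ r) (q +ₚ s) k) (cong₂ _+_ (coeff-+ p r k) (coeff-+ q s k)) ⟨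
  coeff ((p +ₚ r) +ₚ (q +ₚ s)) k                   ∎

scale-+ : ∀ c p q → scaleₚ c (p +ₚ q) ≋ scaleₚ c p +ₚ scaleₚ c q
scale-+ c p q = co λ k → begin
  coeff (scaleₚ c (p +ₚ q)) k               ≡⟨ trans (coeff-scale c (p +ₚ q) k) (cong (c *_) (coeff-+ p q k)) ⟩
  c * (coeff p k + coeff q k)               ≡⟨ ℤP.*-distribˡ-+ c (coeff p k) (coeff q k) ⟩
  c * coeff p k + c * coeff q k             ≡⟨ trans (coeff-+ (scaleₚ c p) (scaleₚ c q) k) (cong₂ _+_ (coeff-scale c p k) (coeff-scale c q k)) ⟨
  coeff (scaleₚ c p +ₚ scaleₚ c q) k        ∎

scale-distrib : ∀ c d p → scaleₚ (c + d) p ≋ scaleₚ c p +ₚ scaleₚ d p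
scale-distrib c d p = co λ k → begin
  coeff (scaleₚ (c + d) p) k                ≡⟨ coeff-scale (c + d) p k ⟩
  (c + d) * coeff p k                       ≡⟨ ℤP.*-distribʳ-+ (coeff p k) c d ⟩
  c * coeff p k + d * coeff p k             ≡⟨ trans (coeff-+ (scaleₚ c p) (scaleₚ d p) k) (cong₂ _+_ (coeff-scale c p k) (coeff-scale d p k)) ⟨
  coeff (scaleₚ c p +ₚ scaleₚ d p) k        ∎

scale-scale : ∀ c d p → scaleₚ c (scaleₚ d p) ≋ scaleₚ (c * d) p
scale-scale c d p = co λ k → trans (coeff-scale c (scaleₚ d p) k) (trans (cong (c *_) (coeff-scale d p k))
  (trans (sym (ℤP.*-assoc c d (coeff p k))) (sym (coeff-scale (c * d) p k))))

scale-0 : ∀ p → scaleₚ 0ℤ p ≋ []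
scale-0 p = co λ k → trans (coeff-scale 0ℤ p k) (ℤP.*-zeroˡ (coeff p k))

scale-1 : ∀ p → scaleₚ 1ℤ p ≋ p
scale-1 p = co λ k → trans (coeff-scale 1ℤ p k) (ℤP.*-identityˡ (coeff p k))

*ₚ-congʳ : ∀ p {q q′} → q ≋ q′ → p *ₚ q ≋ p *ₚ q′
*ₚ-congʳ []      h = ≋-refl
*ₚ-congʳ (a ∷ p) {q} h = +ₚ-cong (scale-cong {a} {a} {q} refl h) (∷-cong refl (*ₚ-congʳ p h))

*ₚ-zeroˡ : ∀ p q → p ≋ [] → p *ₚ q ≋ []
*ₚ-zeroˡ []      q h = ≋-refl
*ₚ-zeroˡ (a ∷ p) q h = ≋-trans (+ₚ-cong (≋-trans (scale-cong {p = q} (coeffs h 0) ≋-refl) (scale-0 q)) (∷-0 refl (*ₚ-zeroˡ p q (co λ k → coeffs h (suc k))))) ≋-refl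

*ₚ-congˡ : ∀ p p′ q → p ≋ p′ → p *ₚ q ≋ p′ *ₚ q
*ₚ-congˡ []      p′       q h = ≋-sym (*ₚ-zeroˡ p′ q (≋-sym h))
*ₚ-congˡ (a ∷ p) []       q h = *ₚ-zeroˡ (a ∷ p) q h
*ₚ-congˡ (a ∷ p) (b ∷ p′) q h = +ₚ-cong (scale-cong {p = q} (coeffs h 0) ≋-refl) (∷-cong refl (*ₚ-congˡ p p′ q (co λ k → coeffs h (suc k))))

*ₚ-cong : ∀ {p p′ q q′} → p ≋ p′ → q ≋ q′ → p *ₚ q ≋ p′ *ₚ q′
*ₚ-cong {p} {p′} {q} h g = ≋-trans (*ₚ-congˡ p p′ q h) (*ₚ-congʳ p′ g)

*ₚ-distribʳ : ∀ r p q → (p +ₚ q) *ₚ r ≋ p *ₚ r +ₚ q *ₚ r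
*ₚ-distribʳ r []      q       = ≋-refl
*ₚ-distribʳ r (a ∷ p) []      = ≋-sym (+ₚ-identityʳ ((a ∷ p) *ₚ r))
*ₚ-distribʳ r (a ∷ p) (b ∷ q) = ≋-trans (+ₚ-cong (scale-distrib a b r) (∷-cong refl (*ₚ-distribʳ r p q)))
  (+ₚ-interchange (scaleₚ a r) (scaleₚ b r) (0ℤ ∷ p *ₚ r) (0ℤ ∷ q *ₚ r))

*ₚ-[] : ∀ p → p *ₚ [] ≋ []
*ₚ-[] []      = ≋-refl
*ₚ-[] (a ∷ p) = ∷-0 refl (*ₚ-[] p)

*ₚ-∷ : ∀ q a p → q *ₚ (a ∷ p) ≋ scaleₚ a q +ₚ (0ℤ ∷ q *ₚ p)
*ₚ-∷ []      a p = ≋-sym (∷-0 refl ≋-refl)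
*ₚ-∷ (b ∷ q) a p = ∷-cong (cong (_+ 0ℤ) (ℤP.*-comm b a)) (≋-trans (+ₚ-cong (≋-refl {scaleₚ b p}) (*ₚ-∷ q a p))
  (≋-trans (≋-sym (+ₚ-assoc (scaleₚ b p) (scaleₚ a q) (0ℤ ∷ q *ₚ p)))
  (≋-trans (+ₚ-cong (+ₚ-comm (scaleₚ b p) (scaleₚ a q)) (≋-refl {0ℤ ∷ q *ₚ p})) (+ₚ-assoc (scaleₚ a q) (scaleₚ b p) (0ℤ ∷ q *ₚ p)))))

*ₚ-comm : ∀ p q → p *ₚ q ≋ q *ₚ p
*ₚ-comm []      q = ≋-sym (*ₚ-[] q)
*ₚ-comm (a ∷ p) q = ≋-trans (+ₚ-cong (≋-refl {scaleₚ a q}) (∷-cong refl (*ₚ-comm p q))) (≋-sym (*ₚ-∷ q a p))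

scale-* : ∀ c p q → scaleₚ c p *ₚ q ≋ scaleₚ c (p *ₚ q)
scale-* c []      q = ≋-refl
scale-* c (a ∷ p) q = ≋-trans (+ₚ-cong (≋-sym (scale-scale c a q)) (∷-cong (sym (ℤP.*-zeroʳ c)) (scale-* c p q)))
  (≋-sym (scale-+ c (scaleₚ a q) (0ℤ ∷ p *ₚ q)))

shift-* : ∀ p q → (0ℤ ∷ p) *ₚ q ≋ 0ℤ ∷ (p *ₚ q)
shift-* p q = +ₚ-cong (scale-0 q) ≋-refl

*ₚ-assoc : ∀ p q r → (p *ₚ q) *ₚ r ≋ p *ₚ (q *ₚ r)
*ₚ-assoc []      q r = ≋-refl
*ₚ-assoc (a ∷ p) q r = ≋-trans (*ₚ-distribʳ r (scaleₚ a q) (0ℤ ∷ p *ₚ q))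
  (+ₚ-cong (scale-* a q r) (≋-trans (shift-* (p *ₚ q) r) (∷-cong refl (*ₚ-assoc p q r))))

const-* : ∀ c q → constₚ c *ₚ q ≋ scaleₚ c q
const-* c q = ≋-trans (+ₚ-cong (≋-refl {scaleₚ c q}) (∷-0 refl ≋-refl)) (+ₚ-identityʳ (scaleₚ c q))

*ₚ-identityˡ : ∀ q → 1ₚ *ₚ q ≋ q
*ₚ-identityˡ q = ≋-trans (const-* 1ℤ q) (scale-1 q)

polyRing : CommutativeRing 0ℓ 0ℓ
polyRing = record
  { Carrier = Poly ; _≈_ = _≋_ ; _+_ = _+ₚ_ ; _*_ = _*ₚ_ ; -_ = -ₚ_ ; 0# = 0ₚ ; 1# = 1ₚ
  ; isCommutativeRing = record
    { isRing = record
      { +-isAbelianGroup = record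
        { isGroup = record
          { isMonoid = record
            { isSemigroup = record
              { isMagma = record { isEquivalence = record { refl = ≋-refl ; sym = ≋-sym ; trans = ≋-trans } ; ∙-cong = +ₚ-cong }
              ; assoc = +ₚ-assoc }
            ; identity = (λ p → ≋-refl) , +ₚ-identityʳ }
          ; inverse = (λ p → ≋-trans (+ₚ-comm (-ₚ p) p) (-ₚ-inverseʳ p)) , -ₚ-inverseʳ
          ; ⁻¹-cong = -ₚ-cong }
        ; comm = +ₚ-comm }
      ; *-cong = *ₚ-cong
      ; *-assoc = *ₚ-assoc
      ; *-identity = *ₚ-identityˡ , (λ q → ≋-trans (*ₚ-comm q 1ₚ) (*ₚ-identityˡ q))
      ; distrib = (λ p q r → ≋-trans (*ₚ-comm p (q +ₚ r)) (≋-trans (*ₚ-distribʳ p q r) (+ₚ-cong (*ₚ-comm q p) (*ₚ-comm r p)))) , *ₚ-distribʳ }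
    ; *-comm = *ₚ-comm } }

zero? : ∀ p → Maybe ([] ≋ p)
zero? [] = just ≋-refl
zero? (a ∷ p) with a ℤP.≟ 0ℤ | zero? p
... | yes h | just g = just (≋-sym (∷-0 h (≋-sym g)))
... | _     | _      = nothing

polySolver : AlmostCommutativeRing 0ℓ 0ℓ
polySolver = fromCommutativeRing polyRing zero?

-- Determinants and alternating forms

sumₚ-cong : ∀ {n} {f g : Fin n → Poly} → (∀ i → f i ≋ g i) → sumₚ n f ≋ sumₚ n g
sumₚ-cong {zero}  h = ≋-refl
sumₚ-cong {suc n} h = +ₚ-cong (h zero) (sumₚ-cong (λ i → h (suc i)))

sumₚ-+ : ∀ {n} (f g : Fin n → Poly) → sumₚ n (λ i → f i +ₚ g i) ≋ sumₚ n f +ₚ sumₚ n g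
sumₚ-+ {zero}  f g = ≋-refl
sumₚ-+ {suc n} f g = ≋-trans (+ₚ-cong (≋-refl {f zero +ₚ g zero}) (sumₚ-+ (λ i → f (suc i)) (λ i → g (suc i)))) (+ₚ-interchange (f zero) (g zero) _ _)

*ₚ-distribˡ : ∀ p q r → p *ₚ (q +ₚ r) ≋ p *ₚ q +ₚ p *ₚ r
*ₚ-distribˡ = solveR polySolver

sumₚ-* : ∀ {n} c (f : Fin n → Poly) → sumₚ n (λ i → c *ₚ f i) ≋ c *ₚ sumₚ n f
sumₚ-* {zero}  c f = ≋-sym (*ₚ-[] c)
sumₚ-* {suc n} c f = ≋-trans (+ₚ-cong (≋-refl {c *ₚ f zero}) (sumₚ-* c (λ i → f (suc i)))) (≋-sym (*ₚ-distribˡ c (f zero) _))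

sumₚ-0 : ∀ {n} {f : Fin n → Poly} → (∀ i → f i ≋ []) → sumₚ n f ≋ []
sumₚ-0 {zero}  h = ≋-refl
sumₚ-0 {suc n} h = +ₚ-cong (h zero) (sumₚ-0 (λ i → h (suc i)))

σ : ℕ → Poly
σ k = signₚ k 1ₚ

neg-* : ∀ p q → (-ₚ p) *ₚ q ≋ -ₚ (p *ₚ q)
neg-* = solveR polySolver

sign-σ : ∀ k p → signₚ k p ≋ σ k *ₚ p
sign-σ zero          p = ≋-sym (*ₚ-identityˡ p)
sign-σ (suc zero)    p = ≋-trans (-ₚ-cong (≋-sym (*ₚ-identityˡ p))) (≋-sym (neg-* 1ₚ p))
sign-σ (suc (suc k)) p = sign-σ k p

σ-suc : ∀ k → σ (suc k) ≋ -ₚ σ k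
σ-suc zero          = ≋-refl
σ-suc (suc zero)    = co λ { zero → refl ; (suc k) → refl }
σ-suc (suc (suc k)) = σ-suc k

Row : ℕ → Set
Row k = Fin k → Poly

Mat : ℕ → ℕ → Set
Mat n k = Fin n → Row k

infixl 6 _⊕_
_⊕_ : ∀ {k} → Row k → Row k → Row k
(u ⊕ v) j = u j +ₚ v j

infixl 7 _⊙_
_⊙_ : ∀ {k} → Poly → Row k → Row k
(c ⊙ u) j = c *ₚ u j

infix 4 _≋ᵣ_
_≋ᵣ_ : ∀ {k} → Row k → Row k → Set
u ≋ᵣ v = ∀ j → u j ≋ v j

_≋ₘ_ : ∀ {n k} → Mat n k → Mat n k → Set
M ≋ₘ N = ∀ i → M i ≋ᵣ N i

upd : ∀ {n} {X : Set} → Fin n → X → (Fin n → X) → Fin n → X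
upd zero    u M zero    = u
upd zero    u M (suc a) = M (suc a)
upd (suc i) u M zero    = M zero
upd (suc i) u M (suc a) = upd i u (λ a → M (suc a)) a

upd-map : ∀ {n} {X Y : Set} (g : X → Y) (i : Fin n) u M a → g (upd i u M a) ≡ upd i (g u) (λ a → g (M a)) a
upd-map g zero    u M zero    = refl
upd-map g zero    u M (suc a) = refl
upd-map g (suc i) u M zero    = refl
upd-map g (suc i) u M (suc a) = upd-map g i u (λ a → M (suc a)) a

upd-same : ∀ {n} {X : Set} (i : Fin n) (u : X) M → upd i u M i ≡ u
upd-same zero    u M = refl
upd-same (suc i) u M = upd-same i u (λ a → M (suc a))

upd-cong : ∀ {n k} (i : Fin n) {u v : Row k} {M N : Mat n k} → u ≋ᵣ v → (∀ a → a ≢ i → M a ≋ᵣ N a) → upd i u M ≋ₘ upd i v N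
upd-cong zero    h g zero    = h
upd-cong zero    h g (suc a) = g (suc a) (λ ())
upd-cong (suc i) h g zero    = g zero (λ ())
upd-cong (suc i) h g (suc a) = upd-cong i h (λ a q → g (suc a) (λ r → q (FP.suc-injective r))) a

upd-self : ∀ {n k} (i : Fin n) {u : Row k} {M : Mat n k} → u ≋ᵣ M i → upd i u M ≋ₘ M
upd-self zero    h zero    = h
upd-self zero    h (suc a) = λ _ → ≋-refl
upd-self (suc i) h zero    = λ _ → ≋-refl
upd-self (suc i) {M = M} h (suc a) = upd-self i {M = λ a → M (suc a)} h a

record Alternating {n k : ℕ} (f : Mat n k → Poly) : Set where
  field
    f-cong : ∀ {M N} → M ≋ₘ N → f M ≋ f N
    f-add  : ∀ M i u v → f (upd i (u ⊕ v) M) ≋ f (upd i u M) +ₚ f (upd i v M)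
    f-scal : ∀ M i c u → f (upd i (c ⊙ u) M) ≋ c *ₚ f (upd i u M)
    f-alt  : ∀ M i j → i ≢ j → M i ≋ᵣ M j → f M ≋ []

-- The pair (a, k) encodes the ordered pair (a, punchIn a k); swp encodes the reversed pair.
swp : ∀ {n} → Fin (suc (suc n)) → Fin (suc n) → Fin (suc (suc n)) × Fin (suc n)
swp zero    k       = suc k , zero
swp (suc a) zero    = zero , a
swp {suc n} (suc a) (suc k) = let b , l = swp a k in suc b , suc l

swp-fst : ∀ {n} (a : Fin (suc (suc n))) k → proj₁ (swp a k) ≡ punchIn a k
swp-fst zero    k       = refl
swp-fst (suc a) zero    = refl
swp-fst {suc n} (suc a) (suc k) = cong suc (swp-fst a k)

swp-back : ∀ {n} (a : Fin (suc (suc n))) k → punchIn (proj₁ (swp a k)) (proj₂ (swp a k)) ≡ a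
swp-back zero    k       = refl
swp-back (suc a) zero    = refl
swp-back {suc n} (suc a) (suc k) = cong suc (swp-back a k)

swp-rest : ∀ {n} (a : Fin (suc (suc n))) k c →
           punchIn (proj₁ (swp a k)) (punchIn (proj₂ (swp a k)) c) ≡ punchIn a (punchIn k c)
swp-rest zero    k       c       = refl
swp-rest (suc a) zero    c       = refl
swp-rest {suc n} (suc a) (suc k) zero    = refl
swp-rest {suc n} (suc a) (suc k) (suc c) = cong suc (swp-rest a k c)

σ₂ : ∀ {m n} → Fin m → Fin n → Poly
σ₂ a k = σ (toℕ a) *ₚ σ (toℕ k)

σ₂-suc : ∀ {m n} (a : Fin m) (k : Fin n) → σ₂ (suc a) (suc k) ≋ σ₂ a k
σ₂-suc a k = ≋-trans (*ₚ-cong (σ-suc (toℕ a)) (σ-suc (toℕ k))) (l (σ (toℕ a)) (σ (toℕ k)))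
  where
  l : ∀ a b → (-ₚ a) *ₚ (-ₚ b) ≋ a *ₚ b
  l = solveR polySolver

swp-sign : ∀ {n} (a : Fin (suc (suc n))) k → σ₂ (proj₁ (swp a k)) (proj₂ (swp a k)) ≋ -ₚ σ₂ a k
swp-sign zero    k       = ≋-trans (*ₚ-cong (σ-suc (toℕ k)) (≋-refl {1ₚ})) (l (σ (toℕ k)) 1ₚ)
  where
  l : ∀ a b → (-ₚ a) *ₚ b ≋ -ₚ (b *ₚ a)
  l = solveR polySolver
swp-sign (suc a) zero    = ≋-trans (l 1ₚ (σ (toℕ a))) (-ₚ-cong (*ₚ-cong (≋-sym (σ-suc (toℕ a))) (≋-refl {1ₚ})))
  where
  l : ∀ b a → b *ₚ a ≋ -ₚ ((-ₚ a) *ₚ b)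
  l = solveR polySolver
swp-sign {suc n} (suc a) (suc k) = ≋-trans (σ₂-suc (proj₁ (swp a k)) (proj₂ (swp a k))) (≋-trans (swp-sign a k) (-ₚ-cong (≋-sym (σ₂-suc a k))))

-- The terms over ordered pairs cancel against those of the reversed pairs. Pairs containing index 0
-- are matched directly, (0, k) with (k + 1, 0); the rest is the same sum in one dimension less.
pair-sum : ∀ n (g : Fin (suc (suc n)) → Fin (suc n) → Poly) → (∀ a k → g (proj₁ (swp a k)) (proj₂ (swp a k)) ≋ -ₚ g a k) →
           sumₚ (suc (suc n)) (λ a → sumₚ (suc n) (g a)) ≋ []
pair-sum n g anti = ≋-trans (+ₚ-cong (≋-refl {sumₚ (suc n) (g zero)}) (sumₚ-+ (λ a → g (suc a) zero) (λ a → sumₚ n (λ k → g (suc a) (suc k)))))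
  (≋-trans (≋-sym (+ₚ-assoc (sumₚ (suc n) (g zero)) _ _)) (+ₚ-cong
    (≋-trans (≋-sym (sumₚ-+ (g zero) (λ a → g (suc a) zero)))
             (sumₚ-0 (λ k → ≋-trans (+ₚ-cong (≋-refl {g zero k}) (anti zero k)) (-ₚ-inverseʳ (g zero k)))))
    (rest n g anti)))
  where
  rest : ∀ n (g : Fin (suc (suc n)) → Fin (suc n) → Poly) → (∀ a k → g (proj₁ (swp a k)) (proj₂ (swp a k)) ≋ -ₚ g a k) →
         sumₚ (suc n) (λ a → sumₚ n (λ k → g (suc a) (suc k))) ≋ []
  rest zero    g anti = ≋-refl
  rest (suc n) g anti = pair-sum n (λ a k → g (suc a) (suc k)) (λ a k → anti (suc a) (suc k))

minor : ∀ {r} → Fin (suc r) → Mat (suc r) (suc r) → Mat r r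
minor j M a b = M (suc a) (punchIn j b)

det-cong : ∀ r {M N : Mat r r} → M ≋ₘ N → detₚ r M ≋ detₚ r N
det-cong zero    h = ≋-refl
det-cong (suc r) {M} {N} h = sumₚ-cong λ j → ≋-trans (sign-σ (toℕ j) (M zero j *ₚ detₚ r (minor j M)))
  (≋-trans (*ₚ-cong (≋-refl {σ (toℕ j)}) (*ₚ-cong (h zero j) (det-cong r (λ a b → h (suc a) (punchIn j b)))))
           (≋-sym (sign-σ (toℕ j) (N zero j *ₚ detₚ r (minor j N)))))

det-expand : ∀ r (M : Mat (suc r) (suc r)) → detₚ (suc r) M ≋ sumₚ (suc r) (λ j → σ (toℕ j) *ₚ (M zero j *ₚ detₚ r (minor j M)))
det-expand r M = sumₚ-cong λ j → sign-σ (toℕ j) (M zero j *ₚ detₚ r (minor j M))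

minor-upd : ∀ {r} (j : Fin (suc r)) i (u : Row (suc r)) M → minor j (upd (suc i) u M) ≋ₘ upd i (λ b → u (punchIn j b)) (minor j M)
minor-upd j i u M a b = ≡⇒≋ (cong (λ z → z b) (upd-map (λ (v : Row _) b → v (punchIn j b)) i u (λ a → M (suc a)) a))
  where
  ≡⇒≋ : ∀ {p q} → p ≡ q → p ≋ q
  ≡⇒≋ refl = ≋-refl

det-add : ∀ r (M : Mat r r) i u v → detₚ r (upd i (u ⊕ v) M) ≋ detₚ r (upd i u M) +ₚ detₚ r (upd i v M)
det-add (suc r) M zero u v = ≋-trans (det-expand r (upd zero (u ⊕ v) M)) (≋-trans
  (≋-trans (sumₚ-cong λ j → l (σ (toℕ j)) (u j) (v j) (detₚ r (minor j M)))
           (sumₚ-+ (λ j → σ (toℕ j) *ₚ (u j *ₚ detₚ r (minor j M))) (λ j → σ (toℕ j) *ₚ (v j *ₚ detₚ r (minor j M)))))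
  (≋-sym (+ₚ-cong (det-expand r (upd zero u M)) (det-expand r (upd zero v M)))))
  where
  l : ∀ s u v d → s *ₚ ((u +ₚ v) *ₚ d) ≋ s *ₚ (u *ₚ d) +ₚ s *ₚ (v *ₚ d)
  l = solveR polySolver
det-add (suc r) M (suc i) u v = ≋-trans (det-expand r (upd (suc i) (u ⊕ v) M)) (≋-trans
  (≋-trans (sumₚ-cong λ j → ≋-trans (*ₚ-cong (≋-refl {σ (toℕ j)}) (*ₚ-cong (≋-refl {M zero j})
             (≋-trans (det-cong r (minor-upd j i (u ⊕ v) M)) (≋-trans (det-add r (minor j M) i (λ b → u (punchIn j b)) (λ b → v (punchIn j b)))
               (+ₚ-cong (≋-sym (det-cong r (minor-upd j i u M))) (≋-sym (det-cong r (minor-upd j i v M))))))))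
             (l (σ (toℕ j)) (M zero j) (detₚ r (minor j (upd (suc i) u M))) (detₚ r (minor j (upd (suc i) v M)))))
           (sumₚ-+ (λ j → σ (toℕ j) *ₚ (M zero j *ₚ detₚ r (minor j (upd (suc i) u M)))) (λ j → σ (toℕ j) *ₚ (M zero j *ₚ detₚ r (minor j (upd (suc i) v M))))))
  (≋-sym (+ₚ-cong (det-expand r (upd (suc i) u M)) (det-expand r (upd (suc i) v M)))))
  where
  l : ∀ s m d e → s *ₚ (m *ₚ (d +ₚ e)) ≋ s *ₚ (m *ₚ d) +ₚ s *ₚ (m *ₚ e)
  l = solveR polySolver

det-scal : ∀ r (M : Mat r r) i c u → detₚ r (upd i (c ⊙ u) M) ≋ c *ₚ detₚ r (upd i u M)
det-scal (suc r) M zero c u = ≋-trans (det-expand r (upd zero (c ⊙ u) M)) (≋-trans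
  (≋-trans (sumₚ-cong λ j → l (σ (toℕ j)) c (u j) (detₚ r (minor j M))) (sumₚ-* c (λ j → σ (toℕ j) *ₚ (u j *ₚ detₚ r (minor j M)))))
  (*ₚ-cong (≋-refl {c}) (≋-sym (det-expand r (upd zero u M)))))
  where
  l : ∀ s c u d → s *ₚ ((c *ₚ u) *ₚ d) ≋ c *ₚ (s *ₚ (u *ₚ d))
  l = solveR polySolver
det-scal (suc r) M (suc i) c u = ≋-trans (det-expand r (upd (suc i) (c ⊙ u) M)) (≋-trans
  (≋-trans (sumₚ-cong λ j → ≋-trans (*ₚ-cong (≋-refl {σ (toℕ j)}) (*ₚ-cong (≋-refl {M zero j})
             (≋-trans (det-cong r (minor-upd j i (c ⊙ u) M)) (≋-trans (det-scal r (minor j M) i c (λ b → u (punchIn j b)))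
               (*ₚ-cong (≋-refl {c}) (≋-sym (det-cong r (minor-upd j i u M))))))))
             (l (σ (toℕ j)) (M zero j) c (detₚ r (minor j (upd (suc i) u M)))))
           (sumₚ-* c (λ j → σ (toℕ j) *ₚ (M zero j *ₚ detₚ r (minor j (upd (suc i) u M))))))
  (*ₚ-cong (≋-refl {c}) (≋-sym (det-expand r (upd (suc i) u M)))))
  where
  l : ∀ s m c d → s *ₚ (m *ₚ (c *ₚ d)) ≋ c *ₚ (s *ₚ (m *ₚ d))
  l = solveR polySolver

-- Expansion along both equal rows gives a sum over ordered pairs of columns. Reversing a pair keeps
-- the remaining minor and the product of entries but flips the sign, so `pair-sum` applies.
det-alt₀₁ : ∀ r (M : Mat (suc (suc r)) (suc (suc r))) → M zero ≋ᵣ M (suc zero) → detₚ (suc (suc r)) M ≋ []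
det-alt₀₁ r M h = ≋-trans (det-expand (suc r) M) (≋-trans (sumₚ-cong row) (pair-sum r g anti))
  where
  u = M zero
  D : Fin (suc (suc r)) → Fin (suc r) → Poly
  D a k = detₚ r (λ i c → M (suc (suc i)) (punchIn a (punchIn k c)))
  g : Fin (suc (suc r)) → Fin (suc r) → Poly
  g a k = σ₂ a k *ₚ ((u a *ₚ u (punchIn a k)) *ₚ D a k)
  row : ∀ a → σ (toℕ a) *ₚ (u a *ₚ detₚ (suc r) (minor a M)) ≋ sumₚ (suc r) (g a)
  row a = ≋-trans (*ₚ-cong (≋-refl {σ (toℕ a)}) (*ₚ-cong (≋-refl {u a}) (det-expand r (minor a M))))
    (≋-trans (*ₚ-cong (≋-refl {σ (toℕ a)}) (≋-sym (sumₚ-* (u a) (λ k → σ (toℕ k) *ₚ (M (suc zero) (punchIn a k) *ₚ D a k)))))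
    (≋-trans (≋-sym (sumₚ-* (σ (toℕ a)) (λ k → u a *ₚ (σ (toℕ k) *ₚ (M (suc zero) (punchIn a k) *ₚ D a k)))))
      (sumₚ-cong λ k → ≋-trans (*ₚ-cong (≋-refl {σ (toℕ a)}) (*ₚ-cong (≋-refl {u a}) (*ₚ-cong (≋-refl {σ (toℕ k)}) (*ₚ-cong (≋-sym (h (punchIn a k))) (≋-refl {D a k})))))
        (l (σ (toℕ a)) (u a) (σ (toℕ k)) (u (punchIn a k)) (D a k)))))
    where
    l : ∀ s u t v d → s *ₚ (u *ₚ (t *ₚ (v *ₚ d))) ≋ (s *ₚ t) *ₚ ((u *ₚ v) *ₚ d)
    l = solveR polySolver
  ≡⇒≋ : ∀ {p q} → p ≡ q → p ≋ q
  ≡⇒≋ refl = ≋-refl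
  anti : ∀ a k → g (proj₁ (swp a k)) (proj₂ (swp a k)) ≋ -ₚ g a k
  anti a k = ≋-trans (*ₚ-cong (swp-sign a k) (*ₚ-cong (*ₚ-cong (≡⇒≋ (cong u (swp-fst a k))) (≡⇒≋ (cong u (swp-back a k))))
      (det-cong r (λ i c → ≡⇒≋ (cong (M (suc (suc i))) (swp-rest a k c))))))
    (l (σ₂ a k) (u a) (u (punchIn a k)) (D a k))
    where
    l : ∀ s u v d → (-ₚ s) *ₚ ((v *ₚ u) *ₚ d) ≋ -ₚ (s *ₚ ((u *ₚ v) *ₚ d))
    l = solveR polySolver

AltRows : ℕ → Set
AltRows r = ∀ (M : Mat r r) i j → i ≢ j → M i ≋ᵣ M j → detₚ r M ≋ []

AltTail : ℕ → Set
AltTail r = ∀ (M : Mat (suc r) (suc r)) i j → i ≢ j → M (suc i) ≋ᵣ M (suc j) → detₚ (suc r) M ≋ []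

det-alt-suc : ∀ r → AltRows r → AltTail r
det-alt-suc r ih M i j h q = ≋-trans (det-expand r M) (sumₚ-0 λ a →
  ≋-trans (*ₚ-cong (≋-refl {σ (toℕ a)}) (≋-trans (*ₚ-cong (≋-refl {M zero a}) (ih (minor a M) i j h (λ b → q (punchIn a b)))) (*ₚ-[] (M zero a))))
          (*ₚ-[] (σ (toℕ a))))

-- Rows 0 and 2+j equal: put the sum of rows 1 and 2+j into both places and expand.
det-alt-0 : ∀ r → AltTail r → ∀ (M : Mat (suc r) (suc r)) j → M zero ≋ᵣ M (suc j) → detₚ (suc r) M ≋ []
det-alt-0 (suc r) alt M zero    q = det-alt₀₁ r M q
det-alt-0 (suc r) alt M (suc j) q = ≋-trans (det-cong (suc (suc r)) (λ a → back a)) (≋-trans (≋-sym (l d₁₁ d₁₀ d₀₁ d₀₀)) (≋-trans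
    (+ₚ-cong (≋-sym expand₄) (-ₚ-cong (+ₚ-cong (+ₚ-cong z₁₁ z₀₁) z₀₀)))
    (+ₚ-cong z-sum ≋-refl)))
  where
  J : Fin (suc (suc r))
  J = suc (suc j)
  one : Fin (suc (suc r))
  one = suc zero
  r₀ = M zero
  r₁ = M one
  two : Row (suc (suc r)) → Row (suc (suc r)) → Mat (suc (suc r)) (suc (suc r))
  two x y = upd one x (upd J y M)
  d : Row (suc (suc r)) → Row (suc (suc r)) → Poly
  d x y = detₚ (suc (suc r)) (two x y)
  d₁₁ = d r₁ r₁
  d₁₀ = d r₁ r₀
  d₀₁ = d r₀ r₁
  d₀₀ = d r₀ r₀
  back : M ≋ₘ two r₁ r₀
  back a b = ≋-sym (≋-trans (upd-self one {r₁} {upd J r₀ M} (λ _ → ≋-refl) a b) (upd-self J {r₀} {M} q a b))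
  flip : ∀ x y → two x y ≋ₘ upd J y (upd one x M)
  flip x y zero b = ≋-refl
  flip x y (suc zero) b = ≋-refl
  flip x y (suc (suc a)) b = ≋-refl
  expand₄ : d (r₁ ⊕ r₀) (r₁ ⊕ r₀) ≋ (d₁₁ +ₚ d₁₀) +ₚ (d₀₁ +ₚ d₀₀)
  expand₄ = ≋-trans (det-add (suc (suc r)) (upd J (r₁ ⊕ r₀) M) one r₁ r₀) (+ₚ-cong (inner r₁) (inner r₀))
    where
    inner : ∀ x → d x (r₁ ⊕ r₀) ≋ d x r₁ +ₚ d x r₀
    inner x = ≋-trans (det-cong (suc (suc r)) (flip x (r₁ ⊕ r₀))) (≋-trans (det-add (suc (suc r)) (upd one x M) J r₁ r₀)
      (+ₚ-cong (≋-sym (det-cong (suc (suc r)) (flip x r₁))) (≋-sym (det-cong (suc (suc r)) (flip x r₀)))))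
  row-J : ∀ x y → two x y J ≡ y
  row-J x y = upd-same j y (λ a → M (suc (suc a)))
  both : ∀ x → d x x ≋ []
  both x = alt (two x x) zero (suc j) (λ ()) (λ b → subst (λ z → x b ≋ z b) (sym (row-J x x)) ≋-refl)
  z₁₁ : d₁₁ ≋ []
  z₁₁ = both r₁
  z₀₀ : d₀₀ ≋ []
  z₀₀ = both r₀
  z-sum : d (r₁ ⊕ r₀) (r₁ ⊕ r₀) ≋ []
  z-sum = both (r₁ ⊕ r₀)
  z₀₁ : d₀₁ ≋ []
  z₀₁ = det-alt₀₁ r (two r₀ r₁) (λ _ → ≋-refl)
  l : ∀ a b c e → ((a +ₚ b) +ₚ (c +ₚ e)) +ₚ (-ₚ ((a +ₚ c) +ₚ e)) ≋ b
  l = solveR polySolver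

det-alt : ∀ r → AltRows r
det-alt (suc r) M zero    zero    h q = ⊥-elim (h refl)
det-alt (suc r) M zero    (suc j) h q = det-alt-0 r (det-alt-suc r (det-alt r)) M j q
det-alt (suc r) M (suc i) zero    h q = det-alt-0 r (det-alt-suc r (det-alt r)) M i (λ b → ≋-sym (q b))
det-alt (suc r) M (suc i) (suc j) h q = det-alt-suc r (det-alt r) M i j (λ p → h (cong suc p)) q

det-alternating : ∀ r → Alternating (detₚ r)
det-alternating r = record { f-cong = det-cong r ; f-add = det-add r ; f-scal = det-scal r ; f-alt = det-alt r }

cons : ∀ {n} {X : Set} → X → (Fin n → X) → Fin (suc n) → X
cons u T zero    = u
cons u T (suc a) = T a

eP : ∀ {n} → Mat n n
eP zero    zero    = 1ₚ
eP zero    (suc _) = 0ₚ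
eP (suc j) zero    = 0ₚ
eP (suc j) (suc i) = eP j i

ins : ∀ {n} → Fin (suc n) → Row n → Row (suc n)
ins zero    v zero    = 0ₚ
ins zero    v (suc b) = v b
ins {suc n} (suc j) v zero    = v zero
ins {suc n} (suc j) v (suc b) = ins j (λ b → v (suc b)) b

ins-cong : ∀ {n} (j : Fin (suc n)) {u v : Row n} → u ≋ᵣ v → ins j u ≋ᵣ ins j v
ins-cong zero    h zero    = ≋-refl
ins-cong zero    h (suc b) = h b
ins-cong {suc n} (suc j) h zero    = h zero
ins-cong {suc n} (suc j) h (suc b) = ins-cong j (λ b → h (suc b)) b

ins-⊕ : ∀ {n} (j : Fin (suc n)) (u v : Row n) → ins j (u ⊕ v) ≋ᵣ ins j u ⊕ ins j v
ins-⊕ zero    u v zero    = ≋-refl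
ins-⊕ zero    u v (suc b) = ≋-refl
ins-⊕ {suc n} (suc j) u v zero    = ≋-refl
ins-⊕ {suc n} (suc j) u v (suc b) = ins-⊕ j (λ b → u (suc b)) (λ b → v (suc b)) b

ins-⊙ : ∀ {n} (j : Fin (suc n)) c (u : Row n) → ins j (c ⊙ u) ≋ᵣ c ⊙ ins j u
ins-⊙ zero    c u zero    = ≋-sym (*ₚ-[] c)
ins-⊙ zero    c u (suc b) = ≋-refl
ins-⊙ {suc n} (suc j) c u zero    = ≋-refl
ins-⊙ {suc n} (suc j) c u (suc b) = ins-⊙ j c (λ b → u (suc b)) b

ins-eP : ∀ {n} (j : Fin (suc n)) a → ins j (eP a) ≋ᵣ eP (punchIn j a)
ins-eP zero    a       zero    = ≋-refl
ins-eP zero    a       (suc b) = ≋-refl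
ins-eP {suc n} (suc j) zero    zero    = ≋-refl
ins-eP {suc n} (suc j) zero    (suc b) = ins-0 j b
  where
  ins-0 : ∀ {n} (j : Fin (suc n)) → ins j (λ _ → 0ₚ) ≋ᵣ (λ _ → 0ₚ)
  ins-0 zero    zero    = ≋-refl
  ins-0 zero    (suc b) = ≋-refl
  ins-0 {suc n} (suc j) zero    = ≋-refl
  ins-0 {suc n} (suc j) (suc b) = ins-0 j b
ins-eP {suc n} (suc j) (suc a) zero    = ≋-refl
ins-eP {suc n} (suc j) (suc a) (suc b) = ins-eP j a b

ins-split : ∀ {n} (j : Fin (suc n)) (u : Row (suc n)) → u ≋ᵣ ins j (λ b → u (punchIn j b)) ⊕ u j ⊙ eP j
ins-split zero u zero    = ≋-sym (≋-trans (*ₚ-comm (u zero) 1ₚ) (*ₚ-identityˡ (u zero)))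
ins-split zero u (suc b) = ≋-sym (≋-trans (+ₚ-cong (≋-refl {u (suc b)}) (*ₚ-[] (u zero))) (+ₚ-identityʳ (u (suc b))))
ins-split {suc n} (suc j) u zero    = ≋-sym (≋-trans (+ₚ-cong (≋-refl {u zero}) (*ₚ-[] (u (suc j)))) (+ₚ-identityʳ (u zero)))
ins-split {suc n} (suc j) u (suc b) = ins-split j (λ b → u (suc b)) b

sum-eP : ∀ {n} (f : Fin n → Poly) b → sumₚ n (λ j → f j *ₚ eP j b) ≋ f b
sum-eP {suc n} f zero    = ≋-trans (+ₚ-cong (≋-trans (*ₚ-comm (f zero) 1ₚ) (*ₚ-identityˡ (f zero))) (sumₚ-0 (λ j → *ₚ-[] (f (suc j))))) (+ₚ-identityʳ (f zero))
sum-eP {suc n} f (suc b) = +ₚ-cong (*ₚ-[] (f zero)) (sum-eP (λ j → f (suc j)) b)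

module _ {n k : ℕ} {f : Mat n k → Poly} (alt : Alternating f) where
  open Alternating alt

  lin-sum : ∀ {s} (c : Fin s → Poly) (R : Fin s → Row k) M i →
            f (upd i (λ b → sumₚ s (λ j → c j *ₚ R j b)) M) ≋ sumₚ s (λ j → c j *ₚ f (upd i (R j) M))
  lin-sum {zero}  c R M i = f-scal M i [] (M i)
  lin-sum {suc s} c R M i = ≋-trans (f-add M i (c zero ⊙ R zero) (λ b → sumₚ s (λ j → c (suc j) *ₚ R (suc j) b)))
    (+ₚ-cong (f-scal M i (c zero) (R zero)) (lin-sum (λ j → c (suc j)) (λ j → R (suc j)) M i))

module _ {n k : ℕ} {f : Mat (suc (suc n)) k → Poly} (alt : Alternating f) where
  open Alternating alt

  swap₀₁ : ∀ u v (T : Mat n k) → f (cons u (cons v T)) ≋ -ₚ f (cons v (cons u T))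
  swap₀₁ u v T = l (g u u) (g u v) (g v u) (g v v) (f-alt (cons u (cons u T)) zero (suc zero) (λ ()) (λ _ → ≋-refl))
      (f-alt (cons v (cons v T)) zero (suc zero) (λ ()) (λ _ → ≋-refl))
      (≋-trans (≋-sym expand₄) (f-alt (cons (u ⊕ v) (cons (u ⊕ v) T)) zero (suc zero) (λ ()) (λ _ → ≋-refl)))
    where
    g : Row k → Row k → Poly
    g x y = f (cons x (cons y T))
    upd₀ : ∀ x y z → upd zero x (cons z (cons y T)) ≋ₘ cons x (cons y T)
    upd₀ x y z zero          b = ≋-refl
    upd₀ x y z (suc a)       b = ≋-refl
    upd₁ : ∀ x y z → upd (suc zero) y (cons x (cons z T)) ≋ₘ cons x (cons y T)
    upd₁ x y z zero          b = ≋-refl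
    upd₁ x y z (suc zero)    b = ≋-refl
    upd₁ x y z (suc (suc a)) b = ≋-refl
    add₀ : ∀ x x′ y → g (x ⊕ x′) y ≋ g x y +ₚ g x′ y
    add₀ x x′ y = ≋-trans (≋-sym (f-cong (upd₀ (x ⊕ x′) y x))) (≋-trans (f-add (cons x (cons y T)) zero x x′) (+ₚ-cong (f-cong (upd₀ x y x)) (f-cong (upd₀ x′ y x))))
    add₁ : ∀ x y y′ → g x (y ⊕ y′) ≋ g x y +ₚ g x y′
    add₁ x y y′ = ≋-trans (≋-sym (f-cong (upd₁ x (y ⊕ y′) y))) (≋-trans (f-add (cons x (cons y T)) (suc zero) y y′) (+ₚ-cong (f-cong (upd₁ x y y)) (f-cong (upd₁ x y′ y))))
    expand₄ : g (u ⊕ v) (u ⊕ v) ≋ (g u u +ₚ g u v) +ₚ (g v u +ₚ g v v)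
    expand₄ = ≋-trans (add₀ u v (u ⊕ v)) (+ₚ-cong (add₁ u u v) (add₁ v u v))
    l : ∀ a b c d → a ≋ [] → d ≋ [] → (a +ₚ b) +ₚ (c +ₚ d) ≋ [] → b ≋ -ₚ c
    l a b c d ha hd h = ≋-trans (l1 a b c d) (≋-trans (+ₚ-cong (+ₚ-cong h (-ₚ-cong ha)) (+ₚ-cong (-ₚ-cong hd) (≋-refl { -ₚ c}))) ≋-refl)
      where
      l1 : ∀ a b c d → b ≋ (((a +ₚ b) +ₚ (c +ₚ d)) +ₚ (-ₚ a)) +ₚ ((-ₚ d) +ₚ (-ₚ c))
      l1 = solveR polySolver

-- The values of f on matrices with first row `eP j` and column j otherwise zero, as a function of
-- the complementary minor; it inherits being alternating, which drives the induction in
-- `universal`.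
restrict : ∀ {n} → (Mat (suc n) (suc n) → Poly) → Fin (suc n) → Mat n n → Poly
restrict f j N = f (cons (eP j) (λ a → ins j (N a)))

module _ {n : ℕ} {f : Mat (suc n) (suc n) → Poly} (alt : Alternating f) where
  open Alternating alt

  ≡⇒≋ᵣ : ∀ {k} {u v : Row k} → u ≡ v → u ≋ᵣ v
  ≡⇒≋ᵣ refl b = ≋-refl

  restrict-upd : ∀ j i u (M : Mat n n) → cons (eP j) (λ a → ins j (upd i u M a)) ≋ₘ upd (suc i) (ins j u) (cons (eP j) (λ a → ins j (M a)))
  restrict-upd j i u M zero    b = ≋-refl
  restrict-upd j i u M (suc a) b = ≡⇒≋ᵣ (upd-map (ins j) i u M a) b

  restrict-alternating : ∀ j → Alternating (restrict f j)
  restrict-alternating j = record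
    { f-cong = λ h → f-cong λ { zero b → ≋-refl ; (suc a) b → ins-cong j (h a) b }
    ; f-add = λ M i u v → ≋-trans (f-cong (restrict-upd j i (u ⊕ v) M)) (≋-trans
        (≋-trans (f-cong (upd-cong (suc i) (ins-⊕ j u v) (λ a _ b → ≋-refl))) (f-add (cons (eP j) (λ a → ins j (M a))) (suc i) (ins j u) (ins j v)))
        (+ₚ-cong (≋-sym (f-cong (restrict-upd j i u M))) (≋-sym (f-cong (restrict-upd j i v M)))))
    ; f-scal = λ M i c u → ≋-trans (f-cong (restrict-upd j i (c ⊙ u) M)) (≋-trans
        (≋-trans (f-cong (upd-cong (suc i) (ins-⊙ j c u) (λ a _ b → ≋-refl))) (f-scal (cons (eP j) (λ a → ins j (M a))) (suc i) c (ins j u)))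
        (*ₚ-cong (≋-refl {c}) (≋-sym (f-cong (restrict-upd j i u M)))))
    ; f-alt = λ M i i′ h q → f-alt (cons (eP j) (λ a → ins j (M a))) (suc i) (suc i′) (λ p → h (FP.suc-injective p)) (ins-cong j q) }

  clear-row : ∀ j (T : Mat n (suc n)) a → f (cons (eP j) T) ≋ f (cons (eP j) (upd a (ins j (λ b → T a (punchIn j b))) T))
  clear-row j T a = begin′
    where
    M = cons (eP j) T
    u = ins j (λ b → T a (punchIn j b))
    c = T a j
    same : ∀ x → upd (suc a) x M ≋ₘ cons (eP j) (upd a x T)
    same x zero    b = ≋-refl
    same x (suc i) b = ≋-refl
    zero-term : f (upd (suc a) (eP j) M) ≋ []
    zero-term = f-alt (upd (suc a) (eP j) M) zero (suc a) (λ ()) (λ b → ≋-sym (≡⇒≋ᵣ (upd-same (suc a) (eP j) M) b))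
    begin′ : f M ≋ f (cons (eP j) (upd a u T))
    begin′ = ≋-trans (≋-sym (f-cong (upd-self (suc a) {u ⊕ c ⊙ eP j} {M} (λ b → ≋-sym (ins-split j (T a) b)))))
      (≋-trans (f-add M (suc a) u (c ⊙ eP j)) (≋-trans (+ₚ-cong (f-cong (same u)) (≋-trans (f-scal M (suc a) c (eP j)) (≋-trans (*ₚ-cong (≋-refl {c}) zero-term) (*ₚ-[] c))))
        (+ₚ-identityʳ (f (cons (eP j) (upd a u T))))))

all-rows : ∀ {n k} (h : Mat n k → Poly) → (∀ {M N} → M ≋ₘ N → h M ≋ h N) → (φ : Row k → Row k) →
           (∀ T a → h T ≋ h (upd a (φ (T a)) T)) → ∀ T → h T ≋ h (λ a → φ (T a))
all-rows {zero}  h h-cong φ p T = h-cong (λ ())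
all-rows {suc n} h h-cong φ p T = ≋-trans (p T zero) (≋-trans (h-cong λ { zero b → ≋-refl ; (suc a) b → ≋-refl })
  (≋-trans (all-rows (λ S → h (cons (φ (T zero)) S)) (λ q → h-cong λ { zero b → ≋-refl ; (suc a) b → q a b }) φ
              (λ S a → ≋-trans (p (cons (φ (T zero)) S) (suc a)) (h-cong λ { zero b → ≋-refl ; (suc i) b → ≋-refl })) (λ a → T (suc a)))
    (h-cong λ { zero b → ≋-refl ; (suc a) b → ≋-refl })))

-- Moving row j of the identity to the top takes j adjacent transpositions. One is done by `swap₀₁`;
-- the others do not involve row 0 and follow by induction for the restricted form.
cyclic : ∀ n {f : Mat (suc n) (suc n) → Poly} → Alternating f → ∀ j → f (cons (eP j) (λ b → eP (punchIn j b))) ≋ σ (toℕ j) *ₚ f eP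
cyclic n {f} alt zero = ≋-trans (Alternating.f-cong alt λ { zero b → ≋-refl ; (suc a) b → ≋-refl }) (≋-sym (*ₚ-identityˡ (f eP)))
cyclic (suc n) {f} alt (suc j) =
  ≋-trans (f-cong λ { zero b → ≋-refl ; (suc zero) b → ≋-refl ; (suc (suc a)) b → ≋-refl })
  (≋-trans (swap₀₁ alt (eP (suc j)) (eP zero) (λ a → eP (suc (punchIn j a))))
  (≋-trans (-ₚ-cong (≋-trans (f-cong {_} {cons (eP zero) (λ a → ins zero (cons (eP j) (λ b → eP (punchIn j b)) a))}
        λ { zero b → ≋-refl ; (suc zero) b → ≋-sym (ins-eP zero j b) ; (suc (suc a)) b → ≋-sym (ins-eP zero (punchIn j a) b) })
      (≋-trans (cyclic n (restrict-alternating alt zero) j)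
        (*ₚ-cong (≋-refl {σ (toℕ j)}) (f-cong λ { zero b → ≋-refl ; (suc a) b → ins-eP zero a b })))))
    (≋-trans (≋-sym (neg-* (σ (toℕ j)) (f eP))) (*ₚ-cong (≋-sym (σ-suc (toℕ j))) (≋-refl {f eP})))))
  where open Alternating alt

-- Linearity in the first row reduces to rows `eP j`. Subtracting multiples of that row clears
-- column j below it, and by induction the restricted form is a multiple of the determinant of the
-- minor; `cyclic` supplies the cofactor sign.
universal : ∀ n {f : Mat n n → Poly} → Alternating f → ∀ M → f M ≋ detₚ n M *ₚ f eP
universal zero    {f} alt M = ≋-trans (Alternating.f-cong alt (λ ())) (≋-sym (*ₚ-identityˡ (f eP)))
universal (suc n) {f} alt M =
  ≋-trans (≋-sym (f-cong (upd-self zero {λ b → sumₚ (suc n) (λ j → M zero j *ₚ eP j b)} {M} (sum-eP (M zero)))))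
  (≋-trans (lin-sum alt (M zero) eP M zero)
  (≋-trans (sumₚ-cong term)
  (≋-trans (sumₚ-* (f eP) (λ j → σ (toℕ j) *ₚ (M zero j *ₚ detₚ n (minor j M))))
  (≋-trans (*ₚ-comm (f eP) _) (*ₚ-cong (≋-sym (det-expand n M)) (≋-refl {f eP}))))))
  where
  open Alternating alt
  term : ∀ j → M zero j *ₚ f (upd zero (eP j) M) ≋ (f eP) *ₚ (σ (toℕ j) *ₚ (M zero j *ₚ detₚ n (minor j M)))
  term j = ≋-trans (*ₚ-cong (≋-refl {M zero j}) value) (l (M zero j) (detₚ n (minor j M)) (σ (toℕ j)) (f eP))
    where
    T : Mat n (suc n)
    T a = M (suc a)
    value : f (upd zero (eP j) M) ≋ detₚ n (minor j M) *ₚ (σ (toℕ j) *ₚ f eP)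
    value = ≋-trans (f-cong {upd zero (eP j) M} {cons (eP j) T} λ { zero b → ≋-refl ; (suc a) b → ≋-refl })
      (≋-trans (all-rows (λ S → f (cons (eP j) S)) (λ q → f-cong λ { zero b → ≋-refl ; (suc a) b → q a b })
                 (λ u → ins j (λ b → u (punchIn j b))) (clear-row alt j) T)
      (≋-trans (universal n (restrict-alternating alt j) (minor j M))
        (*ₚ-cong (≋-refl {detₚ n (minor j M)})
          (≋-trans (f-cong {cons (eP j) (λ a → ins j (eP a))} {cons (eP j) (λ a → eP (punchIn j a))} λ { zero b → ≋-refl ; (suc a) b → ins-eP j a b }) (cyclic n alt j)))))
    l : ∀ m d s f → m *ₚ (d *ₚ (s *ₚ f)) ≋ f *ₚ (s *ₚ (m *ₚ d))
    l = solveR polySolver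

_·M_ : ∀ {n k s} → Mat n k → Mat k s → Mat n s
_·M_ {k = k} M N i j = sumₚ k (λ l → M i l *ₚ N l j)

-- For fixed N the function det (M N) is alternating in the rows of M, so uniqueness applies; its
-- value at the identity is det N.
det-mult : ∀ n (M N : Mat n n) → detₚ n (M ·M N) ≋ detₚ n M *ₚ detₚ n N
det-mult n M N = ≋-trans (universal n {λ M → detₚ n (M ·M N)} alt M) (*ₚ-cong (≋-refl {detₚ n M}) (det-cong n (λ i j → eP-·M i j)))
  where
  eP-·M : ∀ i j → (eP ·M N) i j ≋ N i j
  eP-·M i j = ≋-trans (sumₚ-cong (λ l → ≋-trans (*ₚ-comm (eP i l) (N l j)) (*ₚ-cong (≋-refl {N l j}) (eP-sym i l)))) (sum-eP (λ l → N l j) i)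
    where
    eP-sym : ∀ {n} (i l : Fin n) → eP i l ≋ eP l i
    eP-sym zero    zero    = ≋-refl
    eP-sym zero    (suc l) = ≋-refl
    eP-sym (suc i) zero    = ≋-refl
    eP-sym (suc i) (suc l) = eP-sym i l
  rowN : Row n → Row n
  rowN u j = sumₚ n (λ l → u l *ₚ N l j)
  upd-rowN : ∀ i u (M : Mat n n) → (upd i u M ·M N) ≋ₘ upd i (rowN u) (M ·M N)
  upd-rowN i u M a b = subst (λ z → rowN (upd i u M a) b ≋ z b) (upd-map rowN i u M a) ≋-refl
  open Alternating (det-alternating n)
  alt : Alternating (λ M → detₚ n (M ·M N))
  alt = record
    { f-cong = λ h → det-cong n (λ i j → sumₚ-cong (λ l → *ₚ-cong (h i l) (≋-refl {N l j})))
    ; f-add = λ M i u v → ≋-trans (f-cong (upd-rowN i (u ⊕ v) M)) (≋-trans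
        (≋-trans (f-cong (upd-cong i {rowN (u ⊕ v)} {rowN u ⊕ rowN v} (λ j → ≋-trans (sumₚ-cong (λ l → *ₚ-distribʳ (N l j) (u l) (v l))) (sumₚ-+ (λ l → u l *ₚ N l j) (λ l → v l *ₚ N l j))) (λ a _ b → ≋-refl)))
                 (f-add (M ·M N) i (rowN u) (rowN v)))
        (+ₚ-cong (≋-sym (f-cong (upd-rowN i u M))) (≋-sym (f-cong (upd-rowN i v M)))))
    ; f-scal = λ M i c u → ≋-trans (f-cong (upd-rowN i (c ⊙ u) M)) (≋-trans
        (≋-trans (f-cong (upd-cong i {rowN (c ⊙ u)} {c ⊙ rowN u} (λ j → ≋-trans (sumₚ-cong (λ l → *ₚ-assoc c (u l) (N l j))) (sumₚ-* c (λ l → u l *ₚ N l j))) (λ a _ b → ≋-refl)))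
                 (f-scal (M ·M N) i c (rowN u)))
        (*ₚ-cong (≋-refl {c}) (≋-sym (f-cong (upd-rowN i u M)))))
    ; f-alt = λ M i j h q → f-alt (M ·M N) i j h (λ b → sumₚ-cong (λ l → *ₚ-cong (q l) (≋-refl {N l b}))) }

det-eP : ∀ n → detₚ n eP ≋ 1ₚ
det-eP zero    = ≋-refl
det-eP (suc n) = ≋-trans (det-expand n eP) (≋-trans (+ₚ-cong
  (≋-trans (*ₚ-identityˡ (1ₚ *ₚ detₚ n eP)) (≋-trans (*ₚ-identityˡ (detₚ n eP)) (det-eP n)))
  (sumₚ-0 {n} (λ j → *ₚ-[] (σ (suc (toℕ j)))))) (+ₚ-identityʳ 1ₚ))

-- Conjugacy invariance of the characteristic polynomial

δ≡e : ∀ {n} (i j : Fin n) → δ i j ≡ e j i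
δ≡e i j with i F.≟ j
... | yes refl = sym (e-≡ i)
... | no  h    = sym (e-≢ {i = i} {j} h)

coeff-sumₚ : ∀ n (f : Fin n → Poly) t → coeff (sumₚ n f) t ≡ sumℤ n (λ i → coeff (f i) t)
coeff-sumₚ zero    f t = refl
coeff-sumₚ (suc n) f t = trans (coeff-+ (f zero) _ t) (cong (coeff (f zero) t +_) (coeff-sumₚ n (λ i → f (suc i)) t))

coeff-const : ∀ a t → coeff (constₚ a) t ≡ a * coeff 1ₚ t
coeff-const a zero    = sym (ℤP.*-identityʳ a)
coeff-const a (suc t) = sym (ℤP.*-zeroʳ a)

charM : ∀ {r} → Matrix r → Mat r r
charM A i j = scaleₚ (δ i j) Xₚ +ₚ constₚ (- A i j)

constM : ∀ {r} → Matrix r → Mat r r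
constM P i j = constₚ (P i j)

module _ {r : ℕ} where

  coeff-charM : ∀ (A : Matrix r) i j t → coeff (charM A i j) t ≡ e j i * coeff Xₚ t - A i j * coeff 1ₚ t
  coeff-charM A i j t = trans (coeff-+ (scaleₚ (δ i j) Xₚ) (constₚ (- A i j)) t)
    (cong₂ _+_ (trans (coeff-scale (δ i j) Xₚ t) (cong (_* coeff Xₚ t) (δ≡e i j)))
               (trans (coeff-const (- A i j) t) (sym (ℤP.neg-distribˡ-* (A i j) (coeff 1ₚ t)))))

  constM-charM : ∀ (P A B : Matrix r) → (P *ₘ A) ≈ₘ (B *ₘ P) → (constM P ·M charM A) ≋ₘ (charM B ·M constM P)
  constM-charM P A B h i j = co λ t → begin
    coeff ((constM P ·M charM A) i j) t
      ≡⟨ trans (coeff-sumₚ r _ t) (sum-cong λ k → trans (coeffs (const-* (P i k) (charM A k j)) t)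
           (trans (coeff-scale (P i k) (charM A k j) t) (trans (cong (P i k *_) (coeff-charM A k j t)) (l1 (P i k) (e j k) (coeff Xₚ t) (A k j) (coeff 1ₚ t))))) ⟩
    sumℤ r (λ k → coeff Xₚ t * (P i k * e j k) + - coeff 1ₚ t * (P i k * A k j))
      ≡⟨ trans (sum-+ (λ k → coeff Xₚ t * (P i k * e j k)) (λ k → - coeff 1ₚ t * (P i k * A k j)))
           (cong₂ _+_ (trans (sum-* (coeff Xₚ t) (λ k → P i k * e j k)) (cong (coeff Xₚ t *_) (sum-e (P i) j))) (sum-* (- coeff 1ₚ t) (λ k → P i k * A k j))) ⟩
    coeff Xₚ t * P i j + - coeff 1ₚ t * (P *ₘ A) i j
      ≡⟨ cong (λ z → coeff Xₚ t * P i j + - coeff 1ₚ t * z) (h i j) ⟩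
    coeff Xₚ t * P i j + - coeff 1ₚ t * (B *ₘ P) i j
      ≡⟨ trans (sum-+ (λ k → coeff Xₚ t * (P k j * e i k)) (λ k → - coeff 1ₚ t * (B i k * P k j)))
           (cong₂ _+_ (trans (sum-* (coeff Xₚ t) (λ k → P k j * e i k)) (cong (coeff Xₚ t *_) (sum-e (λ k → P k j) i))) (sum-* (- coeff 1ₚ t) (λ k → B i k * P k j))) ⟨
    sumℤ r (λ k → coeff Xₚ t * (P k j * e i k) + - coeff 1ₚ t * (B i k * P k j))
      ≡⟨ trans (coeff-sumₚ r _ t) (sum-cong λ k → trans (coeffs (*ₚ-comm (charM B i k) (constM P k j)) t) (trans (coeffs (const-* (P k j) (charM B i k)) t)
           (trans (coeff-scale (P k j) (charM B i k) t) (trans (cong (P k j *_) (trans (coeff-charM B i k t) (cong (λ z → z * coeff Xₚ t - B i k * coeff 1ₚ t) (e-symm k i))))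
             (l2 (P k j) (e i k) (coeff Xₚ t) (B i k) (coeff 1ₚ t)))))) ⟨
    coeff ((charM B ·M constM P) i j) t ∎
    where
    e-symm : ∀ {n} (i j : Fin n) → e i j ≡ e j i
    e-symm zero    zero    = refl
    e-symm zero    (suc j) = refl
    e-symm (suc i) zero    = refl
    e-symm (suc i) (suc j) = e-symm i j
    l1 : ∀ p d x a o → p * (d * x - a * o) ≡ x * (p * d) + - o * (p * a)
    l1 = solve-∀
    l2 : ∀ p d x b o → p * (d * x - b * o) ≡ x * (p * d) + - o * (b * p)
    l2 = solve-∀

  constM-inverse : ∀ (P Q : Matrix r) → (P *ₘ Q) ≈ₘ idM r → (constM P ·M constM Q) ≋ₘ eP
  constM-inverse P Q h i j = co λ t → begin
    coeff ((constM P ·M constM Q) i j) t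
      ≡⟨ trans (coeff-sumₚ r _ t) (sum-cong λ k → trans (coeffs (const-* (P i k) (constₚ (Q k j))) t)
           (trans (coeff-scale (P i k) (constₚ (Q k j)) t) (trans (cong (P i k *_) (coeff-const (Q k j) t)) (l (P i k) (Q k j) (coeff 1ₚ t))))) ⟩
    sumℤ r (λ k → coeff 1ₚ t * (P i k * Q k j))   ≡⟨ sum-* (coeff 1ₚ t) (λ k → P i k * Q k j) ⟩
    coeff 1ₚ t * (P *ₘ Q) i j                     ≡⟨ cong (coeff 1ₚ t *_) (trans (h i j) (δ≡e i j)) ⟩
    coeff 1ₚ t * e j i                            ≡⟨ eP-coeff i j t ⟨
    coeff (eP i j) t                              ∎
    where
    l : ∀ p q o → p * (q * o) ≡ o * (p * q)
    l = solve-∀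
    eP-coeff : ∀ {n} (i j : Fin n) t → coeff (eP i j) t ≡ coeff 1ₚ t * e j i
    eP-coeff zero    zero    t = sym (ℤP.*-identityʳ (coeff 1ₚ t))
    eP-coeff zero    (suc j) t = sym (ℤP.*-zeroʳ (coeff 1ₚ t))
    eP-coeff (suc i) zero    t = sym (ℤP.*-zeroʳ (coeff 1ₚ t))
    eP-coeff (suc i) (suc j) t = eP-coeff i j t

  -- From P(x - A) = (x - B)P the determinant p of P satisfies p χ_A = χ_B p. Multiplying by q = det
  -- Q, where q p = 1, and commuting cancels p.
  charPoly-conj : ∀ {A B : Matrix r} → A ∼ℤ B → charPoly A ≈ₚ charPoly B
  charPoly-conj {A} {B} (P , Q , PQ , QP , h) = coeffs (≋-trans (≋-sym (*ₚ-identityˡ (charPoly A)))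
      (≋-trans (*ₚ-cong (≋-sym qp) (≋-refl {charPoly A})) (≋-trans (l1 q p (charPoly A)) (≋-trans (*ₚ-cong (≋-refl {q}) commute)
      (≋-trans (l2 q p (charPoly B)) (≋-trans (*ₚ-cong qp (≋-refl {charPoly B})) (*ₚ-identityˡ (charPoly B))))))))
    where
    p = detₚ r (constM P)
    q = detₚ r (constM Q)
    qp : q *ₚ p ≋ 1ₚ
    qp = ≋-trans (≋-sym (det-mult r (constM Q) (constM P))) (≋-trans (det-cong r (constM-inverse Q P QP)) (det-eP r))
    commute : p *ₚ charPoly A ≋ charPoly B *ₚ p
    commute = ≋-trans (≋-sym (det-mult r (constM P) (charM A))) (≋-trans (det-cong r (constM-charM P A B h)) (det-mult r (charM B) (constM P)))
    l1 : ∀ q p a → (q *ₚ p) *ₚ a ≋ q *ₚ (p *ₚ a)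
    l1 = solveR polySolver
    l2 : ∀ q p b → q *ₚ (b *ₚ p) ≋ (q *ₚ p) *ₚ b
    l2 = solveR polySolver

-- Derivatives, degrees and division

≡⇒≋ : ∀ {p q : Poly} → p ≡ q → p ≋ q
≡⇒≋ refl = ≋-refl

coeff-deriv : ∀ p k → coeff (deriv p) k ≡ ℤ.+ suc k * coeff p (suc k)
coeff-deriv []      k       = sym (ℤP.*-zeroʳ (ℤ.+ suc k))
coeff-deriv (c ∷ p) zero    = trans (coeff-+ p (0ℤ ∷ deriv p) zero) (trans (ℤP.+-identityʳ (coeff p 0)) (sym (ℤP.*-identityˡ (coeff p 0))))
coeff-deriv (c ∷ p) (suc k) = trans (coeff-+ p (0ℤ ∷ deriv p) (suc k)) (trans (cong (coeff p (suc k) +_) (coeff-deriv p k)) (l (ℤ.+ suc k) (coeff p (suc k))))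
  where
  l : ∀ n a → a + n * a ≡ (1ℤ + n) * a
  l = solve-∀

deriv-cong : ∀ {p q} → p ≋ q → deriv p ≋ deriv q
deriv-cong {p} {q} h = co λ k → trans (coeff-deriv p k) (trans (cong (ℤ.+ suc k *_) (coeffs h (suc k))) (sym (coeff-deriv q k)))

deriv-+ : ∀ p q → deriv (p +ₚ q) ≋ deriv p +ₚ deriv q
deriv-+ p q = co λ k → begin
  coeff (deriv (p +ₚ q)) k                                                 ≡⟨ trans (coeff-deriv (p +ₚ q) k) (cong (ℤ.+ suc k *_) (coeff-+ p q (suc k))) ⟩
  ℤ.+ suc k * (coeff p (suc k) + coeff q (suc k))                          ≡⟨ ℤP.*-distribˡ-+ (ℤ.+ suc k) (coeff p (suc k)) (coeff q (suc k)) ⟩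
  ℤ.+ suc k * coeff p (suc k) + ℤ.+ suc k * coeff q (suc k)                ≡⟨ trans (coeff-+ (deriv p) (deriv q) k) (cong₂ _+_ (coeff-deriv p k) (coeff-deriv q k)) ⟨
  coeff (deriv p +ₚ deriv q) k                                             ∎

deriv-scale : ∀ c p → deriv (scaleₚ c p) ≋ scaleₚ c (deriv p)
deriv-scale c p = co λ k → trans (coeff-deriv (scaleₚ c p) k) (trans (cong (ℤ.+ suc k *_) (coeff-scale c p (suc k)))
  (trans (*-swap (ℤ.+ suc k) c (coeff p (suc k))) (sym (trans (coeff-scale c (deriv p) k) (cong (c *_) (coeff-deriv p k))))))

shift-+ : ∀ p q → 0ℤ ∷ (p +ₚ q) ≋ (0ℤ ∷ p) +ₚ (0ℤ ∷ q)
shift-+ p q = ≋-refl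

deriv-* : ∀ p q → deriv (p *ₚ q) ≋ deriv p *ₚ q +ₚ p *ₚ deriv q
deriv-* []      q = ≋-refl
deriv-* (a ∷ p) q = ≋-trans (deriv-+ (scaleₚ a q) (0ℤ ∷ p *ₚ q)) (≋-trans
  (+ₚ-cong (deriv-scale a q) (+ₚ-cong (≋-refl {p *ₚ q}) (≋-trans (∷-cong refl (deriv-* p q)) (≋-trans (shift-+ (deriv p *ₚ q) (p *ₚ deriv q))
    (+ₚ-cong (≋-sym (shift-* (deriv p) q)) (≋-refl {0ℤ ∷ p *ₚ deriv q}))))))
  (≋-trans (l (scaleₚ a (deriv q)) (p *ₚ q) ((0ℤ ∷ deriv p) *ₚ q) (0ℤ ∷ p *ₚ deriv q))
    (+ₚ-cong (≋-sym (*ₚ-distribʳ q p (0ℤ ∷ deriv p))) ≋-refl)))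
  where
  l : ∀ a b c d → a +ₚ (b +ₚ (c +ₚ d)) ≋ (b +ₚ c) +ₚ (a +ₚ d)
  l = solveR polySolver

DegLt : Poly → ℕ → Set
DegLt p d = ∀ k → d ℕ.≤ k → coeff p k ≡ 0ℤ

DegLt-≋ : ∀ {p q d} → p ≋ q → DegLt p d → DegLt q d
DegLt-≋ h g k l = trans (sym (coeffs h k)) (g k l)

DegLt-length : ∀ p → DegLt p (L.length p)
DegLt-length []      k       _         = refl
DegLt-length (a ∷ p) (suc k) (ℕ.s≤s l) = DegLt-length p k l

DegLt-0 : ∀ {p} → DegLt p 0 → p ≋ []
DegLt-0 h = co λ k → h k ℕ.z≤n

DegLt-+ : ∀ {p q d} → DegLt p d → DegLt q d → DegLt (p +ₚ q) d
DegLt-+ {p} {q} h g k l = trans (coeff-+ p q k) (cong₂ _+_ (h k l) (g k l))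

DegLt-scale : ∀ c {p d} → DegLt p d → DegLt (scaleₚ c p) d
DegLt-scale c {p} h k l = trans (coeff-scale c p k) (trans (cong (c *_) (h k l)) (ℤP.*-zeroʳ c))

DegLt-neg : ∀ {p d} → DegLt p d → DegLt (-ₚ p) d
DegLt-neg {p} h k l = trans (coeff-neg p k) (cong -_ (h k l))

top-coeff : ∀ s p n D → DegLt s (suc n) → DegLt p (suc D) → coeff (s *ₚ p) (n ℕ.+ D) ≡ coeff s n * coeff p D
top-coeff []      p n       D hs hp = sym (ℤP.*-zeroˡ (coeff p D))
top-coeff (a ∷ s) p zero    D hs hp = trans (coeff-+ (scaleₚ a p) (0ℤ ∷ s *ₚ p) D)
  (trans (cong₂ _+_ (coeff-scale a p D) (shifted D)) (ℤP.+-identityʳ (a * coeff p D)))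
  where
  shifted : ∀ D → coeff (0ℤ ∷ s *ₚ p) D ≡ 0ℤ
  shifted zero    = refl
  shifted (suc D) = coeffs (*ₚ-zeroˡ s p (co λ k → hs (suc k) (ℕ.s≤s ℕ.z≤n))) D
top-coeff (a ∷ s) p (suc n) D hs hp = trans (coeff-+ (scaleₚ a p) (0ℤ ∷ s *ₚ p) (suc n ℕ.+ D))
  (trans (cong₂ _+_ (DegLt-scale a {p} hp (suc n ℕ.+ D) (ℕ.s≤s (ℕP.m≤n+m D n))) (top-coeff s p n D (λ k l → hs (suc k) (ℕ.s≤s l)) hp))
         (ℤP.+-identityˡ (coeff s n * coeff p D)))

DegLt-* : ∀ s p n D → DegLt s (suc n) → DegLt p (suc D) → DegLt (s *ₚ p) (suc (n ℕ.+ D))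
DegLt-* []      p n       D hs hp k l = refl
DegLt-* (a ∷ s) p zero    D hs hp k l = trans (coeff-+ (scaleₚ a p) (0ℤ ∷ s *ₚ p) k)
  (cong₂ _+_ (DegLt-scale a {p} hp k l) (shifted k))
  where
  shifted : ∀ k → coeff (0ℤ ∷ s *ₚ p) k ≡ 0ℤ
  shifted zero    = refl
  shifted (suc k) = coeffs (*ₚ-zeroˡ s p (co λ k → hs (suc k) (ℕ.s≤s ℕ.z≤n))) k
DegLt-* (a ∷ s) p (suc n) D hs hp (suc k) (ℕ.s≤s l) = trans (coeff-+ (scaleₚ a p) (0ℤ ∷ s *ₚ p) (suc k))
  (cong₂ _+_ (DegLt-scale a {p} hp (suc k) (ℕ.s≤s (ℕP.≤-trans (ℕP.m≤n+m D (suc n)) l))) (DegLt-* s p n D (λ k l → hs (suc k) (ℕ.s≤s l)) hp k l))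

record MonicOf (p : Poly) (D : ℕ) : Set where
  field
    degLt : DegLt p (suc D)
    lead  : coeff p D ≡ 1ℤ
open MonicOf public

Monic⇒MonicOf : ∀ {p} → (M : Monic p) → MonicOf p (proj₁ M)
Monic⇒MonicOf (D , (_ , h) , l) = record { degLt = h ; lead = l }

-- The top coefficient of s p is that of s because p is monic; so the degree bound kills the
-- coefficients of s from the top downwards.
monic-cancel : ∀ {p D} → MonicOf p D → ∀ s → DegLt (s *ₚ p) D → s ≋ []
monic-cancel {p} {D} M s h = DegLt-0 (descend (L.length s) (DegLt-length s))
  where
  descend : ∀ n → DegLt s n → DegLt s 0
  descend zero    g = g
  descend (suc n) g = descend n λ k n≤k → hit k (ℕP.m≤n⇒m<n∨m≡n n≤k)
    where
    hit : ∀ k → n ℕ.< k ⊎ n ≡ k → coeff s k ≡ 0ℤ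
    hit k (inj₁ n<k)  = g k n<k
    hit .n (inj₂ refl) = trans (sym (ℤP.*-identityʳ (coeff s n))) (trans (cong (coeff s n *_) (sym (lead M)))
      (trans (sym (top-coeff s p n D g (degLt M))) (h (n ℕ.+ D) (ℕP.m≤n+m D n))))

infix 4 _∣ₚ_
_∣ₚ_ : Poly → Poly → Set
p ∣ₚ q = Σ Poly λ s → q ≋ s *ₚ p

∣ₚ-+ : ∀ {p a b} → p ∣ₚ a → p ∣ₚ b → p ∣ₚ a +ₚ b
∣ₚ-+ {p} (s , h) (t , g) = s +ₚ t , ≋-trans (+ₚ-cong h g) (≋-sym (*ₚ-distribʳ p s t))

∣ₚ-* : ∀ {p a} c → p ∣ₚ a → p ∣ₚ c *ₚ a
∣ₚ-* {p} c (s , h) = c *ₚ s , ≋-trans (*ₚ-cong (≋-refl {c}) h) (≋-sym (*ₚ-assoc c s p))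

∣ₚ-≋ : ∀ {p a b} → a ≋ b → p ∣ₚ a → p ∣ₚ b
∣ₚ-≋ h (s , g) = s , ≋-trans (≋-sym h) g

record DivMod (p : Poly) (D : ℕ) (q : Poly) : Set where
  field
    quot rest : Poly
    eqn       : q ≋ quot *ₚ p +ₚ rest
    small     : DegLt rest D

divMonic : ∀ {p D} → MonicOf p D → ∀ q → DivMod p D q
divMonic M [] = record { quot = [] ; rest = [] ; eqn = ≋-refl ; small = λ _ _ → refl }
divMonic {p} {D} M (c ∷ q) = record
  { quot = (0ℤ ∷ s) +ₚ constₚ t
  ; rest = (c ∷ r) +ₚ (-ₚ (constₚ t *ₚ p))
  ; eqn = ≋-trans cq (l (c ∷ r) (0ℤ ∷ s) (constₚ t) p)
  ; small = sm }
  where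
  open DivMod (divMonic M q) renaming (quot to s; rest to r; eqn to eq₀; small to sm₀)
  t = coeff (c ∷ r) D
  cq : c ∷ q ≋ (c ∷ r) +ₚ ((0ℤ ∷ s) *ₚ p)
  cq = ≋-trans (∷-cong (sym (ℤP.+-identityʳ c)) (≋-trans eq₀ (+ₚ-comm (s *ₚ p) r))) (+ₚ-cong (≋-refl {c ∷ r}) (≋-sym (shift-* s p)))
  l : ∀ a b t p → a +ₚ b *ₚ p ≋ (b +ₚ t) *ₚ p +ₚ (a +ₚ (-ₚ (t *ₚ p)))
  l = solveR polySolver
  sm : DegLt ((c ∷ r) +ₚ (-ₚ (constₚ t *ₚ p))) D
  sm k D≤k = trans (coeff-+ (c ∷ r) (-ₚ (constₚ t *ₚ p)) k) (trans (cong (coeff (c ∷ r) k +_)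
      (trans (coeff-neg (constₚ t *ₚ p) k) (cong -_ (trans (coeffs (const-* t p) k) (coeff-scale t p k))))) (go k (ℕP.m≤n⇒m<n∨m≡n D≤k)))
    where
    go : ∀ k → D ℕ.< k ⊎ D ≡ k → coeff (c ∷ r) k + - (t * coeff p k) ≡ 0ℤ
    go (suc k) (inj₁ (ℕ.s≤s D≤k)) = trans (cong₂ (λ a b → a + - (t * b)) (sm₀ k D≤k) (degLt M (suc k) (ℕ.s≤s D≤k))) (cong (λ z → 0ℤ + - z) (ℤP.*-zeroʳ t))
    go .D (inj₂ refl) = trans (cong (λ z → t + - (t * z)) (lead M)) (trans (cong (λ z → t + - z) (ℤP.*-identityʳ t)) (ℤP.+-inverseʳ t))

rest-unique : ∀ {p D} → MonicOf p D → ∀ s s′ r r′ → s *ₚ p +ₚ r ≋ s′ *ₚ p +ₚ r′ → DegLt r D → DegLt r′ D → r ≋ r′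
rest-unique {p} {D} M s s′ r r′ h d d′ = ≋-trans (l2 ((s +ₚ (-ₚ s′)) *ₚ p) r r′ diff) (+ₚ-cong (≋-trans (-ₚ-cong (*ₚ-zeroˡ (s +ₚ (-ₚ s′)) p z)) ≋-refl) (≋-refl {r′}))
  where
  diff : (s +ₚ (-ₚ s′)) *ₚ p ≋ r′ +ₚ (-ₚ r)
  diff = ≋-trans (l s s′ r p) (≋-trans (+ₚ-cong h (≋-refl { -ₚ (s′ *ₚ p +ₚ r)})) (l1 s′ r r′ p))
    where
    l : ∀ s s′ r p → (s +ₚ (-ₚ s′)) *ₚ p ≋ (s *ₚ p +ₚ r) +ₚ (-ₚ (s′ *ₚ p +ₚ r))
    l = solveR polySolver
    l1 : ∀ s′ r r′ p → (s′ *ₚ p +ₚ r′) +ₚ (-ₚ (s′ *ₚ p +ₚ r)) ≋ r′ +ₚ (-ₚ r)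
    l1 = solveR polySolver
  z : s +ₚ (-ₚ s′) ≋ []
  z = monic-cancel M (s +ₚ (-ₚ s′)) (DegLt-≋ (≋-sym diff) (DegLt-+ {r′} { -ₚ r} d′ (DegLt-neg {r} d)))
  l2 : ∀ a r r′ → a ≋ r′ +ₚ (-ₚ r) → r ≋ (-ₚ a) +ₚ r′
  l2 a r r′ h = ≋-trans (l3 r r′) (+ₚ-cong (-ₚ-cong (≋-sym h)) (≋-refl {r′}))
    where
    l3 : ∀ r r′ → r ≋ (-ₚ (r′ +ₚ (-ₚ r))) +ₚ r′
    l3 = solveR polySolver

scale-cancel : ∀ {c} → c ≢ 0ℤ → ∀ {p q} → scaleₚ c p ≋ scaleₚ c q → p ≋ q
scale-cancel {c} c≢0 {p} {q} h = co λ k → ℤP.*-cancelˡ-≡ c (coeff p k) (coeff q k) {{ℤ.≢-nonZero c≢0}}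
  (trans (sym (coeff-scale c p k)) (trans (coeffs h k) (coeff-scale c q k)))

-- Remainders modulo a monic polynomial are unique, so the remainder of c a is c times that of a. It
-- vanishes, and c can be cancelled.
monic-∣-scale : ∀ {p D} → MonicOf p D → ∀ {c} → c ≢ 0ℤ → ∀ {a} → p ∣ₚ scaleₚ c a → p ∣ₚ a
monic-∣-scale {p} {D} M {c} c≢0 {a} (t , h) = s , ≋-trans eqn (≋-trans (+ₚ-cong (≋-refl {s *ₚ p}) r≋0) (+ₚ-identityʳ (s *ₚ p)))
  where
  open DivMod (divMonic M a) renaming (quot to s; rest to r)
  r≋0 : r ≋ []
  r≋0 = scale-cancel c≢0 {r} {[]} (rest-unique M (scaleₚ c s) t (scaleₚ c r) [] (≋-trans (≋-trans (+ₚ-cong (scale-* c s p) (≋-refl {scaleₚ c r})) (≋-trans (≋-sym (scale-+ c (s *ₚ p) r))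
    (≋-trans (scale-cong {c} {c} refl (≋-sym eqn)) h))) (≋-sym (+ₚ-identityʳ (t *ₚ p)))) (DegLt-scale c {r} small) (λ _ _ → refl))

record PseudoDiv (w : Poly) (e : ℕ) (q : Poly) : Set where
  field
    c         : ℤ
    c≢0       : c ≢ 0ℤ
    quot rest : Poly
    eqn       : scaleₚ c q ≋ quot *ₚ w +ₚ rest
    small     : DegLt rest e

-- Each reduction of the top coefficient first multiplies by the leading coefficient of w, so c is a
-- power of it. This replaces division over ℚ.
pseudoDiv : ∀ {w e} → HasDegree w e → ∀ q → PseudoDiv w e q
pseudoDiv H [] = record { c = 1ℤ ; c≢0 = λ () ; quot = [] ; rest = [] ; eqn = ≋-refl ; small = λ _ _ → refl }
pseudoDiv {w} {e} H@(l≢0 , deg) (c₀ ∷ q) = record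
  { c = l * c ; c≢0 = lc≢0
  ; quot = scaleₚ l (0ℤ ∷ s) +ₚ constₚ t
  ; rest = scaleₚ l R +ₚ (-ₚ (constₚ t *ₚ w))
  ; eqn = ≋-trans (≋-sym (scale-scale l c (c₀ ∷ q))) (≋-trans (scale-cong {l} {l} refl cq) (≋-trans (scale-+ l R ((0ℤ ∷ s) *ₚ w))
            (≋-trans (+ₚ-cong (≋-refl {scaleₚ l R}) (≋-sym (scale-* l (0ℤ ∷ s) w))) (ll (scaleₚ l R) (scaleₚ l (0ℤ ∷ s)) (constₚ t) w))))
  ; small = sm }
  where
  open PseudoDiv (pseudoDiv {w} {e} H q) renaming (quot to s; rest to r; eqn to eq₀; small to sm₀)
  l = coeff w e
  R = c * c₀ ∷ r
  t = coeff R e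
  lc≢0 : l * c ≢ 0ℤ
  lc≢0 h with ℤP.i*j≡0⇒i≡0∨j≡0 l h
  ... | inj₁ p = l≢0 p
  ... | inj₂ p = c≢0 p
  cq : scaleₚ c (c₀ ∷ q) ≋ R +ₚ ((0ℤ ∷ s) *ₚ w)
  cq = ≋-trans (∷-cong (sym (ℤP.+-identityʳ (c * c₀))) (≋-trans eq₀ (+ₚ-comm (s *ₚ w) r))) (+ₚ-cong (≋-refl {R}) (≋-sym (shift-* s w)))
  ll : ∀ a b t p → a +ₚ b *ₚ p ≋ (b +ₚ t) *ₚ p +ₚ (a +ₚ (-ₚ (t *ₚ p)))
  ll = solveR polySolver
  sm : DegLt (scaleₚ l R +ₚ (-ₚ (constₚ t *ₚ w))) e
  sm k e≤k = trans (coeff-+ (scaleₚ l R) (-ₚ (constₚ t *ₚ w)) k) (trans (cong₂ _+_ (coeff-scale l R k)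
      (trans (coeff-neg (constₚ t *ₚ w) k) (cong -_ (trans (coeffs (const-* t w) k) (coeff-scale t w k))))) (go k (ℕP.m≤n⇒m<n∨m≡n e≤k)))
    where
    go : ∀ k → e ℕ.< k ⊎ e ≡ k → l * coeff R k + - (t * coeff w k) ≡ 0ℤ
    go (suc k) (inj₁ (ℕ.s≤s D≤k)) = trans (cong₂ (λ a b → l * a + - (t * b)) (sm₀ k D≤k) (deg (suc k) (ℕ.s≤s D≤k)))
      (cong₂ (λ a b → a + - b) (ℤP.*-zeroʳ l) (ℤP.*-zeroʳ t))
    go .e (inj₂ refl) = trans (cong (λ z → l * t + - z) (ℤP.*-comm t l)) (ℤP.+-inverseʳ (l * t))

degree : ∀ p → p ≋ [] ⊎ Σ ℕ (HasDegree p)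
degree [] = inj₁ ≋-refl
degree (a ∷ p) with degree p
... | inj₂ (d , l , h) = inj₂ (suc d , l , λ { (suc k) (ℕ.s≤s q) → h k q })
... | inj₁ z with a ℤP.≟ 0ℤ
...   | yes q = inj₁ (∷-0 q z)
...   | no  q = inj₂ (0 , q , λ { (suc k) _ → coeffs z k })

-- Gauss's lemma

DvdP : ℕ → Poly → Set
DvdP ℓ p = ∀ k → ℤ.+ ℓ ∣ᵢ coeff p k

module _ {ℓ : ℕ} (prime : Prime ℓ) where

  ℤ-euclid : ∀ a b → ℤ.+ ℓ ∣ᵢ a * b → ℤ.+ ℓ ∣ᵢ a ⊎ ℤ.+ ℓ ∣ᵢ b
  ℤ-euclid a b h with euclidsLemma ∣ a ∣ ∣ b ∣ prime (subst (ℓ ℕ∣_) (ℤP.∣i*j∣≡∣i∣*∣j∣ a b) (ℤDS.∣⇒∣ᵤ h))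
  ... | inj₁ g = inj₁ (ℤDS.∣ᵤ⇒∣ g)
  ... | inj₂ g = inj₂ (ℤDS.∣ᵤ⇒∣ g)

  gauss-combine : ∀ a w b q → DvdP ℓ ((a ∷ w) *ₚ (b ∷ q)) →
                  (DvdP ℓ (w *ₚ (b ∷ q)) → DvdP ℓ w ⊎ DvdP ℓ (b ∷ q)) → (DvdP ℓ ((a ∷ w) *ₚ q) → DvdP ℓ (a ∷ w) ⊎ DvdP ℓ q) →
                  DvdP ℓ (a ∷ w) ⊎ DvdP ℓ (b ∷ q)
  gauss-combine a w b q h left right with (ℤ.+ ℓ) ℤDS.∣? a
  ... | yes ℓ∣a with left (λ k → ℤDS.∣m+n∣m⇒∣n (subst (ℤ.+ ℓ ∣ᵢ_) (coeff-+ (scaleₚ a (b ∷ q)) (0ℤ ∷ w *ₚ (b ∷ q)) (suc k)) (h (suc k)))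
                              (subst (ℤ.+ ℓ ∣ᵢ_) (sym (coeff-scale a (b ∷ q) (suc k))) (ℤDS.∣m⇒∣m*n (coeff q k) ℓ∣a)))
  ...   | inj₁ g = inj₁ λ { zero → ℓ∣a ; (suc k) → g k }
  ...   | inj₂ g = inj₂ g
  gauss-combine a w b q h left right | no ℓ∤a with (ℤ.+ ℓ) ℤDS.∣? b
  ... | no ℓ∤b with ℤ-euclid a b (subst (ℤ.+ ℓ ∣ᵢ_) (ℤP.+-identityʳ (a * b)) (h 0))
  ...   | inj₁ g = ⊥-elim (ℓ∤a g)
  ...   | inj₂ g = ⊥-elim (ℓ∤b g)
  gauss-combine a w b q h left right | no ℓ∤a | yes ℓ∣b
    with right (λ k → ℤDS.∣m+n∣m⇒∣n (subst (ℤ.+ ℓ ∣ᵢ_) (trans (coeffs (*ₚ-∷ (a ∷ w) b q) (suc k)) (coeff-+ (scaleₚ b (a ∷ w)) (0ℤ ∷ (a ∷ w) *ₚ q) (suc k))) (h (suc k)))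
                              (subst (ℤ.+ ℓ ∣ᵢ_) (sym (coeff-scale b (a ∷ w) (suc k))) (ℤDS.∣m⇒∣m*n (coeff w k) ℓ∣b)))
  ...   | inj₁ g = inj₁ g
  ...   | inj₂ g = inj₂ λ { zero → ℓ∣b ; (suc k) → g k }

  gauss-prime : ∀ w q → DvdP ℓ (w *ₚ q) → DvdP ℓ w ⊎ DvdP ℓ q
  gauss-prime []      q       h = inj₁ λ k → ℤDS.divides 0ℤ refl
  gauss-prime (a ∷ w) []      h = inj₂ λ k → ℤDS.divides 0ℤ refl
  gauss-prime (a ∷ w) (b ∷ q) h = gauss-combine a w b q h (gauss-prime w (b ∷ q)) (gauss-prime (a ∷ w) q)

DvdP-quotient : ∀ ℓ p → DvdP ℓ p → Σ Poly λ p′ → p ≋ scaleₚ (ℤ.+ ℓ) p′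
DvdP-quotient ℓ []      h = [] , ≋-refl
DvdP-quotient ℓ (a ∷ p) h with h 0 | DvdP-quotient ℓ p (λ k → h (suc k))
... | ℤDS.divides q a≡ | p′ , g = q ∷ p′ , ∷-cong (trans a≡ (ℤP.*-comm q (ℤ.+ ℓ))) g

Splitting : Poly → Poly → Set
Splitting p w = Σ Poly λ w₁ → Σ Poly λ q₁ → Σ ℤ λ α → α ≢ 0ℤ × w ≋ scaleₚ α w₁ × p ≋ w₁ *ₚ q₁

-- Prime factors of c are removed one by one: each divides w or q. Those taken out of w are
-- collected in α. At the end c is 1 or -1 and is its own inverse.
gauss-list : ∀ ls → All Prime ls → ∀ c → ∣ c ∣ ≡ Nat.product ls → ∀ p w q → scaleₚ c p ≋ w *ₚ q → Splitting p w
gauss-list [] _ c ∣c∣≡1 p w q h = scaleₚ c w , q , c , c≢0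
    , ≋-sym (≋-trans (scale-scale c c w) (≋-trans (scale-cong {c * c} {1ℤ} {w} cc≡1 ≋-refl) (scale-1 w)))
    , ≋-trans (≋-sym (≋-trans (scale-scale c c p) (≋-trans (scale-cong {c * c} {1ℤ} {p} cc≡1 ≋-refl) (scale-1 p)))) (≋-trans (scale-cong {c} {c} refl h) (≋-sym (scale-* c w q)))
  where
  cc≡1 : c * c ≡ 1ℤ
  cc≡1 = sq-unit c ∣c∣≡1
    where
    sq-unit : ∀ c → ∣ c ∣ ≡ 1 → c * c ≡ 1ℤ
    sq-unit (ℤ.+ 1) refl = refl
    sq-unit -[1+ 0 ] refl = refl
  c≢0 : c ≢ 0ℤ
  c≢0 c≡0 = contradiction (trans (sym ∣c∣≡1) (cong ∣_∣ c≡0)) (λ ())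
gauss-list (ℓ ∷ ls) (pr All.∷ prs) c ∣c∣≡ p w q h = cases (gauss-prime pr w q dvd)
  where
  c∣ : ℤ.+ ℓ ∣ᵢ c
  c∣ = ℤDS.∣ᵤ⇒∣ (subst (ℓ ℕ∣_) (sym ∣c∣≡) (ℕD.m∣m*n (Nat.product ls)))
  c′ = ℤDS._∣_.quotient c∣
  c≡ : c ≡ c′ * ℤ.+ ℓ
  c≡ = ℤDS._∣_.equality c∣
  instance
    ℓ-nz : ℕ.NonZero ℓ
    ℓ-nz = prime⇒nonZero pr
  ℓ≢0 : ℤ.+ ℓ ≢ 0ℤ
  ℓ≢0 z = ℕ.≢-nonZero⁻¹ ℓ (ℤP.+-injective z)
  ∣c′∣≡ : ∣ c′ ∣ ≡ Nat.product ls
  ∣c′∣≡ = ℕP.*-cancelˡ-≡ ∣ c′ ∣ (Nat.product ls) ℓ (trans (ℕP.*-comm ℓ ∣ c′ ∣) (trans (sym (ℤP.∣i*j∣≡∣i∣*∣j∣ c′ (ℤ.+ ℓ))) (trans (cong ∣_∣ (sym c≡)) ∣c∣≡)))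
  dvd : DvdP ℓ (w *ₚ q)
  dvd k = subst (ℤ.+ ℓ ∣ᵢ_) (trans (sym (coeff-scale c p k)) (coeffs h k)) (ℤDS.∣m⇒∣m*n (coeff p k) c∣)
  h′ : scaleₚ (ℤ.+ ℓ) (scaleₚ c′ p) ≋ w *ₚ q
  h′ = ≋-trans (scale-scale (ℤ.+ ℓ) c′ p) (≋-trans (scale-cong {q = p} (trans (ℤP.*-comm (ℤ.+ ℓ) c′) (sym c≡)) ≋-refl) h)
  cases : DvdP ℓ w ⊎ DvdP ℓ q → Splitting p w
  cases (inj₁ g) with DvdP-quotient ℓ w g
  ... | w′ , w≋ with gauss-list ls prs c′ ∣c′∣≡ p w′ q (scale-cancel ℓ≢0 (≋-trans h′ (≋-trans (*ₚ-congˡ w (scaleₚ (ℤ.+ ℓ) w′) q w≋) (scale-* (ℤ.+ ℓ) w′ q))))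
  ...   | w₁ , q₁ , α , α≢0 , w′≋ , p≋ = w₁ , q₁ , ℤ.+ ℓ * α , (λ z → αℓ z) , ≋-trans w≋ (≋-trans (scale-cong {ℤ.+ ℓ} {ℤ.+ ℓ} refl w′≋) (scale-scale (ℤ.+ ℓ) α w₁)) , p≋
    where
    αℓ : ℤ.+ ℓ * α ≢ 0ℤ
    αℓ z with ℤP.i*j≡0⇒i≡0∨j≡0 (ℤ.+ ℓ) z
    ... | inj₁ s = ℓ≢0 s
    ... | inj₂ s = α≢0 s
  cases (inj₂ g) with DvdP-quotient ℓ q g
  ... | q′ , q≋ = gauss-list ls prs c′ ∣c′∣≡ p w q′ (scale-cancel ℓ≢0 (≋-trans h′ (≋-trans (*ₚ-congʳ w q≋)
      (≋-trans (*ₚ-comm w (scaleₚ (ℤ.+ ℓ) q′)) (≋-trans (scale-* (ℤ.+ ℓ) q′ w) (scale-cong {ℤ.+ ℓ} {ℤ.+ ℓ} refl (*ₚ-comm q′ w)))))))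

gauss : ∀ c → c ≢ 0ℤ → ∀ p w q → scaleₚ c p ≋ w *ₚ q → Splitting p w
gauss c c≢0 = gauss-list (PrimeFactorisation.factors f) (PrimeFactorisation.factorsPrime f) c (PrimeFactorisation.isFactorisation f)
  where
  instance
    nz : ℕ.NonZero ∣ c ∣
    nz = ℕ.≢-nonZero (λ z → c≢0 (ℤP.∣i∣≡0⇒i≡0 z))
  f = factorise ∣ c ∣

-- Monic irreducible polynomials are prime

unit-coeff : ∀ {u} → IsUnitₚ u → ∀ k → 0 ℕ.< k → coeff u k ≡ 0ℤ
unit-coeff (inj₁ h) (suc k) _ = h (suc k)
unit-coeff (inj₂ h) (suc k) _ = h (suc k)

unit-∣ : ∀ {u} → IsUnitₚ u → ∀ p → p *ₚ u ≋ p ⊎ p *ₚ u ≋ scaleₚ -1ℤ p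
unit-∣ {u} (inj₁ h) p = inj₁ (≋-trans (*ₚ-congʳ p {u} {1ₚ} (co h)) (≋-trans (*ₚ-comm p 1ₚ) (*ₚ-identityˡ p)))
unit-∣ {u} (inj₂ h) p = inj₂ (≋-trans (*ₚ-congʳ p {u} {constₚ -1ℤ} (co h)) (≋-trans (*ₚ-comm p (constₚ -1ℤ)) (const-* -1ℤ p)))

HasDegree-0 : ∀ {w} → HasDegree w 0 → w ≋ constₚ (coeff w 0)
HasDegree-0 (_ , h) = co λ { zero → refl ; (suc k) → h (suc k) (ℕ.s≤s ℕ.z≤n) }

module IrreducibleMonic {p : Poly} {D : ℕ} (M : MonicOf p D) (irr : Irreducible p) where

  0<D : 0 ℕ.< D
  0<D = positive D M
    where
    positive : ∀ D → MonicOf p D → 0 ℕ.< D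
    positive (suc D) _ = ℕ.s≤s ℕ.z≤n
    positive zero M = ⊥-elim (proj₁ (proj₂ irr) (inj₁ λ { zero → lead M ; (suc k) → degLt M (suc k) (ℕ.s≤s ℕ.z≤n) }))

  -- One factor of the integral splitting is a unit. If it is w₁, then w would be constant; if it is
  -- the cofactor, then p is plus or minus w₁, which has no coefficient in degree D.
  no-factor : ∀ {w e} → HasDegree w e → 0 ℕ.< e → e ℕ.< D → ¬ Splitting p w
  no-factor {w} {e} (we , wdeg) 0<e e<D (w₁ , q₁ , α , α≢0 , w≋ , p≋) = cases (proj₂ (proj₂ irr) w₁ q₁ (coeffs p≋))
    where
    cases : IsUnitₚ w₁ ⊎ IsUnitₚ q₁ → ⊥
    cases (inj₁ u) = we (trans (coeffs w≋ e) (trans (coeff-scale α w₁ e) (trans (cong (α *_) (unit-coeff {w₁} u e 0<e)) (ℤP.*-zeroʳ α))))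
    cases (inj₂ u) = absurd (unit-∣ u w₁)
      where
      w₁D : coeff w₁ D ≡ 0ℤ
      w₁D with ℤP.i*j≡0⇒i≡0∨j≡0 α (trans (sym (coeff-scale α w₁ D)) (trans (sym (coeffs w≋ D)) (wdeg D e<D)))
      ... | inj₁ z = ⊥-elim (α≢0 z)
      ... | inj₂ z = z
      absurd : w₁ *ₚ q₁ ≋ w₁ ⊎ w₁ *ₚ q₁ ≋ scaleₚ -1ℤ w₁ → ⊥
      absurd (inj₁ h) = contradiction (trans (sym (lead M)) (trans (coeffs (≋-trans p≋ h) D) w₁D)) (λ ())
      absurd (inj₂ h) = contradiction (trans (sym (lead M)) (trans (coeffs (≋-trans p≋ h) D) (trans (coeff-scale -1ℤ w₁ D) (cong (-1ℤ *_) w₁D)))) (λ ())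

  module _ (a : Poly) where

    Claim : ℕ → Set
    Claim e = ∀ w → HasDegree w e → e ℕ.< D → p ∣ₚ w *ₚ a → p ∣ₚ a

    -- Euclid's algorithm without fractions: from c p = s w + r it follows that p divides r a, with
    -- r of smaller degree than w. By Gauss r cannot vanish, for w would then be a rational factor
    -- of p; the descent ends at a constant.
    small-factor : ∀ e → Claim e
    small-factor = <-rec Claim go
      where
      go : ∀ e → (∀ {s} → s ℕ.< e → Claim s) → Claim e
      go zero ih w H e<D h = monic-∣-scale M (proj₁ H) (∣ₚ-≋ (≋-trans (*ₚ-congˡ w (constₚ (coeff w 0)) a (HasDegree-0 H)) (const-* (coeff w 0) a)) h)
      go (suc e) ih w H e<D h = finish (degree r)
        where
        open PseudoDiv (pseudoDiv {w} {suc e} H p) renaming (quot to s; rest to r)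
        finish : r ≋ [] ⊎ Σ ℕ (HasDegree r) → p ∣ₚ a
        finish (inj₁ z) = ⊥-elim (no-factor H (ℕ.s≤s ℕ.z≤n) e<D (gauss c c≢0 p w s (≋-trans eqn (≋-trans (+ₚ-cong (≋-refl {s *ₚ w}) z) (≋-trans (+ₚ-identityʳ (s *ₚ w)) (*ₚ-comm s w))))))
        finish (inj₂ (d , hd)) = ih d<e r hd (ℕP.<-trans d<e e<D) (∣ₚ-≋ ra≋ (∣ₚ-+ (scaleₚ c a , ≋-refl {scaleₚ c a *ₚ p}) (∣ₚ-* (-ₚ s) h)))
          where
          d<e : d ℕ.< suc e
          d<e = ℕP.≰⇒> λ q → proj₁ hd (small d q)
          ra≋ : scaleₚ c a *ₚ p +ₚ (-ₚ s) *ₚ (w *ₚ a) ≋ r *ₚ a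
          ra≋ = ≋-trans (+ₚ-cong (≋-trans (scale-* c a p) (≋-trans (scale-cong {c} {c} refl (*ₚ-comm a p)) (≋-trans (≋-sym (scale-* c p a)) (*ₚ-congˡ (scaleₚ c p) (s *ₚ w +ₚ r) a eqn)))) (≋-refl {(-ₚ s) *ₚ (w *ₚ a)})) (l s w r a)
            where
            l : ∀ s w r a → (s *ₚ w +ₚ r) *ₚ a +ₚ (-ₚ s) *ₚ (w *ₚ a) ≋ r *ₚ a
            l = solveR polySolver

  is-prime : ∀ b a → p ∣ₚ b *ₚ a → p ∣ₚ b ⊎ p ∣ₚ a
  is-prime b a h = finish (degree w)
    where
    open DivMod (divMonic M b) renaming (quot to s; rest to w)
    finish : w ≋ [] ⊎ Σ ℕ (HasDegree w) → p ∣ₚ b ⊎ p ∣ₚ a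
    finish (inj₁ z) = inj₁ (s , ≋-trans eqn (≋-trans (+ₚ-cong (≋-refl {s *ₚ p}) z) (+ₚ-identityʳ (s *ₚ p))))
    finish (inj₂ (d , hd)) = inj₂ (small-factor a d w hd (ℕP.≰⇒> λ q → proj₁ hd (small d q))
      (∣ₚ-≋ (≋-trans (+ₚ-cong (*ₚ-congˡ b (s *ₚ p +ₚ w) a eqn) (≋-refl {(-ₚ (s *ₚ a)) *ₚ p})) (l s p w a)) (∣ₚ-+ h ((-ₚ (s *ₚ a)) , ≋-refl))))
      where
      l : ∀ s p w a → (s *ₚ p +ₚ w) *ₚ a +ₚ (-ₚ (s *ₚ a)) *ₚ p ≋ w *ₚ a
      l = solveR polySolver

  -- By degree the only multiple of p that could be p′ is zero, but the top coefficient of p′ is the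
  -- positive degree D.
  ∤deriv : ¬ p ∣ₚ deriv p
  ∤deriv (s , h) = contradiction (trans (sym (coeffs p′≋0 (ℕ.pred D))) top) (λ z → D≢0 (sym z))
    where
    D≡ : suc (ℕ.pred D) ≡ D
    D≡ = ℕP.suc-pred D {{ℕ.>-nonZero 0<D}}
    deg : DegLt (deriv p) D
    deg k D≤k = trans (coeff-deriv p k) (trans (cong (ℤ.+ suc k *_) (degLt M (suc k) (ℕ.s≤s D≤k))) (ℤP.*-zeroʳ (ℤ.+ suc k)))
    p′≋0 : deriv p ≋ []
    p′≋0 = ≋-trans h (*ₚ-zeroˡ s p (monic-cancel M s (DegLt-≋ h deg)))
    top : coeff (deriv p) (ℕ.pred D) ≡ ℤ.+ suc (ℕ.pred D)
    top = trans (coeff-deriv p (ℕ.pred D)) (trans (cong (λ z → ℤ.+ suc (ℕ.pred D) * coeff p z) D≡) (trans (cong (ℤ.+ suc (ℕ.pred D) *_) (lead M)) (ℤP.*-identityʳ (ℤ.+ suc (ℕ.pred D)))))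
    D≢0 : ℤ.+ suc (ℕ.pred D) ≢ 0ℤ
    D≢0 ()

  ∤1 : ¬ p ∣ₚ 1ₚ
  ∤1 (s , h) = contradiction (trans (coeffs h 0) (coeffs (*ₚ-zeroˡ s p (monic-cancel M s (DegLt-≋ h λ { zero l → ⊥-elim (ℕP.<⇒≱ 0<D l) ; (suc k) _ → refl }))) 0)) (λ ())

monic-associate : ∀ {p q D E} → MonicOf p D → MonicOf q E → q ≋ p ⊎ q ≋ scaleₚ -1ℤ p → p ≈ₚ q
monic-associate Mp Mq (inj₁ h) k = sym (coeffs h k)
monic-associate {p} {q} {D} {E} Mp Mq (inj₂ h) = ⊥-elim (contradiction (trans (sym (lead Mq)) (trans (coeffs h E) (trans (coeff-scale -1ℤ p E) (cong (-1ℤ *_) (trans (cong (coeff p) E≡D) (lead Mp)))))) (λ ()))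
  where
  E≤D : E ℕ.≤ D
  E≤D = ℕP.≮⇒≥ λ D<E → contradiction (trans (sym (lead Mq)) (trans (coeffs h E) (trans (coeff-scale -1ℤ p E) (cong (-1ℤ *_) (degLt Mp E D<E))))) (λ ())
  D≤E : D ℕ.≤ E
  D≤E = ℕP.≮⇒≥ λ E<D → contradiction (trans (sym (degLt Mq D E<D)) (trans (coeffs h D) (trans (coeff-scale -1ℤ p D) (cong (-1ℤ *_) (lead Mp))))) (λ ())
  E≡D : E ≡ D
  E≡D = ℕP.≤-antisym E≤D D≤E

∤-other : ∀ {p q D E} → MonicOf p D → MonicOf q E → Irreducible p → Irreducible q → ¬ (p ≈ₚ q) → ¬ p ∣ₚ q
∤-other {p} {q} Mp Mq Ip Iq p≉q (s , h) = cases (proj₂ (proj₂ Iq) s p (coeffs h))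
  where
  cases : IsUnitₚ s ⊎ IsUnitₚ p → ⊥
  cases (inj₂ u) = proj₁ (proj₂ Ip) u
  cases (inj₁ u) = p≉q (monic-associate Mp Mq (associate (unit-∣ u p)))
    where
    q≋ = ≋-trans h (*ₚ-comm s p)
    associate : p *ₚ s ≋ p ⊎ p *ₚ s ≋ scaleₚ -1ℤ p → q ≋ p ⊎ q ≋ scaleₚ -1ℤ p
    associate (inj₁ g) = inj₁ (≋-trans q≋ g)
    associate (inj₂ g) = inj₂ (≋-trans q≋ g)

-- Separability of the squarefree product

record Factors (n : ℕ) (ms : Fin n → Poly) : Set where
  field
    deg      : Fin n → ℕ
    monic    : ∀ i → MonicOf (ms i) (deg i)
    irr      : ∀ i → Irreducible (ms i)
    distinct : ∀ i j → ms i ≈ₚ ms j → i ≡ j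

tail-factors : ∀ {n ms} → Factors (suc n) ms → Factors n (λ i → ms (suc i))
tail-factors F = record { deg = λ i → deg (suc i) ; monic = λ i → monic (suc i) ; irr = λ i → irr (suc i)
  ; distinct = λ i j h → FP.suc-injective (distinct (suc i) (suc j) h) }
  where open Factors F

module _ {n : ℕ} {ms : Fin n → Poly} (F : Factors n ms) where
  open Factors F
  module Irr (i : Fin n) = IrreducibleMonic (monic i) (irr i)

  ∤-distinct : ∀ i j → i ≢ j → ¬ ms i ∣ₚ ms j
  ∤-distinct i j h = ∤-other (monic i) (monic j) (irr i) (irr j) (λ q → h (distinct i j q))

  ∤-prod : ∀ {k} i (f : Fin k → Fin n) → (∀ j → i ≢ f j) → ¬ ms i ∣ₚ prodₚ k (λ j → ms (f j))
  ∤-prod {zero}  i f h d = Irr.∤1 i d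
  ∤-prod {suc k} i f h d with Irr.is-prime i (ms (f zero)) (prodₚ k (λ j → ms (f (suc j)))) d
  ... | inj₁ g = ∤-distinct i (f zero) (h zero) g
  ... | inj₂ g = ∤-prod i (λ j → f (suc j)) (λ j → h (suc j)) g

factor-∣prod : ∀ n (ms : Fin n → Poly) i → ms i ∣ₚ prodₚ n ms
factor-∣prod (suc n) ms zero    = prodₚ n (λ i → ms (suc i)) , *ₚ-comm (ms zero) _
factor-∣prod (suc n) ms (suc i) = ∣ₚ-* (ms zero) (factor-∣prod n (λ i → ms (suc i)) i)

cancel-∣ : ∀ {p a b} → p ∣ₚ a +ₚ b → p ∣ₚ b → p ∣ₚ a
cancel-∣ {p} {a} {b} h g = ∣ₚ-≋ (l a b) (∣ₚ-+ h (∣ₚ-* (-ₚ 1ₚ) g))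
  where
  l : ∀ a b → (a +ₚ b) +ₚ (-ₚ 1ₚ) *ₚ b ≋ a
  l = solveR polySolver

-- In the product rule, modulo the chosen factor only the term that differentiates this factor
-- survives. Primality reduces its vanishing to divisibility of the factor's derivative or of
-- another factor.
∤deriv-prod : ∀ n ms → Factors n ms → ∀ i → ¬ ms i ∣ₚ deriv (prodₚ n ms)
∤deriv-prod (suc n) ms F zero h = cases (Irr.is-prime F zero (deriv (ms zero)) N (cancel-∣ (∣ₚ-≋ (deriv-* (ms zero) N) h) (deriv N , *ₚ-comm (ms zero) (deriv N))))
  where
  N = prodₚ n (λ i → ms (suc i))
  cases : ms zero ∣ₚ deriv (ms zero) ⊎ ms zero ∣ₚ N → ⊥
  cases (inj₁ g) = Irr.∤deriv F zero g
  cases (inj₂ g) = ∤-prod F zero suc (λ _ ()) g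
∤deriv-prod (suc n) ms F (suc i) h = cases (Irr.is-prime F (suc i) (ms zero) (deriv N)
    (cancel-∣ (∣ₚ-≋ (≋-trans (deriv-* (ms zero) N) (+ₚ-comm (deriv (ms zero) *ₚ N) (ms zero *ₚ deriv N))) h) (∣ₚ-* (deriv (ms zero)) (factor-∣prod n (λ i → ms (suc i)) i))))
  where
  N = prodₚ n (λ i → ms (suc i))
  cases : ms (suc i) ∣ₚ ms zero ⊎ ms (suc i) ∣ₚ deriv N → ⊥
  cases (inj₁ g) = ∤-distinct F (suc i) zero (λ ()) g
  cases (inj₂ g) = ∤deriv-prod n (λ i → ms (suc i)) (tail-factors F) i g

-- After v is divided by the first factor, each remaining one still divides the quotient, since it
-- is prime and does not divide the first.
prod-∣ : ∀ n ms → Factors n ms → ∀ v → (∀ i → ms i ∣ₚ v) → prodₚ n ms ∣ₚ v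
prod-∣ zero    ms F v h = v , ≋-sym (≋-trans (*ₚ-comm v 1ₚ) (*ₚ-identityˡ v))
prod-∣ (suc n) ms F v h with h zero
... | t , v≋ with prod-∣ n (λ i → ms (suc i)) (tail-factors F) t rest
  where
  rest : ∀ i → ms (suc i) ∣ₚ t
  rest i with Irr.is-prime F (suc i) t (ms zero) (∣ₚ-≋ v≋ (h (suc i)))
  ... | inj₁ g = g
  ... | inj₂ g = ⊥-elim (∤-distinct F (suc i) zero (λ ()) g)
...   | s , t≋ = s , ≋-trans v≋ (≋-trans (*ₚ-congˡ t _ (ms zero) t≋) (l s (prodₚ n (λ i → ms (suc i))) (ms zero)))
  where
  l : ∀ s N m → (s *ₚ N) *ₚ m ≋ s *ₚ (m *ₚ N)
  l = solveR polySolver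

prod-monic : ∀ n ms → (∀ i → Σ ℕ (MonicOf (ms i))) → Σ ℕ (MonicOf (prodₚ n ms))
prod-monic zero    ms h = 0 , record { degLt = λ { (suc k) _ → refl } ; lead = refl }
prod-monic (suc n) ms h with h zero | prod-monic n (λ i → ms (suc i)) (λ i → h (suc i))
... | D , M | E , N = D ℕ.+ E , record
  { degLt = DegLt-* (ms zero) _ D E (degLt M) (degLt N)
  ; lead = trans (top-coeff (ms zero) _ D E (degLt M) (degLt N)) (cong₂ _*_ (lead M) (lead N)) }

-- A separability certificate, or an obstruction, by linear algebra in ℤ[x]/m

polyV : ∀ {n} → V n → Poly
polyV {zero}  x = []
polyV {suc n} x = x zero ∷ polyV (ap tail-L x)

polyV-cong : ∀ {n} {x y : V n} → x ≗ y → polyV x ≋ polyV y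
polyV-cong {zero}  h = ≋-refl
polyV-cong {suc n} h = ∷-cong (h zero) (polyV-cong (λ i → h (suc i)))

polyV-+ : ∀ {n} (x y : V n) → polyV (x +v y) ≋ polyV x +ₚ polyV y
polyV-+ {zero}  x y = ≋-refl
polyV-+ {suc n} x y = ∷-cong refl (polyV-+ (ap tail-L x) (ap tail-L y))

polyV-· : ∀ {n} c (x : V n) → polyV (c ·v x) ≋ scaleₚ c (polyV x)
polyV-· {zero}  c x = ≋-refl
polyV-· {suc n} c x = ∷-cong refl (polyV-· c (ap tail-L x))

polyV-deg : ∀ {n} (x : V n) → DegLt (polyV x) n
polyV-deg {zero}  x k       _         = refl
polyV-deg {suc n} x (suc k) (ℕ.s≤s l) = polyV-deg (ap tail-L x) k l

polyV-0 : ∀ {n} (x : V n) → polyV x ≋ [] → x ≗ 0v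
polyV-0 {suc n} x h zero    = coeffs h 0
polyV-0 {suc n} x h (suc i) = polyV-0 (ap tail-L x) (co λ k → coeffs h (suc k)) i

coeff-polyV : ∀ {n} (x : V n) i → coeff (polyV x) (toℕ i) ≡ x i
coeff-polyV {suc n} x zero    = refl
coeff-polyV {suc n} x (suc i) = coeff-polyV (ap tail-L x) i

module Certificate {m : Poly} {D : ℕ} (M : MonicOf m D) where

  remainder : Poly → Poly
  remainder q = DivMod.rest (divMonic M q)

  remainder-lin : ∀ q s r → q ≋ s *ₚ m +ₚ r → DegLt r D → remainder q ≋ r
  remainder-lin q s r h d = rest-unique M quot s rest r (≋-trans (≋-sym eqn) h) small d
    where open DivMod (divMonic M q)

  remainder-cong : ∀ {p q} → p ≋ q → remainder p ≋ remainder q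
  remainder-cong {p} {q} h = remainder-lin p quot rest (≋-trans h eqn) small
    where open DivMod (divMonic M q)

  remainder-+ : ∀ p q → remainder (p +ₚ q) ≋ remainder p +ₚ remainder q
  remainder-+ p q = remainder-lin (p +ₚ q) (P.quot +ₚ Q.quot) (P.rest +ₚ Q.rest) (≋-trans (+ₚ-cong P.eqn Q.eqn) (l P.quot Q.quot m P.rest Q.rest)) (DegLt-+ {P.rest} {Q.rest} P.small Q.small)
    where
    module P = DivMod (divMonic M p)
    module Q = DivMod (divMonic M q)
    l : ∀ s t m a b → (s *ₚ m +ₚ a) +ₚ (t *ₚ m +ₚ b) ≋ (s +ₚ t) *ₚ m +ₚ (a +ₚ b)
    l = solveR polySolver

  remainder-· : ∀ c q → remainder (scaleₚ c q) ≋ scaleₚ c (remainder q)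
  remainder-· c q = remainder-lin (scaleₚ c q) (scaleₚ c quot) (scaleₚ c rest)
      (≋-trans (scale-cong {c} {c} refl eqn) (≋-trans (scale-+ c (quot *ₚ m) rest) (+ₚ-cong (≋-sym (scale-* c quot m)) ≋-refl))) (DegLt-scale c {rest} small)
    where open DivMod (divMonic M q)

  target : V (suc D) → Poly
  target x = constₚ (x zero) +ₚ polyV (ap tail-L x) *ₚ deriv m

  target-+ : ∀ x y → target (x +v y) ≋ target x +ₚ target y
  target-+ x y = ≋-trans (+ₚ-cong (≋-refl {constₚ (x zero + y zero)}) (≋-trans (*ₚ-congˡ _ _ (deriv m) (polyV-+ (ap tail-L x) (ap tail-L y))) (*ₚ-distribʳ (deriv m) (polyV (ap tail-L x)) (polyV (ap tail-L y)))))
    (+ₚ-interchange (constₚ (x zero)) (constₚ (y zero)) (polyV (ap tail-L x) *ₚ deriv m) (polyV (ap tail-L y) *ₚ deriv m))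

  target-· : ∀ c x → target (c ·v x) ≋ scaleₚ c (target x)
  target-· c x = ≋-trans (+ₚ-cong (≋-refl {constₚ (c * x zero)}) (≋-trans (*ₚ-congˡ _ _ (deriv m) (polyV-· c (ap tail-L x))) (scale-* c (polyV (ap tail-L x)) (deriv m))))
    (≋-sym (scale-+ c (constₚ (x zero)) (polyV (ap tail-L x) *ₚ deriv m)))

  target-cong : ∀ {x y} → x ≗ y → target x ≋ target y
  target-cong h = +ₚ-cong (∷-cong (h zero) ≋-refl) (*ₚ-congˡ _ _ (deriv m) (polyV-cong (λ i → h (suc i))))

  -- There are D + 1 unknowns, a constant x₀ and the coefficients of v, against the D coefficients
  -- of x₀ + v m′ modulo m. A nonzero solution therefore exists for every monic m.
  map : Lin (suc D) D
  ap    map x i   = coeff (remainder (target x)) (toℕ i)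
  congr map h i   = coeffs (remainder-cong (target-cong h)) (toℕ i)
  add   map x y i = trans (coeffs (≋-trans (remainder-cong (target-+ x y)) (remainder-+ (target x) (target y))) (toℕ i)) (coeff-+ (remainder (target x)) (remainder (target y)) (toℕ i))
  scal  map c x i = trans (coeffs (≋-trans (remainder-cong (target-· c x)) (remainder-· c (target x))) (toℕ i)) (coeff-scale c (remainder (target x)) (toℕ i))

  Obstruction : Set
  Obstruction = Σ Poly λ v → ¬ (v ≋ []) × DegLt v D × m ∣ₚ v *ₚ deriv m

  -- A solution reads x₀ + v m′ = s m. If x₀ is nonzero this is a certificate with d = -x₀;
  -- otherwise v is nonzero, of degree below D, and m divides v m′.
  certificate : Separable m ⊎ Obstruction
  certificate = build (x zero ℤP.≟ 0ℤ)
    where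
    kv = wide-kernel ℕP.≤-refl map
    x = proj₁ kv
    y = ap tail-L x
    open DivMod (divMonic M (target x))
    rest≋0 : rest ≋ []
    rest≋0 = co λ k → zero-at k (k ℕ.<? D)
      where
      zero-at : ∀ k → Dec (k ℕ.< D) → coeff rest k ≡ 0ℤ
      zero-at k (no  k≮D) = small k (ℕP.≮⇒≥ k≮D)
      zero-at k (yes k<D) = subst (λ z → coeff rest z ≡ 0ℤ) (FP.toℕ-fromℕ< k<D) (proj₂ (proj₂ kv) (F.fromℕ< k<D))
    target≋ : target x ≋ quot *ₚ m
    target≋ = ≋-trans eqn (≋-trans (+ₚ-cong (≋-refl {quot *ₚ m}) rest≋0) (+ₚ-identityʳ (quot *ₚ m)))
    build : Dec (x zero ≡ 0ℤ) → Separable m ⊎ Obstruction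
    build (no x0≢0) = inj₁ record { u = quot ; v = polyV y ; d = - x zero ; d≢0 = λ z → x0≢0 (trans (sym (ℤP.neg-involutive (x zero))) (cong -_ z))
      ; cert = coeffs (≋-trans (l (constₚ (x zero)) (polyV y *ₚ deriv m)) (+ₚ-cong (≋-refl {constₚ (- x zero)}) target≋)) }
      where
      l : ∀ a b → b ≋ (-ₚ a) +ₚ (a +ₚ b)
      l = solveR polySolver
    build (yes x0≡0) = inj₂ (polyV y , (λ z → proj₁ (proj₂ kv) λ { zero → x0≡0 ; (suc i) → polyV-0 y z i }) , polyV-deg y
      , quot , ≋-trans (≋-sym (≋-trans (+ₚ-cong (∷-0 {p = []} x0≡0 ≋-refl) (≋-refl {polyV y *ₚ deriv m})) ≋-refl)) target≋)

-- Each factor is prime, divides v m′ and does not divide m′, so it divides v. Hence m divides v,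
-- which is impossible for a nonzero v of smaller degree.
no-obstruction : ∀ {n ms} → Factors n ms → ∀ {D} (M : MonicOf (prodₚ n ms) D) → ¬ Certificate.Obstruction M
no-obstruction {n} {ms} F M (v , v≢0 , vdeg , h) = v≢0 (≋-trans (proj₂ m∣v) (*ₚ-zeroˡ s (prodₚ n ms) (monic-cancel M s (DegLt-≋ (proj₂ m∣v) vdeg))))
  where
  each : ∀ i → ms i ∣ₚ v
  each i with Irr.is-prime F i v (deriv (prodₚ n ms)) (trans-∣ (factor-∣prod n ms i) h)
    where
    trans-∣ : ∀ {a b c} → a ∣ₚ b → b ∣ₚ c → a ∣ₚ c
    trans-∣ ab (t , g) = ∣ₚ-≋ (≋-sym g) (∣ₚ-* t ab)
  ... | inj₁ g = g
  ... | inj₂ g = ⊥-elim (∤deriv-prod n ms F i g)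
  m∣v = prod-∣ n ms F v each
  s = proj₁ m∣v

-- Matrices and linear maps

module _ {r : ℕ} where

  fromMatrix-* : ∀ (A B : Matrix r) → fromMatrix (A *ₘ B) ≐ fromMatrix A ∘L fromMatrix B
  fromMatrix-* A B = ≐-ent λ i j → trans (ent-fromMatrix (A *ₘ B) i j) (sum-cong λ k → cong (A i k *_) (sym (ent-fromMatrix B k j)))

  fromMatrix-cong : ∀ {A B : Matrix r} → A ≈ₘ B → fromMatrix A ≐ fromMatrix B
  fromMatrix-cong {A} {B} h = ≐-ent λ i j → trans (ent-fromMatrix A i j) (trans (h i j) (sym (ent-fromMatrix B i j)))

  fromMatrix-id : fromMatrix (idM r) ≐ idL
  fromMatrix-id = ≐-ent λ i j → trans (ent-fromMatrix (idM r) i j) (δ≡e i j)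

  fromMatrix-eval : ∀ p (A : Matrix r) → fromMatrix (evalₘ p A) ≐ evalL p (fromMatrix A)
  fromMatrix-eval []      A = ≐-ent λ i j → ent-fromMatrix (zeroM r) i j
  fromMatrix-eval (c ∷ p) A = ≐-ent λ i j → trans (ent-fromMatrix (evalₘ (c ∷ p) A) i j) (cong₂ _+_ (cong (c *_) (δ≡e i j))
    (trans (sym (ent-fromMatrix (A *ₘ evalₘ p A) i j)) (trans (at (fromMatrix-* A (evalₘ p A)) (e j) i) (congr (fromMatrix A) (at (fromMatrix-eval p A) (e j)) i))))

  kills⇒ : ∀ p (A : Matrix r) → evalₘ p A ≈ₘ zeroM r → Kills p (fromMatrix A)
  kills⇒ p A h = ≐-trans (≐-sym (fromMatrix-eval p A)) (≐-trans (fromMatrix-cong h) (≐-ent λ i j → ent-fromMatrix (zeroM r) i j))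

  ⇒kills : ∀ p (A : Matrix r) → Kills p (fromMatrix A) → evalₘ p A ≈ₘ zeroM r
  ⇒kills p A h i j = trans (sym (ent-fromMatrix (evalₘ p A) i j)) (trans (at (fromMatrix-eval p A) (e j) i) (at h (e j) i))

  ∼⇒Iso : ∀ {A B : Matrix r} ((P , Q , _) : A ∼ℤ B) → Iso (fromMatrix A) (fromMatrix B) (fromMatrix P) (fromMatrix Q)
  ∼⇒Iso {A} {B} (P , Q , pq , qp , t) = record
    { PQ≐id = ≐-trans (≐-sym (fromMatrix-* P Q)) (≐-trans (fromMatrix-cong pq) fromMatrix-id)
    ; QP≐id = ≐-trans (≐-sym (fromMatrix-* Q P)) (≐-trans (fromMatrix-cong qp) fromMatrix-id)
    ; tw = ≐-trans (≐-sym (fromMatrix-* P A)) (≐-trans (fromMatrix-cong t) (fromMatrix-* B P)) }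

  ent-∘ : ∀ (f g : Lin r r) i j → ((λ i j → ent f i j) *ₘ (λ i j → ent g i j)) i j ≡ ent (f ∘L g) i j
  ent-∘ f g i j = sym (trans (expand f (ap g (e j)) i) (sum-cong λ k → ℤP.*-comm (ent g k j) (ent f i k)))

  Iso⇒∼ : ∀ {A B P Q : Lin r r} → Iso A B P Q → ent A ∼ℤ ent B
  Iso⇒∼ {A} {B} {P} {Q} I = ent P , ent Q
    , (λ i j → trans (ent-∘ P Q i j) (trans (at (PQ≐id I) (e j) i) (sym (δ≡e i j))))
    , (λ i j → trans (ent-∘ Q P i j) (trans (at (QP≐id I) (e j) i) (sym (δ≡e i j))))
    , (λ i j → trans (ent-∘ P A i j) (trans (at (tw I) (e j) i) (sym (ent-∘ B P i j))))

  *ₘ-cong : ∀ {A A′ B B′ : Matrix r} → A ≈ₘ A′ → B ≈ₘ B′ → (A *ₘ B) ≈ₘ (A′ *ₘ B′)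
  *ₘ-cong h g i j = sum-cong λ k → cong₂ _*_ (h i k) (g k j)

  ≈ₘ-sym : ∀ {A B : Matrix r} → A ≈ₘ B → B ≈ₘ A
  ≈ₘ-sym h i j = sym (h i j)

  ∼-resp : ∀ {A A′ B B′ : Matrix r} → A ≈ₘ A′ → B ≈ₘ B′ → A ∼ℤ B → A′ ∼ℤ B′
  ∼-resp {A} {A′} {B} {B′} a b (P , Q , pq , qp , t) = P , Q , pq , qp , λ i j →
    trans (*ₘ-cong {P} {P} {A′} {A} (λ _ _ → refl) (≈ₘ-sym {A} {A′} a) i j) (trans (t i j) (*ₘ-cong {B} {B′} {P} {P} b (λ _ _ → refl) i j))

  ∼-trans : ∀ {A B C : Matrix r} → A ∼ℤ B → B ∼ℤ C → A ∼ℤ C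
  ∼-trans {A} {B} {C} s t = ∼-resp {ent (fromMatrix A)} {A} {ent (fromMatrix C)} {C} (ent-fromMatrix A) (ent-fromMatrix C) (Iso⇒∼ (Iso-trans (∼⇒Iso {A} {B} s) (∼⇒Iso {B} {C} t)))

  ∼-sym : ∀ {A B : Matrix r} → A ∼ℤ B → B ∼ℤ A
  ∼-sym {A} {B} s = ∼-resp {ent (fromMatrix B)} {B} {ent (fromMatrix A)} {A} (ent-fromMatrix B) (ent-fromMatrix A) (Iso⇒∼ (Iso-sym (∼⇒Iso {A} {B} s)))

  ≈⇒∼ : ∀ {A B : Matrix r} → A ≈ₘ B → A ∼ℤ B
  ≈⇒∼ {A} {B} h = ∼-resp {ent (fromMatrix A)} {A} {ent (fromMatrix B)} {B} (ent-fromMatrix A) (ent-fromMatrix B) (Iso⇒∼ (Iso-id (fromMatrix-cong {A} {B} h)))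

  InMat-∼ : ∀ {m h} {A B : Matrix r} → A ∼ℤ B → InMat m h A → InMat m h B
  InMat-∼ {m} {h} {A} {B} s ((d , deg , lead , kill , least) , cp) =
    (d , deg , lead , move {A} {B} s m kill , λ p e hp z → least p e hp (move {B} {A} (∼-sym {A} {B} s) p z)) ,
    λ k → trans (sym (charPoly-conj {A = A} {B} s k)) (cp k)
    where
    move : ∀ {A B : Matrix r} → A ∼ℤ B → ∀ p → evalₘ p A ≈ₘ zeroM r → evalₘ p B ≈ₘ zeroM r
    move {A} {B} s p z = ⇒kills p B (Kills-Iso p (∼⇒Iso {A} {B} s) (kills⇒ p A z))

-- Deciding membership in the set of matrices

≈ₚ? : ∀ p q → Dec (p ≈ₚ q)
≈ₚ? p q with degree (p +ₚ (-ₚ q))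
... | inj₁ z = yes λ k → ℤP.i-j≡0⇒i≡j (coeff p k) (coeff q k) (trans (sym (trans (coeff-+ p (-ₚ q) k) (cong (coeff p k +_) (coeff-neg q k)))) (coeffs z k))
... | inj₂ (d , l , _) = no λ h → l (trans (coeff-+ p (-ₚ q) d) (trans (cong₂ _+_ (h d) (coeff-neg q d)) (ℤP.+-inverseʳ (coeff q d))))

-- Minimality of the polynomial m is injectivity of p ↦ p(A) in degrees below deg m.
module MinimalPolynomial {m : Poly} {D : ℕ} (M : MonicOf m D) {r : ℕ} (A : Matrix r) where

  Â : Lin r r
  Â = fromMatrix A

  entry : Fin (r ℕ.* r) → Fin r × Fin r
  entry = F.remQuot {r} r

  evaluation : Lin D (r ℕ.* r)
  ap    evaluation x t   = ent (evalL (polyV x) Â) (proj₁ (entry t)) (proj₂ (entry t))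
  congr evaluation {x} {y} h t = at (evalL-≈ (polyV x) (polyV y) Â (coeffs (polyV-cong h))) (e (proj₂ (entry t))) (proj₁ (entry t))
  add   evaluation x y t = trans (at (evalL-≈ (polyV (x +v y)) (polyV x +ₚ polyV y) Â (coeffs (polyV-+ x y))) (e (proj₂ (entry t))) (proj₁ (entry t)))
                                 (at (evalL-+ (polyV x) (polyV y) Â) (e (proj₂ (entry t))) (proj₁ (entry t)))
  scal  evaluation c x t = trans (at (evalL-≈ (polyV (c ·v x)) (scaleₚ c (polyV x)) Â (coeffs (polyV-· c x))) (e (proj₂ (entry t))) (proj₁ (entry t)))
                                 (at (evalL-scale c (polyV x) Â) (e (proj₂ (entry t))) (proj₁ (entry t)))

  evaluation-0 : ∀ x → ap evaluation x ≗ 0v → Kills (polyV x) Â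
  evaluation-0 x h = ≐-ent λ i j → trans (cong (λ (a , b) → ent (evalL (polyV x) Â) a b) (sym (FP.remQuot-combine i j))) (h (F.combine i j))

  degree-unique : ∀ {d} → HasDegree m d → d ≡ D
  degree-unique {d} (l , h) = ℕP.≤-antisym (ℕP.≮⇒≥ λ D<d → l (degLt M d D<d)) (ℕP.≮⇒≥ λ d<D → contradiction (trans (sym (lead M)) (h D d<D)) (λ ()))

  m-degree : HasDegree m D
  m-degree = (λ z → contradiction (trans (sym (lead M)) z) (λ ())) , λ k l → degLt M k l

  coeffV : Poly → V D
  coeffV p i = coeff p (toℕ i)

  polyV-coeffV : ∀ p → DegLt p D → polyV (coeffV p) ≋ p
  polyV-coeffV p h = co λ k → go k (k ℕ.<? D)
    where
    go : ∀ k → Dec (k ℕ.< D) → coeff (polyV (coeffV p)) k ≡ coeff p k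
    go k (no  q) = trans (polyV-deg (coeffV p) k (ℕP.≮⇒≥ q)) (sym (h k (ℕP.≮⇒≥ q)))
    go k (yes q) = subst (λ z → coeff (polyV (coeffV p)) z ≡ coeff p z) (FP.toℕ-fromℕ< q) (coeff-polyV (coeffV p) (F.fromℕ< q))

  minPoly? : Dec (IsMinPoly A m)
  minPoly? with FP.all? (λ i → FP.all? (λ j → evalₘ m A i j ℤP.≟ 0ℤ)) | kernel (r ℕ.* r) evaluation
  ... | no ¬z | _ = no λ (_ , _ , _ , z , _) → ¬z z
  ... | yes z | inj₂ (inj , _) = yes (D , m-degree , lead M , z , least)
    where
    least : ∀ p d → HasDegree p d → evalₘ p A ≈ₘ zeroM r → D ℕ.≤ d
    least p d (l , h) pA = ℕP.≮⇒≥ λ d<D → l (vanish d<D)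
      where
      vanish : d ℕ.< D → coeff p d ≡ 0ℤ
      vanish d<D = trans (cong (coeff p) (sym (FP.toℕ-fromℕ< d<D)))
          (inj (coeffV p) (λ t → at (≐-trans (evalL-≈ (polyV (coeffV p)) p Â (coeffs p≋)) (kills⇒ p A pA)) (e (proj₂ (entry t))) (proj₁ (entry t))) (F.fromℕ< d<D))
        where
        p≋ : polyV (coeffV p) ≋ p
        p≋ = polyV-coeffV p (λ k D≤k → h k (ℕP.<-≤-trans d<D D≤k))
  ... | yes z | inj₁ (x , x≢0 , fx) = no λ (d , deg , _ , _ , least) → absurd (degree (polyV x)) least (degree-unique deg)
    where
    absurd : ∀ {d} → polyV x ≋ [] ⊎ Σ ℕ (HasDegree (polyV x)) → (∀ p e → HasDegree p e → evalₘ p A ≈ₘ zeroM r → d ℕ.≤ e) → d ≡ D → ⊥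
    absurd (inj₁ q) _ _ = x≢0 (polyV-0 x q)
    absurd (inj₂ (k , hk)) least refl = proj₁ hk (polyV-deg x k (least (polyV x) k hk (⇒kills (polyV x) A (evaluation-0 x fx))))

-- Enumeration of bounded matrices and graph search

Funs : ∀ {X : Set} → List X → ∀ n → List (Fin n → X)
Funs xs zero    = (λ ()) ∷ []
Funs xs (suc n) = L.concatMap (λ x → L.map (cons x) (Funs xs n)) xs

-- Functions on `Fin n` are compared pointwise, so completeness is stated up to a relation R in
-- place of membership. Matrices use it twice, for entries within a row and for rows.
Funs-complete : ∀ {X : Set} {R : X → X → Set} (xs : List X) n (f : Fin n → X) → (∀ i → Any (λ x → R x (f i)) xs) →
                Any (λ g → ∀ i → R (g i) (f i)) (Funs xs n)
Funs-complete xs zero    f h = here λ ()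
Funs-complete {X} {R} xs (suc n) f h = AnyP.concatMap⁺ (λ x → L.map (cons x) (Funs xs n)) (Any.map (λ {x} p → AnyP.map⁺ (Any.map (λ q → λ { zero → p ; (suc i) → q i })
  (Funs-complete {R = R} xs n (λ i → f (suc i)) (λ i → h (suc i))))) (h zero))

ints : ℕ → List ℤ
ints zero    = 0ℤ ∷ []
ints (suc N) = ℤ.+ suc N ∷ -[1+ N ] ∷ ints N

ints-complete : ∀ N z → ∣ z ∣ ℕ.≤ N → Any (_≡ z) (ints N)
ints-complete zero    (ℤ.+ zero) _ = here refl
ints-complete (suc N) z p with ∣ z ∣ ℕ.≟ suc N
... | no  q = there (there (ints-complete N z (ℕP.≤-pred (ℕP.≤∧≢⇒< p q))))
ints-complete (suc N) (ℤ.+ .(suc N)) p | yes refl = here refl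
ints-complete (suc N) -[1+ .N ]      p | yes refl = there (here refl)

mats : ℕ → ∀ r → List (Matrix r)
mats N r = Funs (Funs (ints N) r) r

mats-complete : ∀ N {r} (A : Matrix r) → (∀ i j → ∣ A i j ∣ ℕ.≤ N) → Any (_≈ₘ A) (mats N r)
mats-complete N {r} A b = Funs-complete {R = λ u v → ∀ j → u j ≡ v j} (Funs (ints N) r) r A
  (λ i → Funs-complete {R = _≡_} (ints N) r (A i) (λ j → ints-complete N (A i j) (b i j)))

≈ₘ? : ∀ {r} (A B : Matrix r) → Dec (A ≈ₘ B)
≈ₘ? A B = FP.all? (λ i → FP.all? (λ j → A i j ℤP.≟ B i j))

-- Warshall's algorithm: the intermediate vertices of a Path vs lie in vs.
module Warshall {r : ℕ} (N : ℕ) where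

  Edge : Matrix r → Matrix r → Matrix r → Matrix r → Set
  Edge A B P Q = ((P *ₘ Q) ≈ₘ idM r) × ((Q *ₘ P) ≈ₘ idM r) × ((P *ₘ A) ≈ₘ (B *ₘ P))

  Adjacent : Matrix r → Matrix r → Set
  Adjacent A B = Any (λ P → Any (λ Q → Edge A B P Q) (mats N r)) (mats N r)

  adjacent? : ∀ A B → Dec (Adjacent A B)
  adjacent? A B = Any.any? (λ P → Any.any? (λ Q → ≈ₘ? (P *ₘ Q) (idM r) ×-dec (≈ₘ? (Q *ₘ P) (idM r) ×-dec ≈ₘ? (P *ₘ A) (B *ₘ P))) (mats N r)) (mats N r)

  Path : List (Matrix r) → Matrix r → Matrix r → Set
  Path []       A B = A ≈ₘ B ⊎ Adjacent A B
  Path (C ∷ vs) A B = Path vs A B ⊎ (Path vs A C × Path vs C B)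

  path? : ∀ vs A B → Dec (Path vs A B)
  path? []       A B = ≈ₘ? A B ⊎-dec adjacent? A B
  path? (C ∷ vs) A B = path? vs A B ⊎-dec (path? vs A C ×-dec path? vs C B)

  path-sound : ∀ vs {A B} → Path vs A B → A ∼ℤ B
  path-sound []       {A} {B} (inj₁ h) = ≈⇒∼ {A = A} {B} h
  path-sound []       {A} {B} (inj₂ h) = let P , h′ = Any.satisfied h ; Q , h″ = Any.satisfied h′ in P , Q , h″
  path-sound (C ∷ vs) {A} {B} (inj₁ h) = path-sound vs {A} {B} h
  path-sound (C ∷ vs) {A} {B} (inj₂ (h , g)) = ∼-trans {A = A} {C} {B} (path-sound vs {A} {C} h) (path-sound vs {C} {B} g)

  Edge-resp : ∀ {A A′ B B′ P P′ Q Q′} → A ≈ₘ A′ → B ≈ₘ B′ → P′ ≈ₘ P → Q′ ≈ₘ Q → Edge A B P Q → Edge A′ B′ P′ Q′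
  Edge-resp {A} {A′} {B} {B′} {P} {P′} {Q} {Q′} a b p q (h₁ , h₂ , h₃) =
      (λ i j → trans (*ₘ-cong {A = P′} {P} {Q′} {Q} p q i j) (h₁ i j)) , (λ i j → trans (*ₘ-cong {A = Q′} {Q} {P′} {P} q p i j) (h₂ i j))
    , (λ i j → trans (*ₘ-cong {A = P′} {P} {A′} {A} p (λ i j → sym (a i j)) i j) (trans (h₃ i j) (*ₘ-cong {A = B} {B′} {P} {P′} b (λ i j → sym (p i j)) i j)))

  adjacent-resp : ∀ {A A′ B B′} → A ≈ₘ A′ → B ≈ₘ B′ → Adjacent A B → Adjacent A′ B′
  adjacent-resp {A} {A′} {B} {B′} a b = Any.map (λ {P} → Any.map (λ {Q} → Edge-resp {A} {A′} {B} {B′} {P} {P} {Q} {Q} a b (λ _ _ → refl) (λ _ _ → refl)))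

  path-resp : ∀ vs {A A′ B B′} → A ≈ₘ A′ → B ≈ₘ B′ → Path vs A B → Path vs A′ B′
  path-resp []       a b (inj₁ h) = inj₁ λ i j → trans (sym (a i j)) (trans (h i j) (b i j))
  path-resp []       {A} {A′} {B} {B′} a b (inj₂ h) = inj₂ (adjacent-resp {A} {A′} {B} {B′} a b h)
  path-resp (C ∷ vs) {A} {A′} {B} {B′} a b (inj₁ h) = inj₁ (path-resp vs {A} {A′} {B} {B′} a b h)
  path-resp (C ∷ vs) {A} {A′} {B} {B′} a b (inj₂ (h , g)) = inj₂ (path-resp vs {A} {A′} {C} {C} a (λ _ _ → refl) h , path-resp vs {C} {C} {B} {B′} (λ _ _ → refl) b g)

  path-base : ∀ vs {A B} → Path [] A B → Path vs A B
  path-base []       h = h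
  path-base (C ∷ vs) {A} {B} h = inj₁ (path-base vs {A} {B} h)

  -- A path to C that also visits C on the way can be stopped at its first visit, and one from C
  -- restarted at its last.
  through-head : ∀ {C vs A B} → Path (C ∷ vs) A C → Path (C ∷ vs) C B → Path (C ∷ vs) A B
  through-head {C} {vs} {A} {B} p q = inj₂ (into p , out q)
    where
    into : Path (C ∷ vs) A C → Path vs A C
    into (inj₁ h) = h
    into (inj₂ (h , _)) = h
    out : Path (C ∷ vs) C B → Path vs C B
    out (inj₁ h) = h
    out (inj₂ (_ , h)) = h

  -- Joining is possible at listed vertices. When both paths also visit the head C, the part between
  -- the first and the last visit of C, which contains U, is discarded.
  path-trans : ∀ {vs A B U} → Any (_≈ₘ U) vs → Path vs A U → Path vs U B → Path vs A B
  path-trans {C ∷ vs} {A} {B} {U} (here h) p q = through-head {C} {vs} {A} {B}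
    (path-resp (C ∷ vs) {A} {A} {U} {C} (λ _ _ → refl) (λ i j → sym (h i j)) p) (path-resp (C ∷ vs) {U} {C} {B} {B} (λ i j → sym (h i j)) (λ _ _ → refl) q)
  path-trans {C ∷ vs} {A} {B} {U} (there u) (inj₁ p) (inj₁ q) = inj₁ (path-trans {vs} {A} {B} {U} u p q)
  path-trans {C ∷ vs} {A} {B} {U} (there u) (inj₁ p) (inj₂ (q , q′)) = inj₂ (path-trans {vs} {A} {C} {U} u p q , q′)
  path-trans {C ∷ vs} {A} {B} {U} (there u) (inj₂ (p , p′)) (inj₁ q) = inj₂ (p , path-trans {vs} {C} {B} {U} u p′ q)
  path-trans {C ∷ vs} {A} {B} {U} (there u) (inj₂ (p , p′)) (inj₂ (q , q′)) = inj₂ (p , q′)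

  adjacent-complete : ∀ {A B P Q : Lin r r} → Bdd N P → Bdd N Q → Iso A B P Q → Adjacent (ent A) (ent B)
  adjacent-complete {A} {B} {P} {Q} bP bQ I = Any.map (λ {P′} p → Any.map (λ {Q′} q → Edge-resp {ent A} {ent A} {ent B} {ent B} {ent P} {P′} {ent Q} {Q′} (λ _ _ → refl) (λ _ _ → refl) p q (proj₂ (proj₂ (Iso⇒∼ I))))
    (mats-complete N (ent Q) (bound bQ))) (mats-complete N (ent P) (bound bP))

  Gen⇒Path : ∀ {A B P : Lin r r} → Gen N A B P → Path (mats N r) (ent A) (ent B)
  Gen⇒Path {A} {B} (done b h _) = path-base (mats N r) {ent A} {ent B} (inj₁ λ i j → at h (e j) i)
  Gen⇒Path {A} {B} (step {C = C} Q Q′ _ bC bQ bQ′ I g _) = path-trans {mats N r} {ent A} {ent B} {ent C} (mats-complete N (ent C) (bound bC))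
    (path-base (mats N r) {ent A} {ent C} (inj₂ (adjacent-complete bQ bQ′ I))) (Gen⇒Path g)

-- Choosing one element per class

module Transversal {X : Set} (_≈_ : X → X → Set) (_≈?_ : ∀ x y → Dec (x ≈ y)) (≈-refl : ∀ {x} → x ≈ x) where

  insert : X → List X → List X
  insert x ys with Any.any? (x ≈?_) ys
  ... | yes _ = ys
  ... | no  _ = x ∷ ys

  transversal : List X → List X
  transversal []       = []
  transversal (x ∷ xs) = insert x (transversal xs)

  insert-All : ∀ {Q : X → Set} x ys → Q x → All Q ys → All Q (insert x ys)
  insert-All x ys q qs with Any.any? (x ≈?_) ys
  ... | yes _ = qs
  ... | no  _ = q All.∷ qs

  transversal-All : ∀ {Q : X → Set} {xs} → All Q xs → All Q (transversal xs)
  transversal-All All.[] = All.[]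
  transversal-All {xs = x ∷ xs} (q All.∷ qs) = insert-All x (transversal xs) q (transversal-All qs)

  insert-pairs : ∀ x ys → AllPairs (λ x y → ¬ (x ≈ y)) ys → AllPairs (λ x y → ¬ (x ≈ y)) (insert x ys)
  insert-pairs x ys h with Any.any? (x ≈?_) ys
  ... | yes _ = h
  ... | no  n = AllP.¬Any⇒All¬ ys n AllPairs.∷ h

  transversal-pairs : ∀ xs → AllPairs (λ x y → ¬ (x ≈ y)) (transversal xs)
  transversal-pairs []       = AllPairs.[]
  transversal-pairs (x ∷ xs) = insert-pairs x (transversal xs) (transversal-pairs xs)

  insert-here : ∀ x ys → Any (x ≈_) (insert x ys)
  insert-here x ys with Any.any? (x ≈?_) ys
  ... | yes a = a
  ... | no  _ = here ≈-refl

  insert-there : ∀ {Q : X → Set} x ys → Any Q ys → Any Q (insert x ys)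
  insert-there x ys a with Any.any? (x ≈?_) ys
  ... | yes _ = a
  ... | no  _ = there a

  -- The kept element is x itself or the one that prevented its insertion. The original x is
  -- returned too, because conjugacy is drawn from the relation only afterwards, by soundness of
  -- paths.
  transversal-complete : ∀ {xs Q} → Any Q xs → Any (λ y → ∃ λ x → Q x × x ≈ y) (transversal xs)
  transversal-complete {x ∷ xs} (here q)  = Any.map (λ h → x , q , h) (insert-here x (transversal xs))
  transversal-complete {x ∷ xs} (there a) = insert-there x (transversal xs) (transversal-complete a)

-- Minimal sets of representatives

module Classification {m : Poly} {D : ℕ} (M : MonicOf m D) (h : Poly) (r N₀ N₁ : ℕ)
  (finite : ∀ (A : Lin r r) → Kills m A → Σ (Lin r r) λ A′ → Σ (Lin r r) λ P → Σ (Lin r r) λ Q → Bdd N₀ A′ × Iso A A′ P Q)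
  (generated : ∀ (A B P Q : Lin r r) → Bdd N₀ A → Bdd N₀ B → Kills m A → Iso A B P Q → Gen N₁ A B P) where

  open Warshall {r} N₁

  _≈_ : Matrix r → Matrix r → Set
  _≈_ = Path (mats N₁ r)

  Good : Matrix r → Set
  Good A = (∀ i j → ∣ A i j ∣ ℕ.≤ N₀) × InMat m h A

  bounded? : ∀ (A : Matrix r) → Dec (∀ i j → ∣ A i j ∣ ℕ.≤ N₀)
  bounded? A = FP.all? (λ i → FP.all? (λ j → ∣ A i j ∣ ℕ.≤? N₀))

  good? : ∀ A → Dec (Good A)
  good? A = bounded? A ×-dec (MinimalPolynomial.minPoly? M A ×-dec ≈ₚ? (charPoly A) h)

  _≈?_ : ∀ A B → Dec (A ≈ B)
  _≈?_ = path? (mats N₁ r)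

  ≈-refl : ∀ {A} → A ≈ A
  ≈-refl {A} = path-base (mats N₁ r) {A} {A} (inj₁ λ _ _ → refl)

  open Transversal _≈_ _≈?_ ≈-refl

  candidates representatives : List (Matrix r)
  candidates      = L.filter good? (mats N₀ r)
  representatives = transversal candidates

  fromMatrix-Bdd : ∀ {A : Matrix r} → (∀ i j → ∣ A i j ∣ ℕ.≤ N₀) → Bdd N₀ (fromMatrix A)
  fromMatrix-Bdd {A} b = bdd λ i j → subst (λ z → ∣ z ∣ ℕ.≤ N₀) (sym (ent-fromMatrix A i j)) (b i j)

  InMat-kills : ∀ {A : Matrix r} → InMat m h A → Kills m (fromMatrix A)
  InMat-kills {A} ((_ , _ , _ , z , _) , _) = kills⇒ m A z

  -- Paths are sound for all matrices, but their completeness comes from `generated` and needs both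
  -- ends within N₀. Hence candidates are filtered by size as well as by membership.
  ∼⇒≈ : ∀ {A B} → Good A → Good B → A ∼ℤ B → A ≈ B
  ∼⇒≈ {A} {B} (bA , gA) (bB , _) s = path-resp (mats N₁ r) {ent (fromMatrix A)} {A} {ent (fromMatrix B)} {B} (ent-fromMatrix A) (ent-fromMatrix B)
    (Gen⇒Path (generated (fromMatrix A) (fromMatrix B) _ _ (fromMatrix-Bdd bA) (fromMatrix-Bdd bB) (InMat-kills gA) (∼⇒Iso {A = A} {B} s)))

  all-good : All Good representatives
  all-good = transversal-All (AllP.all-filter good? (mats N₀ r))

  distinct : ∀ Bs → All Good Bs → AllPairs (λ A B → ¬ (A ≈ B)) Bs → ∀ i j → L.lookup Bs i ∼ℤ L.lookup Bs j → i ≡ j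
  distinct (A ∷ Bs) gs       ps                    zero    zero    s = refl
  distinct (A ∷ Bs) (g All.∷ gs) (p AllPairs.∷ ps) zero    (suc j) s = ⊥-elim (All.lookup p (∈-lookup j) (∼⇒≈ {A} {L.lookup Bs j} g (All.lookup gs (∈-lookup j)) s))
  distinct (A ∷ Bs) (g All.∷ gs) (p AllPairs.∷ ps) (suc i) zero    s = ⊥-elim (All.lookup p (∈-lookup i) (∼⇒≈ {A} {L.lookup Bs i} g (All.lookup gs (∈-lookup i)) (∼-sym {A = L.lookup Bs i} {A} s)))
  distinct (A ∷ Bs) (g All.∷ gs) (p AllPairs.∷ ps) (suc i) (suc j) s = cong suc (distinct Bs gs ps i j s)

  -- `finite` gives a bounded conjugate, which occurs in the enumeration up to pointwise equality.
  -- It survives the filter because minimal and characteristic polynomials are conjugacy invariants.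
  candidate : ∀ {A} → InMat m h A → Any (A ∼ℤ_) candidates
  candidate {A} inm = any-filter (mats-complete N₀ (ent A′) (bound bA′))
    where
    fin = finite (fromMatrix A) (InMat-kills inm)
    A′ = proj₁ fin
    bA′ = proj₁ (proj₂ (proj₂ (proj₂ fin)))
    A∼A′ : A ∼ℤ ent A′
    A∼A′ = ∼-resp {A = ent (fromMatrix A)} {A} {ent A′} {ent A′} (ent-fromMatrix A) (λ _ _ → refl) (Iso⇒∼ (proj₂ (proj₂ (proj₂ (proj₂ fin)))))
    any-filter : ∀ {xs} → Any (_≈ₘ ent A′) xs → Any (A ∼ℤ_) (L.filter good? xs)
    any-filter {xs} a with Membership.find a
    ... | B , B∈ , B≈ = Membership.lose (∈-filter⁺ good? B∈ good) A∼B
      where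
      A∼B : A ∼ℤ B
      A∼B = ∼-resp {A = A} {A} {ent A′} {B} (λ _ _ → refl) (≈ₘ-sym {A = B} {ent A′} B≈) A∼A′
      good : Good B
      good = (λ i j → subst (λ z → ∣ z ∣ ℕ.≤ N₀) (sym (B≈ i j)) (bound bA′ i j)) , InMat-∼ {m = m} {h} {A} {B} A∼B inm

  minimalReps : MinimalReps r m h representatives
  minimalReps = (λ i → proj₂ (All.lookup all-good (∈-lookup i))) , complete , distinct representatives all-good (transversal-pairs candidates)
    where
    complete : ∀ A → InMat m h A → ∃ λ i → A ∼ℤ L.lookup representatives i
    complete A inm = Any.index a , ∼-trans {A = A} {proj₁ found} {B} (proj₁ (proj₂ found)) (path-sound (mats N₁ r) {proj₁ found} {B} (proj₂ (proj₂ found)))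
      where
      a = transversal-complete {candidates} {A ∼ℤ_} (candidate {A} inm)
      B = L.lookup representatives (Any.index a)
      found = AnyP.lookup-index a

-- Assembling the algorithm

module Algorithm {m : Poly} {D : ℕ} (M : MonicOf m D) (S : Separable m) (h : Poly) (r : ℕ) where

  lowerCoeffs : Poly
  lowerCoeffs = polyV {D} (λ i → coeff m (toℕ i))

  -- `Finiteness` reads the degree off the list and expects it to end in the leading 1, whereas the
  -- list of a product may carry trailing zeros. So m is rewritten in this shape.
  m̂ : Poly
  m̂ = lowerCoeffs ++ 1ℤ ∷ []

  snoc-lo : ∀ {n} (x : V n) i → coeff (polyV x ++ 1ℤ ∷ []) (toℕ i) ≡ x i
  snoc-lo {suc n} x zero    = refl
  snoc-lo {suc n} x (suc i) = snoc-lo (ap tail-L x) i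

  snoc-top : ∀ {n} (x : V n) → coeff (polyV x ++ 1ℤ ∷ []) n ≡ 1ℤ
  snoc-top {zero}  x = refl
  snoc-top {suc n} x = snoc-top (ap tail-L x)

  snoc-hi : ∀ {n} (x : V n) k → n ℕ.< k → coeff (polyV x ++ 1ℤ ∷ []) k ≡ 0ℤ
  snoc-hi {zero}  x (suc k) _         = refl
  snoc-hi {suc n} x (suc k) (ℕ.s≤s l) = snoc-hi (ap tail-L x) k l

  m̂≋m : m̂ ≋ m
  m̂≋m = co λ k → go k (k ℕ.<? D)
    where
    go : ∀ k → Dec (k ℕ.< D) → coeff m̂ k ≡ coeff m k
    go k (yes k<D) = subst (λ z → coeff m̂ z ≡ coeff m z) (FP.toℕ-fromℕ< k<D) (snoc-lo (λ i → coeff m (toℕ i)) (F.fromℕ< k<D))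
    go k (no  k≮D) = above (ℕP.m≤n⇒m<n∨m≡n (ℕP.≮⇒≥ k≮D))
      where
      above : ∀ {k} → D ℕ.< k ⊎ D ≡ k → coeff m̂ k ≡ coeff m k
      above {k} (inj₁ D<k) = trans (snoc-hi (λ i → coeff m (toℕ i)) k D<k) (sym (degLt M k D<k))
      above (inj₂ refl) = trans (snoc-top {D} (λ i → coeff m (toℕ i))) (sym (lead M))

  Ŝ : Separable m̂
  Ŝ = record { u = u ; v = v ; d = d ; d≢0 = d≢0
    ; cert = coeffs (≋-trans (*ₚ-congʳ v (deriv-cong m̂≋m)) (≋-trans (co cert) (+ₚ-cong (≋-refl {constₚ d}) (*ₚ-congʳ u (≋-sym m̂≋m))))) }
    where open Separable S

  kills-m̂ : ∀ {A : Lin r r} → Kills m A → Kills m̂ A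
  kills-m̂ {A} z = ≐-trans (evalL-≈ m̂ m A (coeffs m̂≋m)) z

  N₀ N₁ : ℕ
  N₀ = Finiteness.N₀ lowerCoeffs Ŝ r
  N₁ = proj₁ (FiniteGeneration.finitely-generated m̂ Ŝ r N₀)

  finite : ∀ (A : Lin r r) → Kills m A → Σ (Lin r r) λ A′ → Σ (Lin r r) λ P → Σ (Lin r r) λ Q → Bdd N₀ A′ × Iso A A′ P Q
  finite A z = Finiteness.finiteness lowerCoeffs Ŝ r A (kills-m̂ z)

  generated : ∀ (A B P Q : Lin r r) → Bdd N₀ A → Bdd N₀ B → Kills m A → Iso A B P Q → Gen N₁ A B P
  generated A B P Q bA bB z I = proj₂ (FiniteGeneration.finitely-generated m̂ Ŝ r N₀) A B P Q bA bB (kills-m̂ z) I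

  open Classification M h r N₀ N₁ finite generated public
    using (representatives; minimalReps)

-- The algorithm receives bare polynomials without a proof of `Hyp`, so it must test monicity by
-- itself before dividing by m.
monic? : ∀ m → Σ ℕ (MonicOf m) ⊎ (∀ D → ¬ MonicOf m D)
monic? m with degree m
... | inj₁ z = inj₂ λ D M → contradiction (trans (sym (lead M)) (coeffs z D)) (λ ())
... | inj₂ (d , l , h) with coeff m d ℤP.≟ 1ℤ
...   | yes q = inj₁ (d , record { degLt = λ k → h k ; lead = q })
...   | no  q = inj₂ λ D M → q (trans (cong (coeff m) (same D M)) (lead M))
  where
  same : ∀ D → MonicOf m D → d ≡ D
  same D M = ℕP.≤-antisym (ℕP.≮⇒≥ λ D<d → l (degLt M d D<d)) (ℕP.≮⇒≥ λ d<D → contradiction (trans (sym (lead M)) (h D d<D)) (λ ()))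

-- Without a certificate of separability the output is irrelevant: this case does not occur under Hyp.
matrixReps : (m h : Poly) (r : ℕ) → Σ ℕ (MonicOf m) ⊎ (∀ D → ¬ MonicOf m D) → List (Matrix r)
matrixReps m h r (inj₂ _) = []
matrixReps m h r (inj₁ (D , M)) with Certificate.certificate M
... | inj₁ S = Algorithm.representatives M S h r
... | inj₂ _ = []

matrixReps-correct : ∀ {n ms} → Factors n ms → Σ ℕ (MonicOf (prodₚ n ms)) → ∀ h r x → MinimalReps r (prodₚ n ms) h (matrixReps (prodₚ n ms) h r x)
matrixReps-correct F (D , M) h r (inj₂ ¬M) = ⊥-elim (¬M D M)
matrixReps-correct F _ h r (inj₁ (D , M)) with Certificate.certificate M
... | inj₁ S = Algorithm.minimalReps M S h r
... | inj₂ o = ⊥-elim (no-obstruction F M o)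

theorem4p2 : Σ ((n : ℕ) → (Fin n → Poly) → (Fin n → ℕ) → (r : ℕ) → List (Matrix r))
    λ alg → (n : ℕ) (ms : Fin n → Poly) (ss : Fin n → ℕ) → Hyp n ms ss →
    (r : ℕ) → MinimalReps r (squarefreeProd n ms) (hPoly n ms ss) (alg n ms ss r)
theorem4p2 = (λ n ms ss r → matrixReps (squarefreeProd n ms) (hPoly n ms ss) r (monic? (squarefreeProd n ms)))
           , λ n ms ss (mon , irr , dist , _) r → matrixReps-correct
               (record { deg = λ i → proj₁ (mon i) ; monic = λ i → Monic⇒MonicOf (mon i) ; irr = irr ; distinct = dist })
               (prod-monic n ms (λ i → proj₁ (mon i) , Monic⇒MonicOf (mon i))) (hPoly n ms ss) r (monic? (squarefreeProd n ms))
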